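{- For every integer $k\ge 2$ we have $\pi_{k-2}\bigl(F^{(k)}\bigr)=2^{1-k}$.
   Context: A $k$-uniform hypergraph is a pair $H=(V,E)$ with $V$ finite and $E\subseteq V^{(k)}=\{e\subseteq V\colon |e|=k\}$. $F^{(k)}$ denotes the (up to isomorphism unique) $k$-uniform hypergraph with $k+1$ vertices and exactly three edges; $H$ is $F$-free if it contains no (not necessarily induced) copy of $F$. For a $j$-uniform hypergraph $G^{(j)}$ on $V$ (with $0\le j<k$), let $\mathcal K_k(G^{(j)})$ be the set of $k$-subsets of $V$ all of whose $j$-element subsets are edges of $G^{(j)}$ (for $j=0$ there are only two $0$-uniform hypergraphs: the one with edge set $\{\emptyset\}$, for which $\mathcal K_k$ consists of all $k$-subsets of $V$, and the one with empty edge set, for which $\mathcal K_k$ is empty). For $d\in[0,1]$, $\eta>0$ and $j\in[0,k-1]$, a $k$-uniform hypergraph $H=(V,E)$ is $(d,\eta,j)$-dense if $|\mathcal K_k(G^{(j)})\cap E|\ge d\,|\mathcal K_k(G^{(j)})|-\eta|V|^k$ for every $j$-uniform hypergraph $G^{(j)}$ with vertex set $V$. For a $k$-uniform hypergraph $F$, $\pi_j(F)$ is the supremum of all $d\in[0,1]$ such that for every $\eta>0$ and every $n\in\mathbb N$ there exists a $k$-uniform, $F$-free, $(d,\eta,j)$-dense hypergraph $H$ with at least $n$ vertices. -}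

module Defs where

open import Data.Bool using (Bool; true; false; _∧_; if_then_else_)
open import Data.Nat using (ℕ; zero; suc; _^_; _∸_)
open import Data.Fin using (Fin; toℕ)
open import Data.Fin.Properties using () renaming (_≟_ to _≟ᶠ_)
open import Data.Fin.Subset using (Subset; ∣_∣; ∁; ⁅_⁆; _⊆_)
open import Data.Vec using (Vec; []; _∷_; lookup; tabulate)
open import Data.List using (List; []; _∷_; map; _++_; filter; length; allFin)
open import Data.Bool.ListAction using (any)
open import Data.Product using (Σ; ∃; ∃-syntax; _×_; _,_)
open import Data.Integer using (+_)
open import Data.Rational using (ℚ; 0ℚ; 1ℚ; ½; _*_; _-_; _≤_; _<_; _/_)
open import Function.Definitions using (Injective)
open import Relation.Binary.PropositionalEquality using (_≡_)
open import Relation.Nullary using (¬_)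
open import Relation.Nullary.Decidable using (⌊_⌋)
open import Data.Nat.Properties using () renaming (_≟_ to _≟ℕ_)

Hypergraph : ℕ → Set
Hypergraph n = Subset n → Bool

Uniform : ∀ {n} → ℕ → Hypergraph n → Set
Uniform {n} k E = ∀ (s : Subset n) → E s ≡ true → ∣ s ∣ ≡ k

allB : {A : Set} → (A → Bool) → List A → Bool
allB p [] = true
allB p (x ∷ xs) = p x ∧ allB p xs

allSubsets : (n : ℕ) → List (Subset n)
allSubsets zero = [] ∷ []
allSubsets (suc n) = map (true ∷_) (allSubsets n) ++ map (false ∷_) (allSubsets n)

hasSize : ∀ {n} → ℕ → Subset n → Bool
hasSize k s = ⌊ ∣ s ∣ ≟ℕ k ⌋

subsetB : ∀ {n} → Subset n → Subset n → Bool
subsetB {n} t s = allB (λ i → if lookup t i then lookup s i else true) (allFin n)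

kSubsets : (n k : ℕ) → List (Subset n)
kSubsets n k = filter (λ s → hasSize k s ≟b true) (allSubsets n)
  where
  open import Data.Bool.Properties using () renaming (_≟_ to _≟b_)

inKk : ∀ {n} → ℕ → Hypergraph n → Subset n → Bool
inKk {n} j G s = allB (λ t → if subsetB t s ∧ hasSize j t then G t else true) (allSubsets n)

countKk : ∀ {n} → (k j : ℕ) → Hypergraph n → ℕ
countKk {n} k j G = length (filter (λ s → inKk j G s ≟b true) (kSubsets n k))
  where
  open import Data.Bool.Properties using () renaming (_≟_ to _≟b_)

countKkE : ∀ {n} → (k j : ℕ) → Hypergraph n → Hypergraph n → ℕ
countKkE {n} k j G E = length (filter (λ s → (inKk j G s ∧ E s) ≟b true) (kSubsets n k))
  where
  open import Data.Bool.Properties using () renaming (_≟_ to _≟b_)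

ℕtoℚ : ℕ → ℚ
ℕtoℚ m = (+ m) / 1

Dense : ∀ {n} → (k : ℕ) → (d η : ℚ) → (j : ℕ) → Hypergraph n → Set
Dense {n} k d η j E =
  ∀ (G : Hypergraph n) → Uniform j G →
    d * ℕtoℚ (countKk k j G) - η * ℕtoℚ (n ^ k) ≤ ℕtoℚ (countKkE k j G E)

image : ∀ {p n} → (Fin p → Fin n) → Subset p → Subset n
image {p} φ s = tabulate (λ y → any (λ x → lookup s x ∧ ⌊ φ x ≟ᶠ y ⌋) (allFin p))

Contains : ∀ {p n} → (Subset p → Set) → Hypergraph n → Set
Contains {p} {n} FE E =
  Σ (Fin p → Fin n) λ φ → Injective _≡_ _≡_ φ × (∀ s → FE s → E (image φ s) ≡ true)

Free : ∀ {p n} → (Subset p → Set) → Hypergraph n → Set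
Free FE E = ¬ Contains FE E

-- F^(k): vertex set Fin (k+1), edges the three k-sets V ∖ {0}, V ∖ {1}, V ∖ {2}
-- (for k ≥ 2 these are three distinct k-subsets of a (k+1)-set).
F-edge : (k : ℕ) → Subset (suc k) → Set
F-edge k s = ∃[ i ] (toℕ i Data.Nat.< 3 × s ≡ ∁ ⁅ i ⁆)

Admissible : (k j p : ℕ) → (Subset p → Set) → ℚ → Set
Admissible k j p FE d =
  ∀ (η : ℚ) → 0ℚ < η → ∀ (N : ℕ) →
    ∃[ n ] (N Data.Nat.≤ n × Σ (Hypergraph n) λ E → Uniform k E × Free FE E × Dense k d η j E)

-- π_j(F) = q : q is the supremum of { d ∈ [0,1] : Admissible d }
-- (d ranging over rationals).
PiEquals : (k j p : ℕ) → (Subset p → Set) → ℚ → Set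
PiEquals k j p FE q =
  (∀ (d : ℚ) → 0ℚ ≤ d → d ≤ 1ℚ → Admissible k j p FE d → d ≤ q)
  × (∀ (ε : ℚ) → 0ℚ < ε →
       ∃[ d ] (0ℚ ≤ d × d ≤ 1ℚ × Admissible k j p FE d × q - ε < d))

halfPow : ℕ → ℚ
halfPow zero = 1ℚ
halfPow (suc m) = ½ * halfPow m

{-# OPTIONS --safe #-}
-- Lower bound. Put a random sign on every (k−1)-set and call v₁ < … < v_k an edge if the signs of its
-- (k−1)-subsets, twisted by the parity of the omitted position, all agree. Comparing parities shows that
-- k+1 vertices never span three edges. The edge indicator is ∏(1+c_i)/2 + ∏(1−c_i)/2; every term that
-- contains some c_i is killed by iterated Cauchy–Schwarz (box norms), so the density over each K_k(G) is 2^{1−k}.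
--
-- Upper bound, by sampling instead of hypergraph regularity. Sample vertices w; the type of a tuple
-- records which of its subtuples extended by parts of w are edges. By energy increment some bounded |w| is
-- such that edges behave like a function β of the types of two consecutive (k−1)-subtuples, and these types
-- behave like independent draws given the types of the (k−2)-subtuples. On further sampled vertices this gives
-- a reduced structure in which density above 2^{1−k} makes, by AM–GM along the chain of k consecutive types,
-- some consecutive pair of degrees exceed 1 in sum; Ramsey's theorem makes the position uniform, and
-- an iterated pigeonhole produces a triangle in a link, that is, a copy of F. The density hypothesis is
-- transferred to cells of types by vertex labels (k ≥ 4), by a multi-affine rounding (k = 3), directly (k = 2).

module Submission where

open import Defs
open import Data.Bool using (Bool; true; false; _∧_; not; if_then_else_; _xor_; _∨_)
open import Data.Empty using (⊥; ⊥-elim)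
import Data.List as List
open import Data.List using (List; []; _∷_; map; _++_; length; take; upTo; drop; filter; zip; concatMap; deduplicate; allFin)
open import Data.List.Membership.Propositional using (_∈_)
import Data.List.Relation.Unary.Any as Any
open import Data.List.Relation.Unary.Any using (here; there)
open import Data.Nat as ℕ using (ℕ; zero; suc; s≤s; z≤n)
import Data.Nat.Properties as ℕ
open import Data.Product using (Σ; ∃; _×_; _,_; proj₁; proj₂)
open import Data.Sum using (_⊎_; inj₁; inj₂)
open import Data.Unit using (⊤; tt)
open import Relation.Binary.Definitions using (DecidableEquality)
open import Relation.Binary.PropositionalEquality using (_≡_; _≢_; refl; sym; trans; cong; cong₂; subst; subst₂)
open import Relation.Nullary using (¬_; Dec; yes; no)
open import Relation.Nullary.Decidable using (dec⇒maybe; ⌊_⌋)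

-- The types that edges are compared with are taken over a first sample `w₀`; their independence is
-- measured against a longer sample `w = ext ++ w₀`. The second increment refines only the
-- conditioning, so the list of types, and with it the energy bound, stays fixed. Every sampling
-- error is a difference of conditional expectations over a sample with and without one or two
-- further vertices: what the other subtuples contribute becomes measurable once the vertex they
-- share has joined the sample. The value 2^(1-k) comes from the k - 1 links in a chain of k types:
-- if the two degrees at each link sum to at most 1, AM-GM charges every link one half. The
-- hypothesis only sees sets K_k(G). For k = 3 these are the triples inside one vertex set, whereas
-- a cell takes its three vertices from three classes; a fractional vertex set and a count over many
-- classes separate the contributions. For k ≥ 4 the labels recorded in the colours force the shape
-- of a cell. All constants, even the length of the sample, are fixed before the hypergraph, because
-- `η` is.

module Rationals where
 import Algebra.Solver.Ring
 open import Algebra.Solver.Ring.AlmostCommutativeRing using (AlmostCommutativeRing; IsAlmostCommutativeRing; fromCommutativeRing; _-Raw-AlmostCommutative⟶_)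
 import Data.Integer as ℤ
 import Data.Rational as ℚ
 open import Data.Rational using (ℚ; 0ℚ; 1ℚ; ½; _≤_; _<_; NonZero; 1/_; nonNegative; positive)
 import Data.Rational.Properties as ℚ
 open import Data.Rational.Properties using (≤-trans; ≤-reflexive; <⇒≤; ≤-refl; <-≤-trans; ≰⇒>; ≤-total)
 open import Function using (_∘_)
 open import Level using (0ℓ)

 -- Ordered-field arithmetic on the rationals.

 infixl 6 _+_ _-_
 infixl 7 _*_
 infix 8 -_

 -- Opaque copies of the rational operations: unification then treats them as injective.
 opaque
   _+_ _*_ : ℚ → ℚ → ℚ
   _+_ = ℚ._+_
   _*_ = ℚ._*_

   -_ : ℚ → ℚ
   -_ = ℚ.-_

 _-_ : ℚ → ℚ → ℚ
 a - b = a + - b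

 opaque
   unfolding _+_

   isACR : IsAlmostCommutativeRing _≡_ _+_ _*_ -_ 0ℚ 1ℚ
   isACR = AlmostCommutativeRing.isAlmostCommutativeRing (fromCommutativeRing ℚ.+-*-commutativeRing)

   +-def : ∀ a b → a + b ≡ a ℚ.+ b
   +-def a b = refl
   *-def : ∀ a b → a * b ≡ a ℚ.* b
   *-def a b = refl
   neg-def : ∀ a → - a ≡ ℚ.- a
   neg-def a = refl

 ringℚ : AlmostCommutativeRing 0ℓ 0ℓ
 ringℚ = record { isAlmostCommutativeRing = isACR }

 -- Coefficients are plain rationals while the carrier has the opaque operations; this identity map
 -- makes constants such as `½` available in ring identities.
 coeffℚ : ℚ.+-*-rawRing -Raw-AlmostCommutative⟶ ringℚ
 coeffℚ = record
   { ⟦_⟧ = λ x → x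
   ; +-homo = λ a b → sym (+-def a b)
   ; *-homo = λ a b → sym (*-def a b)
   ; -‿homo = λ a → sym (neg-def a)
   ; 0-homo = refl
   ; 1-homo = refl
   }

 open Algebra.Solver.Ring ℚ.+-*-rawRing ringℚ coeffℚ (λ a b → dec⇒maybe (a ℚ.≟ b)) using (solve; _:=_; _:+_; _:*_; _:-_; :-_; con) public

 open AlmostCommutativeRing ringℚ using (+-assoc; +-comm; +-identityˡ; +-identityʳ; *-assoc; *-comm; *-identityˡ; *-identityʳ; zeroˡ; zeroʳ; distribˡ; distribʳ) public

 opaque
   unfolding _+_

   +-inverseʳ : ∀ a → a - a ≡ 0ℚ
   +-inverseʳ = ℚ.+-inverseʳ
   +-monoʳ-≤ : ∀ a {b c} → b ≤ c → a + b ≤ a + c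
   +-monoʳ-≤ a p = ℚ.+-monoʳ-≤ a p
   +-monoˡ-≤ : ∀ a {b c} → b ≤ c → b + a ≤ c + a
   +-monoˡ-≤ a p = ℚ.+-monoˡ-≤ a p
   +-mono-≤ : ∀ {a b c d} → a ≤ b → c ≤ d → a + c ≤ b + d
   +-mono-≤ = ℚ.+-mono-≤
   +-monoʳ-< : ∀ a {b c} → b < c → a + b < a + c
   +-monoʳ-< a p = ℚ.+-monoʳ-< a p
   neg-antimono-≤ : ∀ {a b} → a ≤ b → - b ≤ - a
   neg-antimono-≤ = ℚ.neg-antimono-≤
   mul-monoˡ : ∀ {a b} c → 0ℚ ≤ c → a ≤ b → c * a ≤ c * b
   mul-monoˡ c 0≤c p = ℚ.*-monoˡ-≤-nonNeg c {{nonNegative 0≤c}} p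
   mul-monoʳ : ∀ {a b} c → 0ℚ ≤ c → a ≤ b → a * c ≤ b * c
   mul-monoʳ c 0≤c p = ℚ.*-monoʳ-≤-nonNeg c {{nonNegative 0≤c}} p
   mul-mono-<ˡ : ∀ {a b} c → 0ℚ < c → a < b → c * a < c * b
   mul-mono-<ˡ c 0<c p = ℚ.*-monoʳ-<-pos c {{positive 0<c}} p
   mul-cancelˡ-≤ : ∀ {a b} c → 0ℚ < c → c * a ≤ c * b → a ≤ b
   mul-cancelˡ-≤ c 0<c p = ℚ.*-cancelˡ-≤-pos c {{positive 0<c}} p
   1/-inverseˡ : ∀ x .{{_ : NonZero x}} → 1/ x * x ≡ 1ℚ
   1/-inverseˡ x = ℚ.*-inverseˡ x

 0≤1 : 0ℚ ≤ 1ℚ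
 0≤1 = ℚ.*≤* (ℤ.+≤+ z≤n)

 0<1 : 0ℚ < 1ℚ
 0<1 = ℚ.*<* (ℤ.+<+ (s≤s z≤n))

 0≤½ : 0ℚ ≤ ½
 0≤½ = ℚ.*≤* (ℤ.+≤+ z≤n)

 ≤∧≢⇒< : ∀ {a b} → a ≤ b → a ≢ b → a < b
 ≤∧≢⇒< p q = ≰⇒> (λ r → q (ℚ.≤-antisym p r))

 <⇒≱ : ∀ {a b} → a < b → ¬ b ≤ a
 <⇒≱ p q = ℚ.<-irrefl refl (<-≤-trans p q)

 -- Many inequalities below are proved by exhibiting the slack `c` as a visibly nonnegative
 -- expression, which leaves only a ring identity.
 ≤-by : ∀ {a b} c → 0ℚ ≤ c → b ≡ a + c → a ≤ b
 ≤-by {a} c 0≤c refl = ≤-trans (≤-reflexive (sym (+-identityʳ a))) (+-monoʳ-≤ a 0≤c)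

 sub≥0 : ∀ {a b} → a ≤ b → 0ℚ ≤ b - a
 sub≥0 {a} {b} p = subst (_≤ b - a) (+-inverseʳ a) (+-monoˡ-≤ (- a) p)

 ≤-sub : ∀ {a b} → 0ℚ ≤ b - a → a ≤ b
 ≤-sub {a} {b} p = ≤-by (b - a) p (eq a b)
   where
   eq : ∀ a b → b ≡ a + (b - a)
   eq = solve 2 (λ a b → b := a :+ (b :- a)) refl

 sub>0 : ∀ {a b} → a < b → 0ℚ < b - a
 sub>0 {a} {b} p = subst₂ _<_ (solve 1 (λ a → (:- a) :+ a := (con 0ℚ)) refl a) (+-comm (- a) b) (+-monoʳ-< (- a) p)

 <-sub : ∀ {a b} → 0ℚ < b - a → a < b
 <-sub {a} {b} p = subst₂ _<_ (+-identityʳ a) (solve 2 (λ a b → a :+ (b :- a) := b) refl a b) (+-monoʳ-< a p)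

 add≥0 : ∀ {a b} → 0ℚ ≤ a → 0ℚ ≤ b → 0ℚ ≤ a + b
 add≥0 {a} {b} p q = ≤-trans p (≤-by b q refl)

 mul≥0 : ∀ {a b} → 0ℚ ≤ a → 0ℚ ≤ b → 0ℚ ≤ a * b
 mul≥0 {a} {b} p q = subst (_≤ a * b) (zeroʳ a) (mul-monoˡ a p q)

 mul-mono : ∀ {a b c d} → 0ℚ ≤ a → 0ℚ ≤ d → a ≤ b → c ≤ d → a * c ≤ b * d
 mul-mono {a} {b} {c} {d} p q r s = ≤-trans (mul-monoˡ a p s) (mul-monoʳ d q r)

 mul>0 : ∀ {a b} → 0ℚ < a → 0ℚ < b → 0ℚ < a * b
 mul>0 {a} {b} p q = subst (_< a * b) (zeroʳ a) (mul-mono-<ˡ a p q)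

 mul≤1 : ∀ {a b} → 0ℚ ≤ a → a ≤ 1ℚ → b ≤ 1ℚ → a * b ≤ 1ℚ
 mul≤1 {a} p q r = ≤-trans (mul-monoˡ a p r) (≤-trans (≤-reflexive (*-identityʳ a)) q)

 sq≥0 : ∀ a → 0ℚ ≤ a * a
 sq≥0 a with ≤-total 0ℚ a
 ... | inj₁ p = mul≥0 p p
 ... | inj₂ p = subst (0ℚ ≤_) (eq a) (mul≥0 q q)
   where
   q : 0ℚ ≤ - a
   q = subst (0ℚ ≤_) (+-identityˡ (- a)) (sub≥0 p)
   eq : ∀ a → (- a) * (- a) ≡ a * a
   eq = solve 1 (λ a → (:- a) :* (:- a) := a :* a) refl

 -- 2θ·a·ψ ≤ θ² + a² for 0 ≤ ψ ≤ 1: a Cauchy–Schwarz step without square roots.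
 amgm : ∀ θ a ψ → 0ℚ ≤ ψ → ψ ≤ 1ℚ → (θ + θ) * (a * ψ) ≤ θ * θ + a * a
 amgm θ a ψ 0≤ψ ψ≤1 = ≤-by ((a - θ * ψ) * (a - θ * ψ) + (θ * θ) * ((1ℚ - ψ) * (1ℚ + ψ)))
     (add≥0 (sq≥0 _) (mul≥0 (sq≥0 θ) (mul≥0 (sub≥0 ψ≤1) (add≥0 0≤1 0≤ψ)))) (eq θ a ψ)
   where
   eq : ∀ θ a ψ → θ * θ + a * a ≡ (θ + θ) * (a * ψ) + ((a - θ * ψ) * (a - θ * ψ) + (θ * θ) * ((1ℚ - ψ) * (1ℚ + ψ)))
   eq = solve 3 (λ θ a ψ → θ :* θ :+ a :* a := (θ :+ θ) :* (a :* ψ) :+ ((a :- θ :* ψ) :* (a :- θ :* ψ) :+ (θ :* θ) :* (((con 1ℚ) :- ψ) :* ((con 1ℚ) :+ ψ)))) refl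

 opaque
   -- Total, with value 0 at 0, so that conditional densities are defined even for empty classes and
   -- `inv*≤1` holds everywhere.
   inv : ℚ → ℚ
   inv x with x ℚ.≟ 0ℚ
   ... | yes _ = 0ℚ
   ... | no x≢0 = 1/_ x {{ℚ.≢-nonZero x≢0}}

   inv-inverseˡ : ∀ x → x ≢ 0ℚ → inv x * x ≡ 1ℚ
   inv-inverseˡ x p with x ℚ.≟ 0ℚ
   ... | yes q = ⊥-elim (p q)
   ... | no q = 1/-inverseˡ x {{ℚ.≢-nonZero q}}

   inv≥0 : ∀ {x} → 0ℚ ≤ x → 0ℚ ≤ inv x
   inv≥0 {x} 0≤x with x ℚ.≟ 0ℚ
   ... | yes q = ≤-refl
   ... | no q = <⇒≤ (ℚ.positive⁻¹ _ {{ℚ.1/pos⇒pos x {{positive (≤∧≢⇒< 0≤x (q ∘ sym))}}}})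

   inv*≤1 : ∀ x → inv x * x ≤ 1ℚ
   inv*≤1 x with x ℚ.≟ 0ℚ
   ... | yes q = subst (_≤ 1ℚ) (sym (zeroˡ x)) 0≤1
   ... | no q = ≤-reflexive (1/-inverseˡ x {{ℚ.≢-nonZero q}})

   infix 4 _≤ᵇ_ _<ᵇ_
   _≤ᵇ_ _<ᵇ_ : ℚ → ℚ → Bool
   a ≤ᵇ b = ⌊ a ℚ.≤? b ⌋
   a <ᵇ b = ⌊ a ℚ.<? b ⌋

   ≤ᵇ⇒≤ : ∀ {a b} → (a ≤ᵇ b) ≡ true → a ≤ b
   ≤ᵇ⇒≤ {a} {b} e with a ℚ.≤? b
   ... | yes p = p

   ≤⇒≤ᵇ : ∀ {a b} → a ≤ b → (a ≤ᵇ b) ≡ true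
   ≤⇒≤ᵇ {a} {b} p with a ℚ.≤? b
   ... | yes _ = refl
   ... | no q = ⊥-elim (q p)

   ≰ᵇ⇒> : ∀ {a b} → (a ≤ᵇ b) ≡ false → b < a
   ≰ᵇ⇒> {a} {b} e with a ℚ.≤? b
   ... | no p = ≰⇒> p

   <ᵇ⇒< : ∀ {a b} → (a <ᵇ b) ≡ true → a < b
   <ᵇ⇒< {a} {b} e with a ℚ.<? b
   ... | yes p = p

   ≮ᵇ⇒≥ : ∀ {a b} → (a <ᵇ b) ≡ false → b ≤ a
   ≮ᵇ⇒≥ {a} {b} e with a ℚ.<? b
   ... | no p = ℚ.≮⇒≥ p

 >0⇒≢0 : ∀ {x} → 0ℚ < x → x ≢ 0ℚ
 >0⇒≢0 p refl = ℚ.<-irrefl refl p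

 inv>0 : ∀ {x} → 0ℚ < x → 0ℚ < inv x
 inv>0 {x} 0<x = ≤∧≢⇒< (inv≥0 (<⇒≤ 0<x)) (λ p → >0⇒≢0 0<1 (trans (sym (inv-inverseˡ x (>0⇒≢0 0<x))) (trans (cong (_* x) (sym p)) (zeroˡ x))))

 𝟙 : Bool → ℚ
 𝟙 true = 1ℚ
 𝟙 false = 0ℚ

 𝟙≥0 : ∀ b → 0ℚ ≤ 𝟙 b
 𝟙≥0 true = 0≤1
 𝟙≥0 false = ≤-refl

 𝟙≤1 : ∀ b → 𝟙 b ≤ 1ℚ
 𝟙≤1 true = ≤-refl
 𝟙≤1 false = 0≤1

 𝟙-∧ : ∀ a b → 𝟙 (a ∧ b) ≡ 𝟙 a * 𝟙 b
 𝟙-∧ true b = sym (*-identityˡ _)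
 𝟙-∧ false b = sym (zeroˡ _)

 infix 4 _∈[0,1]
 _∈[0,1] : ℚ → Set
 a ∈[0,1] = 0ℚ ≤ a × a ≤ 1ℚ

 𝟙∈ : ∀ b → 𝟙 b ∈[0,1]
 𝟙∈ b = 𝟙≥0 b , 𝟙≤1 b

 *∈ : ∀ {a b} → a ∈[0,1] → b ∈[0,1] → a * b ∈[0,1]
 *∈ (p , q) (r , s) = mul≥0 p r , mul≤1 p q s

 -- Linear functionals, finite sums and expectations.

 record Lin (A : Set) : Set where
   field
     L : (A → ℚ) → ℚ
     L-cong : ∀ {f g} → (∀ a → f a ≡ g a) → L f ≡ L g
     L-+ : ∀ f g → L (λ a → f a + g a) ≡ L f + L g
     L-* : ∀ c f → L (λ a → c * f a) ≡ c * L f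

   L-0 : L (λ _ → 0ℚ) ≡ 0ℚ
   L-0 = trans (L-cong (λ _ → sym (zeroˡ 1ℚ))) (trans (L-* 0ℚ (λ _ → 1ℚ)) (zeroˡ _))

   L-*ʳ : ∀ f c → L (λ a → f a * c) ≡ L f * c
   L-*ʳ f c = trans (L-cong (λ a → *-comm (f a) c)) (trans (L-* c f) (*-comm c _))

   L-neg : ∀ f → L (λ a → - f a) ≡ - L f
   L-neg f = trans (L-cong (λ a → eq (f a))) (trans (L-* (- 1ℚ) f) (sym (eq (L f))))
     where
     eq : ∀ x → - x ≡ (- 1ℚ) * x
     eq = solve 1 (λ x → :- x := (:- (con 1ℚ)) :* x) refl

   L-- : ∀ f g → L (λ a → f a - g a) ≡ L f - L g
   L-- f g = trans (L-+ f (λ a → - g a)) (cong (L f +_) (L-neg g))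

 ∑ : {A : Set} → List A → (A → ℚ) → ℚ
 ∑ [] f = 0ℚ
 ∑ (x ∷ xs) f = f x + ∑ xs f

 ∑-cong : ∀ {A : Set} (xs : List A) {f g} → (∀ a → a ∈ xs → f a ≡ g a) → ∑ xs f ≡ ∑ xs g
 ∑-cong [] p = refl
 ∑-cong (x ∷ xs) p = cong₂ _+_ (p x (here refl)) (∑-cong xs (λ a → p a ∘ there))

 ∑-mono : ∀ {A : Set} (xs : List A) {f g} → (∀ a → a ∈ xs → f a ≤ g a) → ∑ xs f ≤ ∑ xs g
 ∑-mono [] p = ≤-refl
 ∑-mono (x ∷ xs) p = +-mono-≤ (p x (here refl)) (∑-mono xs (λ a → p a ∘ there))

 ∑-+ : ∀ {A : Set} (xs : List A) f g → ∑ xs (λ a → f a + g a) ≡ ∑ xs f + ∑ xs g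
 ∑-+ [] f g = sym (+-identityˡ 0ℚ)
 ∑-+ (x ∷ xs) f g = trans (cong (f x + g x +_) (∑-+ xs f g)) (eq (f x) (g x) (∑ xs f) (∑ xs g))
   where
   eq : ∀ a b c d → a + b + (c + d) ≡ a + c + (b + d)
   eq = solve 4 (λ a b c d → a :+ b :+ (c :+ d) := a :+ c :+ (b :+ d)) refl

 ∑-* : ∀ {A : Set} (xs : List A) c f → ∑ xs (λ a → c * f a) ≡ c * ∑ xs f
 ∑-* [] c f = sym (zeroʳ c)
 ∑-* (x ∷ xs) c f = trans (cong (c * f x +_) (∑-* xs c f)) (sym (distribˡ c _ _))

 ∑-++ : ∀ {A : Set} (xs ys : List A) f → ∑ (xs ++ ys) f ≡ ∑ xs f + ∑ ys f
 ∑-++ [] ys f = sym (+-identityˡ _)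
 ∑-++ (x ∷ xs) ys f = trans (cong (f x +_) (∑-++ xs ys f)) (sym (+-assoc _ _ _))

 ∑-map : ∀ {A B : Set} (g : A → B) (xs : List A) f → ∑ (map g xs) f ≡ ∑ xs (f ∘ g)
 ∑-map g [] f = refl
 ∑-map g (x ∷ xs) f = cong (f (g x) +_) (∑-map g xs f)

 ∑-swap : ∀ {A B : Set} (xs : List A) (M : Lin B) (f : A → B → ℚ) → ∑ xs (λ a → Lin.L M (f a)) ≡ Lin.L M (λ b → ∑ xs (λ a → f a b))
 ∑-swap [] M f = sym (Lin.L-0 M)
 ∑-swap (x ∷ xs) M f = trans (cong (Lin.L M (f x) +_) (∑-swap xs M f)) (sym (Lin.L-+ M (f x) _))

 ∑-lin : ∀ {A : Set} → List A → Lin A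
 ∑-lin xs = record { L = ∑ xs ; L-cong = λ p → ∑-cong xs (λ a _ → p a) ; L-+ = ∑-+ xs ; L-* = ∑-* xs }

 ∑≥0 : ∀ {A : Set} (xs : List A) {f} → (∀ a → a ∈ xs → 0ℚ ≤ f a) → 0ℚ ≤ ∑ xs f
 ∑≥0 [] p = ≤-refl
 ∑≥0 (x ∷ xs) p = add≥0 (p x (here refl)) (∑≥0 xs (λ a → p a ∘ there))

 ∑-≥term : ∀ {A : Set} (xs : List A) {f} → (∀ a → a ∈ xs → 0ℚ ≤ f a) → ∀ {a} → a ∈ xs → f a ≤ ∑ xs f
 ∑-≥term (x ∷ xs) {f} p (here refl) = ≤-by (∑ xs f) (∑≥0 xs (λ a → p a ∘ there)) refl
 ∑-≥term (x ∷ xs) {f} p {a} (there q) = ≤-by (f x + (∑ xs f - f a)) (add≥0 (p x (here refl)) (sub≥0 (∑-≥term xs (λ a → p a ∘ there) q))) (eq (f x) (∑ xs f) (f a))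
   where
   eq : ∀ x s a → x + s ≡ a + (x + (s - a))
   eq = solve 3 (λ x s a → x :+ s := a :+ (x :+ (s :- a))) refl

 -- The embedding of the naturals is recursive so that it unfolds together with sums over lists.
 _/1 : ℕ → ℚ
 zero /1 = 0ℚ
 suc n /1 = 1ℚ + n /1

 /1≥0 : ∀ n → 0ℚ ≤ n /1
 /1≥0 zero = ≤-refl
 /1≥0 (suc n) = add≥0 0≤1 (/1≥0 n)

 /1>0 : ∀ n → 0ℚ < suc n /1
 /1>0 n = <-≤-trans 0<1 (≤-by (n /1) (/1≥0 n) refl)

 /1-+ : ∀ m n → (m ℕ.+ n) /1 ≡ m /1 + n /1
 /1-+ zero n = sym (+-identityˡ _)
 /1-+ (suc m) n = trans (cong (1ℚ +_) (/1-+ m n)) (sym (+-assoc 1ℚ _ _))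

 /1-* : ∀ m n → (m ℕ.* n) /1 ≡ m /1 * n /1
 /1-* zero n = sym (zeroˡ (n /1))
 /1-* (suc m) n = trans (/1-+ n (m ℕ.* n)) (trans (cong (n /1 +_) (/1-* m n)) (eq (m /1) (n /1)))
   where
   eq : ∀ m n → n + m * n ≡ (1ℚ + m) * n
   eq = solve 2 (λ m n → n :+ m :* n := ((con 1ℚ) :+ m) :* n) refl

 /1-mono : ∀ {m n} → m ℕ.≤ n → m /1 ≤ n /1
 /1-mono {n = n} z≤n = /1≥0 n
 /1-mono (s≤s p) = +-monoʳ-≤ 1ℚ (/1-mono p)

 ∑-const : ∀ {A : Set} (xs : List A) c → ∑ xs (λ _ → c) ≡ length xs /1 * c
 ∑-const [] c = sym (zeroˡ c)
 ∑-const (x ∷ xs) c = trans (cong (c +_) (∑-const xs c)) (eq (length xs /1) c)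
   where
   eq : ∀ n c → c + n * c ≡ (1ℚ + n) * c
   eq = solve 2 (λ n c → c :+ n :* c := ((con 1ℚ) :+ n) :* c) refl

 ∑-≤const : ∀ {A : Set} (xs : List A) {f} c → (∀ a → a ∈ xs → f a ≤ c) → ∑ xs f ≤ length xs /1 * c
 ∑-≤const xs c p = ≤-trans (∑-mono xs p) (≤-reflexive (∑-const xs c))

 -- A finitely supported probability measure on P, seen as an expectation functional.
 record Mean {A : Set} (P : A → Set) : Set₁ where
   field
     E : (A → ℚ) → ℚ
     E-cong : ∀ {f g} → (∀ a → P a → f a ≡ g a) → E f ≡ E g
     E-+ : ∀ f g → E (λ a → f a + g a) ≡ E f + E g
     E-* : ∀ c f → E (λ a → c * f a) ≡ c * E f
     E-mono : ∀ {f g} → (∀ a → P a → f a ≤ g a) → E f ≤ E g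
     E-1 : E (λ _ → 1ℚ) ≡ 1ℚ
     -- Stated against every linear functional at once: it yields Fubini (`E-comm`) as well as the
     -- interchange with finite sums.
     E-swap : ∀ {B : Set} (M : Lin B) (f : A → B → ℚ) → E (λ a → Lin.L M (f a)) ≡ Lin.L M (λ b → E (λ a → f a b))
     -- The strict bound and the decidable `search` together produce a point whose value is at least
     -- the mean (`E-∃`), without excluded middle.
     E-< : ∀ {f} c → (∀ a → P a → f a < c) → E f < c
     search : ∀ (Q : A → Bool) → (∃ λ a → P a × Q a ≡ true) ⊎ (∀ a → P a → Q a ≡ false)

   E-∃ : ∀ {f} c → c ≤ E f → ∃ λ a → P a × c ≤ f a
   E-∃ {f} c p with search (λ a → c ≤ᵇ f a)
   ... | inj₁ (a , Pa , q) = a , Pa , ≤ᵇ⇒≤ q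
   ... | inj₂ none = ⊥-elim (<⇒≱ (E-< c (λ a Pa → ≰ᵇ⇒> (none a Pa))) p)

   lin : Lin A
   lin = record { L = E ; L-cong = λ p → E-cong (λ a _ → p a) ; L-+ = E-+ ; L-* = E-* }

   open Lin lin public using () renaming (L-0 to E-0; L-*ʳ to E-*ʳ; L-neg to E-neg; L-- to E--)

   E-const : ∀ c → E (λ _ → c) ≡ c
   E-const c = trans (E-cong (λ _ _ → sym (*-identityʳ c))) (trans (E-* c _) (trans (cong (c *_) E-1) (*-identityʳ c)))

   E≥0 : ∀ {f} → (∀ a → P a → 0ℚ ≤ f a) → 0ℚ ≤ E f
   E≥0 p = ≤-trans (≤-reflexive (sym E-0)) (E-mono p)

   E≤ : ∀ {f} c → (∀ a → P a → f a ≤ c) → E f ≤ c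
   E≤ c p = ≤-trans (E-mono p) (≤-reflexive (E-const c))

   E∈ : ∀ {f} → (∀ a → P a → f a ∈[0,1]) → E f ∈[0,1]
   E∈ p = E≥0 (λ a q → proj₁ (p a q)) , E≤ 1ℚ (λ a q → proj₂ (p a q))

 open Mean public

 E-comm : ∀ {A B : Set} {P : A → Set} {Q : B → Set} (M : Mean P) (N : Mean Q) f →
   E M (λ a → E N (f a)) ≡ E N (λ b → E M (λ a → f a b))
 E-comm M N f = E-swap M (lin N) f

 ∑-< : ∀ {A : Set} (xs : List A) {f} → 0 ℕ.< length xs → ∀ c → (∀ a → a ∈ xs → f a < c) → ∑ xs f < length xs /1 * c
 ∑-< (x ∷ xs) {f} _ c p = <-≤-trans (subst₂ _<_ (+-comm _ _) (+-comm _ _) (+-monoʳ-< (∑ xs f) (p x (here refl))))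
   (≤-trans (+-monoʳ-≤ c (∑-≤const xs c (λ a q → <⇒≤ (p a (there q))))) (≤-reflexive (solve 2 (λ c n → c :+ n :* c := ((con 1ℚ) :+ n) :* c) refl c (length xs /1))))

 any-list : ∀ {A : Set} (Q : A → Bool) (xs : List A) → (∃ λ a → a ∈ xs × Q a ≡ true) ⊎ (∀ a → a ∈ xs → Q a ≡ false)
 any-list Q [] = inj₂ λ a ()
 any-list Q (x ∷ xs) with Q x in eq | any-list Q xs
 ... | true | _ = inj₁ (x , here refl , eq)
 ... | false | inj₁ (a , p , q) = inj₁ (a , there p , q)
 ... | false | inj₂ none = inj₂ λ { a (here refl) → eq ; a (there p) → none a p }

 /1>0′ : ∀ {n} → 0 ℕ.< n → 0ℚ < n /1
 /1>0′ {suc n} _ = /1>0 n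

 -- Every point of `P` has positive weight, so conditioning on the class of an actual tuple is never
 -- conditioning on a null event.
 record FullMean {A : Set} (P : A → Set) : Set₁ where
   field
     mean : Mean P
     pos : ∀ {f} → (∀ a → P a → 0ℚ ≤ f a) → ∀ a → P a → 0ℚ < f a → 0ℚ < E mean f

 open FullMean public

 uniform : ∀ {A : Set} (xs : List A) → 0 ℕ.< length xs → (∀ a → a ∈ xs) → FullMean {A} (λ _ → ⊤)
 uniform {A} xs ne all = record
   { mean = record
     { E = λ f → r * ∑ xs f
     ; E-cong = λ p → cong (r *_) (∑-cong xs (λ a _ → p a tt))
     ; E-+ = λ f g → trans (cong (r *_) (∑-+ xs f g)) (distribˡ r _ _)
     ; E-* = λ c f → trans (cong (r *_) (∑-* xs c f)) (solve 3 (λ r c s → r :* (c :* s) := c :* (r :* s)) refl r c (∑ xs f))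
     ; E-mono = λ p → mul-monoˡ r r≥0 (∑-mono xs (λ a _ → p a tt))
     ; E-1 = trans (cong (r *_) (∑-const xs 1ℚ)) (trans (cong (r *_) (*-identityʳ _)) (inv-inverseˡ n (>0⇒≢0 n>0)))
     ; E-swap = λ M f → trans (cong (r *_) (∑-swap xs M f)) (sym (Lin.L-* M r _))
     ; E-< = λ {f} c p → subst₂ _<_ refl (trans (solve 3 (λ r n c → r :* (n :* c) := (r :* n) :* c) refl r n c) (trans (cong (_* c) rn) (*-identityˡ c))) (mul-mono-<ˡ r (inv>0 n>0) (∑-< xs ne c (λ a _ → p a tt)))
     ; search = λ Q → srch Q (any-list Q xs)
     }
   ; pos = λ p a _ q → mul>0 (inv>0 n>0) (<-≤-trans q (∑-≥term xs (λ a _ → p a tt) (all a)))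
   }
   where
   n r : ℚ
   n = length xs /1
   r = inv n
   n>0 : 0ℚ < n
   n>0 = /1>0′ ne
   r≥0 : 0ℚ ≤ r
   r≥0 = inv≥0 (<⇒≤ n>0)
   srch : ∀ (Q : A → Bool) → (∃ λ a → a ∈ xs × Q a ≡ true) ⊎ (∀ a → a ∈ xs → Q a ≡ false) → (∃ λ a → ⊤ × Q a ≡ true) ⊎ (∀ a → ⊤ → Q a ≡ false)
   srch Q (inj₁ (a , _ , q)) = inj₁ (a , tt , q)
   srch Q (inj₂ none) = inj₂ (λ a _ → none a (all a))
   rn : r * n ≡ 1ℚ
   rn = inv-inverseˡ n (>0⇒≢0 n>0)

 Len : {A : Set} → ℕ → List A → Set
 Len r l = length l ≡ r

 suc-inj : ∀ {m n} → suc m ≡ suc n → m ≡ n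
 suc-inj refl = refl

 -- Independent samples. The support is cut out by `Len r` because the integrands are defined on
 -- lists of all lengths.
 lists : ∀ {A : Set} → FullMean {A} (λ _ → ⊤) → (r : ℕ) → FullMean {List A} (Len r)
 lists {A} M zero = record
   { mean = record
     { E = λ f → f [] ; E-cong = λ p → p [] refl ; E-+ = λ f g → refl ; E-* = λ c f → refl
     ; E-mono = λ p → p [] refl ; E-1 = refl ; E-swap = λ L f → refl ; E-< = λ c p → p [] refl
     ; search = λ Q → srch0 Q }
   ; pos = λ { p [] refl q → q }
   }
   where
   srch0 : ∀ (Q : List A → Bool) → (∃ λ a → Len zero a × Q a ≡ true) ⊎ (∀ a → Len zero a → Q a ≡ false)
   srch0 Q with Q [] in eq
   ... | true = inj₁ ([] , refl , eq)
   ... | false = inj₂ (λ { [] refl → eq })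
 lists {A} M (suc r) = record
   { mean = record
     { E = λ f → E mV (λ v → E mr (λ l → f (v ∷ l)))
     ; E-cong = λ p → E-cong mV (λ v _ → E-cong mr (λ l q → p (v ∷ l) (cong suc q)))
     ; E-+ = λ f g → trans (E-cong mV (λ v _ → E-+ mr _ _)) (E-+ mV _ _)
     ; E-* = λ c f → trans (E-cong mV (λ v _ → E-* mr c _)) (E-* mV c _)
     ; E-mono = λ p → E-mono mV (λ v _ → E-mono mr (λ l q → p (v ∷ l) (cong suc q)))
     ; E-1 = trans (E-cong mV (λ v _ → E-1 mr)) (E-1 mV)
     ; E-swap = λ L f → trans (E-cong mV (λ v _ → E-swap mr L _)) (E-swap mV L _)
     ; E-< = λ c p → E-< mV c (λ v _ → E-< mr c (λ l q → p (v ∷ l) (cong suc q)))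
     ; search = λ Q → srch Q (search mV (λ v → found (search mr (λ l → Q (v ∷ l)))))
     }
   ; pos = λ { p (v ∷ l) q s → pos M (λ v _ → E≥0 mr (λ l q → p (v ∷ l) (cong suc q))) v tt (pos (lists M r) (λ l q → p (v ∷ l) (cong suc q)) l (suc-inj q) s) }
   }
   where
   mV = mean M
   mr = mean (lists M r)
   found : ∀ {X Y : Set} → X ⊎ Y → Bool
   found (inj₁ _) = true
   found (inj₂ _) = false
   srch : ∀ (Q : List A → Bool) → (∃ λ v → ⊤ × found (search mr (λ l → Q (v ∷ l))) ≡ true) ⊎ (∀ v → ⊤ → found (search mr (λ l → Q (v ∷ l))) ≡ false) →
     (∃ λ a → Len (suc r) a × Q a ≡ true) ⊎ (∀ a → Len (suc r) a → Q a ≡ false)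
   srch Q (inj₁ (v , _ , q)) with search mr (λ l → Q (v ∷ l))
   ... | inj₁ (l , s , t) = inj₁ (v ∷ l , cong suc s , t)
   srch Q (inj₂ none) = inj₂ none'
     where
     none' : ∀ a → Len (suc r) a → Q a ≡ false
     none' (v ∷ l) s with search mr (λ l → Q (v ∷ l)) | none v tt
     ... | inj₂ t | _ = t l (suc-inj s)

 module _ {A : Set} (M : FullMean {A} (λ _ → ⊤)) where

   Eᴸ : ℕ → (List A → ℚ) → ℚ
   Eᴸ r = E (mean (lists M r))

   Eᴸ-++ : ∀ r s f → Eᴸ (r ℕ.+ s) f ≡ Eᴸ r (λ l → Eᴸ s (λ l' → f (l ++ l')))
   Eᴸ-++ zero s f = refl
   Eᴸ-++ (suc r) s f = E-cong (mean M) (λ v _ → Eᴸ-++ r s (λ l → f (v ∷ l)))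

 insertAt : {A : Set} → ℕ → A → List A → List A
 insertAt zero v l = v ∷ l
 insertAt (suc i) v [] = v ∷ []
 insertAt (suc i) v (x ∷ l) = x ∷ insertAt i v l

 -- Independent samples are exchangeable, so a single sample may be moved to any position of the
 -- tuple.
 Eᴸ-insert : ∀ {A : Set} (M : FullMean {A} (λ _ → ⊤)) r i → i ℕ.≤ r → ∀ f → Eᴸ M (suc r) f ≡ E (mean M) (λ v → Eᴸ M r (λ l → f (insertAt i v l)))
 Eᴸ-insert M r zero _ f = refl
 Eᴸ-insert M (suc r) (suc i) (s≤s p) f = trans
   (E-cong (mean M) (λ x _ → Eᴸ-insert M r i p (λ l → f (x ∷ l))))
   (E-comm (mean M) (mean M) _)

 -- Conditional expectation on finitely many classes, and its energy.

 module Cond {A O : Set} {P : A → Set} (FM : FullMean P) (_≟_ : DecidableEquality O) where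
   private
     M = mean FM

   module _ (τ : A → O) where
     at : O → A → ℚ
     at o a = 𝟙 ⌊ τ a ≟ o ⌋

     mass : O → ℚ
     mass o = E M (at o)

     mass≥0 : ∀ o → 0ℚ ≤ mass o
     mass≥0 o = E≥0 M (λ a _ → 𝟙≥0 ⌊ τ a ≟ o ⌋)

     cond : (A → ℚ) → O → ℚ
     cond φ o = inv (mass o) * E M (λ a → at o a * φ a)

     at-refl : ∀ {o} a → τ a ≡ o → at o a ≡ 1ℚ
     at-refl {o} a p with τ a ≟ o
     ... | yes _ = refl
     ... | no q = ⊥-elim (q p)

     at-false : ∀ {o} a → τ a ≢ o → at o a ≡ 0ℚ
     at-false {o} a p with τ a ≟ o
     ... | yes q = ⊥-elim (p q)
     ... | no _ = refl

     at-* : ∀ {f g : A → ℚ} o a → (τ a ≡ o → f a ≡ g a) → at o a * f a ≡ at o a * g a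
     at-* o a p with τ a ≟ o
     ... | yes q = cong (1ℚ *_) (p q)
     ... | no _ = trans (zeroˡ _) (sym (zeroˡ _))

     at-sym : ∀ a b → at (τ b) a ≡ at (τ a) b
     at-sym a b with τ a ≟ τ b
     ... | yes q = sym (at-refl b (sym q))
     ... | no q = sym (at-false b (λ r → q (sym r)))

     mass>0 : ∀ a → P a → 0ℚ < mass (τ a)
     mass>0 a p = pos FM (λ b _ → 𝟙≥0 ⌊ τ b ≟ τ a ⌋) a p (<-≤-trans 0<1 (≤-reflexive (sym (at-refl a refl))))

     mass-inv : ∀ a → P a → inv (mass (τ a)) * mass (τ a) ≡ 1ℚ
     mass-inv a p = inv-inverseˡ _ (>0⇒≢0 (mass>0 a p))

     condMean : ∀ o → 0ℚ < mass o → Mean (λ a → P a × τ a ≡ o)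
     condMean o m>0 = record
       { E = λ φ → cond φ o
       ; E-cong = λ {f} {g} p → cong (i *_) (E-cong M (λ a q → at-* {f} {g} o a (λ r → p a (q , r))))
       ; E-+ = λ f g → trans (cong (i *_) (trans (E-cong M (λ a _ → distribˡ (at o a) (f a) (g a))) (E-+ M _ _))) (distribˡ i _ _)
       ; E-* = λ c f → trans (cong (i *_) (trans (E-cong M (λ a _ → solve 3 (λ x c y → x :* (c :* y) := c :* (x :* y)) refl (at o a) c (f a))) (E-* M c _))) (solve 3 (λ x c y → x :* (c :* y) := c :* (x :* y)) refl i c _)
       ; E-mono = λ {f} {g} p → mul-monoˡ i i≥0 (E-mono M (mono f g p))
       ; E-1 = trans (cong (i *_) (E-cong M (λ a _ → *-identityʳ _))) (inv-inverseˡ _ (>0⇒≢0 m>0))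
       ; E-swap = λ L f → trans (cong (i *_) (trans (E-cong M (λ a _ → sym (Lin.L-* L (at o a) (f a)))) (E-swap M L _))) (sym (Lin.L-* L i _))
       ; E-< = lt
       ; search = λ Q → srch Q (search M (λ a → ⌊ τ a ≟ o ⌋ ∧ Q a))
       }
       where
       i = inv (mass o)
       i≥0 : 0ℚ ≤ i
       i≥0 = inv≥0 (mass≥0 o)
       mono : ∀ f g → (∀ a → P a × τ a ≡ o → f a ≤ g a) → ∀ a → P a → at o a * f a ≤ at o a * g a
       mono f g p a q with τ a ≟ o
       ... | yes r = mul-monoˡ 1ℚ 0≤1 (p a (q , r))
       ... | no r = ≤-reflexive (trans (zeroˡ _) (sym (zeroˡ _)))
       srch : ∀ (Q : A → Bool) → (∃ λ a → P a × ⌊ τ a ≟ o ⌋ ∧ Q a ≡ true) ⊎ (∀ a → P a → ⌊ τ a ≟ o ⌋ ∧ Q a ≡ false) →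
         (∃ λ a → (P a × τ a ≡ o) × Q a ≡ true) ⊎ (∀ a → P a × τ a ≡ o → Q a ≡ false)
       srch Q (inj₁ (a , Pa , q)) with τ a ≟ o
       ... | yes r = inj₁ (a , (Pa , r) , q)
       srch Q (inj₂ none) = inj₂ none'
         where
         none' : ∀ a → P a × τ a ≡ o → Q a ≡ false
         none' a (Pa , r) with τ a ≟ o | none a Pa
         ... | yes _ | q = q
         ... | no r' | _ = ⊥-elim (r' r)
       lt : ∀ {f} c → (∀ a → P a × τ a ≡ o → f a < c) → cond f o < c
       -- A class of positive mass contains a point, the gap `c - f` is positive there, and fullness
       -- of the measure turns this into a positive integral of the gap.
       lt {f} c p with E-∃ M (mass o) ≤-refl
       ... | a , Pa , q with τ a ≟ o in eq
       ... | no r = ⊥-elim (<⇒≱ m>0 q)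
       ... | yes r = <-sub (<-≤-trans (mul>0 (inv>0 m>0) big) (≤-reflexive calc))
         where
         nn : ∀ b → P b → 0ℚ ≤ at o b * (c - f b)
         nn b Pb with τ b ≟ o
         ... | yes r = mul≥0 0≤1 (sub≥0 (<⇒≤ (p b (Pb , r))))
         ... | no r = ≤-reflexive (sym (zeroˡ _))
         big : 0ℚ < E M (λ b → at o b * (c - f b))
         big = pos FM nn a Pa (subst (λ x → 0ℚ < x * (c - f a)) (sym (at-refl a r)) (mul>0 0<1 (sub>0 (p a (Pa , r)))))
         calc : i * E M (λ b → at o b * (c - f b)) ≡ c - cond f o
         calc = trans (cong (i *_) (trans (E-cong M (λ b _ → solve 3 (λ x y c → x :* (c :- y) := c :* x :- x :* y) refl (at o b) (f b) c)) (trans (E-- M _ _) (cong (_- _) (E-* M c (at o))))))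
           (trans (solve 4 (λ i c m e → i :* (c :* m :- e) := c :* (i :* m) :- i :* e) refl i c (mass o) _) (cong (λ x → x - cond f o) (trans (cong (c *_) (inv-inverseˡ _ (>0⇒≢0 m>0))) (*-identityʳ c))))

     cond∈ : ∀ {φ} → (∀ a → P a → φ a ∈[0,1]) → ∀ a → P a → cond φ (τ a) ∈[0,1]
     cond∈ p a Pa = E∈ (condMean (τ a) (mass>0 a Pa)) (λ b q → p b (proj₁ q))

     -- The defining property of conditional expectation. Both sides are double averages over pairs
     -- of points in a common class; the roles of the two points are exchanged by `at-sym`.
     cond-test : ∀ (φ ψ : A → ℚ) → (∀ a b → P a → P b → τ a ≡ τ b → ψ a ≡ ψ b) → E M (λ a → cond φ (τ a) * ψ a) ≡ E M (λ a → φ a * ψ a)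
     cond-test φ ψ meas =
       trans (E-cong M (λ a _ → trans (solve 3 (λ i e p → i :* e :* p := (i :* p) :* e) refl (inv (mass (τ a))) (E M (λ b → at (τ a) b * φ b)) (ψ a)) (sym (E-* M _ _))))
       (trans (E-comm M M (λ a b → inv (mass (τ a)) * ψ a * (at (τ a) b * φ b)))
       (E-cong M (λ b Pb → trans (E-cong M (λ a Pa → step a b Pa Pb)) (trans (E-* M (φ b * ψ b * inv (mass (τ b))) (at (τ b)))
         (trans (*-assoc (φ b * ψ b) _ _) (trans (cong (φ b * ψ b *_) (mass-inv b Pb)) (*-identityʳ _)))))))
       where
       step : ∀ a b → P a → P b → inv (mass (τ a)) * ψ a * (at (τ a) b * φ b) ≡ φ b * ψ b * inv (mass (τ b)) * at (τ b) a
       step a b Pa Pb = trans (cong (λ x → inv (mass (τ a)) * ψ a * (x * φ b)) (at-sym b a))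
         (trans (solve 4 (λ i p x f → i :* p :* (x :* f) := x :* (f :* p :* i)) refl (inv (mass (τ a))) (ψ a) (at (τ b) a) (φ b))
         (trans (at-* {λ a → φ b * ψ a * inv (mass (τ a))} {λ _ → φ b * ψ b * inv (mass (τ b))} (τ b) a (λ q → cong₂ (λ x y → φ b * x * inv (mass y)) (meas a b Pa Pb q) q)) (*-comm _ _)))

     energy : (A → ℚ) → ℚ
     energy φ = E M (λ a → cond φ (τ a) * cond φ (τ a))

   Refines : (τ σ : A → O) → Set
   Refines τ σ = ∀ a b → P a → P b → τ a ≡ τ b → σ a ≡ σ b

   -- The coarse conditional expectation is measurable for the finer classes, so its inner product
   -- with the fine one equals its own energy (`cross`).
   pythagoras : ∀ τ σ φ → Refines τ σ →
     E M (λ a → (cond τ φ (τ a) - cond σ φ (σ a)) * (cond τ φ (τ a) - cond σ φ (σ a))) ≡ energy τ φ - energy σ φ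
   pythagoras τ σ φ ref =
     trans (E-cong M (λ a _ → solve 2 (λ x y → (x :- y) :* (x :- y) := x :* x :- y :* y :- ((x :* y :- y :* y) :+ (x :* y :- y :* y))) refl (cond τ φ (τ a)) (cond σ φ (σ a))))
     (trans (E-- M _ _) (trans (cong₂ _-_ (E-- M _ _) (trans (E-+ M _ _) (cong₂ _+_ zero' zero'))) (solve 1 (λ x → x :- ((con 0ℚ) :+ (con 0ℚ)) := x) refl _)))
     where
     cross : E M (λ a → cond τ φ (τ a) * cond σ φ (σ a)) ≡ energy σ φ
     cross = trans (cond-test τ φ (λ a → cond σ φ (σ a)) (λ a b Pa Pb q → cong (cond σ φ) (ref a b Pa Pb q)))
       (sym (cond-test σ φ (λ a → cond σ φ (σ a)) (λ a b _ _ q → cong (cond σ φ) q)))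
     zero' : E M (λ a → cond τ φ (τ a) * cond σ φ (σ a) - cond σ φ (σ a) * cond σ φ (σ a)) ≡ 0ℚ
     zero' = trans (E-- M _ _) (trans (cong (_- energy σ φ) cross) (+-inverseʳ _))

open Rationals

-- Ramsey's theorem for sublists.

module Ramsey where
 import Data.Bool.Properties as Bool
 import Data.Fin as Fin
 open import Data.Fin using (Fin; zero; suc; toℕ; fromℕ<; combine; remQuot)
 import Data.Fin.Properties as Fin
 import Data.Integer as ℤ
 open import Data.Integer using (-[1+_])
 import Data.Integer.Properties as ℤ
 open import Data.List.Membership.Propositional.Properties using (∈-++⁺ˡ; ∈-++⁺ʳ; ∈-upTo⁺; ∈-upTo⁻)
 open import Data.List.Properties using (length-take; length-++; length-drop; take++drop≡id; length-upTo)
 import Data.List.Relation.Binary.Sublist.DecPropositional as DecSub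
 open import Data.List.Relation.Binary.Sublist.Propositional using (_⊆_; []; _∷_; _∷ʳ_; ⊆-refl; ⊆-trans; minimum)
 open import Data.List.Relation.Binary.Sublist.Propositional.Properties using (take-⊆; ++⁺)
 import Data.Rational as ℚ
 open import Data.Rational using (ℚ; 0ℚ; 1ℚ; ½; _≤_; _<_)
 import Data.Rational.Properties as ℚ
 open import Data.Rational.Properties using (≤-trans; ≤-reflexive; <⇒≤; ≤-refl; <-≤-trans; ≤-<-trans; ≰⇒>; ≤-total)
 import Data.Rational.Unnormalised as ℚᵘ
 import Data.Rational.Unnormalised.Properties as ℚᵘ
 open import Function using (_∘_)

 module _ {A : Set} {K : ℕ} where

   -- Prehomogeneous lists: the colour of a (k+1)-sublist depends only on its first element, and the
   -- second list records this dependence.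
   data Pre (k : ℕ) (χ : List A → Fin K) : List A → List (Fin K) → Set where
     [] : Pre k χ [] []
     _∷_ : ∀ {x c l cs} → (∀ Y → Y ⊆ l → length Y ≡ k → χ (x ∷ Y) ≡ c) → Pre k χ l cs → Pre k χ (x ∷ l) (c ∷ cs)

 Hom : {A : Set} {K : ℕ} → ℕ → (List A → Fin K) → Fin K → List A → Set
 Hom k χ c l = ∀ Y → Y ⊆ l → length Y ≡ k → χ Y ≡ c

 count : ∀ {K} → Fin K → List (Fin K) → ℕ
 count c [] = 0
 count c (x ∷ cs) with x Fin.≟ c

 ... | yes _ = suc (count c cs)
 ... | no _ = count c cs

 select : ∀ {A : Set} {K k χ l cs} (c : Fin K) → Pre {A} k χ l cs → ∃ λ l' → l' ⊆ l × length l' ≡ count c cs × Hom (suc k) χ c l'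
 select c [] = [] , [] , refl , λ { .[] [] () }
 select {k = k} {χ} c (_∷_ {x} {c'} {l} h pre) with c' Fin.≟ c | select c pre

 ... | no _ | l' , s , n , hom = l' , x ∷ʳ s , n , hom
 ... | yes refl | l' , s , n , hom = x ∷ l' , refl ∷ s , cong suc n , hom'
   where
   hom' : Hom (suc k) χ c (x ∷ l')
   hom' Y (.x ∷ʳ q) m = hom Y q m
   hom' (.x ∷ Y) (refl ∷ q) m = h Y (⊆-trans q s) (suc-inj m)

 drop-zeros : ∀ {K} → List (Fin (suc K)) → List (Fin K)
 drop-zeros [] = []
 drop-zeros (zero ∷ cs) = drop-zeros cs
 drop-zeros (suc c ∷ cs) = c ∷ drop-zeros cs

 count-drop : ∀ {K} (c : Fin K) cs → count c (drop-zeros cs) ≡ count (suc c) cs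
 count-drop c [] = refl
 count-drop c (zero ∷ cs) = count-drop c cs
 count-drop c (suc c' ∷ cs) with c' Fin.≟ c

 ... | yes _ = cong suc (count-drop c cs)
 ... | no _ = count-drop c cs

 count-zero : ∀ {K} (cs : List (Fin (suc K))) → length cs ≡ count zero cs ℕ.+ length (drop-zeros cs)
 count-zero [] = refl
 count-zero (zero ∷ cs) = cong suc (count-zero cs)
 count-zero (suc c ∷ cs) = trans (cong suc (count-zero cs)) (sym (ℕ.+-suc (count zero cs) _))

 pigeon : ∀ K s (cs : List (Fin (suc K))) → suc K ℕ.* s ℕ.≤ length cs → ∃ λ c → s ℕ.≤ count c cs
 pigeon K s cs p with s ℕ.≤? count zero cs
 ... | yes q = zero , q
 pigeon zero s cs p | no q = ⊥-elim (q (ℕ.≤-trans (ℕ.≤-reflexive (sym (ℕ.+-identityʳ s))) (ℕ.≤-trans p (ℕ.≤-reflexive (trans (count-zero cs) (trans (cong (count zero cs ℕ.+_) (none (drop-zeros cs))) (ℕ.+-identityʳ _)))))))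
   where
   none : (l : List (Fin 0)) → length l ≡ 0
   none [] = refl
 pigeon (suc K) s cs p | no q with pigeon K s (drop-zeros cs) (ℕ.+-cancelˡ-≤ s _ _ (ℕ.≤-trans p (ℕ.≤-trans (ℕ.≤-reflexive (count-zero cs)) (ℕ.+-monoˡ-≤ _ (ℕ.<⇒≤ (ℕ.≰⇒> q))))))
 ... | c , r = suc c , ℕ.≤-trans r (ℕ.≤-reflexive (count-drop c cs))

 shorten : ∀ {A : Set} (l : List A) s → s ℕ.≤ length l → ∃ λ l' → l' ⊆ l × length l' ≡ s
 shorten l s p = take s l , take-⊆ s l , trans (length-take s l) (ℕ.m≤n⇒m⊓n≡m p)

 -- The bound `N` comes before the vertex type and the colouring; later it has to be known before
 -- the hypergraph.
 Ramsey : ℕ → ℕ → ℕ → ℕ → Set₁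
 Ramsey K k s N = ∀ {A : Set} (χ : List A → Fin K) (l : List A) → N ℕ.≤ length l →
   ∃ λ l' → l' ⊆ l × length l' ≡ s × ∃ λ c → Hom k χ c l'

 -- Induction on the uniformity. The theorem for `k` applied to the link of the first element fixes
 -- that element's colour; `pre-size t` elements allow `t` such rounds, and a majority colour among
 -- the fixed ones is homogeneous.
 ramsey : ∀ K k s → ∃ (Ramsey (suc K) k s)
 ramsey K zero s = s , λ χ l p → let l' , q , n = shorten l s p in l' , q , n , χ [] , λ { [] _ _ → refl }
 ramsey K (suc k) s = N , result
   where
   pre-size : ℕ → ℕ
   pre-size zero = 0
   pre-size (suc t) = suc (proj₁ (ramsey K k (pre-size t)))
   N = pre-size (suc K ℕ.* s)
   prehom : ∀ {A : Set} (χ : List A → Fin (suc K)) t l → pre-size t ℕ.≤ length l → ∃ λ l' → l' ⊆ l × ∃ λ cs → length cs ≡ t × Pre k χ l' cs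
   prehom χ zero l p = [] , minimum l , [] , refl , []
   prehom χ (suc t) (x ∷ l) (s≤s p) with proj₂ (ramsey K k (pre-size t)) (λ Y → χ (x ∷ Y)) l p
   ... | l₁ , s₁ , n₁ , c , hom with prehom χ t l₁ (ℕ.≤-reflexive (sym n₁))
   ... | l₂ , s₂ , cs , n₂ , pre = x ∷ l₂ , refl ∷ ⊆-trans s₂ s₁ , c ∷ cs , cong suc n₂ , (λ Y q → hom Y (⊆-trans q s₂)) ∷ pre
   result : Ramsey (suc K) (suc k) s N
   result χ l p with prehom χ (suc K ℕ.* s) l p
   ... | l₁ , s₁ , cs , n₁ , pre with pigeon K s cs (ℕ.≤-reflexive (sym n₁))
   ... | c , q with select c pre
   ... | l₂ , s₂ , n₂ , hom with shorten l₂ s (ℕ.≤-trans q (ℕ.≤-reflexive (sym n₂)))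
   ... | l₃ , s₃ , n₃ = l₃ , ⊆-trans s₃ (⊆-trans s₂ s₁) , n₃ , c , λ Y r → hom Y (⊆-trans r s₃)

 split-⊆ : ∀ {A : Set} (pre : List A) {z post l} → pre ++ z ∷ post ⊆ l → ∃ λ pre' → ∃ λ post' → l ≡ pre' ++ z ∷ post' × pre ⊆ pre'
 split-⊆ [] (y ∷ʳ p) with split-⊆ [] p
 ... | pre' , post' , e , q = y ∷ pre' , post' , cong (y ∷_) e , minimum _
 split-⊆ [] (refl ∷ p) = [] , _ , refl , []
 split-⊆ (x ∷ pre) (y ∷ʳ p) with split-⊆ (x ∷ pre) p
 ... | pre' , post' , e , q = y ∷ pre' , post' , cong (y ∷_) e , y ∷ʳ q
 split-⊆ (x ∷ pre) (refl ∷ p) with split-⊆ pre p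
 ... | pre' , post' , e , q = x ∷ pre' , post' , cong (x ∷_) e , refl ∷ q

 ∈⇒[]⊆ : ∀ {A : Set} {x : A} {l} → x ∈ l → x ∷ [] ⊆ l
 ∈⇒[]⊆ (here refl) = refl ∷ minimum _
 ∈⇒[]⊆ (there p) = _ ∷ʳ ∈⇒[]⊆ p

 ⊆⇒∈ : ∀ {A : Set} {x : A} {l l'} → l ⊆ l' → x ∈ l → x ∈ l'
 ⊆⇒∈ (y ∷ʳ p) q = there (⊆⇒∈ p q)
 ⊆⇒∈ (refl ∷ p) (here refl) = here refl
 ⊆⇒∈ (refl ∷ p) (there q) = there (⊆⇒∈ p q)

 ∈-split-⊆ : ∀ {A : Set} {y z : A} pre {post} → y ∈ pre → y ∷ z ∷ [] ⊆ pre ++ z ∷ post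
 ∈-split-⊆ (y ∷ pre) (here refl) = refl ∷ ∈⇒[]⊆ (∈-++⁺ʳ pre (here refl))
 ∈-split-⊆ (x ∷ pre) (there p) = x ∷ʳ ∈-split-⊆ pre p

 keep : {A : Set} → (A → Bool) → List A → List A
 keep Q [] = []
 keep Q (x ∷ l) = if Q x then x ∷ keep Q l else keep Q l

 keep-⊆ : ∀ {A : Set} (Q : A → Bool) l → keep Q l ⊆ l
 keep-⊆ Q [] = []
 keep-⊆ Q (x ∷ l) with Q x
 ... | true = refl ∷ keep-⊆ Q l
 ... | false = x ∷ʳ keep-⊆ Q l

 keep-∈ : ∀ {A : Set} (Q : A → Bool) {x} l → x ∈ keep Q l → Q x ≡ true
 keep-∈ Q (x ∷ l) p with Q x in eq
 keep-∈ Q (x ∷ l) (here refl) | true = eq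
 keep-∈ Q (x ∷ l) (there p) | true = keep-∈ Q l p
 ... | false = keep-∈ Q l p

 length-keep : ∀ {A : Set} (Q : A → Bool) l → length (keep Q l) /1 ≡ ∑ l (λ x → 𝟙 (Q x))
 length-keep Q [] = refl
 length-keep Q (x ∷ l) with Q x
 ... | true = cong (1ℚ +_) (length-keep Q l)
 ... | false = trans (length-keep Q l) (sym (+-identityˡ _))

 /1-cancel-≤ : ∀ {m n} → m /1 ≤ n /1 → m ℕ.≤ n
 /1-cancel-≤ {zero} p = z≤n
 /1-cancel-≤ {suc m} {zero} p = ⊥-elim (<⇒≱ (/1>0 m) p)
 /1-cancel-≤ {suc m} {suc n} p = s≤s (/1-cancel-≤ (≤-sub (≤-trans (sub≥0 p) (≤-reflexive (solve 2 (λ m n → (con 1ℚ) :+ n :- ((con 1ℚ) :+ m) := n :- m) refl (m /1) (n /1))))))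

 anyᵇ : {A : Set} → (A → Bool) → List A → Bool
 anyᵇ Q [] = false
 anyᵇ Q (x ∷ l) = if Q x then true else anyᵇ Q l

 anyᵇ-true : ∀ {A : Set} (Q : A → Bool) {x} l → x ∈ l → Q x ≡ true → anyᵇ Q l ≡ true
 anyᵇ-true Q (x ∷ l) (here refl) e rewrite e = refl
 anyᵇ-true Q (x ∷ l) (there p) e with Q x
 ... | true = refl
 ... | false = anyᵇ-true Q l p e

 anyᵇ-∃ : ∀ {A : Set} (Q : A → Bool) l → anyᵇ Q l ≡ true → ∃ λ x → x ∈ l × Q x ≡ true
 anyᵇ-∃ Q (x ∷ l) p with Q x in eq
 ... | true = x , here refl , eq
 ... | false with anyᵇ-∃ Q l p
 ... | y , q , e = y , there q , e

 -- The iterated pigeonhole by loss of mass.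

 mass-size : ℕ → ℕ → ℕ
 mass-size B zero = 1
 mass-size B (suc s) = suc (mass-size B s ℕ.* B)

 -- Each round fixes one point of the first space; on the indices that survive, every space loses
 -- mass c/2 of points that still see an earlier index.  This bounds the number of indices.
 module MassLoss {A Ω : Set} {P : A → Ω → Set} (p : (x : A) → Mean (P x))
   (Up Dn : A → A → Ω → Bool) (R : A → A → Ω → Ω → Bool) (c : ℚ) (c>0 : 0ℚ < c)
   (B : ℕ) (B-large : 1ℚ ≤ B /1 * (½ * c)) (J₀ : List A)
   (R-mass : ∀ {x z} → x ∷ z ∷ [] ⊆ J₀ → c ≤ E (p x) (λ a → E (p z) (λ b → 𝟙 (R x z a b))))
   (R-Up : ∀ {x z a b} → R x z a b ≡ true → Up x z a ≡ true)
   (R-Dn : ∀ {x z a b} → R x z a b ≡ true → Dn z x b ≡ true)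
   (R-free : ∀ {x y z a b} → x ∷ y ∷ z ∷ [] ⊆ J₀ → R x z a b ≡ true → Up x y a ≡ true → Dn z y b ≡ true → ⊥)
   where

   private
     size = mass-size B

   h : ℚ
   h = ½ * c

   seen : A → List A → ℚ
   seen z pre = E (p z) (λ b → 𝟙 (anyᵇ (λ y → Dn z y b) pre))

   Inv : ℕ → List A → Set
   Inv s J = ∀ pre z post → J ≡ pre ++ z ∷ post → seen z pre < s /1 * h

   h≥0 : 0ℚ ≤ h
   h≥0 = mul≥0 0≤½ (<⇒≤ c>0)

   -- Induction on the number `s` of quanta `h` that still bound `seen`. A round uses up one quantum
   -- and keeps at least a 1/`B` part of the indices.
   bound : ∀ s J → J ⊆ J₀ → Inv s J → size s ℕ.≤ length J → ⊥
   bound zero (x ∷ J) sub inv _ = <⇒≱ (inv [] x J refl) (≤-trans (≤-reflexive (zeroˡ h)) (E≥0 (p x) (λ b _ → ≤-refl)))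
   -- A point `a` over the first index whose total degree into the later spaces is at least the
   -- average.
   bound (suc s) (x ∷ J) sub inv (s≤s big) with E-∃ (p x) {λ a → ∑ J (λ z → E (p z) (λ b → 𝟙 (R x z a b)))} (length J /1 * c)
       (≤-trans (≤-reflexive (sym (∑-const J c))) (≤-trans (∑-mono J (λ z q → R-mass (⊆-trans (refl ∷ ∈⇒[]⊆ q) sub))) (≤-reflexive (∑-swap J (lin (p x)) (λ z a → E (p z) (λ b → 𝟙 (R x z a b)))))))
   ... | a , _ , heavy = bound s J' (⊆-trans J'⊆J (⊆-trans (x ∷ʳ ⊆-refl) sub)) inv' size'
     where
     r : A → ℚ
     r z = E (p z) (λ b → 𝟙 (R x z a b))
     Q : A → Bool
     Q z = h ≤ᵇ r z
     J' : List A
     J' = keep Q J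
     J'⊆J : J' ⊆ J
     J'⊆J = keep-⊆ Q J
     r≤ : ∀ z → r z ≤ 𝟙 (Q z) + h
     r≤ z with h ≤ᵇ r z in e
     ... | true = ≤-trans (E≤ (p z) 1ℚ (λ b _ → 𝟙≤1 (R x z a b))) (≤-by h h≥0 refl)
     ... | false = ≤-trans (<⇒≤ (≰ᵇ⇒> e)) (≤-reflexive (sym (+-identityˡ h)))
     many : length J /1 * h ≤ length J' /1
     many = ≤-sub (≤-trans (sub≥0 (≤-trans heavy (∑-mono J (λ z _ → r≤ z)))) (≤-reflexive (trans
       (cong (_- length J /1 * c) (trans (∑-+ J _ _) (cong₂ _+_ (sym (length-keep Q J)) (∑-const J h))))
       (solve 3 (λ n m c → m :+ n :* ((con ½) :* c) :- n :* c := m :- n :* ((con ½) :* c)) refl (length J /1) (length J' /1) c))))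
     size' : size s ℕ.≤ length J'
     size' = /1-cancel-≤ (≤-trans (≤-by (size s /1 * (B /1 * h - 1ℚ)) (mul≥0 (/1≥0 (size s)) (sub≥0 B-large)) (solve 3 (λ s b h → s :* b :* h := s :+ s :* (b :* h :- (con 1ℚ))) refl (size s /1) (B /1) h))
       (≤-trans (mul-monoʳ h h≥0 (≤-trans (≤-reflexive (sym (/1-* (size s) B))) (/1-mono big))) many))
     inv' : Inv s J'
     inv' pre' z post' eq with split-⊆ pre' (subst (_⊆ J) eq J'⊆J)
     ... | pre , post , eqJ , pre'⊆pre = <-sub (<-≤-trans (sub>0 (inv (x ∷ pre) z post (cong (x ∷_) eqJ)))
         (≤-by (seen z (x ∷ pre) - (seen z pre' + h)) (sub≥0 loss) (solve 4 (λ s h u v → s :* h :- u := ((con 1ℚ) :+ s) :* h :- v :+ (v :- (u :+ h))) refl (s /1) h (seen z pre') (seen z (x ∷ pre)))))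
       where
       z∈J' : ∀ {y} → y ∈ pre' ++ z ∷ post' → y ∈ J'
       z∈J' q = subst (_ ∈_) (sym eq) q
       hz : h ≤ r z
       hz = ≤ᵇ⇒≤ (keep-∈ Q J (z∈J' (∈-++⁺ʳ pre' (here refl))))
       -- A surviving `y` has positive degree from `a`, so `a` sees `y`; by `R-free` a point over
       -- `z` related to `a` cannot see `y` as well.
       up : ∀ {y} → y ∈ J' → Up x y a ≡ true
       up {y} q with E-∃ (p y) h (≤ᵇ⇒≤ (keep-∈ Q J q))
       ... | b , _ , t with R x y a b in e
       ... | true = R-Up e
       ... | false = ⊥-elim (<⇒≱ (mul>0 (ℚ.*<* (ℤ.+<+ (s≤s z≤n))) c>0) t)

       -- The points related to `a` and those seeing a surviving earlier index form disjoint events,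
       -- and each of them implies seeing some index of `x ∷ pre`.
       point : ∀ b → 𝟙 (anyᵇ (λ y → Dn z y b) pre') + 𝟙 (R x z a b) ≤ 𝟙 (anyᵇ (λ y → Dn z y b) (x ∷ pre))
       point b with R x z a b in e | anyᵇ (λ y → Dn z y b) pre' in e'
       ... | true | false rewrite R-Dn e = ≤-reflexive (+-identityˡ 1ℚ)
       ... | false | false = ≤-trans (≤-reflexive (+-identityˡ 0ℚ)) (𝟙≥0 (anyᵇ (λ y → Dn z y b) (x ∷ pre)))
       ... | false | true with anyᵇ-∃ (λ y → Dn z y b) pre' e'
       ... | y , y∈ , ye rewrite anyᵇ-true (λ y → Dn z y b) (x ∷ pre) (there (⊆⇒∈ pre'⊆pre y∈)) ye = ≤-reflexive (+-identityʳ 1ℚ)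
       point b | true | true with anyᵇ-∃ (λ y → Dn z y b) pre' e'
       ... | y , y∈ , ye = ⊥-elim (R-free (⊆-trans (refl ∷ ⊆-trans (∈-split-⊆ pre' y∈) (subst (_⊆ J) eq J'⊆J)) sub) e (up (z∈J' (∈-++⁺ˡ y∈))) ye)
       loss : seen z pre' + h ≤ seen z (x ∷ pre)
       loss = ≤-trans (+-monoʳ-≤ (seen z pre') hz) (≤-trans (≤-reflexive (sym (E-+ (p z) _ _))) (E-mono (p z) (λ b _ → point b)))

 bool-case : ∀ b → b ≡ true ⊎ b ≡ false
 bool-case true = inj₁ refl
 bool-case false = inj₂ refl

 not-false : ∀ b → (b ≡ false → ⊥) → b ≡ true
 not-false true h = refl
 not-false false h = ⊥-elim (h refl)

 not-true : ∀ b → (b ≡ true → ⊥) → b ≡ false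
 not-true true h = ⊥-elim (h refl)
 not-true false h = refl

 ∧-true : ∀ a b → a ∧ b ≡ true → a ≡ true × b ≡ true
 ∧-true true true _ = refl , refl

 ∧-intro : ∀ {a b} → a ≡ true → b ≡ true → a ∧ b ≡ true
 ∧-intro refl refl = refl

 pow : ℚ → ℕ → ℚ
 pow x zero = 1ℚ
 pow x (suc n) = x * pow x n

 pow≥0 : ∀ {x} → 0ℚ ≤ x → ∀ n → 0ℚ ≤ pow x n
 pow≥0 p zero = 0≤1
 pow≥0 p (suc n) = mul≥0 p (pow≥0 p n)

 0<½ : 0ℚ < ½
 0<½ = ℚ.*<* (ℤ.+<+ (s≤s z≤n))

 add>0 : ∀ {a b} → 0ℚ < a → 0ℚ ≤ b → 0ℚ < a + b
 add>0 {a} {b} p q = <-≤-trans p (≤-by b q refl)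

 sq-cancel-≤ : ∀ {a b} → 0ℚ ≤ b → a * a ≤ b * b → a ≤ b
 sq-cancel-≤ {a} {b} 0≤b p with ≤-total a b
 ... | inj₁ q = q
 ... | inj₂ b≤a with a ℚ.≟ b
 ... | yes refl = ≤-refl
 ... | no a≢b = ⊥-elim (<⇒≱ (<-sub (<-≤-trans (mul>0 a-b>0 (<-≤-trans (add>0 a-b>0 (add≥0 0≤b 0≤b)) (≤-reflexive (solve 2 (λ a b → a :- b :+ (b :+ b) := a :+ b) refl a b)))) (≤-reflexive (solve 2 (λ a b → (a :- b) :* (a :+ b) := a :* a :- b :* b) refl a b)))) p)
   where
   a-b>0 : 0ℚ < a - b
   a-b>0 = sub>0 (≤∧≢⇒< b≤a (a≢b ∘ sym))

 ∑-∃ : ∀ {A : Set} (xs : List A) {f} c → 0 ℕ.< length xs → c ≤ ∑ xs f → ∃ λ a → a ∈ xs × inv (length xs /1) * c ≤ f a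
 ∑-∃ xs {f} c ne p with any-list (λ a → (inv (length xs /1) * c ≤ᵇ f a)) xs
 ... | inj₁ (a , a∈ , q) = a , a∈ , ≤ᵇ⇒≤ q
 ... | inj₂ none = ⊥-elim (<⇒≱ (∑-< xs {f} ne (inv (length xs /1) * c) (λ a a∈ → ≰ᵇ⇒> (none a a∈)))
   (≤-trans (≤-reflexive (trans (solve 3 (λ n i c → n :* (i :* c) := (i :* n) :* c) refl (length xs /1) (inv (length xs /1)) c) (trans (cong (_* c) (inv-inverseˡ _ (>0⇒≢0 (/1>0′ ne)))) (*-identityˡ c)))) p))

 -- Chains of probability spaces and the heavy consecutive pair.

 module Chain {Ω : Set} {P : ℕ → Ω → Set} (p : ∀ i → Mean (P i)) where

   PL : ℕ → ℕ → List Ω → Set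
   PL i zero l = l ≡ []
   PL i (suc m) [] = ⊥
   PL i (suc m) (q ∷ l) = P i q × PL (suc i) m l

   prod : ∀ i m → Mean (PL i m)
   prod i zero = record
     { E = λ f → f [] ; E-cong = λ h → h [] refl ; E-+ = λ f g → refl ; E-* = λ c f → refl
     ; E-mono = λ h → h [] refl ; E-1 = refl ; E-swap = λ L f → refl ; E-< = λ c h → h [] refl
     ; search = srch0 }
     where
     srch0 : ∀ (Q : List Ω → Bool) → (∃ λ a → PL i zero a × Q a ≡ true) ⊎ (∀ a → PL i zero a → Q a ≡ false)
     srch0 Q with Q [] in eq
     ... | true = inj₁ ([] , refl , eq)
     ... | false = inj₂ (λ { [] refl → eq })
   prod i (suc m) = record
     { E = λ f → E (p i) (λ v → E pr (λ l → f (v ∷ l)))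
     ; E-cong = λ h → E-cong (p i) (λ v a → E-cong pr (λ l q → h (v ∷ l) (a , q)))
     ; E-+ = λ f g → trans (E-cong (p i) (λ v _ → E-+ pr _ _)) (E-+ (p i) _ _)
     ; E-* = λ c f → trans (E-cong (p i) (λ v _ → E-* pr c _)) (E-* (p i) c _)
     ; E-mono = λ h → E-mono (p i) (λ v a → E-mono pr (λ l q → h (v ∷ l) (a , q)))
     ; E-1 = trans (E-cong (p i) (λ v _ → E-1 pr)) (E-1 (p i))
     ; E-swap = λ L f → trans (E-cong (p i) (λ v _ → E-swap pr L _)) (E-swap (p i) L _)
     ; E-< = λ c h → E-< (p i) c (λ v a → E-< pr c (λ l q → h (v ∷ l) (a , q)))
     ; search = λ Q → srch Q (search (p i) (λ v → found (search pr (λ l → Q (v ∷ l)))))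
     }
     where
     pr = prod (suc i) m
     found : ∀ {X Y : Set} → X ⊎ Y → Bool
     found (inj₁ _) = true
     found (inj₂ _) = false
     srch : ∀ (Q : List Ω → Bool) → (∃ λ v → P i v × found (search pr (λ l → Q (v ∷ l))) ≡ true) ⊎ (∀ v → P i v → found (search pr (λ l → Q (v ∷ l))) ≡ false) →
       (∃ λ a → PL i (suc m) a × Q a ≡ true) ⊎ (∀ a → PL i (suc m) a → Q a ≡ false)
     srch Q (inj₁ (v , a , q)) with search pr (λ l → Q (v ∷ l))
     ... | inj₁ (l , s , t) = inj₁ (v ∷ l , (a , s) , t)
     srch Q (inj₂ none) = inj₂ none'
       where
       none' : ∀ a → PL i (suc m) a → Q a ≡ false
       none' (v ∷ l) (a , s) with search pr (λ l → Q (v ∷ l)) | none v a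
       ... | inj₂ t | _ = t l s

   cp cs : (ℕ → Ω → Ω → ℚ) → ℕ → List Ω → ℚ
   cp ω i [] = 1ℚ
   cp ω i (q ∷ []) = 1ℚ
   cp ω i (q ∷ q' ∷ l) = ω i q q' * cp ω (suc i) (q' ∷ l)
   cs ω i [] = 0ℚ
   cs ω i (q ∷ []) = 0ℚ
   cs ω i (q ∷ q' ∷ l) = ω i q q' + cs ω (suc i) (q' ∷ l)

   cp≥0 : ∀ ω → (∀ i q q' → 0ℚ ≤ ω i q q') → ∀ i l → 0ℚ ≤ cp ω i l
   cp≥0 ω h i [] = 0≤1
   cp≥0 ω h i (q ∷ []) = 0≤1
   cp≥0 ω h i (q ∷ q' ∷ l) = mul≥0 (h i q q') (cp≥0 ω h (suc i) (q' ∷ l))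

   cs≥0 : ∀ ω → (∀ i q q' → 0ℚ ≤ ω i q q') → ∀ i l → 0ℚ ≤ cs ω i l
   cs≥0 ω h i [] = ≤-refl
   cs≥0 ω h i (q ∷ []) = ≤-refl
   cs≥0 ω h i (q ∷ q' ∷ l) = add≥0 (h i q q') (cs≥0 ω h (suc i) (q' ∷ l))

   cp∈ : ∀ ω → (∀ i q q' → ω i q q' ∈[0,1]) → ∀ i l → cp ω i l ∈[0,1]
   cp∈ ω h i [] = 0≤1 , ≤-refl
   cp∈ ω h i (q ∷ []) = 0≤1 , ≤-refl
   cp∈ ω h i (q ∷ q' ∷ l) = *∈ (h i q q') (cp∈ ω h (suc i) (q' ∷ l))

   module _ (β : ℕ → Ω → Ω → Bool) (ε : ℚ) (0<ε : 0ℚ < ε) (ε≤½ : ε ≤ ½) where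

     𝟙β : ℕ → Ω → Ω → ℚ
     𝟙β i q q' = 𝟙 (β i q q')

     t s : ℕ → Ω → ℚ
     t i q = E (p (suc i)) (λ q' → 𝟙β i q q')
     s i q' = E (p i) (λ q → 𝟙β i q q')

     ρ : ℚ
     ρ = ½ + ε

     ρ>0 : 0ℚ < ρ
     ρ>0 = add>0 0<½ (<⇒≤ 0<ε)

     ρ≤1 : ρ ≤ 1ℚ
     ρ≤1 = ≤-by (½ - ε) (sub≥0 ε≤½) (solve 1 (λ e → (con 1ℚ) := (con ½) :+ e :+ ((con ½) :- e)) refl ε)

     large : ℕ → Ω → Ω → Bool
     large i q q' = (1ℚ + (ε + ε) <ᵇ t i q + s i q')

     β' γ : ℕ → Ω → Ω → ℚ
     β' i q q' = 𝟙 (β i q q' ∧ not (large i q q'))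
     γ i q q' = 𝟙 (β i q q' ∧ large i q q')

     -- Along the chain, the first edge with large degree sum already contributes 1 to the sum,
     -- which pays for the whole product.
     cp-split : ∀ i l → cp 𝟙β i l ≤ cp β' i l + cs γ i l
     cp-split i [] = ≤-reflexive (sym (+-identityʳ _))
     cp-split i (q ∷ []) = ≤-reflexive (sym (+-identityʳ _))
     cp-split i (q ∷ q' ∷ l) with β i q q' | large i q q' | cp-split (suc i) (q' ∷ l) | cp∈ 𝟙β (λ i q q' → 𝟙∈ (β i q q')) (suc i) (q' ∷ l) | cs≥0 γ (λ i q q' → 𝟙≥0 (β i q q' ∧ large i q q')) (suc i) (q' ∷ l)
     ... | false | _ | _ | _ | nn = ≤-by (cs γ (suc i) (q' ∷ l)) nn (solve 3 (λ x y s → (con 0ℚ) :* y :+ ((con 0ℚ) :+ s) := (con 0ℚ) :* x :+ s) refl (cp 𝟙β (suc i) (q' ∷ l)) (cp β' (suc i) (q' ∷ l)) _)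
     ... | true | true | _ | C | nn = ≤-by (1ℚ - cp 𝟙β (suc i) (q' ∷ l) + cs γ (suc i) (q' ∷ l)) (add≥0 (sub≥0 (proj₂ C)) nn) (solve 3 (λ x y s → (con 0ℚ) :* y :+ ((con 1ℚ) :+ s) := (con 1ℚ) :* x :+ ((con 1ℚ) :- x :+ s)) refl (cp 𝟙β (suc i) (q' ∷ l)) (cp β' (suc i) (q' ∷ l)) _)
     ... | true | false | ih | _ | _ = ≤-trans (≤-reflexive (*-identityˡ _)) (≤-trans ih (≤-reflexive (solve 2 (λ y s → y :+ s := (con 1ℚ) :* y :+ ((con 0ℚ) :+ s)) refl (cp β' (suc i) (q' ∷ l)) _)))

     t∈ : ∀ i q → t i q ∈[0,1]
     t∈ i q = E∈ (p (suc i)) (λ q' _ → 𝟙∈ (β i q q'))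

     s∈ : ∀ i q → s i q ∈[0,1]
     s∈ i q' = E∈ (p i) (λ q _ → 𝟙∈ (β i q q'))

     -- positive replacement for a degree; only degree 0 is changed
     plus : ℚ → ℚ
     plus x with x ℚ.≟ 0ℚ
     ... | yes _ = ρ * ρ
     ... | no _ = x

     plus>0 : ∀ {x} → 0ℚ ≤ x → 0ℚ < plus x
     plus>0 {x} p with x ℚ.≟ 0ℚ
     ... | yes _ = mul>0 ρ>0 ρ>0
     ... | no q = ≤∧≢⇒< p (q ∘ sym)

     ≤plus : ∀ x → x ≤ plus x
     ≤plus x with x ℚ.≟ 0ℚ
     ... | yes refl = <⇒≤ (mul>0 ρ>0 ρ>0)
     ... | no q = ≤-refl

     -- AM-GM for two degrees of sum at most `ρ + ρ`. The substitute `ρ * ρ` for degree 0 is chosen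
     -- so that the bound persists when the partner is only known to be at most 1.
     plus-* : ∀ {x y} → x ∈[0,1] → y ∈[0,1] → x + y ≤ 1ℚ + (ε + ε) → plus x * plus y ≤ ρ * ρ
     plus-* {x} {y} (x0 , x1) (y0 , y1) h with x ℚ.≟ 0ℚ | y ℚ.≟ 0ℚ
     ... | yes _ | yes _ = ≤-trans (mul-monoˡ (ρ * ρ) (sq≥0 ρ) (mul≤1 (<⇒≤ ρ>0) ρ≤1 ρ≤1)) (≤-reflexive (*-identityʳ _))
     ... | yes _ | no _ = ≤-trans (mul-monoˡ (ρ * ρ) (sq≥0 ρ) y1) (≤-reflexive (*-identityʳ _))
     ... | no _ | yes _ = ≤-trans (mul-monoʳ (ρ * ρ) (sq≥0 ρ) x1) (≤-reflexive (*-identityˡ _))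
     ... | no _ | no _ = ≤-by (½ * (½ * ((x - y) * (x - y))) + (ρ - ½ * (x + y)) * (ρ + ½ * (x + y)))
         (add≥0 (mul≥0 0≤½ (mul≥0 0≤½ (sq≥0 (x - y)))) (mul≥0 low (add≥0 (<⇒≤ ρ>0) (mul≥0 0≤½ (add≥0 x0 y0)))))
         (solve 3 (λ r x y → r :* r := x :* y :+ ((con ½) :* ((con ½) :* ((x :- y) :* (x :- y))) :+ (r :- (con ½) :* (x :+ y)) :* (r :+ (con ½) :* (x :+ y)))) refl ρ x y)
       where
       low : 0ℚ ≤ ρ - ½ * (x + y)
       low = ≤-trans (mul≥0 0≤½ (sub≥0 h)) (≤-reflexive (solve 3 (λ e x y → (con ½) :* ((con 1ℚ) :+ (e :+ e) :- (x :+ y)) := (con ½) :+ e :- (con ½) :* (x :+ y)) refl ε x y))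

     -- Two normalisations of the same edge: by the forward degree of its left end, giving a
     -- subprobability kernel to the right, and by the backward degree of its right end, giving one
     -- to the left.
     ωa ωb : ℕ → Ω → Ω → ℚ
     ωa i q q' = β' i q q' * inv (plus (t i q))
     ωb i q q' = β' i q q' * inv (plus (s i q'))

     inv-plus≥0 : ∀ {x} → x ∈[0,1] → 0ℚ ≤ inv (plus x)
     inv-plus≥0 p = inv≥0 (<⇒≤ (plus>0 (proj₁ p)))

     ωa≥0 : ∀ i q q' → 0ℚ ≤ ωa i q q'
     ωa≥0 i q q' = mul≥0 (𝟙≥0 (β i q q' ∧ not (large i q q'))) (inv-plus≥0 (t∈ i q))

     ωb≥0 : ∀ i q q' → 0ℚ ≤ ωb i q q'
     ωb≥0 i q q' = mul≥0 (𝟙≥0 (β i q q' ∧ not (large i q q'))) (inv-plus≥0 (s∈ i q'))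

     weight≥1 : ∀ i q q' → large i q q' ≡ false → 1ℚ ≤ (ρ * ρ) * (inv (plus (t i q)) * inv (plus (s i q')))
     weight≥1 i q q' e = ≤-trans (≤-reflexive (sym eq)) (mul-monoʳ (ia * ib) (mul≥0 (inv-plus≥0 (t∈ i q)) (inv-plus≥0 (s∈ i q'))) (plus-* (t∈ i q) (s∈ i q') (≮ᵇ⇒≥ e)))
       where
       ia = inv (plus (t i q))
       ib = inv (plus (s i q'))
       eq : plus (t i q) * plus (s i q') * (ia * ib) ≡ 1ℚ
       eq = trans (solve 4 (λ x y a b → x :* y :* (a :* b) := (a :* x) :* (b :* y)) refl (plus (t i q)) (plus (s i q')) ia ib)
         (trans (cong₂ _*_ (inv-inverseˡ _ (>0⇒≢0 (plus>0 (proj₁ (t∈ i q))))) (inv-inverseˡ _ (>0⇒≢0 (plus>0 (proj₁ (s∈ i q')))))) (*-identityˡ 1ℚ))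

     zero-chain : ∀ c x a A z → 0ℚ * c ≡ (x * (0ℚ * a * A)) * z
     zero-chain c x a A z = trans (zeroˡ c) (sym (trans (cong (λ y → x * y * z) (trans (cong (_* A) (zeroˡ a)) (zeroˡ A))) (trans (cong (_* z) (zeroʳ x)) (zeroˡ z))))

     -- An indicator equals its own square, so each edge can be given to both normalised chains; as
     -- the two degrees have product at most `ρ * ρ`, each chain pays one factor `ρ` per edge.
     cp-prod : ∀ i m l → length l ≡ suc m → cp β' i l ≤ (pow ρ m * cp ωa i l) * (pow ρ m * cp ωb i l)
     cp-prod i zero (q ∷ []) _ = ≤-reflexive (solve 0 ((con 1ℚ) := ((con 1ℚ) :* (con 1ℚ)) :* ((con 1ℚ) :* (con 1ℚ))) refl)
     cp-prod i (suc m) (q ∷ q' ∷ l) e with β i q q' | large i q q' in eq | cp-prod (suc i) m (q' ∷ l) (suc-inj e)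
     ... | false | _ | ih = ≤-reflexive (zero-chain _ _ _ _ _)
     ... | true | true | ih = ≤-reflexive (zero-chain _ _ _ _ _)
     ... | true | false | ih = ≤-trans (mul-monoˡ 1ℚ 0≤1 ih) (≤-trans (mul-monoʳ XY XY≥0 (weight≥1 i q q' eq))
         (≤-reflexive (solve 6 (λ r p a A b B → (r :* r) :* (a :* b) :* ((p :* A) :* (p :* B)) := (r :* p :* ((con 1ℚ) :* a :* A)) :* (r :* p :* ((con 1ℚ) :* b :* B))) refl ρ (pow ρ m) (inv (plus (t i q))) (cp ωa (suc i) (q' ∷ l)) (inv (plus (s i q'))) (cp ωb (suc i) (q' ∷ l)))))
       where
       XY = (pow ρ m * cp ωa (suc i) (q' ∷ l)) * (pow ρ m * cp ωb (suc i) (q' ∷ l))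
       XY≥0 : 0ℚ ≤ XY
       XY≥0 = mul≥0 (mul≥0 (pow≥0 (<⇒≤ ρ>0) m) (cp≥0 ωa ωa≥0 (suc i) (q' ∷ l))) (mul≥0 (pow≥0 (<⇒≤ ρ>0) m) (cp≥0 ωb ωb≥0 (suc i) (q' ∷ l)))

     -- AM–GM between the two ways of integrating out a chain
     cp-mean : ∀ i m l → length l ≡ suc m → cp β' i l ≤ ½ * (pow ρ m * (cp ωa i l + cp ωb i l))
     cp-mean i m l e = ≤-trans (sq-cancel-≤ (mul≥0 0≤½ (add≥0 X≥0 Y≥0)) key) (≤-reflexive (cong (½ *_) (sym (distribˡ (pow ρ m) _ _))))
       where
       c = cp β' i l
       X = pow ρ m * cp ωa i l
       Y = pow ρ m * cp ωb i l
       X≥0 : 0ℚ ≤ X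
       X≥0 = mul≥0 (pow≥0 (<⇒≤ ρ>0) m) (cp≥0 ωa ωa≥0 i l)
       Y≥0 : 0ℚ ≤ Y
       Y≥0 = mul≥0 (pow≥0 (<⇒≤ ρ>0) m) (cp≥0 ωb ωb≥0 i l)
       c∈ : c ∈[0,1]
       c∈ = cp∈ β' (λ i q q' → 𝟙∈ (β i q q' ∧ not (large i q q'))) i l
       key : c * c ≤ (½ * (X + Y)) * (½ * (X + Y))
       key = ≤-by ((½ * (X - Y)) * (½ * (X - Y)) + (X * Y - c) + c * (1ℚ - c))
         (add≥0 (add≥0 (sq≥0 _) (sub≥0 (cp-prod i m l e))) (mul≥0 (proj₁ c∈) (sub≥0 (proj₂ c∈))))
         (solve 3 (λ c X Y → ((con ½) :* (X :+ Y)) :* ((con ½) :* (X :+ Y)) := c :* c :+ (((con ½) :* (X :- Y)) :* ((con ½) :* (X :- Y)) :+ (X :* Y :- c) :+ c :* ((con 1ℚ) :- c))) refl c X Y)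

     β'≤β : ∀ i q q' → β' i q q' ≤ 𝟙β i q q'
     β'≤β i q q' with β i q q'
     ... | true = 𝟙≤1 (not (large i q q'))
     ... | false = ≤-refl

     -- Integrate the last point first: given its predecessor, the normalised edges have total
     -- weight at most 1. `Eb` is the mirror image and integrates the first point first.
     Ea : ∀ i m q → E (prod (suc i) m) (λ l → cp ωa i (q ∷ l)) ≤ 1ℚ
     Ea i zero q = ≤-refl
     Ea i (suc m) q = ≤-trans (E-mono (p (suc i)) (λ q' _ → ≤-trans (≤-reflexive (E-* (prod (suc (suc i)) m) (ωa i q q') _))
         (≤-trans (mul-monoˡ (ωa i q q') (ωa≥0 i q q') (Ea (suc i) m q')) (≤-reflexive (*-identityʳ _)))))
       (≤-trans (≤-reflexive (E-*ʳ (p (suc i)) (β' i q) (inv (plus (t i q)))))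
       (≤-trans (mul-monoʳ (inv (plus (t i q))) (inv-plus≥0 (t∈ i q)) (≤-trans (E-mono (p (suc i)) (λ q' _ → β'≤β i q q')) (≤plus (t i q))))
       (≤-trans (≤-reflexive (*-comm _ _)) (inv*≤1 (plus (t i q))))))

     Eb : ∀ i m → E (prod i (suc m)) (cp ωb i) ≤ 1ℚ
     Eb i zero = ≤-reflexive (E-1 (p i))
     Eb i (suc m) = ≤-trans (≤-reflexive (E-comm (p i) (prod (suc i) (suc m)) (λ q l → cp ωb i (q ∷ l))))
       (≤-trans (E-mono (prod (suc i) (suc m)) step) (Eb (suc i) m))
       where
       step : ∀ l → PL (suc i) (suc m) l → E (p i) (λ q → cp ωb i (q ∷ l)) ≤ cp ωb (suc i) l
       step (q' ∷ l) _ = ≤-trans (≤-reflexive (E-*ʳ (p i) (λ q → ωb i q q') _))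
         (≤-trans (mul-monoʳ _ (cp≥0 ωb ωb≥0 (suc i) (q' ∷ l)) (≤-trans (≤-reflexive (E-*ʳ (p i) (λ q → β' i q q') _))
           (≤-trans (mul-monoʳ (inv (plus (s i q'))) (inv-plus≥0 (s∈ i q')) (≤-trans (E-mono (p i) (λ q _ → β'≤β i q q')) (≤plus (s i q'))))
           (≤-trans (≤-reflexive (*-comm _ _)) (inv*≤1 (plus (s i q')))))))
         (≤-reflexive (*-identityˡ _)))

     PL-length : ∀ i m l → PL i m l → length l ≡ m
     PL-length i zero .[] refl = refl
     PL-length i (suc m) (q ∷ l) (_ , h) = cong suc (PL-length (suc i) m l h)

     -- The origin of the extremal density: without large degree sums, each of the `m` links costs a
     -- factor `ρ`, which is barely above one half.
     E-β' : ∀ m → E (prod 0 (suc m)) (cp β' 0) ≤ pow ρ m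
     E-β' m = ≤-trans (E-mono (prod 0 (suc m)) (λ l h → cp-mean 0 m l (PL-length 0 (suc m) l h)))
       (≤-trans (≤-reflexive (trans (E-* pr ½ (λ l → pow ρ m * (cp ωa 0 l + cp ωb 0 l))) (cong (½ *_) (trans (E-* pr (pow ρ m) (λ l → cp ωa 0 l + cp ωb 0 l)) (cong (pow ρ m *_) (E-+ pr (cp ωa 0) (cp ωb 0)))))))
       (≤-by (½ * (pow ρ m * ((1ℚ - A) + (1ℚ - B)))) (mul≥0 0≤½ (mul≥0 (pow≥0 (<⇒≤ ρ>0) m) (add≥0 (sub≥0 A≤1) (sub≥0 (Eb 0 m)))))
         (solve 3 (λ r a b → r := (con ½) :* (r :* (a :+ b)) :+ (con ½) :* (r :* (((con 1ℚ) :- a) :+ ((con 1ℚ) :- b)))) refl (pow ρ m) A B)))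
       where
       pr = prod 0 (suc m)
       A = E pr (cp ωa 0)
       B = E pr (cp ωb 0)
       A≤1 : A ≤ 1ℚ
       A≤1 = E≤ (p 0) 1ℚ (λ q _ → Ea 0 m q)

     Γ : ℕ → ℚ
     Γ i = E (p i) (λ q → E (p (suc i)) (γ i q))

     E-cs : ∀ c m i → (∃ λ j → j ℕ.< i ℕ.+ m × c ≤ Γ j) ⊎ (E (prod i (suc m)) (cs γ i) ≤ m /1 * c)
     E-cs c zero i = inj₂ (≤-reflexive (trans (E-0 (p i)) (sym (zeroˡ c))))
     E-cs c (suc m) i with c ℚ.≤? Γ i | E-cs c m (suc i)
     ... | yes q | _ = inj₁ (i , ℕ.m<m+n i (s≤s z≤n) , q)
     ... | no q | inj₁ (j , j< , h) = inj₁ (j , ℕ.≤-trans j< (ℕ.≤-reflexive (sym (ℕ.+-suc i m))) , h)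
     ... | no q | inj₂ h = inj₂ (≤-trans (≤-reflexive eq) (≤-trans (+-mono-≤ (<⇒≤ (≰⇒> q)) h) (≤-reflexive (solve 2 (λ m c → c :+ m :* c := ((con 1ℚ) :+ m) :* c) refl (m /1) c))))
       where
       eq : E (prod i (suc (suc m))) (cs γ i) ≡ Γ i + E (prod (suc i) (suc m)) (cs γ (suc i))
       eq = trans (E-cong (p i) (λ a _ → trans (E-cong (p (suc i)) (λ b _ → trans (E-+ (prod (suc (suc i)) m) (λ _ → γ i a b) (λ l → cs γ (suc i) (b ∷ l))) (cong (_+ _) (E-const (prod (suc (suc i)) m) _)))) (E-+ (p (suc i)) (γ i a) _)))
         (trans (E-+ (p i) _ _) (cong (Γ i +_) (E-const (p i) _)))

     heavy-pair : ∀ r c → pow ρ r + r /1 * c < E (prod 0 (suc r)) (cp 𝟙β 0) → ∃ λ i → i ℕ.< r × c ≤ Γ i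
     heavy-pair r c h with E-cs c r 0
     ... | inj₁ x = x
     ... | inj₂ q = ⊥-elim (<⇒≱ h (≤-trans (E-mono (prod 0 (suc r)) (λ l _ → cp-split 0 l)) (≤-trans (≤-reflexive (E-+ (prod 0 (suc r)) (cp β' 0) (cs γ 0))) (+-mono-≤ (E-β' r) q))))

     module _ (M : ℕ) (M>0 : 0 ℕ.< M) (step≤ε : inv (M /1) ≤ ε) where

       δ : ℚ
       δ = inv (M /1)

       floor : ∀ {x} → 0ℚ ≤ x → ∀ n → x < suc n /1 * δ → ∃ λ j → j ℕ.≤ n × j /1 * δ ≤ x × x < suc j /1 * δ
       floor 0≤x zero h = 0 , z≤n , ≤-trans (≤-reflexive (zeroˡ δ)) 0≤x , h
       floor {x} 0≤x (suc n) h with suc n /1 * δ ℚ.≤? x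
       ... | yes q = suc n , ℕ.≤-refl , q , h
       ... | no q with floor 0≤x n (≰⇒> q)
       ... | j , j≤ , a , b = j , ℕ.m≤n⇒m≤1+n j≤ , a , b

       -- For every `j` the two thresholds sum to `1 + ε`. Rounding the degrees leaves finitely many
       -- values, hence a colour for Ramsey's theorem, and still forces an overlap of measure `ε`.
       bucket : ℕ → ℕ → Ω → Ω → Bool
       bucket j i q q' = β i q q' ∧ (j /1 * δ ≤ᵇ t i q) ∧ (1ℚ + ε - j /1 * δ ≤ᵇ s i q')

       γ≤-large : ∀ i q q' → β i q q' ∧ large i q q' ≡ true → γ i q q' ≤ ∑ (upTo (suc M)) (λ j → 𝟙 (bucket j i q q'))
       γ≤-large i q q' e = found (floor (proj₁ (t∈ i q)) M
           (≤-<-trans (proj₂ (t∈ i q)) (<-≤-trans (subst (_< 1ℚ + δ) (+-identityʳ 1ℚ) (+-monoʳ-< 1ℚ (inv>0 (/1>0′ M>0)))) (≤-reflexive (trans (cong (_+ δ) (sym (inv-inverseˡ _ (>0⇒≢0 (/1>0′ M>0))))) (solve 2 (λ m d → d :* m :+ d := ((con 1ℚ) :+ m) :* d) refl (M /1) δ))))))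
         where
         found : (∃ λ j → j ℕ.≤ M × j /1 * δ ≤ t i q × t i q < suc j /1 * δ) → γ i q q' ≤ ∑ (upTo (suc M)) (λ j → 𝟙 (bucket j i q q'))
         found (j , j≤ , a , b) = ≤-trans (𝟙≤1 (β i q q' ∧ large i q q')) (≤-trans (≤-reflexive (cong 𝟙 (sym yes!))) (∑-≥term (upTo (suc M)) {λ j → 𝟙 (bucket j i q q')} (λ j _ → 𝟙≥0 (bucket j i q q')) (∈-upTo⁺ (s≤s j≤))))
           where
           -- Rounding `t` down loses less than `δ ≤ ε`, which uses up one of the two `ε` in the
           -- definition of `large`.
           sge : 1ℚ + ε - j /1 * δ ≤ s i q'
           sge = ≤-sub (≤-trans (add≥0 (add≥0 (<⇒≤ (sub>0 (<ᵇ⇒< (proj₂ (∧-true (β i q q') (large i q q') e))))) (<⇒≤ (sub>0 b))) (sub≥0 step≤ε))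
             (≤-reflexive (solve 5 (λ t s e j d → t :+ s :- ((con 1ℚ) :+ (e :+ e)) :+ (((con 1ℚ) :+ j) :* d :- t) :+ (e :- d) := s :- ((con 1ℚ) :+ e :- j :* d)) refl (t i q) (s i q') ε (j /1) δ)))
           yes! : bucket j i q q' ≡ true
           yes! = ∧-intro {β i q q'} (proj₁ (∧-true (β i q q') (large i q q') e)) (∧-intro (≤⇒≤ᵇ a) (≤⇒≤ᵇ sge))

       γ≤ : ∀ i q q' → γ i q q' ≤ ∑ (upTo (suc M)) (λ j → 𝟙 (bucket j i q q'))
       γ≤ i q q' with bool-case (β i q q' ∧ large i q q')
       ... | inj₂ e = ≤-trans (≤-reflexive (cong 𝟙 e)) (∑≥0 (upTo (suc M)) (λ j _ → 𝟙≥0 (bucket j i q q')))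
       ... | inj₁ e = γ≤-large i q q' e

       heavy-bucket : ∀ r c → pow ρ r + r /1 * c < E (prod 0 (suc r)) (cp 𝟙β 0) →
         ∃ λ i → i ℕ.< r × ∃ λ j → j ℕ.< suc M × inv (suc M /1) * c ≤ E (p i) (λ q → E (p (suc i)) (λ q' → 𝟙 (bucket j i q q')))
       heavy-bucket r c h with heavy-pair r c h
       ... | i , i< , q with ∑-∃ (upTo (suc M)) {λ j → E (p i) (λ q → E (p (suc i)) (λ q' → 𝟙 (bucket j i q q')))} c (ℕ.≤-trans (s≤s z≤n) (ℕ.≤-reflexive (sym (length-upTo (suc M)))))
           (≤-trans q (≤-trans (E-mono (p i) (λ a _ → E-mono (p (suc i)) (λ b _ → γ≤ i a b)))
             (≤-reflexive (trans (E-cong (p i) (λ a _ → sym (∑-swap (upTo (suc M)) (lin (p (suc i))) (λ j b → 𝟙 (bucket j i a b))))) (sym (∑-swap (upTo (suc M)) (lin (p i)) (λ j a → E (p (suc i)) (λ b → 𝟙 (bucket j i a b)))))))))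
       ... | j , j∈ , v = i , i< , j , ∈-upTo⁻ j∈ , ≤-trans (≤-reflexive (cong (λ n → inv (n /1) * c) (sym (length-upTo (suc M))))) v

 opaque
   unfolding _+_

   -- The bridge from the recursive embedding to the one in the definition of density.
   /1≡ℕtoℚ : ∀ m → m /1 ≡ ℕtoℚ m
   /1≡ℕtoℚ zero = refl
   /1≡ℕtoℚ (suc m) = trans (cong (1ℚ ℚ.+_) (/1≡ℕtoℚ m)) (ℚ.toℚᵘ-injective
     (ℚᵘ.≃-trans (ℚ.toℚᵘ-homo-+ 1ℚ (ℕtoℚ m)) (ℚᵘ.≃-trans (ℚᵘ.+-congʳ (ℚ.toℚᵘ 1ℚ) (ℚ.toℚᵘ-fromℚᵘ (ℚᵘ.mkℚᵘ (ℤ.+ m) 0)))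
     (ℚᵘ.≃-trans (ℚᵘ.*≡* (cong (λ x → x ℤ.* (ℤ.+ 1)) (cong (λ x → (ℤ.+ 1) ℤ.+ x) (ℤ.*-identityʳ (ℤ.+ m))))) (ℚᵘ.≃-sym (ℚ.toℚᵘ-fromℚᵘ (ℚᵘ.mkℚᵘ (ℤ.+ suc m) 0)))))))

 archimedes : ∀ x → ∃ λ n → x ≤ n /1
 archimedes x@(ℚ.mkℚ -[1+ n ] d _) = 0 , ℚ.nonPositive⁻¹ x
 archimedes x@(ℚ.mkℚ (ℤ.+ n) d _) = n , ≤-trans (ℚ.toℚᵘ-cancel-≤ (ℚᵘ.≤-trans le (ℚᵘ.≤-reflexive (ℚᵘ.≃-sym (ℚ.toℚᵘ-fromℚᵘ (ℚᵘ.mkℚᵘ (ℤ.+ n) 0)))))) (≤-reflexive (sym (/1≡ℕtoℚ n)))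
   where
   le : ℚ.toℚᵘ x ℚᵘ.≤ ℚᵘ.mkℚᵘ (ℤ.+ n) 0
   le = ℚᵘ.*≤* (subst₂ ℤ._≤_ (ℤ.pos-* n 1) (ℤ.pos-* n (suc d)) (ℤ.+≤+ (ℕ.*-monoʳ-≤ n (s≤s z≤n))))

 archimedes* : ∀ {h} → 0ℚ < h → ∃ λ n → 1ℚ ≤ n /1 * h
 archimedes* {h} h>0 with archimedes (inv h)
 ... | n , p = n , ≤-trans (≤-reflexive (sym (inv-inverseˡ h (>0⇒≢0 h>0)))) (mul-monoʳ h (<⇒≤ h>0) p)

 -- Reduced structures and the contradiction inside a link.

 rem : {A : Set} → ℕ → List A → List A
 rem i [] = []
 rem zero (x ∷ l) = l
 rem (suc i) (x ∷ l) = x ∷ rem i l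

 rem-++ : ∀ {A : Set} (T₁ : List A) {x T₂} → rem (length T₁) (T₁ ++ x ∷ T₂) ≡ T₁ ++ T₂
 rem-++ [] = refl
 rem-++ (y ∷ T₁) = cong (y ∷_) (rem-++ T₁)

 rem-suc-++ : ∀ {A : Set} (T₁ : List A) {x y T₂} → rem (suc (length T₁)) (T₁ ++ x ∷ y ∷ T₂) ≡ T₁ ++ x ∷ T₂
 rem-suc-++ [] = refl
 rem-suc-++ (y ∷ T₁) = cong (y ∷_) (rem-suc-++ T₁)

 module Reduced {A Ω : Set} {P : List A → Ω → Set} (p : ∀ X → Mean (P X)) (β : ℕ → Ω → Ω → Bool) where

   pY : (Y : List A) (i : ℕ) → Mean (P (rem i Y))
   pY Y i = p (rem i Y)

   chain : ℕ → List A → ℚ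
   chain r Y = E (Chain.prod (pY Y) 0 (suc r)) (Chain.cp (pY Y) (λ i q q' → 𝟙 (β i q q')) 0)

   -- Deleting position `i` from `T₁ ++ x ∷ z ∷ T₂` leaves the tuple through `z`, deleting the next
   -- one leaves that through `x`. Hence the argument belonging to the later vertex comes first in
   -- `β`.
   tri : ℕ → List A → A → A → A → List A → ℚ
   tri i T₁ x y z T₂ = E (p (T₁ ++ x ∷ T₂)) (λ a → E (p (T₁ ++ z ∷ T₂)) (λ b → E (p (T₁ ++ y ∷ T₂)) (λ q → 𝟙 (β i b a) * (𝟙 (β i q a) * 𝟙 (β i b q)))))

   tri≥0 : ∀ i T₁ x y z T₂ → 0ℚ ≤ tri i T₁ x y z T₂
   tri≥0 i T₁ x y z T₂ = E≥0 (p (T₁ ++ x ∷ T₂)) (λ a _ → E≥0 (p (T₁ ++ z ∷ T₂)) (λ b _ → E≥0 (p (T₁ ++ y ∷ T₂)) (λ q _ → mul≥0 (𝟙≥0 (β i b a)) (mul≥0 (𝟙≥0 (β i q a)) (𝟙≥0 (β i b q))))))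

 -- The contradiction inside one link: J is long, consecutive pairs are heavy and triangles are light.
 module Link {A Ω : Set} (_≟_ : DecidableEquality A) {P : A → Ω → Set} (p : ∀ x → Mean (P x)) (β : Ω → Ω → Bool)
   (ε b₀ c' : ℚ) (0<ε : 0ℚ < ε) (c₂>0 : 0ℚ < ½ * c') (B : ℕ) (B-large : 1ℚ ≤ B /1 * (½ * (½ * c')))
   (s : ℕ) (s-large : 1ℚ < s /1 * (½ * (½ * c'))) (J : List A) (J>0 : 0ℚ < length J /1) (J-large : mass-size B s ℕ.≤ length J) where

   private
     c₂ a₀ : ℚ
     c₂ = ½ * c'
     a₀ = 1ℚ + ε - b₀

     su td : A → Ω → ℚ
     su y a = E (p y) (λ q → 𝟙 (β q a))
     td y b = E (p y) (λ q → 𝟙 (β b q))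
     Up Dn : A → A → Ω → Bool
     Up x y a = a₀ ≤ᵇ su y a
     Dn z y b = b₀ ≤ᵇ td y b
     R₀ : A → A → Ω → Ω → Bool
     R₀ x z a b = β b a ∧ Dn z x b ∧ Up x z a
     open DecSub _≟_ using (_⊆?_)
     btw : A → A → A → Bool
     btw x y z = ⌊ (x ∷ y ∷ z ∷ []) ⊆? J ⌋
     hit : A → A → Ω → Ω → A → Bool
     hit x z a b y = btw x y z ∧ Up x y a ∧ Dn z y b
     R : A → A → Ω → Ω → Bool
     R x z a b = R₀ x z a b ∧ not (anyᵇ (hit x z a b) J)

   module _ (R₀-mass : ∀ {x z} → x ∷ z ∷ [] ⊆ J → c' ≤ E (p z) (λ b → E (p x) (λ a → 𝟙 (β b a ∧ (b₀ ≤ᵇ td x b) ∧ (a₀ ≤ᵇ su z a)))))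
     (tri-small : ∀ {x y z} → x ∷ y ∷ z ∷ [] ⊆ J → E (p x) (λ a → E (p z) (λ b → E (p y) (λ q → 𝟙 (β b a) * (𝟙 (β q a) * 𝟙 (β b q))))) ≤ ε * (c₂ * inv (length J /1))) where

     -- Inclusion-exclusion in the space over `y`: two events whose measures sum to at least `1 + ε`
     -- meet in measure `ε`.
     meet : ∀ {a b x y z} → Up x y a ≡ true → Dn z y b ≡ true → ε ≤ E (p y) (λ q → 𝟙 (β q a) * 𝟙 (β b q))
     meet {a} {b} {x} {y} {z} u d = ≤-trans (≤-by ((su y a - a₀) + (td y b - b₀)) (add≥0 (sub≥0 (≤ᵇ⇒≤ u)) (sub≥0 (≤ᵇ⇒≤ d))) (solve 4 (λ s t e b → s :+ t :- (con 1ℚ) := e :+ ((s :- ((con 1ℚ) :+ e :- b)) :+ (t :- b))) refl (su y a) (td y b) ε b₀))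
       (≤-trans (≤-reflexive (trans (cong₂ _-_ (sym (E-+ (p y) (λ q → 𝟙 (β q a)) (λ q → 𝟙 (β b q)))) (sym (E-1 (p y)))) (sym (E-- (p y) _ _)))) (E-mono (p y) (λ q _ → both (β q a) (β b q))))
       where
       both : ∀ u v → 𝟙 u + 𝟙 v - 1ℚ ≤ 𝟙 u * 𝟙 v
       both true v = ≤-reflexive (solve 1 (λ x → (con 1ℚ) :+ x :- (con 1ℚ) := (con 1ℚ) :* x) refl (𝟙 v))
       both false v = ≤-by (1ℚ - 𝟙 v) (sub≥0 (𝟙≤1 v)) (solve 1 (λ x → (con 0ℚ) :* x := (con 0ℚ) :+ x :- (con 1ℚ) :+ ((con 1ℚ) :- x)) refl (𝟙 v))
     W : A → A → A → ℚ
     W x y z = E (p x) (λ a → E (p z) (λ b → 𝟙 (R₀ x z a b ∧ hit x z a b y)))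
     -- By `meet`, every pair counted here extends to triangles through `y` of measure at least `ε`;
     -- the assumed bound on triangles is divided by `ε`.
     W-small : ∀ x z y → W x y z ≤ c₂ * inv (length J /1)
     W-small x z y = mul-cancelˡ-≤ ε 0<ε (≤-trans (≤-reflexive (trans (sym (E-* (p x) ε _)) (E-cong (p x) (λ a _ → sym (E-* (p z) ε _))))) bound)
       where
       bound : E (p x) (λ a → E (p z) (λ b → ε * 𝟙 (R₀ x z a b ∧ hit x z a b y))) ≤ ε * (c₂ * inv (length J /1))
       bound with (x ∷ y ∷ z ∷ []) ⊆? J in eq
       ... | yes q = ≤-trans (E-mono (p x) (λ a _ → E-mono (p z) (λ b _ → point a b))) (tri-small q)
         where
         point : ∀ a b → ε * 𝟙 (R₀ x z a b ∧ true ∧ Up x y a ∧ Dn z y b) ≤ E (p y) (λ q → 𝟙 (β b a) * (𝟙 (β q a) * 𝟙 (β b q)))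
         point a b with bool-case (R₀ x z a b ∧ true ∧ Up x y a ∧ Dn z y b)
         ... | inj₂ e rewrite e = ≤-trans (≤-reflexive (zeroʳ ε)) (E≥0 (p y) (λ q _ → mul≥0 (𝟙≥0 (β b a)) (mul≥0 (𝟙≥0 (β q a)) (𝟙≥0 (β b q)))))
         ... | inj₁ e with ∧-true (R₀ x z a b) _ e
         ... | e₁ , e₂ with ∧-true (β b a) _ e₁ | ∧-true (Up x y a) _ e₂
         ... | eβ , _ | eu , ed = ≤-trans (mul-monoˡ ε (<⇒≤ 0<ε) (𝟙≤1 (R₀ x z a b ∧ true ∧ Up x y a ∧ Dn z y b))) (≤-trans (≤-reflexive (*-identityʳ ε)) (≤-trans (meet {x = x} {z = z} eu ed)
             (≤-reflexive (E-cong (p y) (λ q _ → sym (trans (cong (λ v → 𝟙 v * (𝟙 (β q a) * 𝟙 (β b q))) eβ) (*-identityˡ _)))))))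
       ... | no _ = ≤-trans (E≤ (p x) 0ℚ (λ a _ → E≤ (p z) 0ℚ (λ b _ → ≤-reflexive (trans (cong (λ v → ε * 𝟙 v) (Bool.∧-zeroʳ (R₀ x z a b))) (zeroʳ ε))))) (<⇒≤ (mul>0 0<ε (mul>0 c₂>0 (inv>0 J>0))))
     R-split : ∀ x z a b → 𝟙 (R₀ x z a b) ≤ 𝟙 (R x z a b) + ∑ J (λ y → 𝟙 (R₀ x z a b ∧ hit x z a b y))
     R-split x z a b with bool-case (R₀ x z a b) | bool-case (anyᵇ (hit x z a b) J)
     ... | inj₂ e | _ rewrite e = add≥0 ≤-refl (∑≥0 J (λ y _ → ≤-refl))
     ... | inj₁ e | inj₂ e' rewrite e | e' = ≤-by _ (∑≥0 J (λ y _ → 𝟙≥0 (hit x z a b y))) refl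
     ... | inj₁ e | inj₁ e' rewrite e | e' with anyᵇ-∃ (hit x z a b) J e'
     ... | y , y∈ , ye = ≤-trans (≤-trans (≤-reflexive (cong 𝟙 (sym ye))) (∑-≥term J {λ y → 𝟙 (hit x z a b y)} (λ y _ → 𝟙≥0 (hit x z a b y)) y∈)) (≤-reflexive (sym (+-identityˡ _)))
     -- Deleting the hit pairs costs at most `c₂` divided by the length of `J` for each index `y`,
     -- hence half of `c'` altogether.
     R-mass : ∀ {x z} → x ∷ z ∷ [] ⊆ J → c₂ ≤ E (p x) (λ a → E (p z) (λ b → 𝟙 (R x z a b)))
     R-mass {x} {z} q = ≤-sub (≤-trans (add≥0 (sub≥0 main-bound) (sub≥0 sum-bound)) (≤-reflexive (solve 3 (λ c r w → r :+ w :- c :+ ((con ½) :* c :- w) := r :- (con ½) :* c) refl c' _ _)))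
       where
       main-bound : c' ≤ E (p x) (λ a → E (p z) (λ b → 𝟙 (R x z a b))) + ∑ J (λ y → W x y z)
       main-bound = ≤-trans (R₀-mass q) (≤-trans (≤-reflexive (E-comm (p z) (p x) _)) (≤-trans (E-mono (p x) (λ a _ → E-mono (p z) (λ b _ → R-split x z a b)))
         (≤-reflexive (trans (E-cong (p x) (λ a _ → trans (E-+ (p z) _ _) (cong (E (p z) (λ b → 𝟙 (R x z a b)) +_) (sym (∑-swap J (lin (p z)) (λ y b → 𝟙 (R₀ x z a b ∧ hit x z a b y)))))))
           (trans (E-+ (p x) _ _) (cong (E (p x) (λ a → E (p z) (λ b → 𝟙 (R x z a b))) +_) (sym (∑-swap J (lin (p x)) (λ y a → E (p z) (λ b → 𝟙 (R₀ x z a b ∧ hit x z a b y)))))))))))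
       sum-bound : ∑ J (λ y → W x y z) ≤ ½ * c'
       sum-bound = ≤-trans (∑-≤const J (c₂ * inv (length J /1)) (λ y _ → W-small x z y)) (≤-reflexive (trans refl
         (trans (solve 3 (λ m c i → m :* (c :* i) := c :* (i :* m)) refl (length J /1) c₂ (inv (length J /1))) (trans (cong (c₂ *_) (inv-inverseˡ _ (>0⇒≢0 J>0))) (*-identityʳ c₂)))))
     R⇒R₀ : ∀ {x z a b} → R x z a b ≡ true → R₀ x z a b ≡ true
     R⇒R₀ {x} {z} {a} {b} e = proj₁ (∧-true (R₀ x z a b) _ e)
     contra : ⊥
     contra = MassLoss.bound p Up Dn R c₂ c₂>0 B B-large J R-mass
       (λ {x} {z} {a} {b} e → proj₂ (∧-true (Dn z x b) _ (proj₂ (∧-true (β b a) _ (R⇒R₀ {x} {z} {a} {b} e)))))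
       (λ {x} {z} {a} {b} e → proj₁ (∧-true (Dn z x b) _ (proj₂ (∧-true (β b a) _ (R⇒R₀ {x} {z} {a} {b} e)))))
       -- At the start `seen` is only known to be at most 1, which is below `s` quanta of `½ * c₂`.
       free s J ⊆-refl (λ pre z post _ → ≤-<-trans (E≤ (p z) 1ℚ (λ b _ → 𝟙≤1 (anyᵇ (λ y → Dn z y b) pre))) s-large) J-large
       where
       free : ∀ {x y z a b} → x ∷ y ∷ z ∷ [] ⊆ J → R x z a b ≡ true → Up x y a ≡ true → Dn z y b ≡ true → ⊥
       free {x} {y} {z} {a} {b} q e u d with ∧-true (R₀ x z a b) (not (anyᵇ (hit x z a b) J)) e
       ... | _ , e' with anyᵇ (hit x z a b) J in ea
       ... | false with trans (sym ea) (anyᵇ-true (hit x z a b) J (⊆⇒∈ q (there (here refl))) (∧-intro btw-true (∧-intro u d)))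
         where
         btw-true : btw x y z ≡ true
         btw-true with (x ∷ y ∷ z ∷ []) ⊆? J
         ... | yes _ = refl
         ... | no n = ⊥-elim (n q)
       ... | ()

 module _ (r' : ℕ) (ε c : ℚ) (0<ε : 0ℚ < ε) (ε≤½ : ε ≤ ½) (sh M' : ℕ) (step≤ε : inv (suc M' /1) ≤ ε)
   (c' : ℚ) (c'-def : c' ≡ inv (suc (suc M') /1) * c) (c'>0 : 0ℚ < c') (B : ℕ) (B-large : 1ℚ ≤ B /1 * (½ * (½ * c')))
   (s : ℕ) (s-large : 1ℚ < s /1 * (½ * (½ * c'))) (m : ℕ) (m/1>0 : 0ℚ < m /1) (m-large : mass-size B s ℕ.≤ m)
   (stot : ℕ) (stot-def : stot ≡ r' ℕ.+ (m ℕ.+ (r' ℕ.+ sh))) (N : ℕ) (ram : Ramsey (suc (suc r' ℕ.* suc (suc M'))) (suc (suc r')) stot N) where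
   private
     r = suc r'
     M = suc M'
     K = r ℕ.* suc M
     c₂ = ½ * c'

   -- Tuples are coloured by a heavy position and bucket, or by `zero` if there is none. A
   -- homogeneous list of colour `zero` contradicts the hereditary density; any other colour gives
   -- one position and one threshold for all pairs in a link.
   reduced-main : ∀ {A Ω : Set} (_≟_ : DecidableEquality A) {P : List A → Ω → Set} (p : ∀ X → Mean (P X)) (β : ℕ → Ω → Ω → Bool) (zs : List A) →
     let open Reduced p β in
     N ℕ.≤ length zs →
     (∀ I → I ⊆ zs → sh ℕ.≤ length I → ∃ λ Y → Y ⊆ I × length Y ≡ suc r × pow (½ + ε) r + r /1 * c < chain r Y) →
     (∀ i T₁ x y z T₂ → length T₁ ≡ i → length T₁ ℕ.+ suc (length T₂) ≡ r → T₁ ++ x ∷ y ∷ z ∷ T₂ ⊆ zs → tri i T₁ x y z T₂ ≤ ε * (c₂ * inv (m /1))) → ⊥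
   reduced-main {A} {Ω} _≟_ {P} p β zs big hered tri-small = by-color (ram color zs big)
     where
     open Reduced p β
     bkt : List A → ℕ → ℕ → Ω → Ω → Bool
     bkt Y j i q q' = Chain.bucket (pY Y) β ε 0<ε ε≤½ M (s≤s z≤n) step≤ε j i q q'
     prop : List A → Fin r → Fin (suc M) → Bool
     prop Y i j = c' ≤ᵇ E (pY Y (toℕ i)) (λ q → E (pY Y (suc (toℕ i))) (λ q' → 𝟙 (bkt Y (toℕ j) (toℕ i) q q')))
     prop? : ∀ Y → Dec (∃ λ i → ∃ λ j → prop Y i j ≡ true)
     prop? Y = Fin.any? (λ i → Fin.any? (λ j → prop Y i j Bool.≟ true))
     col : ∀ Y → Dec (∃ λ i → ∃ λ j → prop Y i j ≡ true) → Fin (suc K)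
     col Y (yes (i , j , _)) = suc (combine i j)
     col Y (no _) = zero
     color : List A → Fin (suc K)
     color Y = col Y (prop? Y)
     col-suc : ∀ Y (d : Dec (∃ λ i → ∃ λ j → prop Y i j ≡ true)) κ → col Y d ≡ suc κ → prop Y (proj₁ (remQuot {r} (suc M) κ)) (proj₂ (remQuot {r} (suc M) κ)) ≡ true
     col-suc Y (yes (i , j , q)) .(combine i j) refl = subst (λ ij → prop Y (proj₁ ij) (proj₂ ij) ≡ true) (sym (Fin.remQuot-combine {r} {suc M} i j)) q
     col-zero : ∀ Y (d : Dec (∃ λ i → ∃ λ j → prop Y i j ≡ true)) → col Y d ≡ zero → ¬ (∃ λ i → ∃ λ j → prop Y i j ≡ true)
     col-zero Y (no n) _ = n
     heavy : ∀ Y → pow (½ + ε) r + r /1 * c < chain r Y → ∃ λ i → ∃ λ j → prop Y i j ≡ true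
     heavy Y q = conv (Chain.heavy-bucket (pY Y) β ε 0<ε ε≤½ M (s≤s z≤n) step≤ε r c q)
       where
       mass : ℕ → ℕ → ℚ
       mass i j = E (pY Y i) (λ q → E (pY Y (suc i)) (λ q' → 𝟙 (bkt Y j i q q')))
       conv : (∃ λ i → i ℕ.< r × ∃ λ j → j ℕ.< suc M × inv (suc M /1) * c ≤ mass i j) → ∃ λ i → ∃ λ j → prop Y i j ≡ true
       conv (i , i< , j , j< , v) = fromℕ< i< , fromℕ< j< , ≤⇒≤ᵇ (≤-trans (≤-reflexive c'-def) (subst₂ (λ i j → inv (suc M /1) * c ≤ mass i j) (sym (Fin.toℕ-fromℕ< i<)) (sym (Fin.toℕ-fromℕ< j<)) v))

     by-color : (∃ λ l' → l' ⊆ zs × length l' ≡ stot × ∃ λ κ → Hom (suc r) color κ l') → ⊥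
     by-color (l' , sub , len , zero , hom) = conv (hered l' sub (ℕ.≤-trans (ℕ.≤-trans (ℕ.m≤n+m sh r') (ℕ.≤-trans (ℕ.m≤n+m _ m) (ℕ.m≤n+m _ r'))) (ℕ.≤-reflexive (trans (sym stot-def) (sym len)))))
       where
       conv : (∃ λ Y → Y ⊆ l' × length Y ≡ suc r × pow (½ + ε) r + r /1 * c < chain r Y) → ⊥
       conv (Y , Y⊆ , Ylen , q) = col-zero Y (prop? Y) (hom Y Y⊆ Ylen) (heavy Y q)
     by-color (l' , sub , len , suc κ , hom) = contra
       where
       i = proj₁ (remQuot {r} (suc M) κ)
       j = proj₂ (remQuot {r} (suc M) κ)
       ι = toℕ i
       ι≤ : ι ℕ.≤ r'
       ι≤ = ℕ.≤-pred (Fin.toℕ<n i)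
       T₁ R₁ J R₂ T₂ : List A
       -- The homogeneous list is cut into `T₁`, `J` and `T₂` so that a pair from `J` occupies
       -- exactly the positions `ι` and `suc ι` of a tuple of length `suc r`.
       T₁ = take ι l'
       R₁ = drop ι l'
       J = take m R₁
       R₂ = drop m R₁
       T₂ = take (r' ℕ.∸ ι) R₂
       len-R₁ : length R₁ ≡ r' ℕ.+ (m ℕ.+ (r' ℕ.+ sh)) ℕ.∸ ι
       len-R₁ = trans (length-drop ι l') (cong (ℕ._∸ ι) (trans len stot-def))
       R₁-big : m ℕ.+ (r' ℕ.+ sh) ℕ.≤ length R₁
       R₁-big = ℕ.≤-trans (ℕ.≤-reflexive (sym (ℕ.m+n∸m≡n ι _))) (ℕ.≤-trans (ℕ.∸-monoˡ-≤ ι (ℕ.+-monoˡ-≤ _ ι≤)) (ℕ.≤-reflexive (sym len-R₁)))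
       R₂-big : r' ℕ.+ sh ℕ.≤ length R₂
       R₂-big = ℕ.≤-trans (ℕ.≤-reflexive (sym (ℕ.m+n∸m≡n m _))) (ℕ.≤-trans (ℕ.∸-monoˡ-≤ m R₁-big) (ℕ.≤-reflexive (sym (length-drop m R₁))))
       len-T₁ : length T₁ ≡ ι
       len-T₁ = trans (length-take ι l') (ℕ.m≤n⇒m⊓n≡m (ℕ.≤-trans ι≤ (ℕ.≤-trans (ℕ.m≤m+n r' _) (ℕ.≤-reflexive (trans (sym stot-def) (sym len))))))
       len-J : length J ≡ m
       len-J = trans (length-take m R₁) (ℕ.m≤n⇒m⊓n≡m (ℕ.≤-trans (ℕ.m≤m+n m _) R₁-big))
       len-T₂ : length T₂ ≡ r' ℕ.∸ ι
       len-T₂ = trans (length-take _ R₂) (ℕ.m≤n⇒m⊓n≡m (ℕ.≤-trans (ℕ.m∸n≤m r' ι) (ℕ.≤-trans (ℕ.m≤m+n r' sh) R₂-big)))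
       len-T : length T₁ ℕ.+ suc (length T₂) ≡ r
       len-T = trans (cong₂ (λ a b → a ℕ.+ suc b) len-T₁ len-T₂) (trans (ℕ.+-suc ι _) (cong suc (ℕ.m+[n∸m]≡n ι≤)))
       into : ∀ {S} → S ⊆ J → T₁ ++ S ++ T₂ ⊆ l'
       into q = ⊆-trans (++⁺ ⊆-refl (⊆-trans (++⁺ q (take-⊆ _ R₂)) (subst (J ++ R₂ ⊆_) (take++drop≡id m R₁) ⊆-refl))) (subst (T₁ ++ R₁ ⊆_) (take++drop≡id ι l') ⊆-refl)
       X : A → List A
       X x = T₁ ++ x ∷ T₂
       b₀ a₀ : ℚ
       b₀ = toℕ j /1 * inv (M /1)
       a₀ = 1ℚ + ε - b₀
       R₀-mass : ∀ {x z} → x ∷ z ∷ [] ⊆ J → c' ≤ E (p (X z)) (λ b → E (p (X x)) (λ a → 𝟙 (β ι b a ∧ (b₀ ≤ᵇ E (p (X x)) (λ q → 𝟙 (β ι b q))) ∧ (a₀ ≤ᵇ E (p (X z)) (λ q → 𝟙 (β ι q a))))))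
       R₀-mass {x} {z} q = go (rem ι Y) (rem (suc ι) Y) (trans (cong (λ n → rem n Y) (sym len-T₁)) (rem-++ T₁)) (trans (cong (λ n → rem (suc n) Y) (sym len-T₁)) (rem-suc-++ T₁)) (≤ᵇ⇒≤ (col-suc Y (prop? Y) κ (hom Y (into q) Ylen)))
         where
         Y : List A
         Y = T₁ ++ x ∷ z ∷ T₂
         Ylen : length Y ≡ suc r
         Ylen = trans (length-++ T₁) (trans (ℕ.+-suc (length T₁) _) (cong suc len-T))
         go : ∀ X₁ X₂ → X₁ ≡ X z → X₂ ≡ X x →
           c' ≤ E (p X₁) (λ b → E (p X₂) (λ a → 𝟙 (β ι b a ∧ (b₀ ≤ᵇ E (p X₂) (λ q' → 𝟙 (β ι b q'))) ∧ (a₀ ≤ᵇ E (p X₁) (λ q → 𝟙 (β ι q a)))))) →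
           c' ≤ E (p (X z)) (λ b → E (p (X x)) (λ a → 𝟙 (β ι b a ∧ (b₀ ≤ᵇ E (p (X x)) (λ q → 𝟙 (β ι b q))) ∧ (a₀ ≤ᵇ E (p (X z)) (λ q → 𝟙 (β ι q a))))))
         go _ _ refl refl v = v
       contra : ⊥
       contra = Link.contra _≟_ (λ x → p (X x)) (β ι) ε b₀ c' 0<ε (mul>0 0<½ c'>0) B B-large s s-large J
         (subst (λ n → 0ℚ < n /1) (sym len-J) m/1>0) (ℕ.≤-trans m-large (ℕ.≤-reflexive (sym len-J))) R₀-mass
         (λ {x} {y} {z} q → ≤-trans (tri-small ι T₁ x y z T₂ len-T₁ len-T (⊆-trans (into q) sub)) (≤-reflexive (cong (λ n → ε * (c₂ * inv (n /1))) (sym len-J))))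

 -- Density is required in every sublist of length `sh`, not only in `zs`, because Ramsey's theorem
 -- may pass to any of these sublists.
 Obstruction : (A Ω : Set) (r N sh : ℕ) (ε c e₀ : ℚ) → Set₁
 Obstruction A Ω r N sh ε c e₀ = ∀ {P : List A → Ω → Set} (p : ∀ X → Mean (P X)) (β : ℕ → Ω → Ω → Bool) (zs : List A) →
   let open Reduced p β in
   N ℕ.≤ length zs →
   (∀ I → I ⊆ zs → sh ℕ.≤ length I → ∃ λ Y → Y ⊆ I × length Y ≡ suc r × pow (½ + ε) r + r /1 * c < chain r Y) →
   (∀ i T₁ x y z T₂ → length T₁ ≡ i → length T₁ ℕ.+ suc (length T₂) ≡ r → T₁ ++ x ∷ y ∷ z ∷ T₂ ⊆ zs → tri i T₁ x y z T₂ ≤ e₀) → ⊥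

 -- `N` and `e₀` do not depend on the structure: the sampling argument needs the number of vertices
 -- and the target for triangles before it can choose its accuracy.
 reduced : ∀ r' ε c → 0ℚ < ε → ε ≤ ½ → 0ℚ < c → ∀ sh → ∃ λ N → ∃ λ e₀ → 0ℚ < e₀ ×
   (∀ {A Ω : Set} (_≟_ : DecidableEquality A) → Obstruction A Ω (suc r') N sh ε c e₀)
 reduced r' ε c 0<ε ε≤½ 0<c sh = from-M (archimedes* 0<ε)
   where
   Goal : Set₁
   Goal = ∃ λ N → ∃ λ e₀ → 0ℚ < e₀ ×
     (∀ {A Ω : Set} (_≟_ : DecidableEquality A) → Obstruction A Ω (suc r') N sh ε c e₀)
   from-R : ∀ M' → inv (suc M' /1) ≤ ε → ∀ c' → c' ≡ inv (suc (suc M') /1) * c → 0ℚ < c' → ∀ B → 1ℚ ≤ B /1 * (½ * (½ * c')) →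
     1ℚ < suc B /1 * (½ * (½ * c')) → ∀ m → 0ℚ < m /1 → mass-size B (suc B) ℕ.≤ m →
     ∃ (Ramsey (suc (suc r' ℕ.* suc (suc M'))) (suc (suc r')) (r' ℕ.+ (m ℕ.+ (r' ℕ.+ sh)))) → Goal
   from-R M' step c' c'-def c'>0 B B-large s-large m m>0 m-large (N , ram) = N , ε * (½ * c' * inv (m /1)) , mul>0 0<ε (mul>0 (mul>0 0<½ c'>0) (inv>0 m>0)) ,
     reduced-main r' ε c 0<ε ε≤½ sh M' step c' c'-def c'>0 B B-large (suc B) s-large m m>0 m-large _ refl N ram
   from-B : ∀ M' → inv (suc M' /1) ≤ ε → ∀ c' → c' ≡ inv (suc (suc M') /1) * c → 0ℚ < c' → (∃ λ B → 1ℚ ≤ B /1 * (½ * (½ * c'))) → Goal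
   from-B M' step c' c'-def c'>0 (B , B-large) = from-R M' step c' c'-def c'>0 B B-large s-large (mass-size B (suc B)) (/1>0 (mass-size B B ℕ.* B)) ℕ.≤-refl (ramsey _ _ _)
     where
     h>0 : 0ℚ < ½ * (½ * c')
     h>0 = mul>0 0<½ (mul>0 0<½ c'>0)
     s-large : 1ℚ < suc B /1 * (½ * (½ * c'))
     s-large = <-≤-trans (subst (_< 1ℚ + ½ * (½ * c')) (+-identityʳ 1ℚ) (+-monoʳ-< 1ℚ h>0)) (≤-trans (+-monoˡ-≤ _ B-large) (≤-reflexive (solve 2 (λ b h → b :* h :+ h := ((con 1ℚ) :+ b) :* h) refl (B /1) (½ * (½ * c')))))
   from-M : (∃ λ n → 1ℚ ≤ n /1 * ε) → Goal
   from-M (M' , h) = from-B M' step _ refl c'>0 (archimedes* (mul>0 0<½ (mul>0 0<½ c'>0)))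
     where
     c'>0 : 0ℚ < inv (suc (suc M') /1) * c
     c'>0 = mul>0 (inv>0 (/1>0 (suc M'))) 0<c
     step : inv (suc M' /1) ≤ ε
     step = ≤-trans (≤-reflexive (sym (*-identityʳ _))) (≤-trans (mul-monoˡ (inv (suc M' /1)) (inv≥0 (/1≥0 (suc M'))) (≤-trans h (mul-monoʳ ε (<⇒≤ 0<ε) (/1-mono (ℕ.n≤1+n M')))))
       (≤-reflexive (trans (solve 3 (λ i m e → i :* (m :* e) := (i :* m) :* e) refl (inv (suc M' /1)) (suc M' /1) ε) (trans (cong (_* ε) (inv-inverseˡ _ (>0⇒≢0 (/1>0 M')))) (*-identityˡ ε)))))

open Ramsey

-- Types of tuples over a sample.

module Sampling where
 import Data.List.Membership.DecPropositional as DecMem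
 open import Data.List.Membership.Propositional.Properties using (∈-++⁺ˡ; ∈-++⁺ʳ; ∈-upTo⁺; ∈-upTo⁻; ∈-map⁺; ∈-map⁻; ∈-++⁻; ∈-concatMap⁺; ∈-deduplicate⁺)
 open import Data.List.Properties using (length-++; ++-assoc; length-upTo; map-++; map-∘; map-id; ≡-dec; ∷-injectiveˡ; ∷-injectiveʳ; ++-identityʳ; length-map)
 open import Data.List.Relation.Binary.Sublist.Propositional using (_⊆_; []; _∷_; _∷ʳ_; ⊆-trans)
 import Data.List.Relation.Unary.All as All
 open import Data.List.Relation.Unary.All using (All; []; _∷_)
 open import Data.List.Relation.Unary.AllPairs using ([]; _∷_)
 open import Data.List.Relation.Unary.Unique.DecPropositional.Properties using (deduplicate-!)
 open import Data.List.Relation.Unary.Unique.Propositional using (Unique)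
 import Data.Product.Properties as Prod
 import Data.Rational as ℚ
 open import Data.Rational using (ℚ; 0ℚ; 1ℚ; ½; _≤_; _<_)
 import Data.Rational.Properties as ℚ
 open import Data.Rational.Properties using (≤-trans; ≤-reflexive; <⇒≤; ≤-refl; <-≤-trans; ≤-<-trans; ≰⇒>)
 open import Function using (_∘_)

 insert-++ : ∀ {A : Set} (T : List A) {v l} → insertAt (length T) v (T ++ l) ≡ T ++ v ∷ l
 insert-++ [] = refl
 insert-++ (x ∷ T) = cong (x ∷_) (insert-++ T)

 insert-suc-++ : ∀ {A : Set} (T : List A) {y v l} → insertAt (suc (length T)) v (T ++ y ∷ l) ≡ T ++ y ∷ v ∷ l
 insert-suc-++ [] = refl
 insert-suc-++ (x ∷ T) = cong (x ∷_) (insert-suc-++ T)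

 length-insert : ∀ {A : Set} a (v : A) l → length (insertAt a v l) ≡ suc (length l)
 length-insert zero v l = refl
 length-insert (suc a) v [] = refl
 length-insert (suc a) v (x ∷ l) = cong suc (length-insert a v l)

 length-rem : ∀ {A : Set} i (l : List A) → i ℕ.< length l → suc (length (rem i l)) ≡ length l
 length-rem zero (x ∷ l) _ = refl
 length-rem (suc i) (x ∷ l) (s≤s p) = cong suc (length-rem i l p)

 ∈-rem : ∀ {A : Set} i (l : List A) {x} → x ∈ rem i l → x ∈ l
 ∈-rem zero (y ∷ l) p = there p
 ∈-rem (suc i) (y ∷ l) (here p) = here p
 ∈-rem (suc i) (y ∷ l) (there p) = there (∈-rem i l p)

 ∈-insert : ∀ {A : Set} i v (l : List A) {x} → x ∈ insertAt i v l → x ≡ v ⊎ x ∈ l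
 ∈-insert zero v l (here p) = inj₁ p
 ∈-insert zero v l (there p) = inj₂ p
 ∈-insert (suc i) v [] (here p) = inj₁ p
 ∈-insert (suc i) v (y ∷ l) (here p) = inj₂ (here p)
 ∈-insert (suc i) v (y ∷ l) (there p) with ∈-insert i v l p
 ... | inj₁ q = inj₁ q
 ... | inj₂ q = inj₂ (there q)

 map-rem : ∀ {A B : Set} (g : A → B) i l → map g (rem i l) ≡ rem i (map g l)
 map-rem g i [] = refl
 map-rem g zero (x ∷ l) = refl
 map-rem g (suc i) (x ∷ l) = cong (g x ∷_) (map-rem g i l)

 map-insert : ∀ {A B : Set} (g : A → B) i v l → map g (insertAt i v l) ≡ insertAt i (g v) (map g l)
 map-insert g zero v l = refl
 map-insert g (suc i) v [] = refl
 map-insert g (suc i) v (x ∷ l) = cong (g x ∷_) (map-insert g i v l)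

 zip-fst : ∀ {A B : Set} (l : List A) (l' : List B) → length l ≡ length l' → map proj₁ (zip l l') ≡ l
 zip-fst [] [] _ = refl
 zip-fst (x ∷ l) (y ∷ l') e = cong (x ∷_) (zip-fst l l' (suc-inj e))

 zip-snd : ∀ {A B : Set} (l : List A) (l' : List B) → length l ≡ length l' → map proj₂ (zip l l') ≡ l'
 zip-snd [] [] _ = refl
 zip-snd (x ∷ l) (y ∷ l') e = cong (y ∷_) (zip-snd l l' (suc-inj e))

 -- Two tuples of equal length become one list of pairs, so that deleting or inserting a position
 -- acts on both simultaneously.
 zipped : ∀ {A : Set} {k : ℕ} (Q : List A → List A → Set) → (∀ (Π : List (A × A)) → Q (map proj₁ Π) (map proj₂ Π)) → ∀ Y Y' → Len k Y → Len k Y' → Q Y Y'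
 zipped Q h Y Y' p q = subst₂ Q (zip-fst Y Y' (trans p (sym q))) (zip-snd Y Y' (trans p (sym q))) (h (zip Y Y'))

 subs : {A : Set} → List A → List (List A)
 subs [] = [] ∷ []
 subs (x ∷ l) = map (x ∷_) (subs l) ++ subs l

 map-subs : ∀ {A B : Set} (g : A → B) l → subs (map g l) ≡ map (map g) (subs l)
 map-subs g [] = refl
 map-subs g (x ∷ l) rewrite map-subs g l = trans (cong (_++ map (map g) (subs l)) (trans (sym (map-∘ (subs l))) (map-∘ (subs l)))) (sym (map-++ (map g) (map (x ∷_) (subs l)) (subs l)))

 subs-∈ : ∀ {A : Set} (l : List A) {σ x} → σ ∈ subs l → x ∈ σ → x ∈ l
 subs-∈ [] (here refl) ()
 subs-∈ (y ∷ l) p q with ∈-++⁻ (map (y ∷_) (subs l)) p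
 ... | inj₂ p' = there (subs-∈ l p' q)
 ... | inj₁ p' with ∈-map⁻ (y ∷_) p'
 subs-∈ (y ∷ l) p (here refl) | inj₁ p' | σ , σ∈ , refl = here refl
 subs-∈ (y ∷ l) p (there q) | inj₁ p' | σ , σ∈ , refl = there (subs-∈ l σ∈ q)

 self∈subs : ∀ {A : Set} (l : List A) → l ∈ subs l
 self∈subs [] = here refl
 self∈subs (x ∷ l) = ∈-++⁺ˡ (∈-map⁺ (x ∷_) (self∈subs l))

 keep∈subs : ∀ {A : Set} (Q : A → Bool) (l : List A) → keep Q l ∈ subs l
 keep∈subs Q [] = here refl
 keep∈subs Q (x ∷ l) with Q x
 ... | true = ∈-++⁺ˡ (∈-map⁺ (x ∷_) (keep∈subs Q l))
 ... | false = ∈-++⁺ʳ (map (x ∷_) (subs l)) (keep∈subs Q l)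

 ∈-keep : ∀ {A : Set} (Q : A → Bool) {x} l → x ∈ l → Q x ≡ true → x ∈ keep Q l
 ∈-keep Q (x ∷ l) (here refl) e rewrite e = here refl
 ∈-keep Q (x ∷ l) (there p) e with Q x
 ... | true = there (∈-keep Q l p e)
 ... | false = ∈-keep Q l p e

 map-≡-∈ : ∀ {A B : Set} {f g : A → B} l → map f l ≡ map g l → ∀ {x} → x ∈ l → f x ≡ g x
 map-≡-∈ (x ∷ l) e (here refl) = ∷-injectiveˡ e
 map-≡-∈ {f = f} {g} (x ∷ l) e (there p) = map-≡-∈ l (∷-injectiveʳ e) p

 map-∈-≡ : ∀ {A B : Set} {f g : A → B} l → (∀ {x} → x ∈ l → f x ≡ g x) → map f l ≡ map g l
 map-∈-≡ [] h = refl
 map-∈-≡ (x ∷ l) h = cong₂ _∷_ (h (here refl)) (map-∈-≡ l (h ∘ there))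

 -- The type of a tuple of vertices records the colour of every subtuple.
 module Types {V B : Set} (_≟V_ : DecidableEquality V) (_≟B_ : DecidableEquality B) (col : List V → B)
   (col-set : ∀ l l' → (∀ v → v ∈ l → v ∈ l') → (∀ v → v ∈ l' → v ∈ l) → col l ≡ col l') where

   Ty : Set
   Ty = List B

   _≟T_ : DecidableEquality Ty
   _≟T_ = ≡-dec _≟B_

   tp : List V → Ty
   tp l = map col (subs l)

   Same : List (V × V) → Set
   Same π = tp (map proj₁ π) ≡ tp (map proj₂ π)

   same-∈ : ∀ {π} → Same π → ∀ {σ} → σ ∈ subs π → col (map proj₁ σ) ≡ col (map proj₂ σ)
   same-∈ {π} s = map-≡-∈ (subs π) (trans (map-∘ (subs π)) (trans (cong (map col) (sym (map-subs proj₁ π))) (trans s (trans (cong (map col) (map-subs proj₂ π)) (sym (map-∘ (subs π)))))))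

   same-col : ∀ {π} → Same π → col (map proj₁ π) ≡ col (map proj₂ π)
   same-col {π} s = same-∈ {π} s (self∈subs π)

   -- Colours depend only on the vertex set. A subtuple of `π'`, possibly reordered or with
   -- repetitions, has on both sides the vertex set of the part of `π` singled out by membership in
   -- it.
   same-⊂ : ∀ {π π'} → Same π → (∀ {x} → x ∈ π' → x ∈ π) → Same π'
   same-⊂ {π} {π'} s sub = trans (cong (map col) (map-subs proj₁ π')) (trans (sym (map-∘ (subs π'))) (trans (map-∈-≡ (subs π') step) (trans (map-∘ (subs π')) (cong (map col) (sym (map-subs proj₂ π'))))))
     where
     open DecMem (Prod.≡-dec _≟V_ _≟V_) using (_∈?_)
     step : ∀ {σ} → σ ∈ subs π' → col (map proj₁ σ) ≡ col (map proj₂ σ)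
     step {σ} σ∈ = trans (side proj₁) (trans (same-∈ {π} s (keep∈subs Q π)) (sym (side proj₂)))
       where
       Q : V × V → Bool
       Q x = ⌊ x ∈? σ ⌋
       Q-true : ∀ {x} → x ∈ σ → Q x ≡ true
       Q-true {x} p with x ∈? σ
       ... | yes _ = refl
       ... | no n = ⊥-elim (n p)
       Q-∈ : ∀ x → Q x ≡ true → x ∈ σ
       Q-∈ x e with x ∈? σ
       ... | yes p = p
       side : (g : V × V → V) → col (map g σ) ≡ col (map g (keep Q π))
       side g = col-set _ _ to from
         where
         to : ∀ v → v ∈ map g σ → v ∈ map g (keep Q π)
         to v p with ∈-map⁻ g p
         ... | x , x∈ , refl = ∈-map⁺ g (∈-keep Q π (sub (subs-∈ π' σ∈ x∈)) (Q-true x∈))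
         from : ∀ v → v ∈ map g (keep Q π) → v ∈ map g σ
         from v p with ∈-map⁻ g p
         ... | x , x∈ , refl = ∈-map⁺ g (Q-∈ x (keep-∈ Q π x∈))

   diag : List V → List (V × V)
   diag w = map (λ v → v , v) w

   diag-fst : ∀ w → map proj₁ (diag w) ≡ w
   diag-fst w = trans (sym (map-∘ w)) (map-id w)

   diag-snd : ∀ w → map proj₂ (diag w) ≡ w
   diag-snd w = trans (sym (map-∘ w)) (map-id w)

   fst-diag : ∀ π w → map proj₁ (π ++ diag w) ≡ map proj₁ π ++ w
   fst-diag π w = trans (map-++ proj₁ π (diag w)) (cong (map proj₁ π ++_) (diag-fst w))

   snd-diag : ∀ π w → map proj₂ (π ++ diag w) ≡ map proj₂ π ++ w
   snd-diag π w = trans (map-++ proj₂ π (diag w)) (cong (map proj₂ π ++_) (diag-snd w))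

   Same-tp : ∀ π w → tp (map proj₁ π ++ w) ≡ tp (map proj₂ π ++ w) → Same (π ++ diag w)
   Same-tp π w e = trans (cong tp (fst-diag π w)) (trans e (cong tp (sym (snd-diag π w))))

   tp-Same : ∀ π w → Same (π ++ diag w) → tp (map proj₁ π ++ w) ≡ tp (map proj₂ π ++ w)
   tp-Same π w e = trans (cong tp (sym (fst-diag π w))) (trans e (cong tp (snd-diag π w)))

 -- Edges as functions of two consecutive types.

 module LevelK {V B : Set} (_≟V_ : DecidableEquality V) (_≟B_ : DecidableEquality B) (col : List V → B)
   (col-set : ∀ l l' → (∀ v → v ∈ l → v ∈ l') → (∀ v → v ∈ l' → v ∈ l) → col l ≡ col l')
   (edge : B → Bool) (MV : FullMean {V} (λ _ → ⊤)) (k : ℕ) where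

   open Types _≟V_ _≟B_ col col-set public

   EV : (V → ℚ) → ℚ
   EV = E (mean MV)

   Eᵏ : ℕ → (List V → ℚ) → ℚ
   Eᵏ = Eᴸ MV

   f : List V → ℚ
   f l = 𝟙 (edge (col l))

   module CK = Cond (lists MV k) (Prod.≡-dec _≟T_ _≟T_)

   τ : ℕ → List V → List V → Ty × Ty
   τ i w Y = tp (rem i Y ++ w) , tp (rem (suc i) Y ++ w)

   W : ℕ → List V → Ty × Ty → ℚ
   W i w = CK.cond (τ i w) f

   f∈ : ∀ l → f l ∈[0,1]
   f∈ l = 𝟙∈ (edge (col l))

   W∈ : ∀ i w Y → Len k Y → W i w (τ i w Y) ∈[0,1]
   W∈ i w Y p = CK.cond∈ (τ i w) (λ l _ → f∈ l) Y p

   gain : ℕ → List V → V → ℚ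
   gain i w v = Eᵏ k (λ Y → (W i (v ∷ w) (τ i (v ∷ w) Y) - W i w (τ i w Y)) * (W i (v ∷ w) (τ i (v ∷ w) Y) - W i w (τ i w Y)))

   gain≥0 : ∀ i w v → 0ℚ ≤ gain i w v
   gain≥0 i w v = E≥0 (mean (lists MV k)) (λ Y _ → sq≥0 (W i (v ∷ w) (τ i (v ∷ w) Y) - W i w (τ i w Y)))

   τ-same : ∀ i w Π → τ i w (map proj₁ Π) ≡ τ i w (map proj₂ Π) → Same (rem i Π ++ diag w) × Same (rem (suc i) Π ++ diag w)
   τ-same i w Π e = one i (cong proj₁ e) , one (suc i) (cong proj₂ e)
     where
     one : ∀ j → tp (rem j (map proj₁ Π) ++ w) ≡ tp (rem j (map proj₂ Π) ++ w) → Same (rem j Π ++ diag w)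
     one j e = Same-tp (rem j Π) w (subst₂ (λ a b → tp (a ++ w) ≡ tp (b ++ w)) (sym (map-rem proj₁ j Π)) (sym (map-rem proj₂ j Π)) e)

   same-τ : ∀ i w Π → Same (rem i Π ++ diag w) → Same (rem (suc i) Π ++ diag w) → τ i w (map proj₁ Π) ≡ τ i w (map proj₂ Π)
   same-τ i w Π s s' = cong₂ _,_ (one i s) (one (suc i) s')
     where
     one : ∀ j → Same (rem j Π ++ diag w) → tp (rem j (map proj₁ Π) ++ w) ≡ tp (rem j (map proj₂ Π) ++ w)
     one j s = subst₂ (λ a b → tp (a ++ w) ≡ tp (b ++ w)) (map-rem proj₁ j Π) (map-rem proj₂ j Π) (tp-Same (rem j Π) w s)

   ++-diag-there : ∀ {π v w} {x : V × V} → x ∈ π ++ diag w → x ∈ π ++ diag (v ∷ w)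
   ++-diag-there {π} p with ∈-++⁻ π p
   ... | inj₁ q = ∈-++⁺ˡ q
   ... | inj₂ q = ∈-++⁺ʳ π (there q)

   refines : ∀ i w v → CK.Refines (τ i (v ∷ w)) (τ i w)
   refines i w v = zipped _ λ Π e → let s , s' = τ-same i (v ∷ w) Π e in
     same-τ i w Π (same-⊂ {rem i Π ++ diag (v ∷ w)} s (++-diag-there {rem i Π})) (same-⊂ {rem (suc i) Π ++ diag (v ∷ w)} s' (++-diag-there {rem (suc i) Π}))

   energyK : ℕ → List V → ℚ
   energyK i w = CK.energy (τ i w) f

   gain-energy : ∀ i w v → gain i w v ≡ energyK i (v ∷ w) - energyK i w
   gain-energy i w v = CK.pythagoras (τ i (v ∷ w)) (τ i w) f (refines i w v)

   β : ℚ → List V → ℕ → Ty → Ty → Bool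
   β δ w i q q' = δ ≤ᵇ W i w (q , q')

   -- The test function is constant on classes, so `f` may be replaced by its conditional mean `W`,
   -- which is below `δ` exactly where the test function is 1.
   light-edges : ∀ δ → 0ℚ ≤ δ → ∀ w i → Eᵏ k (λ Y → f Y * (1ℚ - 𝟙 (β δ w i (tp (rem i Y ++ w)) (tp (rem (suc i) Y ++ w))))) ≤ δ
   light-edges δ 0≤δ w i = ≤-trans (≤-reflexive (sym (CK.cond-test (τ i w) f (λ Y → 1ℚ - 𝟙 (δ ≤ᵇ W i w (τ i w Y))) (λ Y Y' _ _ e → cong (λ o → 1ℚ - 𝟙 (δ ≤ᵇ W i w o)) e))))
     (E≤ (mean (lists MV k)) δ point)
     where
     point : ∀ Y → Len k Y → W i w (τ i w Y) * (1ℚ - 𝟙 (δ ≤ᵇ W i w (τ i w Y))) ≤ δ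
     point Y p with bool-case (δ ≤ᵇ W i w (τ i w Y))
     ... | inj₁ e = ≤-trans (≤-reflexive (trans (cong (λ b → W i w (τ i w Y) * (1ℚ - 𝟙 b)) e) (solve 1 (λ x → x :* ((con 1ℚ) :- (con 1ℚ)) := (con 0ℚ)) refl (W i w (τ i w Y))))) 0≤δ
     ... | inj₂ e = ≤-trans (≤-reflexive (trans (cong (λ b → W i w (τ i w Y) * (1ℚ - 𝟙 b)) e) (solve 1 (λ x → x :* ((con 1ℚ) :- (con 0ℚ)) := x) refl (W i w (τ i w Y))))) (<⇒≤ (≰ᵇ⇒> e))

   -- The tuple with one vertex exchanged for `v`. Once `v` joins the sample, the type of `rem b Y`
   -- records the colour of the result and of its subtuples over `w`.
   extend : ℕ → ℕ → V → List V → List V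
   extend a b v Y = insertAt a v (rem b Y)

   ext-same : ∀ a b v w Π → Same (rem b Π ++ diag (v ∷ w)) → ∀ {π} → (∀ {x} → x ∈ π → x ∈ insertAt a (v , v) (rem b Π)) → Same (π ++ diag w)
   ext-same a b v w Π s {π} sub = same-⊂ {rem b Π ++ diag (v ∷ w)} s into
     where
     into : ∀ {x} → x ∈ π ++ diag w → x ∈ rem b Π ++ diag (v ∷ w)
     into p with ∈-++⁻ π p
     ... | inj₂ q = ∈-++⁺ʳ (rem b Π) (there q)
     ... | inj₁ q with ∈-insert a (v , v) (rem b Π) (sub q)
     ... | inj₁ refl = ∈-++⁺ʳ (rem b Π) (here refl)
     ... | inj₂ r = ∈-++⁺ˡ r

   map-extend : ∀ (g : V × V → V) a b v Π → g (v , v) ≡ v → map g (insertAt a (v , v) (rem b Π)) ≡ extend a b v (map g Π)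
   map-extend g a b v Π e = trans (map-insert g a (v , v) (rem b Π)) (cong₂ (insertAt a) e (map-rem g b Π))

   f-ext : ∀ a b v w Π → Same (rem b Π ++ diag (v ∷ w)) → f (extend a b v (map proj₁ Π)) ≡ f (extend a b v (map proj₂ Π))
   f-ext a b v w Π s = subst₂ (λ x y → f x ≡ f y) (map-extend proj₁ a b v Π refl) (map-extend proj₂ a b v Π refl)
     (cong (𝟙 ∘ edge) (same-col {insertAt a (v , v) (rem b Π)} (same-⊂ {insertAt a (v , v) (rem b Π) ++ diag w} {insertAt a (v , v) (rem b Π)} (ext-same a b v w Π s {insertAt a (v , v) (rem b Π)} (λ p → p)) ∈-++⁺ˡ)))

   W-ext : ∀ i a b v w Π → Same (rem b Π ++ diag (v ∷ w)) → W i w (τ i w (extend a b v (map proj₁ Π))) ≡ W i w (τ i w (extend a b v (map proj₂ Π)))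
   W-ext i a b v w Π s = cong (W i w) (subst₂ (λ x y → τ i w x ≡ τ i w y) (map-extend proj₁ a b v Π refl) (map-extend proj₂ a b v Π refl)
     (same-τ i w (insertAt a (v , v) (rem b Π)) (ext-same a b v w Π s (∈-rem i _)) (ext-same a b v w Π s (∈-rem (suc i) _))))

   -- replacing W by f costs at most the energy gain
   replace : ∀ i w v θ Ψ → 0ℚ ≤ θ → (∀ Y → Len k Y → Ψ Y ∈[0,1]) → (∀ Y Y' → Len k Y → Len k Y' → τ i (v ∷ w) Y ≡ τ i (v ∷ w) Y' → Ψ Y ≡ Ψ Y') →
     (θ + θ) * Eᵏ k (λ Y → W i w (τ i w Y) * Ψ Y) ≤ (θ + θ) * Eᵏ k (λ Y → f Y * Ψ Y) + (θ * θ + gain i w v)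
   replace i w v θ Ψ 0≤θ Ψ∈ meas = ≤-sub (≤-trans (sub≥0 bound) (≤-reflexive (trans (cong (λ t → θ * θ + gain i w v - t) eq)
       (solve 4 (λ t g a b → t :* t :+ g :- ((t :+ t) :* b :- (t :+ t) :* a) := (t :+ t) :* a :+ (t :* t :+ g) :- (t :+ t) :* b) refl θ (gain i w v) (Eᵏ k (λ Y → f Y * Ψ Y)) (Eᵏ k (λ Y → W₀ Y * Ψ Y))))))
     where
     M = mean (lists MV k)
     W₀ W₁ : List V → ℚ
     W₀ Y = W i w (τ i w Y)
     W₁ Y = W i (v ∷ w) (τ i (v ∷ w) Y)
     bound : Eᵏ k (λ Y → (θ + θ) * ((W₀ Y - W₁ Y) * Ψ Y)) ≤ θ * θ + gain i w v
     bound = ≤-trans (E-mono M (λ Y p → amgm θ (W₀ Y - W₁ Y) (Ψ Y) (proj₁ (Ψ∈ Y p)) (proj₂ (Ψ∈ Y p))))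
       (≤-reflexive (trans (E-+ M (λ _ → θ * θ) (λ Y → (W₀ Y - W₁ Y) * (W₀ Y - W₁ Y))) (cong₂ _+_ (E-const M (θ * θ)) (E-cong M (λ Y _ → solve 2 (λ a b → (a :- b) :* (a :- b) := (b :- a) :* (b :- a)) refl (W₀ Y) (W₁ Y))))))
     -- Here `f` enters: `W₁` is its conditional expectation over the sample with `v`, and `Ψ` is
     -- measurable for that sample.
     eq : Eᵏ k (λ Y → (θ + θ) * ((W₀ Y - W₁ Y) * Ψ Y)) ≡ (θ + θ) * Eᵏ k (λ Y → W₀ Y * Ψ Y) - (θ + θ) * Eᵏ k (λ Y → f Y * Ψ Y)
     eq = trans (E-* M (θ + θ) _) (trans (cong ((θ + θ) *_) (trans (E-cong M (λ Y _ → solve 3 (λ a b p → (a :- b) :* p := a :* p :- b :* p) refl (W₀ Y) (W₁ Y) (Ψ Y))) (trans (E-- M _ _) (cong (λ t → Eᵏ k (λ Y → W₀ Y * Ψ Y) - t) (CK.cond-test (τ i (v ∷ w)) f Ψ meas)))))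
       (solve 3 (λ t a b → t :* (a :- b) := t :* a :- t :* b) refl (θ + θ) _ _))

   module Triangle (i j : ℕ) (k≡ : i ℕ.+ suc (suc j) ≡ k) (free : ∀ T₁ x y z T₂ → Len i T₁ → Len j T₂ → edge (col (T₁ ++ x ∷ y ∷ T₂)) ≡ true → edge (col (T₁ ++ y ∷ z ∷ T₂)) ≡ true → edge (col (T₁ ++ x ∷ z ∷ T₂)) ≡ true → ⊥) where

     Epair : (V → V → List V → List V → ℚ) → ℚ
     Epair φ = EV (λ x → EV (λ y → Eᵏ i (λ T₁ → Eᵏ j (λ T₂ → φ x y T₁ T₂))))

     Epair-E : ∀ φ → Epair (λ x y T₁ T₂ → φ (T₁ ++ x ∷ y ∷ T₂)) ≡ Eᵏ k φ
     Epair-E φ = trans (E-cong mV (λ x _ → E-comm mV (mean (lists MV i)) _)) (trans (E-comm mV (mean (lists MV i)) _)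
       (trans (sym (Eᴸ-++ MV i (suc (suc j)) φ)) (cong (λ n → Eᵏ n φ) k≡)))
       where mV = mean MV

     Epair-cong : ∀ {φ ψ} → (∀ x y T₁ T₂ → Len i T₁ → Len j T₂ → φ x y T₁ T₂ ≡ ψ x y T₁ T₂) → Epair φ ≡ Epair ψ
     Epair-cong h = E-cong (mean MV) (λ x _ → E-cong (mean MV) (λ y _ → E-cong (mean (lists MV i)) (λ T₁ p → E-cong (mean (lists MV j)) (λ T₂ q → h x y T₁ T₂ p q))))

     len-k : ∀ {x y : V} T₁ T₂ → Len i T₁ → Len j T₂ → Len k (T₁ ++ x ∷ y ∷ T₂)
     len-k T₁ T₂ p q = trans (length-++ T₁) (trans (cong₂ (λ a b → a ℕ.+ suc (suc b)) p q) k≡)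

     𝓔 : (V → V → V → List V → List V → ℚ) → ℚ
     𝓔 φ = EV (λ x → EV (λ y → EV (λ z → Eᵏ i (λ T₁ → Eᵏ j (λ T₂ → φ x y z T₁ T₂)))))

     𝓔-mono : ∀ {φ ψ} → (∀ x y z T₁ T₂ → Len i T₁ → Len j T₂ → φ x y z T₁ T₂ ≤ ψ x y z T₁ T₂) → 𝓔 φ ≤ 𝓔 ψ
     𝓔-mono h = E-mono (mean MV) (λ x _ → E-mono (mean MV) (λ y _ → E-mono (mean MV) (λ z _ → E-mono (mean (lists MV i)) (λ T₁ p → E-mono (mean (lists MV j)) (λ T₂ q → h x y z T₁ T₂ p q)))))

     𝓔-* : ∀ c φ → 𝓔 (λ x y z T₁ T₂ → c * φ x y z T₁ T₂) ≡ c * 𝓔 φ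
     𝓔-* c φ = trans (E-cong (mean MV) (λ x _ → trans (E-cong (mean MV) (λ y _ → trans (E-cong (mean MV) (λ z _ → trans (E-cong (mean (lists MV i)) (λ T₁ _ → E-* (mean (lists MV j)) c _)) (E-* (mean (lists MV i)) c _))) (E-* (mean MV) c _))) (E-* (mean MV) c _))) (E-* (mean MV) c _)

     module _ (w : List V) (θ : ℚ) (0≤θ : 0ℚ ≤ θ) where
       W₀ : List V → ℚ
       W₀ Y = W i w (τ i w Y)

       xy yz xz : V → V → V → List V → List V → List V
       xy x y z T₁ T₂ = T₁ ++ x ∷ y ∷ T₂
       yz x y z T₁ T₂ = T₁ ++ y ∷ z ∷ T₂
       xz x y z T₁ T₂ = T₁ ++ x ∷ z ∷ T₂

       err : V → ℚ
       err v = θ * θ + gain i w v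

       -- one replacement step, for fixed extra vertex v; (a , b) and (a' , b') say how the other two edges arise
       step : ∀ v a b a' b' (g h : List V → ℚ) → (b ≡ i ⊎ b ≡ suc i) → (b' ≡ i ⊎ b' ≡ suc i) →
         (∀ l → Len k l → g l ∈[0,1]) → (∀ l → Len k l → h l ∈[0,1]) →
         (∀ Π → Same (rem b Π ++ diag (v ∷ w)) → g (extend a b v (map proj₁ Π)) ≡ g (extend a b v (map proj₂ Π))) →
         (∀ Π → Same (rem b' Π ++ diag (v ∷ w)) → h (extend a' b' v (map proj₁ Π)) ≡ h (extend a' b' v (map proj₂ Π))) →
         (l₁ l₂ : V → V → List V → List V → List V) →
         (∀ x y T₁ T₂ → Len i T₁ → extend a b v (T₁ ++ x ∷ y ∷ T₂) ≡ l₁ x y T₁ T₂) → (∀ x y T₁ T₂ → Len i T₁ → extend a' b' v (T₁ ++ x ∷ y ∷ T₂) ≡ l₂ x y T₁ T₂) →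
         (∀ Y → Len k Y → Len k (extend a b v Y)) → (∀ Y → Len k Y → Len k (extend a' b' v Y)) →
         (θ + θ) * Epair (λ x y T₁ T₂ → W₀ (T₁ ++ x ∷ y ∷ T₂) * (g (l₁ x y T₁ T₂) * h (l₂ x y T₁ T₂))) ≤
         (θ + θ) * Epair (λ x y T₁ T₂ → f (T₁ ++ x ∷ y ∷ T₂) * (g (l₁ x y T₁ T₂) * h (l₂ x y T₁ T₂))) + err v
       step v a b a' b' g h bi bi' g∈ h∈ gm hm l₁ l₂ e₁ e₂ n₁ n₂ = subst₂ (λ p q → (θ + θ) * p ≤ (θ + θ) * q + err v) (conv W₀) (conv f)
         (replace i w v θ Ψ 0≤θ (λ Y p → *∈ (g∈ _ (n₁ Y p)) (h∈ _ (n₂ Y p))) meas)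
         where
         Ψ : List V → ℚ
         Ψ Y = g (extend a b v Y) * h (extend a' b' v Y)
         pick : ∀ {c} Π → (c ≡ i ⊎ c ≡ suc i) → τ i (v ∷ w) (map proj₁ Π) ≡ τ i (v ∷ w) (map proj₂ Π) → Same (rem c Π ++ diag (v ∷ w))
         pick Π (inj₁ refl) e = proj₁ (τ-same i (v ∷ w) Π e)
         pick Π (inj₂ refl) e = proj₂ (τ-same i (v ∷ w) Π e)
         meas : ∀ Y Y' → Len k Y → Len k Y' → τ i (v ∷ w) Y ≡ τ i (v ∷ w) Y' → Ψ Y ≡ Ψ Y'
         meas = zipped _ (λ Π e → cong₂ _*_ (gm Π (pick Π bi e)) (hm Π (pick Π bi' e)))
         conv : ∀ (u : List V → ℚ) → Eᵏ k (λ Y → u Y * Ψ Y) ≡ Epair (λ x y T₁ T₂ → u (T₁ ++ x ∷ y ∷ T₂) * (g (l₁ x y T₁ T₂) * h (l₂ x y T₁ T₂)))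
         conv u = trans (sym (Epair-E (λ Y → u Y * Ψ Y))) (Epair-cong (λ x y T₁ T₂ p q → cong (u (T₁ ++ x ∷ y ∷ T₂) *_) (cong₂ (λ s t → g s * h t) (e₁ x y T₁ T₂ p) (e₂ x y T₁ T₂ p))))

       i<k : i ℕ.< k
       i<k = ℕ.≤-trans (ℕ.≤-trans (ℕ.≤-reflexive (ℕ.+-comm 1 i)) (ℕ.+-monoʳ-≤ i (s≤s z≤n))) (ℕ.≤-reflexive k≡)

       si<k : suc i ℕ.< k
       si<k = ℕ.≤-trans (ℕ.≤-trans (ℕ.≤-reflexive (ℕ.+-comm 2 i)) (ℕ.+-monoʳ-≤ i (s≤s (s≤s z≤n)))) (ℕ.≤-reflexive k≡)

       len-ext : ∀ a b v → b ℕ.< k → ∀ Y → Len k Y → Len k (extend a b v Y)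
       len-ext a b v b<k Y p = trans (length-insert a v (rem b Y)) (trans (length-rem b Y (subst (b ℕ.<_) (sym p) b<k)) p)

       rem-i : ∀ {x y : V} (T₁ T₂ : List V) → Len i T₁ → rem i (T₁ ++ x ∷ y ∷ T₂) ≡ T₁ ++ y ∷ T₂
       rem-i {x} {y} T₁ T₂ refl = rem-++ T₁

       rem-si : ∀ {x y : V} (T₁ T₂ : List V) → Len i T₁ → rem (suc i) (T₁ ++ x ∷ y ∷ T₂) ≡ T₁ ++ x ∷ T₂
       rem-si {x} {y} T₁ T₂ refl = rem-suc-++ T₁

       ins-i : ∀ {v : V} {l} T₁ → Len i T₁ → insertAt i v (T₁ ++ l) ≡ T₁ ++ v ∷ l
       ins-i T₁ refl = insert-++ T₁

       ins-si : ∀ {y v : V} {l} T₁ → Len i T₁ → insertAt (suc i) v (T₁ ++ y ∷ l) ≡ T₁ ++ y ∷ v ∷ l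
       ins-si T₁ refl = insert-suc-++ T₁

       gbar G : ℚ
       gbar = EV (gain i w)
       G = θ * θ + gbar

       lift : ∀ (φ ψ : V → ℚ) → (∀ v → (θ + θ) * φ v ≤ (θ + θ) * ψ v + err v) → (θ + θ) * EV φ ≤ (θ + θ) * EV ψ + G
       lift φ ψ h = ≤-trans (≤-reflexive (sym (E-* mV (θ + θ) φ))) (≤-trans (E-mono mV (λ v _ → h v))
         (≤-reflexive (trans (E-+ mV _ _) (cong₂ _+_ (E-* mV (θ + θ) ψ) (trans (E-+ mV _ _) (cong (_+ gbar) (E-const mV (θ * θ))))))))
         where mV = mean MV

       𝓔-cong : ∀ {φ ψ : V → V → V → List V → List V → ℚ} → (∀ x y z T₁ T₂ → φ x y z T₁ T₂ ≡ ψ x y z T₁ T₂) → 𝓔 φ ≡ 𝓔 ψ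
       𝓔-cong h = E-cong (mean MV) (λ x _ → E-cong (mean MV) (λ y _ → E-cong (mean MV) (λ z _ → E-cong (mean (lists MV i)) (λ T₁ _ → E-cong (mean (lists MV j)) (λ T₂ _ → h x y z T₁ T₂)))))

       𝓔-z : ∀ φ → EV (λ z → Epair (λ x y T₁ T₂ → φ x y z T₁ T₂)) ≡ 𝓔 φ
       𝓔-z φ = trans (E-comm (mean MV) (mean MV) _) (E-cong (mean MV) (λ x _ → E-comm (mean MV) (mean MV) _))

       𝓔-y : ∀ φ → EV (λ y → Epair (λ x z T₁ T₂ → φ x y z T₁ T₂)) ≡ 𝓔 φ
       𝓔-y φ = E-comm (mean MV) (mean MV) _

       W₀∈ : ∀ l → Len k l → W₀ l ∈[0,1]
       W₀∈ l p = W∈ i w l p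

       -- The vertex outside the edge to be replaced joins the sample, here `z`. The other two edges
       -- contain it and each misses one vertex of the replaced edge, so both are visible in its
       -- subtuples. The next two steps add `x` and `y`.
       step₁ : (θ + θ) * 𝓔 (λ x y z T₁ T₂ → W₀ (T₁ ++ x ∷ y ∷ T₂) * (W₀ (T₁ ++ y ∷ z ∷ T₂) * W₀ (T₁ ++ x ∷ z ∷ T₂))) ≤
               (θ + θ) * 𝓔 (λ x y z T₁ T₂ → f (T₁ ++ x ∷ y ∷ T₂) * (W₀ (T₁ ++ y ∷ z ∷ T₂) * W₀ (T₁ ++ x ∷ z ∷ T₂))) + G
       step₁ = subst₂ (λ a b → (θ + θ) * a ≤ (θ + θ) * b + G) (𝓔-z _) (𝓔-z _) (lift _ _ (λ z →
         step z (suc i) i (suc i) (suc i) W₀ W₀ (inj₁ refl) (inj₂ refl) W₀∈ W₀∈ (W-ext i (suc i) i z w) (W-ext i (suc i) (suc i) z w)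
           (λ x y T₁ T₂ → T₁ ++ y ∷ z ∷ T₂) (λ x y T₁ T₂ → T₁ ++ x ∷ z ∷ T₂)
           (λ x y T₁ T₂ p → trans (cong (insertAt (suc i) z) (rem-i T₁ T₂ p)) (ins-si T₁ p))
           (λ x y T₁ T₂ p → trans (cong (insertAt (suc i) z) (rem-si T₁ T₂ p)) (ins-si T₁ p))
           (len-ext (suc i) i z i<k) (len-ext (suc i) (suc i) z si<k)))

       step₂ : (θ + θ) * 𝓔 (λ x y z T₁ T₂ → W₀ (T₁ ++ y ∷ z ∷ T₂) * (f (T₁ ++ x ∷ y ∷ T₂) * W₀ (T₁ ++ x ∷ z ∷ T₂))) ≤
               (θ + θ) * 𝓔 (λ x y z T₁ T₂ → f (T₁ ++ y ∷ z ∷ T₂) * (f (T₁ ++ x ∷ y ∷ T₂) * W₀ (T₁ ++ x ∷ z ∷ T₂))) + G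
       step₂ = lift _ _ (λ x →
         step x i (suc i) i i f W₀ (inj₂ refl) (inj₁ refl) (λ l _ → f∈ l) W₀∈ (f-ext i (suc i) x w) (W-ext i i i x w)
           (λ y z T₁ T₂ → T₁ ++ x ∷ y ∷ T₂) (λ y z T₁ T₂ → T₁ ++ x ∷ z ∷ T₂)
           (λ y z T₁ T₂ p → trans (cong (insertAt i x) (rem-si T₁ T₂ p)) (ins-i T₁ p))
           (λ y z T₁ T₂ p → trans (cong (insertAt i x) (rem-i T₁ T₂ p)) (ins-i T₁ p))
           (len-ext i (suc i) x si<k) (len-ext i i x i<k))

       step₃ : (θ + θ) * 𝓔 (λ x y z T₁ T₂ → W₀ (T₁ ++ x ∷ z ∷ T₂) * (f (T₁ ++ x ∷ y ∷ T₂) * f (T₁ ++ y ∷ z ∷ T₂))) ≤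
               (θ + θ) * 𝓔 (λ x y z T₁ T₂ → f (T₁ ++ x ∷ z ∷ T₂) * (f (T₁ ++ x ∷ y ∷ T₂) * f (T₁ ++ y ∷ z ∷ T₂))) + G
       step₃ = subst₂ (λ a b → (θ + θ) * a ≤ (θ + θ) * b + G) (𝓔-y _) (𝓔-y _) (lift _ _ (λ y →
         step y (suc i) (suc i) i i f f (inj₂ refl) (inj₁ refl) (λ l _ → f∈ l) (λ l _ → f∈ l) (f-ext (suc i) (suc i) y w) (f-ext i i y w)
           (λ x z T₁ T₂ → T₁ ++ x ∷ y ∷ T₂) (λ x z T₁ T₂ → T₁ ++ y ∷ z ∷ T₂)
           (λ x z T₁ T₂ p → trans (cong (insertAt (suc i) y) (rem-si T₁ T₂ p)) (ins-si T₁ p))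
           (λ x z T₁ T₂ p → trans (cong (insertAt i y) (rem-i T₁ T₂ p)) (ins-i T₁ p))
           (len-ext (suc i) (suc i) y si<k) (len-ext i i y i<k)))

       no-triangle : 𝓔 (λ x y z T₁ T₂ → f (T₁ ++ x ∷ z ∷ T₂) * (f (T₁ ++ x ∷ y ∷ T₂) * f (T₁ ++ y ∷ z ∷ T₂))) ≤ 0ℚ
       no-triangle = ≤-trans (𝓔-mono {ψ = λ _ _ _ _ _ → 0ℚ} (λ x y z T₁ T₂ p q → ≤-reflexive (zero' (free T₁ x y z T₂ p q))))
         (≤-reflexive (trans (E-cong mV (λ x _ → trans (E-cong mV (λ y _ → trans (E-cong mV (λ z _ → trans (E-cong (mean (lists MV i)) (λ T₁ _ → E-0 (mean (lists MV j)))) (E-0 (mean (lists MV i))))) (E-0 mV))) (E-0 mV))) (E-0 mV)))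
         where
         mV = mean MV
         zero' : ∀ {a b c} → (b ≡ true → c ≡ true → a ≡ true → ⊥) → 𝟙 a * (𝟙 b * 𝟙 c) ≡ 0ℚ
         zero' {false} {b} {c} h = zeroˡ _
         zero' {true} {false} {c} h = solve 1 (λ c → (con 1ℚ) :* ((con 0ℚ) :* c) := (con 0ℚ)) refl (𝟙 c)
         zero' {true} {true} {false} h = solve 0 ((con 1ℚ) :* ((con 1ℚ) :* (con 0ℚ)) := (con 0ℚ)) refl
         zero' {true} {true} {true} h = ⊥-elim (h refl refl refl)

       -- Three replacements, each of cost `G`, lead to a triangle of actual edges, which `free`
       -- excludes.
       triangle-W : (θ + θ) * 𝓔 (λ x y z T₁ T₂ → W₀ (T₁ ++ x ∷ y ∷ T₂) * (W₀ (T₁ ++ y ∷ z ∷ T₂) * W₀ (T₁ ++ x ∷ z ∷ T₂))) ≤ G + (G + G)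
       triangle-W = ≤-trans step₁ (≤-trans (+-monoˡ-≤ G (≤-trans (≤-reflexive (cong ((θ + θ) *_) (𝓔-cong (λ x y z T₁ T₂ → solve 3 (λ a b c → a :* (b :* c) := b :* (a :* c)) refl _ _ _))))
         (≤-trans step₂ (+-monoˡ-≤ G (≤-trans (≤-reflexive (cong ((θ + θ) *_) (𝓔-cong (λ x y z T₁ T₂ → solve 3 (λ a b c → a :* (b :* c) := c :* (b :* a)) refl _ _ _)))) (≤-trans step₃ (+-monoˡ-≤ G (mul-monoˡ (θ + θ) (add≥0 0≤θ 0≤θ) no-triangle))))))))
         (≤-reflexive (solve 2 (λ t g → (t :+ t) :* (con 0ℚ) :+ g :+ g :+ g := g :+ (g :+ g)) refl θ G)))

       ct : V → List V → List V → Ty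
       ct x T₁ T₂ = tp ((T₁ ++ x ∷ T₂) ++ w)

       -- A pair satisfying `β` has conditional edge probability at least `δ`, so one such triangle
       -- carries weight `δ * (δ * δ)` in the average of `W`.
       triangle-β : ∀ δ → 0ℚ ≤ δ → (θ + θ) * ((δ * (δ * δ)) * 𝓔 (λ x y z T₁ T₂ → 𝟙 (β δ w i (ct z T₁ T₂) (ct x T₁ T₂)) * (𝟙 (β δ w i (ct y T₁ T₂) (ct x T₁ T₂)) * 𝟙 (β δ w i (ct z T₁ T₂) (ct y T₁ T₂))))) ≤ G + (G + G)
       triangle-β δ 0≤δ = ≤-trans (mul-monoˡ (θ + θ) (add≥0 0≤θ 0≤θ) (≤-trans (≤-reflexive (sym (𝓔-* (δ * (δ * δ)) _))) (𝓔-mono (λ x y z T₁ T₂ p q →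
           ≤-trans (≤-reflexive (solve 4 (λ d a b c → (d :* (d :* d)) :* (a :* (b :* c)) := (d :* b) :* ((d :* c) :* (d :* a))) refl δ _ _ _))
           (mul-mono (mul≥0 0≤δ (𝟙≥0 (β δ w i (ct y T₁ T₂) (ct x T₁ T₂)))) (mul≥0 (nn y z T₁ T₂ p q) (nn x z T₁ T₂ p q)) (low x y T₁ T₂ p q)
             (mul-mono (mul≥0 0≤δ (𝟙≥0 (β δ w i (ct z T₁ T₂) (ct y T₁ T₂)))) (nn x z T₁ T₂ p q) (low y z T₁ T₂ p q) (low x z T₁ T₂ p q))))))) triangle-W
         where
         nn : ∀ x y T₁ T₂ → Len i T₁ → Len j T₂ → 0ℚ ≤ W₀ (T₁ ++ x ∷ y ∷ T₂)
         nn x y T₁ T₂ p q = proj₁ (W₀∈ (T₁ ++ x ∷ y ∷ T₂) (len-k T₁ T₂ p q))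
         low : ∀ x y T₁ T₂ → Len i T₁ → Len j T₂ → δ * 𝟙 (β δ w i (ct y T₁ T₂) (ct x T₁ T₂)) ≤ W₀ (T₁ ++ x ∷ y ∷ T₂)
         low x y T₁ T₂ p q = subst (λ o → δ * 𝟙 (δ ≤ᵇ W i w o) ≤ W₀ (T₁ ++ x ∷ y ∷ T₂)) (cong₂ (λ a b → tp (a ++ w) , tp (b ++ w)) (rem-i {x} {y} T₁ T₂ p) (rem-si {x} {y} T₁ T₂ p)) low'
           where
           u = W₀ (T₁ ++ x ∷ y ∷ T₂)
           low' : δ * 𝟙 (δ ≤ᵇ u) ≤ u
           low' with bool-case (δ ≤ᵇ u)
           ... | inj₁ e = ≤-trans (≤-reflexive (trans (cong (λ b → δ * 𝟙 b) e) (*-identityʳ δ))) (≤ᵇ⇒≤ e)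
           ... | inj₂ e = ≤-trans (≤-reflexive (trans (cong (λ b → δ * 𝟙 b) e) (zeroʳ δ))) (nn x y T₁ T₂ p q)

 sift : ∀ {A : Set} (_≟_ : DecidableEquality A) (Q : List A) → Unique Q → ∀ {t} → t ∈ Q → (g : A → ℚ) → ∑ Q (λ q → 𝟙 ⌊ t ≟ q ⌋ * g q) ≡ g t
 sift _≟_ (q ∷ Q) (fresh ∷ u) {t} t∈ g with t ≟ q
 ... | yes refl = trans (cong₂ _+_ (*-identityˡ (g t)) (trans (∑-cong Q others) (trans (∑-const Q 0ℚ) (zeroʳ _)))) (+-identityʳ _)
   where
   others : ∀ q → q ∈ Q → 𝟙 ⌊ t ≟ q ⌋ * g q ≡ 0ℚ
   others q q∈ with t ≟ q
   ... | yes refl = ⊥-elim (All.lookup fresh q∈ refl)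
   ... | no _ = zeroˡ _
 sift _≟_ (q ∷ Q) (fresh ∷ u) (here refl) g | no n = ⊥-elim (n refl)
 sift _≟_ (q ∷ Q) (fresh ∷ u) (there t∈) g | no n = trans (cong₂ _+_ (zeroˡ (g q)) (sift _≟_ Q u t∈ g)) (+-identityˡ _)

 -- Types of (k-1)-tuples as independent draws given lower types.

 module LevelR {V B : Set} (_≟V_ : DecidableEquality V) (_≟B_ : DecidableEquality B) (col : List V → B)
   (col-set : ∀ l l' → (∀ v → v ∈ l → v ∈ l') → (∀ v → v ∈ l' → v ∈ l) → col l ≡ col l')
   (MV : FullMean {V} (λ _ → ⊤)) (r : ℕ) (w₀ : List V) where

   open Types _≟V_ _≟B_ col col-set public

   _≟L_ : DecidableEquality (List Ty)
   _≟L_ = ≡-dec _≟T_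

   module CR = Cond (lists MV r) _≟L_

   Mr : Mean (Len {V} r)
   Mr = mean (lists MV r)

   Eʳ : (List V → ℚ) → ℚ
   Eʳ = E Mr

   -- What is known about `X` when its own type is hidden. The sample `w` may be longer than the
   -- `w₀` in `ct`: refining the conditioning then creates no new values of `ct`.
   low : List V → List V → List Ty
   low w X = map (λ j → tp (rem j X ++ w)) (upTo r)

   ct : List V → Ty
   ct X = tp (X ++ w₀)

   one : Ty → List V → ℚ
   one q X = 𝟙 ⌊ ct X ≟T q ⌋

   one∈ : ∀ q X → one q X ∈[0,1]
   one∈ q X = 𝟙∈ ⌊ ct X ≟T q ⌋

   low-same : ∀ w Π → low w (map proj₁ Π) ≡ low w (map proj₂ Π) → ∀ {j} → j ℕ.< r → Same (rem j Π ++ diag w)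
   low-same w Π e {j} j<r = Same-tp (rem j Π) w (subst₂ (λ a b → tp (a ++ w) ≡ tp (b ++ w)) (sym (map-rem proj₁ j Π)) (sym (map-rem proj₂ j Π)) (map-≡-∈ (upTo r) e (∈-upTo⁺ j<r)))

   same-low : ∀ w Π → (∀ {j} → j ℕ.< r → Same (rem j Π ++ diag w)) → low w (map proj₁ Π) ≡ low w (map proj₂ Π)
   same-low w Π s = map-∈-≡ (upTo r) (λ {j} j∈ → subst₂ (λ a b → tp (a ++ w) ≡ tp (b ++ w)) (map-rem proj₁ j Π) (map-rem proj₂ j Π) (tp-Same (rem j Π) w (s (∈-upTo⁻ j∈))))

   diag-++ : ∀ u w {π} {x : V × V} → x ∈ π ++ diag w → x ∈ π ++ diag (u ++ w)
   diag-++ u w {π} p with ∈-++⁻ π p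
   ... | inj₁ q = ∈-++⁺ˡ q
   ... | inj₂ q = ∈-++⁺ʳ π (subst (_ ∈_) (sym (map-++ _ u w)) (∈-++⁺ʳ (diag u) q))

   low-refines : ∀ u w → CR.Refines (low (u ++ w)) (low w)
   low-refines u w = zipped _ λ Π e → same-low w Π (λ {j} j<r → same-⊂ {rem j Π ++ diag (u ++ w)} (low-same (u ++ w) Π e j<r) (diag-++ u w {rem j Π}))

   pr : List V → Ty → List V → ℚ
   pr w q X = CR.cond (low w) (one q) (low w X)

   module _ (Q : List Ty) (Q-unique : Unique Q) (Q-all : ∀ X → Len r X → ct X ∈ Q) where

     energyR : List V → ℚ
     energyR w = ∑ Q (λ q → CR.energy (low w) (one q))

     gainR : List V → List V → ℚ
     gainR u w = ∑ Q (λ q → Eʳ (λ X → (pr (u ++ w) q X - pr w q X) * (pr (u ++ w) q X - pr w q X)))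

     gainR-energy : ∀ u w → gainR u w ≡ energyR (u ++ w) - energyR w
     gainR-energy u w = trans (∑-cong Q (λ q _ → CR.pythagoras (low (u ++ w)) (low w) (one q) (low-refines u w))) (Lin.L-- (∑-lin Q) _ _)

     module Hybrid (u w : List V) (h : List V → Ty → ℚ) (h∈ : ∀ X q → Len r X → h X q ∈[0,1])
       (meas : ∀ X X' → Len r X → Len r X' → low (u ++ w) X ≡ low (u ++ w) X' → ∀ q → h X q ≡ h X' q) where

       actual independent : ℚ
       actual = Eʳ (λ X → h X (ct X))
       independent = Eʳ (λ X → CR.cond (low w) (λ X' → h X (ct X')) (low w X))

       -- As `h` is measurable over `u ++ w`, the indicator of each type may be replaced by its
       -- conditional probability there. `independent-sum` is the same expression with conditional
       -- probabilities over `w`, so the difference is governed by the energy gain.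
       actual-sum : actual ≡ ∑ Q (λ q → Eʳ (λ X → pr (u ++ w) q X * h X q))
       actual-sum = trans (E-cong Mr (λ X p → sym (sift _≟T_ Q Q-unique (Q-all X p) (h X))))
         (trans (sym (∑-swap Q (lin Mr) (λ q X → one q X * h X q))) (∑-cong Q (λ q _ → sym (CR.cond-test (low (u ++ w)) (one q) (λ X → h X q) (λ X X' p p' e → meas X X' p p' e q)))))

       independent-sum : independent ≡ ∑ Q (λ q → Eʳ (λ X → pr w q X * h X q))
       independent-sum = trans (E-cong Mr (λ X p → inner X p)) (sym (∑-swap Q (lin Mr) (λ q X → pr w q X * h X q)))
         where
         inner : ∀ X → Len r X → CR.cond (low w) (λ X' → h X (ct X')) (low w X) ≡ ∑ Q (λ q → pr w q X * h X q)
         inner X p = trans (E-cong N (λ X' s → sym (sift _≟T_ Q Q-unique (Q-all X' (proj₁ s)) (h X))))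
           (trans (sym (∑-swap Q (lin N) (λ q X' → one q X' * h X q))) (∑-cong Q (λ q _ → E-*ʳ N (one q) (h X q))))
           where N = CR.condMean (low w) (low w X) (CR.mass>0 (low w) X p)

       module _ (θ : ℚ) (0≤θ : 0ℚ ≤ θ) where
         err : ℚ
         err = length Q /1 * (θ * θ) + gainR u w

         -- The sign `σ` yields the estimates in both directions from one computation.
         diff : ∀ (σ : ℚ) → σ * σ ≡ 1ℚ → (θ + θ) * (σ * (actual - independent)) ≤ err
         diff σ σ² = ≤-trans (≤-reflexive eq) (≤-trans (∑-mono Q (λ q _ → each q)) (≤-reflexive (trans (∑-+ Q (λ _ → θ * θ) _) (cong (_+ gainR u w) (∑-const Q (θ * θ))))))
           where
           d : Ty → List V → ℚ
           d q X = pr (u ++ w) q X - pr w q X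
           eq : (θ + θ) * (σ * (actual - independent)) ≡ ∑ Q (λ q → Eʳ (λ X → (θ + θ) * ((σ * d q X) * h X q)))
           eq = trans (cong (λ t → (θ + θ) * (σ * t)) (trans (cong₂ _-_ actual-sum independent-sum) (sym (Lin.L-- (∑-lin Q) _ _))))
             (trans (cong ((θ + θ) *_) (sym (∑-* Q σ _))) (trans (sym (∑-* Q (θ + θ) _)) (∑-cong Q (λ q _ →
               trans (cong (λ t → (θ + θ) * (σ * t)) (sym (E-- Mr _ _))) (trans (cong ((θ + θ) *_) (sym (E-* Mr σ _))) (trans (sym (E-* Mr (θ + θ) _))
               (E-cong Mr (λ X _ → solve 5 (λ t s a b p → t :* (s :* (a :* p :- b :* p)) := t :* ((s :* (a :- b)) :* p)) refl (θ + θ) σ (pr (u ++ w) q X) (pr w q X) (h X q)))))))))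
           each : ∀ q → Eʳ (λ X → (θ + θ) * ((σ * d q X) * h X q)) ≤ θ * θ + Eʳ (λ X → d q X * d q X)
           each q = ≤-trans (E-mono Mr (λ X p → amgm θ (σ * d q X) (h X q) (proj₁ (h∈ X q p)) (proj₂ (h∈ X q p))))
             (≤-reflexive (trans (E-+ Mr (λ _ → θ * θ) _) (cong₂ _+_ (E-const Mr (θ * θ)) (E-cong Mr (λ X _ → trans (solve 2 (λ s d → s :* d :* (s :* d) := (s :* s) :* (d :* d)) refl σ (d q X)) (trans (cong (_* (d q X * d q X)) σ²) (*-identityˡ _)))))))

         actual≤ : (θ + θ) * actual ≤ (θ + θ) * independent + err
         actual≤ = ≤-sub (≤-trans (sub≥0 (diff 1ℚ (*-identityˡ 1ℚ))) (≤-reflexive (solve 4 (λ t a b e → e :- t :* ((con 1ℚ) :* (a :- b)) := t :* b :+ e :- t :* a) refl (θ + θ) actual independent err)))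

         independent≤ : (θ + θ) * independent ≤ (θ + θ) * actual + err
         independent≤ = ≤-sub (≤-trans (sub≥0 (diff (- 1ℚ) (solve 0 ((:- (con 1ℚ)) :* (:- (con 1ℚ)) := (con 1ℚ)) refl))) (≤-reflexive (solve 4 (λ t a b e → e :- t :* ((:- (con 1ℚ)) :* (a :- b)) := t :* a :+ e :- t :* b) refl (θ + θ) actual independent err)))

   -- the reduced distributions; lists of the wrong length get a default one
   module _ (X₀ : List V) (X₀-len : Len r X₀) where
     fix : List V → List V
     fix X with length X ℕ.≟ r
     ... | yes _ = X
     ... | no _ = X₀

     fix-len : ∀ X → Len r (fix X)
     fix-len X with length X ℕ.≟ r
     ... | yes p = p
     ... | no _ = X₀-len

     fix-id : ∀ X → Len r X → fix X ≡ X
     fix-id X p with length X ℕ.≟ r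
     ... | yes _ = refl
     ... | no n = ⊥-elim (n p)

     law : ∀ w X → Mean (λ a → Len r a × low w a ≡ low w (fix X))
     law w X = CR.condMean (low w) (low w (fix X)) (CR.mass>0 (low w) (fix X) (fix-len X))

     law-cond : ∀ w X φ → Len r X → E (law w X) φ ≡ CR.cond (low w) φ (low w X)
     law-cond w X φ p = cong (λ Z → CR.cond (low w) φ (low w Z)) (fix-id X p)

     law-low : ∀ w X X' φ → Len r X → Len r X' → low w X ≡ low w X' → E (law w X) φ ≡ E (law w X') φ
     law-low w X X' φ p p' e = trans (law-cond w X φ p) (trans (cong (CR.cond (low w) φ) e) (sym (law-cond w X' φ p')))

 zipped-len : ∀ {A : Set} {k : ℕ} (Q : List A → List A → Set) → (∀ (Π : List (A × A)) → length Π ≡ k → Q (map proj₁ Π) (map proj₂ Π)) → ∀ Y Y' → Len k Y → Len k Y' → Q Y Y'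
 zipped-len {k = k} Q h Y Y' p q = subst₂ Q (zip-fst Y Y' (trans p (sym q))) (zip-snd Y Y' (trans p (sym q))) (h (zip Y Y') (len Y Y' k p q))
   where
   len : ∀ {A : Set} (Y Y' : List A) k → length Y ≡ k → length Y' ≡ k → length (zip Y Y') ≡ k
   len [] [] k p q = p
   len [] (y ∷ Y') .0 refl ()
   len (y ∷ Y) (y' ∷ Y') (suc k) p q = cong suc (len Y Y' k (suc-inj p) (suc-inj q))

 rem-insert : ∀ {A : Set} m (v : A) l → m ℕ.≤ length l → rem m (insertAt m v l) ≡ l
 rem-insert zero v l _ = refl
 rem-insert (suc m) v (x ∷ l) (s≤s p) = cong (x ∷_) (rem-insert m v l p)

 -- A deletion at another position keeps `v`; the other vertices then form a subtuple with two fewer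
 -- vertices than the whole, which lower types record once `v` is in the sample.
 rem-insert-∈ : ∀ {A : Set} m j (v : A) l → m ℕ.≤ length l → j ℕ.≤ length l → j ≢ m → ∃ λ j' → j' ℕ.< length l × (∀ {x} → x ∈ rem j (insertAt m v l) → x ≡ v ⊎ x ∈ rem j' l)
 rem-insert-∈ zero zero v l _ _ ne = ⊥-elim (ne refl)
 rem-insert-∈ zero (suc j) v l _ q ne = j , q , λ { (here e) → inj₁ e ; (there p) → inj₂ p }
 rem-insert-∈ (suc m) zero v (y ∷ l) _ _ _ = 0 , s≤s z≤n , ∈-insert m v l
 rem-insert-∈ (suc m) (suc j) v (y ∷ l) (s≤s p) (s≤s q) ne with rem-insert-∈ m j v l p q (ne ∘ cong suc)
 ... | j' , j'< , h = suc j' , s≤s j'< , λ { (here e) → inj₂ (here e) ; (there s) → up (h s) }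
   where
   up : ∀ {x} → x ≡ v ⊎ x ∈ rem j' l → x ≡ v ⊎ x ∈ y ∷ rem j' l
   up (inj₁ e) = inj₁ e
   up (inj₂ e) = inj₂ (there e)

 prod-snoc : ∀ {Ω : Set} {P : ℕ → Ω → Set} (p : ∀ i → Mean (P i)) i m (Φ : List Ω → ℚ) →
   E (Chain.prod p i (suc m)) Φ ≡ E (Chain.prod p i m) (λ l → E (p (i ℕ.+ m)) (λ q → Φ (l ++ q ∷ [])))
 prod-snoc p i zero Φ = cong (λ n → E (p n) (λ q → Φ (q ∷ []))) (sym (ℕ.+-identityʳ i))
 prod-snoc p i (suc m) Φ = E-cong (p i) (λ v _ → trans (prod-snoc p (suc i) m (λ l → Φ (v ∷ l)))
   (E-cong (Chain.prod p (suc i) m) (λ l _ → cong (λ n → E (p n) (λ q → Φ (v ∷ l ++ q ∷ []))) (sym (ℕ.+-suc i m)))))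

 -- Exchanging actual types for independent draws.

 module Mixed {V B : Set} (_≟V_ : DecidableEquality V) (_≟B_ : DecidableEquality B) (col : List V → B)
   (col-set : ∀ l l' → (∀ v → v ∈ l → v ∈ l') → (∀ v → v ∈ l' → v ∈ l) → col l ≡ col l')
   (MV : FullMean {V} (λ _ → ⊤)) (r : ℕ) (w₀ ext : List V) (X₀ : List V) (X₀-len : Len r X₀)
   (Q : List (List B)) (Q-unique : Unique Q) (Q-all : ∀ X → Len r X → Types.tp _≟V_ _≟B_ col col-set (X ++ w₀) ∈ Q)
   (β : ℕ → List B → List B → Bool) (θ : ℚ) (0≤θ : 0ℚ ≤ θ) where

   open LevelR _≟V_ _≟B_ col col-set MV r w₀ hiding (law; law-cond; law-low)

   w : List V
   w = ext ++ w₀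

   EV : (V → ℚ) → ℚ
   EV = E (mean MV)

   opaque
     law : ∀ X → Mean (λ a → Len r a × low w a ≡ low w (fix X₀ X₀-len X))
     law = LevelR.law _≟V_ _≟B_ col col-set MV r w₀ X₀ X₀-len w

     law-cond : ∀ X φ → Len r X → E (law X) φ ≡ CR.cond (low w) φ (low w X)
     law-cond = LevelR.law-cond _≟V_ _≟B_ col col-set MV r w₀ X₀ X₀-len w

     law-low : ∀ X X' φ → Len r X → Len r X' → low w X ≡ low w X' → E (law X) φ ≡ E (law X') φ
     law-low = LevelR.law-low _≟V_ _≟B_ col col-set MV r w₀ X₀ X₀-len w

   open Reduced law (λ i a b → β i (ct a) (ct b)) public

   -- the cost of one replacement, averaged over two extra sample vertices
   cost : ℚ
   cost = EV (λ x → EV (λ y → length Q /1 * (θ * θ) + gainR Q Q-unique Q-all (x ∷ y ∷ []) w))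

   Same-w₀ : ∀ π → Same (π ++ diag w) → Same (π ++ diag w₀)
   Same-w₀ π s = same-⊂ {π ++ diag w} s (diag-++ ext w₀ {π})

   avg : ∀ (a b : V → V → ℚ) → (∀ x y → (θ + θ) * a x y ≤ (θ + θ) * b x y + (length Q /1 * (θ * θ) + gainR Q Q-unique Q-all (x ∷ y ∷ []) w)) →
     (θ + θ) * EV (λ x → EV (a x)) ≤ (θ + θ) * EV (λ x → EV (b x)) + cost
   avg a b h = ≤-trans (≤-reflexive (trans (sym (E-* mV (θ + θ) _)) (E-cong mV (λ x _ → sym (E-* mV (θ + θ) _)))))
     (≤-trans (E-mono mV (λ x _ → E-mono mV (λ y _ → h x y))) (≤-reflexive (trans (E-cong mV (λ x _ → trans (E-+ mV _ _) (cong (_+ _) (E-* mV (θ + θ) _)))) (trans (E-+ mV _ _) (cong (_+ _) (E-* mV (θ + θ) _))))))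
     where mV = mean MV

   module Triangle (i j : ℕ) (r≡ : i ℕ.+ suc j ≡ r) where

     i<r : i ℕ.< r
     i<r = ℕ.≤-trans (ℕ.≤-trans (ℕ.≤-reflexive (ℕ.+-comm 1 i)) (ℕ.+-monoʳ-≤ i (s≤s z≤n))) (ℕ.≤-reflexive r≡)

     rep : V → List V → List V
     rep v X = insertAt i v (rem i X)

     rep-len : ∀ v X → Len r X → Len r (rep v X)
     rep-len v X p = trans (length-insert i v (rem i X)) (trans (length-rem i X (subst (i ℕ.<_) (sym p) i<r)) p)

     rep-++ : ∀ v {x : V} T₁ T₂ → Len i T₁ → rep v (T₁ ++ x ∷ T₂) ≡ T₁ ++ v ∷ T₂
     rep-++ v T₁ T₂ refl = trans (cong (insertAt (length T₁) v) (rem-++ T₁)) (insert-++ T₁)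

     rep-same : ∀ u v Π → v ∈ u → low (u ++ w) (map proj₁ Π) ≡ low (u ++ w) (map proj₂ Π) → ∀ {π} → (∀ {x} → x ∈ π → x ∈ insertAt i (v , v) (rem i Π)) → Same (π ++ diag w)
     rep-same u v Π v∈ e {π} sub = same-⊂ {rem i Π ++ diag (u ++ w)} (low-same (u ++ w) Π e i<r) into
       where
       into : ∀ {x} → x ∈ π ++ diag w → x ∈ rem i Π ++ diag (u ++ w)
       into p with ∈-++⁻ π p
       ... | inj₂ q = diag-++ u w {rem i Π} (∈-++⁺ʳ (rem i Π) q)
       ... | inj₁ q with ∈-insert i (v , v) (rem i Π) (sub q)
       ... | inj₁ refl = ∈-++⁺ʳ (rem i Π) (∈-map⁺ (λ v → v , v) (∈-++⁺ˡ v∈))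
       ... | inj₂ s = ∈-++⁺ˡ s

     map-rep : ∀ (g : V × V → V) v Π → g (v , v) ≡ v → map g (insertAt i (v , v) (rem i Π)) ≡ rep v (map g Π)
     map-rep g v Π e = trans (map-insert g i (v , v) (rem i Π)) (cong₂ (insertAt i) e (map-rem g i Π))

     ct-rep : ∀ u v Π → v ∈ u → low (u ++ w) (map proj₁ Π) ≡ low (u ++ w) (map proj₂ Π) → ct (rep v (map proj₁ Π)) ≡ ct (rep v (map proj₂ Π))
     ct-rep u v Π v∈ e = subst₂ (λ a b → tp (a ++ w₀) ≡ tp (b ++ w₀)) (map-rep proj₁ v Π refl) (map-rep proj₂ v Π refl) (tp-Same Π' w₀ (Same-w₀ Π' (rep-same u v Π v∈ e (λ p → p))))
       where Π' = insertAt i (v , v) (rem i Π)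

     low-rep : ∀ u v Π → v ∈ u → low (u ++ w) (map proj₁ Π) ≡ low (u ++ w) (map proj₂ Π) → low w (rep v (map proj₁ Π)) ≡ low w (rep v (map proj₂ Π))
     low-rep u v Π v∈ e = subst₂ (λ a b → low w a ≡ low w b) (map-rep proj₁ v Π refl) (map-rep proj₂ v Π refl) (same-low w Π' (λ {l} _ → rep-same u v Π v∈ e (∈-rem l Π')))
       where Π' = insertAt i (v , v) (rem i Π)

     ct-rep′ : ∀ u v X X' → Len r X → Len r X' → v ∈ u → low (u ++ w) X ≡ low (u ++ w) X' → ct (rep v X) ≡ ct (rep v X')
     ct-rep′ u v X X' p p' v∈ = zipped (λ X X' → low (u ++ w) X ≡ low (u ++ w) X' → ct (rep v X) ≡ ct (rep v X')) (λ Π → ct-rep u v Π v∈) X X' p p'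

     law-rep : ∀ u v X X' → Len r X → Len r X' → v ∈ u → low (u ++ w) X ≡ low (u ++ w) X' → ∀ φ → E (law (rep v X)) φ ≡ E (law (rep v X')) φ
     law-rep u v X X' p p' v∈ e φ = law-low (rep v X) (rep v X') φ (rep-len v X p) (rep-len v X' p') (zipped (λ X X' → low (u ++ w) X ≡ low (u ++ w) X' → low w (rep v X) ≡ low w (rep v X')) (λ Π → low-rep u v Π v∈) X X' p p' e)

     F : Ty → Ty → Ty → ℚ
     F a b q = 𝟙 (β i b a) * (𝟙 (β i q a) * 𝟙 (β i b q))

     F∈ : ∀ a b q → F a b q ∈[0,1]
     F∈ a b q = *∈ (𝟙∈ (β i b a)) (*∈ (𝟙∈ (β i q a)) (𝟙∈ (β i b q)))

     Ecore : (List V → List V → ℚ) → ℚ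
     Ecore φ = Eᴸ MV i (λ T₁ → Eᴸ MV j (λ T₂ → φ T₁ T₂))

     Ecore-cong : ∀ {φ ψ} → (∀ T₁ T₂ → Len i T₁ → Len j T₂ → φ T₁ T₂ ≡ ψ T₁ T₂) → Ecore φ ≡ Ecore ψ
     Ecore-cong h = E-cong (mean (lists MV i)) (λ T₁ p → E-cong (mean (lists MV j)) (λ T₂ q → h T₁ T₂ p q))

     EX-core : ∀ φ → Eʳ φ ≡ EV (λ v → Ecore (λ T₁ T₂ → φ (T₁ ++ v ∷ T₂)))
     EX-core φ = trans (cong (λ n → Eᴸ MV n φ) (sym r≡)) (trans (Eᴸ-++ MV i (suc j) φ) (E-comm (mean (lists MV i)) (mean MV) _))

     𝓔 : (V → V → V → List V → List V → ℚ) → ℚ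
     𝓔 φ = EV (λ x → EV (λ y → EV (λ z → Ecore (φ x y z))))

     𝓔-cong : ∀ {φ ψ : V → V → V → List V → List V → ℚ} → (∀ x y z T₁ T₂ → Len i T₁ → Len j T₂ → φ x y z T₁ T₂ ≡ ψ x y z T₁ T₂) → 𝓔 φ ≡ 𝓔 ψ
     𝓔-cong h = E-cong (mean MV) (λ x _ → E-cong (mean MV) (λ y _ → E-cong (mean MV) (λ z _ → Ecore-cong (h x y z))))

     P : ∀ v T₁ T₂ → Mean (λ a → Len r a × low w a ≡ low w (fix X₀ X₀-len (T₁ ++ v ∷ T₂)))
     P v T₁ T₂ = law (T₁ ++ v ∷ T₂)

     -- The hybrids between drawn and actual types: the type through `x` becomes actual first, then
     -- that through `z`, then that through `y`.
     A₀ A₁ A₂ A₃ : V → V → V → List V → List V → ℚ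
     A₀ x y z T₁ T₂ = tri i T₁ x y z T₂
     A₁ x y z T₁ T₂ = E (P z T₁ T₂) (λ b → E (P y T₁ T₂) (λ q → F (ct (T₁ ++ x ∷ T₂)) (ct b) (ct q)))
     A₂ x y z T₁ T₂ = E (P y T₁ T₂) (λ q → F (ct (T₁ ++ x ∷ T₂)) (ct (T₁ ++ z ∷ T₂)) (ct q))
     A₃ x y z T₁ T₂ = F (ct (T₁ ++ x ∷ T₂)) (ct (T₁ ++ z ∷ T₂)) (ct (T₁ ++ y ∷ T₂))

     -- Only the type of `T₁ ++ v ∷ T₂` changes from drawn to actual. The other two tuples differ
     -- from it in the vertex `v` alone, and their own vertices in that place will be members of
     -- `u`, which makes `h` measurable.
     one-step : ∀ u (h : List V → Ty → ℚ) → (∀ X q → Len r X → h X q ∈[0,1]) →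
       (∀ X X' → Len r X → Len r X' → low (u ++ w) X ≡ low (u ++ w) X' → ∀ q → h X q ≡ h X' q) →
       (φ ψ : V → List V → List V → ℚ) →
       (∀ v T₁ T₂ → Len i T₁ → Len j T₂ → E (P v T₁ T₂) (λ a → h (T₁ ++ v ∷ T₂) (ct a)) ≡ φ v T₁ T₂) →
       (∀ v T₁ T₂ → Len i T₁ → Len j T₂ → h (T₁ ++ v ∷ T₂) (ct (T₁ ++ v ∷ T₂)) ≡ ψ v T₁ T₂) →
       (θ + θ) * EV (λ v → Ecore (φ v)) ≤ (θ + θ) * EV (λ v → Ecore (ψ v)) + (length Q /1 * (θ * θ) + gainR Q Q-unique Q-all u w)
     one-step u h h∈ meas φ ψ eφ eψ = subst₂ (λ a b → (θ + θ) * a ≤ (θ + θ) * b + (length Q /1 * (θ * θ) + gainR Q Q-unique Q-all u w)) ind act (Hybrid.independent≤ Q Q-unique Q-all u w h h∈ meas θ 0≤θ)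
       where
       ind : Hybrid.independent Q Q-unique Q-all u w h h∈ meas ≡ EV (λ v → Ecore (φ v))
       ind = trans (E-cong Mr (λ X p → sym (law-cond X (λ X' → h X (ct X')) p))) (trans (EX-core _) (E-cong (mean MV) (λ v _ → Ecore-cong (λ T₁ T₂ p q → eφ v T₁ T₂ p q))))
       act : Hybrid.actual Q Q-unique Q-all u w h h∈ meas ≡ EV (λ v → Ecore (ψ v))
       act = trans (EX-core _) (E-cong (mean MV) (λ v _ → Ecore-cong (λ T₁ T₂ p q → eψ v T₁ T₂ p q)))

     stepA : (θ + θ) * 𝓔 A₀ ≤ (θ + θ) * 𝓔 A₁ + cost
     stepA = subst₂ (λ a b → (θ + θ) * a ≤ (θ + θ) * b + cost) (swap A₀) (swap A₁) (avg _ _ (λ y z →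
         one-step (y ∷ z ∷ []) (λ X q → E (law (rep z X)) (λ b → E (law (rep y X)) (λ q' → F q (ct b) (ct q'))))
           (λ X q p → E∈ (law (rep z X)) (λ b _ → E∈ (law (rep y X)) (λ q' _ → F∈ _ _ _)))
           (λ X X' p p' e q → trans (E-cong (law (rep z X)) (λ b _ → law-rep (y ∷ z ∷ []) y X X' p p' (here refl) e _)) (law-rep (y ∷ z ∷ []) z X X' p p' (there (here refl)) e _))
           (λ x → A₀ x y z) (λ x → A₁ x y z)
           (λ x T₁ T₂ p q → cong₂ (λ Z Y → E (P x T₁ T₂) (λ a → E (law Z) (λ b → E (law Y) (λ q → F (ct a) (ct b) (ct q))))) (rep-++ z T₁ T₂ p) (rep-++ y T₁ T₂ p))
           (λ x T₁ T₂ p q → cong₂ (λ Z Y → E (law Z) (λ b → E (law Y) (λ q → F (ct (T₁ ++ x ∷ T₂)) (ct b) (ct q)))) (rep-++ z T₁ T₂ p) (rep-++ y T₁ T₂ p))))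
       where
       swap : ∀ φ → EV (λ y → EV (λ z → EV (λ x → Ecore (φ x y z)))) ≡ 𝓔 φ
       swap φ = trans (E-cong (mean MV) (λ y _ → E-comm (mean MV) (mean MV) _)) (E-comm (mean MV) (mean MV) _)

     stepB : (θ + θ) * 𝓔 A₁ ≤ (θ + θ) * 𝓔 A₂ + cost
     stepB = avg _ _ (λ x y →
         one-step (x ∷ y ∷ []) (λ X q → E (law (rep y X)) (λ q' → F (ct (rep x X)) q (ct q')))
           (λ X q p → E∈ (law (rep y X)) (λ q' _ → F∈ _ _ _))
           (λ X X' p p' e q → trans (law-rep (x ∷ y ∷ []) y X X' p p' (there (here refl)) e _) (cong (λ a → E (law (rep y X')) (λ q' → F a q (ct q'))) (ct-rep′ (x ∷ y ∷ []) x X X' p p' (here refl) e)))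
           (λ z → A₁ x y z) (λ z → A₂ x y z)
           (λ z T₁ T₂ p q → cong₂ (λ X Y → E (P z T₁ T₂) (λ b → E (law Y) (λ q → F (ct X) (ct b) (ct q)))) (rep-++ x T₁ T₂ p) (rep-++ y T₁ T₂ p))
           (λ z T₁ T₂ p q → cong₂ (λ X Y → E (law Y) (λ q → F (ct X) (ct (T₁ ++ z ∷ T₂)) (ct q))) (rep-++ x T₁ T₂ p) (rep-++ y T₁ T₂ p)))

     stepC : (θ + θ) * 𝓔 A₂ ≤ (θ + θ) * 𝓔 A₃ + cost
     stepC = subst₂ (λ a b → (θ + θ) * a ≤ (θ + θ) * b + cost) (swap A₂) (swap A₃) (avg _ _ (λ x z →
         one-step (x ∷ z ∷ []) (λ X q → F (ct (rep x X)) (ct (rep z X)) q)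
           (λ X q p → F∈ _ _ _)
           (λ X X' p p' e q → cong₂ (λ a b → F a b q) (ct-rep′ (x ∷ z ∷ []) x X X' p p' (here refl) e) (ct-rep′ (x ∷ z ∷ []) z X X' p p' (there (here refl)) e))
           (λ y → A₂ x y z) (λ y → A₃ x y z)
           (λ y T₁ T₂ p q → cong₂ (λ X Z → E (P y T₁ T₂) (λ q → F (ct X) (ct Z) (ct q))) (rep-++ x T₁ T₂ p) (rep-++ z T₁ T₂ p))
           (λ y T₁ T₂ p q → cong₂ (λ X Z → F (ct X) (ct Z) (ct (T₁ ++ y ∷ T₂))) (rep-++ x T₁ T₂ p) (rep-++ z T₁ T₂ p))))
       where
       swap : ∀ φ → EV (λ x → EV (λ z → EV (λ y → Ecore (φ x y z)))) ≡ 𝓔 φ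
       swap φ = E-cong (mean MV) (λ x _ → E-comm (mean MV) (mean MV) _)

     tri-hybrid : (θ + θ) * 𝓔 A₀ ≤ (θ + θ) * 𝓔 A₃ + (cost + (cost + cost))
     tri-hybrid = ≤-trans stepA (≤-trans (+-monoˡ-≤ cost (≤-trans stepB (+-monoˡ-≤ cost stepC))) (≤-reflexive (solve 2 (λ a c → a :+ c :+ c :+ c := a :+ (c :+ (c :+ c))) refl _ cost)))

   cpT : ℕ → List Ty → ℚ
   cpT i [] = 1ℚ
   cpT i (q ∷ []) = 1ℚ
   cpT i (q ∷ q' ∷ l) = 𝟙 (β i q q') * cpT (suc i) (q' ∷ l)

   cpT∈ : ∀ i l → cpT i l ∈[0,1]
   cpT∈ i [] = 0≤1 , ≤-refl
   cpT∈ i (q ∷ []) = 0≤1 , ≤-refl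
   cpT∈ i (q ∷ q' ∷ l) = *∈ (𝟙∈ (β i q q')) (cpT∈ (suc i) (q' ∷ l))

   cp-cpT : ∀ Y i l → Chain.cp (pY Y) (λ i a b → 𝟙 (β i (ct a) (ct b))) i l ≡ cpT i (map ct l)
   cp-cpT Y i [] = refl
   cp-cpT Y i (q ∷ []) = refl
   cp-cpT Y i (q ∷ q' ∷ l) = cong (𝟙 (β i (ct q) (ct q')) *_) (cp-cpT Y (suc i) (q' ∷ l))

   acts : List V → ℕ → ℕ → List (List V)
   acts Y m zero = []
   acts Y m (suc n) = rem m Y ∷ acts Y (suc m) n

   -- The hybrids along a chain: the first `m` types are drawn, the following `n` are actual.
   mixed : ℕ → ℕ → List V → ℚ
   mixed m n Y = E (Chain.prod (pY Y) 0 m) (λ l → cpT 0 (map ct l ++ map ct (acts Y m n)))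

   chain-mixed : ∀ Y → chain r Y ≡ mixed (suc r) 0 Y
   chain-mixed Y = E-cong (Chain.prod (pY Y) 0 (suc r)) (λ l _ → trans (cp-cpT Y 0 l) (cong (cpT 0) (sym (++-identityʳ (map ct l)))))

   rem-len : ∀ j (Y : List V) → j ℕ.≤ r → Len (suc r) Y → Len r (rem j Y)
   rem-len j Y j≤ p = suc-inj (trans (length-rem j Y (ℕ.≤-trans (s≤s j≤) (ℕ.≤-reflexive (sym p)))) p)

   module Mix (χ : List V → ℚ) (χ∈ : ∀ Y → Len (suc r) Y → χ Y ∈[0,1])
     (χ-meas : ∀ Y Y' → Len (suc r) Y → Len (suc r) Y' → (∀ j → j ℕ.≤ r → low w (rem j Y) ≡ low w (rem j Y')) → χ Y ≡ χ Y') where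

     module _ (m n : ℕ) (m+n : m ℕ.+ suc n ≡ suc r) where
       m≤r : m ℕ.≤ r
       m≤r = ℕ.≤-pred (ℕ.≤-trans (ℕ.≤-trans (ℕ.≤-reflexive (ℕ.+-comm 1 m)) (ℕ.+-monoʳ-≤ m (s≤s z≤n))) (ℕ.≤-reflexive m+n))

       -- `q` takes the place of the one type being exchanged, that of `X`, which is `Y` without its
       -- vertex `x`; the remaining factors have to be visible without it.
       h : V → List V → Ty → ℚ
       h x X q = χ Y * E (Chain.prod (pY Y) 0 m) (λ l → cpT 0 (map ct l ++ q ∷ map ct (acts Y (suc m) n)))
         where Y = insertAt m x X

       ins-len : ∀ (x : V) X → Len r X → Len (suc r) (insertAt m x X)
       ins-len x X p = trans (length-insert m x X) (cong suc p)

       h∈ : ∀ x X q → Len r X → h x X q ∈[0,1]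
       h∈ x X q p = *∈ (χ∈ (insertAt m x X) (ins-len x X p)) (E∈ (Chain.prod (pY (insertAt m x X)) 0 m) (λ l _ → cpT∈ 0 (map ct l ++ q ∷ map ct (acts (insertAt m x X) (suc m) n))))

       -- everything except the full type of X is visible to the sample x ∷ x' ∷ w
       visible : ∀ x x' Π → length Π ≡ r → low ((x ∷ x' ∷ []) ++ w) (map proj₁ Π) ≡ low ((x ∷ x' ∷ []) ++ w) (map proj₂ Π) →
         ∀ j → j ℕ.≤ r → j ≢ m → ∀ {π} → (∀ {v} → v ∈ π → v ∈ rem j (insertAt m (x , x) Π)) → Same (π ++ diag w)
       visible x x' Π len e j j≤ ne {π} sub with rem-insert-∈ m j (x , x) Π (subst (m ℕ.≤_) (sym len) m≤r) (subst (j ℕ.≤_) (sym len) j≤) ne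
       ... | j' , j'< , mem = same-⊂ {rem j' Π ++ diag ((x ∷ x' ∷ []) ++ w)} (low-same ((x ∷ x' ∷ []) ++ w) Π e (subst (j' ℕ.<_) len j'<)) into
         where
         into : ∀ {v} → v ∈ π ++ diag w → v ∈ rem j' Π ++ diag ((x ∷ x' ∷ []) ++ w)
         into p with ∈-++⁻ π p
         ... | inj₂ q = diag-++ (x ∷ x' ∷ []) w {rem j' Π} (∈-++⁺ʳ (rem j' Π) q)
         ... | inj₁ q with mem (sub q)
         ... | inj₁ refl = ∈-++⁺ʳ (rem j' Π) (here refl)
         ... | inj₂ s = ∈-++⁺ˡ s

       map-rem-ins : ∀ (g : V × V → V) j x Π → g (x , x) ≡ x → map g (rem j (insertAt m (x , x) Π)) ≡ rem j (insertAt m x (map g Π))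
       map-rem-ins g j x Π e = trans (map-rem g j (insertAt m (x , x) Π)) (cong (rem j) (trans (map-insert g m (x , x) Π) (cong (λ v → insertAt m v (map g Π)) e)))

       ct-vis : ∀ x x' X X' → Len r X → Len r X' → low ((x ∷ x' ∷ []) ++ w) X ≡ low ((x ∷ x' ∷ []) ++ w) X' → ∀ j → j ℕ.≤ r → j ≢ m → ct (rem j (insertAt m x X)) ≡ ct (rem j (insertAt m x X'))
       ct-vis x x' = λ X X' p p' → zipped-len (λ X X' → low ((x ∷ x' ∷ []) ++ w) X ≡ low ((x ∷ x' ∷ []) ++ w) X' → ∀ j → j ℕ.≤ r → j ≢ m → ct (rem j (insertAt m x X)) ≡ ct (rem j (insertAt m x X')))
         (λ Π len e j j≤ ne → subst₂ (λ a b → tp (a ++ w₀) ≡ tp (b ++ w₀)) (map-rem-ins proj₁ j x Π refl) (map-rem-ins proj₂ j x Π refl)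
           (tp-Same (rem j (insertAt m (x , x) Π)) w₀ (Same-w₀ (rem j (insertAt m (x , x) Π)) (visible x x' Π len e j j≤ ne (λ p → p))))) X X' p p'

       -- For `j` equal to `m` the deletion returns `X` itself: its own type is hidden, but its
       -- lower types are part of the conditioning.
       low-vis : ∀ x x' X X' → Len r X → Len r X' → low ((x ∷ x' ∷ []) ++ w) X ≡ low ((x ∷ x' ∷ []) ++ w) X' → ∀ j → j ℕ.≤ r → low w (rem j (insertAt m x X)) ≡ low w (rem j (insertAt m x X'))
       low-vis x x' X X' p p' e j j≤ with j ℕ.≟ m
       ... | yes refl = subst₂ (λ a b → low w a ≡ low w b) (sym (rem-insert m x X (subst (m ℕ.≤_) (sym p) m≤r))) (sym (rem-insert m x X' (subst (m ℕ.≤_) (sym p') m≤r))) (low-refines (x ∷ x' ∷ []) w X X' p p' e)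
       ... | no ne = zipped-len (λ X X' → low ((x ∷ x' ∷ []) ++ w) X ≡ low ((x ∷ x' ∷ []) ++ w) X' → low w (rem j (insertAt m x X)) ≡ low w (rem j (insertAt m x X')))
         (λ Π len e → subst₂ (λ a b → low w a ≡ low w b) (map-rem-ins proj₁ j x Π refl) (map-rem-ins proj₂ j x Π refl)
           (same-low w (rem j (insertAt m (x , x) Π)) (λ {l} _ → visible x x' Π len e j j≤ ne (∈-rem l _)))) X X' p p' e

       prod-low : ∀ Y Y' → Len (suc r) Y → Len (suc r) Y' → (∀ j → j ℕ.≤ r → low w (rem j Y) ≡ low w (rem j Y')) → ∀ i n → i ℕ.+ n ℕ.≤ suc r → ∀ Φ →
         E (Chain.prod (pY Y) i n) Φ ≡ E (Chain.prod (pY Y') i n) Φ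
       prod-low Y Y' p p' e i zero _ Φ = refl
       prod-low Y Y' p p' e i (suc n) le Φ = trans (E-cong (pY Y i) (λ v _ → prod-low Y Y' p p' e (suc i) n (ℕ.≤-trans (ℕ.≤-reflexive (sym (ℕ.+-suc i n))) le) _))
         (law-low (rem i Y) (rem i Y') (λ v → E (Chain.prod (pY Y') (suc i) n) (λ l → Φ (v ∷ l))) (rem-len i Y i≤r p) (rem-len i Y' i≤r p') (e i i≤r))
         where
         i≤r : i ℕ.≤ r
         i≤r = ℕ.≤-pred (ℕ.≤-trans (ℕ.≤-trans (ℕ.≤-reflexive (ℕ.+-comm 1 i)) (ℕ.+-monoʳ-≤ i (s≤s z≤n))) le)

       acts-vis : ∀ x x' X X' → Len r X → Len r X' → low ((x ∷ x' ∷ []) ++ w) X ≡ low ((x ∷ x' ∷ []) ++ w) X' → ∀ m' n' → m ℕ.< m' → m' ℕ.+ n' ℕ.≤ suc r →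
         map ct (acts (insertAt m x X) m' n') ≡ map ct (acts (insertAt m x X') m' n')
       acts-vis x x' X X' p p' e m' zero _ _ = refl
       acts-vis x x' X X' p p' e m' (suc n') lt le = cong₂ _∷_ (ct-vis x x' X X' p p' e m' (ℕ.≤-pred (ℕ.≤-trans (ℕ.≤-trans (ℕ.≤-reflexive (ℕ.+-comm 1 m')) (ℕ.+-monoʳ-≤ m' (s≤s z≤n))) le)) (λ q → ℕ.<-irrefl (sym q) lt))
         (acts-vis x x' X X' p p' e (suc m') n' (ℕ.m≤n⇒m≤1+n lt) (ℕ.≤-trans (ℕ.≤-reflexive (sym (ℕ.+-suc m' n'))) le))

       meas : ∀ x x' X X' → Len r X → Len r X' → low ((x ∷ x' ∷ []) ++ w) X ≡ low ((x ∷ x' ∷ []) ++ w) X' → ∀ q → h x X q ≡ h x X' q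
       meas x x' X X' p p' e q = cong₂ _*_ (χ-meas (insertAt m x X) (insertAt m x X') (ins-len x X p) (ins-len x X' p') (low-vis x x' X X' p p' e))
         (trans (cong (λ l' → E (Chain.prod (pY (insertAt m x X)) 0 m) (λ l → cpT 0 (map ct l ++ q ∷ l'))) (acts-vis x x' X X' p p' e (suc m) n ℕ.≤-refl (ℕ.≤-reflexive (trans (sym (ℕ.+-suc m n)) m+n))))
           (prod-low (insertAt m x X) (insertAt m x X') (ins-len x X p) (ins-len x X' p') (low-vis x x' X X' p p' e) 0 m (ℕ.≤-trans m≤r (ℕ.n≤1+n r)) _))

       actual-eq : ∀ x X → Len r X → h x X (ct X) ≡ χ (insertAt m x X) * mixed m (suc n) (insertAt m x X)
       actual-eq x X p = cong (λ Z → χ (insertAt m x X) * E (Chain.prod (pY (insertAt m x X)) 0 m) (λ l → cpT 0 (map ct l ++ ct Z ∷ map ct (acts (insertAt m x X) (suc m) n)))) (sym (rem-insert m x X (subst (m ℕ.≤_) (sym p) m≤r)))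

       ind-eq : ∀ x X → Len r X → CR.cond (low w) (λ X' → h x X (ct X')) (low w X) ≡ χ (insertAt m x X) * mixed (suc m) n (insertAt m x X)
       ind-eq x X p = trans (sym (law-cond X _ p)) (trans (E-* (law X) (χ Y) _) (cong (χ Y *_) (trans (E-comm (law X) (Chain.prod (pY Y) 0 m) _)
           (trans (E-cong (Chain.prod (pY Y) 0 m) (λ l _ → trans (cong (λ Z → E (law Z) (λ a → cpT 0 (map ct l ++ ct a ∷ map ct (acts Y (suc m) n)))) (sym (rem-insert m x X (subst (m ℕ.≤_) (sym p) m≤r))))
             (E-cong (pY Y m) (λ a _ → cong (cpT 0) (trans (sym (++-assoc (map ct l) (ct a ∷ []) _)) (cong (_++ map ct (acts Y (suc m) n)) (sym (map-++ ct l (a ∷ [])))))))))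
           (sym (prod-snoc (pY Y) 0 m (λ l → cpT 0 (map ct l ++ map ct (acts Y (suc m) n)))))))))
         where Y = insertAt m x X

       -- Visibility comes from `x`; the second vertex `x'` is averaged along with it so that the
       -- same `cost` covers the chain and the triangles.
       mix-step : (θ + θ) * Eᴸ MV (suc r) (λ Y → χ Y * mixed m (suc n) Y) ≤ (θ + θ) * Eᴸ MV (suc r) (λ Y → χ Y * mixed (suc m) n Y) + cost
       mix-step = subst₂ (λ a b → (θ + θ) * a ≤ (θ + θ) * b + cost) (back (λ Y → χ Y * mixed m (suc n) Y)) (back (λ Y → χ Y * mixed (suc m) n Y)) (avg _ _ (λ x x' →
           subst₂ (λ a b → (θ + θ) * a ≤ (θ + θ) * b + (length Q /1 * (θ * θ) + gainR Q Q-unique Q-all (x ∷ x' ∷ []) w)) (E-cong Mr (actual-eq x)) (E-cong Mr (ind-eq x))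
             (Hybrid.actual≤ Q Q-unique Q-all (x ∷ x' ∷ []) w (h x) (h∈ x) (meas x x') θ 0≤θ)))
         where
         back : ∀ φ → EV (λ x → EV (λ x' → Eʳ (λ X → φ (insertAt m x X)))) ≡ Eᴸ MV (suc r) φ
         back φ = trans (E-cong (mean MV) (λ x _ → E-const (mean MV) _)) (sym (Eᴸ-insert MV r m m≤r φ))

     mix-steps : ∀ n m → m ℕ.+ n ≡ suc r → (θ + θ) * Eᴸ MV (suc r) (λ Y → χ Y * mixed m n Y) ≤ (θ + θ) * Eᴸ MV (suc r) (λ Y → χ Y * mixed (suc r) 0 Y) + n /1 * cost
     mix-steps zero m e = ≤-by 0ℚ ≤-refl (trans (cong₂ (λ a b → (θ + θ) * Eᴸ MV (suc r) (λ Y → χ Y * mixed a 0 Y) + b) (trans (sym e) (ℕ.+-identityʳ m)) (zeroˡ cost)) refl)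
     mix-steps (suc n) m e = ≤-trans (mix-step m n e) (≤-trans (+-monoˡ-≤ cost (mix-steps n (suc m) (trans (sym (ℕ.+-suc m n)) e))) (≤-reflexive (solve 3 (λ a n c → a :+ n :* c :+ c := a :+ ((con 1ℚ) :+ n) :* c) refl _ (n /1) cost)))

     chain-hybrid : (θ + θ) * Eᴸ MV (suc r) (λ Y → χ Y * cpT 0 (map ct (acts Y 0 (suc r)))) ≤ (θ + θ) * Eᴸ MV (suc r) (λ Y → χ Y * chain r Y) + suc r /1 * cost
     chain-hybrid = ≤-trans (mix-steps (suc r) 0 refl) (≤-reflexive (cong (λ t → (θ + θ) * t + suc r /1 * cost) (E-cong (mean (lists MV (suc r))) (λ Y _ → cong (χ Y *_) (sym (chain-mixed Y))))))

 -- Poor tuples and triangles are rare.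

 module Estimates {V B : Set} (_≟V_ : DecidableEquality V) (_≟B_ : DecidableEquality B) (col : List V → B)
   (col-set : ∀ l l' → (∀ v → v ∈ l → v ∈ l') → (∀ v → v ∈ l' → v ∈ l) → col l ≡ col l')
   (edge : B → Bool) (MV : FullMean {V} (λ _ → ⊤)) (r : ℕ) (w₀ ext : List V) (X₀ : List V) (X₀-len : Len r X₀)
   (Q : List (List B)) (Q-unique : Unique Q) (Q-all : ∀ X → Len r X → Types.tp _≟V_ _≟B_ col col-set (X ++ w₀) ∈ Q)
   (δ θ : ℚ) (0≤δ : 0ℚ ≤ δ) (0≤θ : 0ℚ ≤ θ) where

   module LK = LevelK _≟V_ _≟B_ col col-set edge MV (suc r)
   open LK using (f; f∈; Eᵏ)

   open Mixed _≟V_ _≟B_ col col-set MV r w₀ ext X₀ X₀-len Q Q-unique Q-all (LK.β δ w₀) θ 0≤θ public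
   open LevelR _≟V_ _≟B_ col col-set MV r w₀ using (low; ct; _≟L_) public

   lowY : List V → List (List (List B))
   lowY Y = map (λ j → low w (rem j Y)) (upTo (suc r))

   module CL = Cond (lists MV (suc r)) (≡-dec _≟L_)

   dens : List V → ℚ
   dens Y = CL.cond lowY f (lowY Y)

   private
     M = mean (lists MV (suc r))

     bY : ℕ → List V → Bool
     bY i Y = LK.β δ w₀ i (ct (rem i Y)) (ct (rem (suc i) Y))

     βY : ℕ → List V → ℚ
     βY i Y = 𝟙 (bY i Y)

   lost : ℕ → ℕ → List V → ℚ
   lost m zero Y = 0ℚ
   lost m (suc n) Y = f Y * (1ℚ - βY m Y) + lost (suc m) n Y

   lost≥0 : ∀ m n Y → 0ℚ ≤ lost m n Y
   lost≥0 m zero Y = ≤-refl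
   lost≥0 m (suc n) Y = add≥0 (mul≥0 (proj₁ (f∈ Y)) (sub≥0 (𝟙≤1 (bY m Y)))) (lost≥0 (suc m) n Y)

   -- An edge either passes every link of the chain of its actual types or is charged to a link of
   -- small conditional probability.
   f≤ : ∀ m n Y → f Y ≤ cpT m (map ct (acts Y m (suc n))) + lost m n Y
   f≤ m zero Y = ≤-trans (proj₂ (f∈ Y)) (≤-reflexive (sym (+-identityʳ 1ℚ)))
   f≤ m (suc n) Y = ≤-trans (≤-reflexive (solve 2 (λ x b → x := b :* x :+ x :* ((con 1ℚ) :- b)) refl (f Y) (βY m Y)))
     (≤-trans (+-monoˡ-≤ (f Y * (1ℚ - βY m Y)) (mul-monoˡ (βY m Y) (𝟙≥0 (bY m Y)) (f≤ (suc m) n Y)))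
     (≤-by ((1ℚ - βY m Y) * lost (suc m) n Y) (mul≥0 (sub≥0 (𝟙≤1 (bY m Y))) (lost≥0 (suc m) n Y))
       (solve 4 (λ b C s t → b :* C :+ (t :+ s) := b :* (C :+ s) :+ t :+ ((con 1ℚ) :- b) :* s) refl (βY m Y) (cpT (suc m) (map ct (acts Y (suc m) (suc n)))) (lost (suc m) n Y) (f Y * (1ℚ - βY m Y)))))

   E-lost : ∀ m n → E M (lost m n) ≤ n /1 * δ
   E-lost m zero = ≤-reflexive (trans (E-0 M) (sym (zeroˡ δ)))
   E-lost m (suc n) = ≤-trans (≤-reflexive (E-+ M (λ Y → f Y * (1ℚ - βY m Y)) (lost (suc m) n))) (≤-trans (+-mono-≤ (LK.light-edges δ 0≤δ w₀ m) (E-lost (suc m) n)) (≤-reflexive (solve 2 (λ n d → d :+ n :* d := ((con 1ℚ) :+ n) :* d) refl (n /1) δ)))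

   module _ (ε' : ℚ) where
     poor : List V → Bool
     poor Y = chain r Y <ᵇ dens Y - ε'

     lowY-rem : ∀ Y Y' → lowY Y ≡ lowY Y' → ∀ j → j ℕ.≤ r → low w (rem j Y) ≡ low w (rem j Y')
     lowY-rem Y Y' e j j≤ = map-≡-∈ (upTo (suc r)) e (∈-upTo⁺ (s≤s j≤))

     rem-lowY : ∀ Y Y' → (∀ j → j ℕ.≤ r → low w (rem j Y) ≡ low w (rem j Y')) → lowY Y ≡ lowY Y'
     rem-lowY Y Y' h = map-∈-≡ (upTo (suc r)) (λ {j} j∈ → h j (ℕ.≤-pred (∈-upTo⁻ j∈)))

     poor-meas : ∀ Y Y' → Len (suc r) Y → Len (suc r) Y' → (∀ j → j ℕ.≤ r → low w (rem j Y) ≡ low w (rem j Y')) → poor Y ≡ poor Y'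
     poor-meas Y Y' p p' h = cong₂ (λ a b → a <ᵇ b - ε') chain-eq (cong (CL.cond lowY f) (rem-lowY Y Y' h))
       where
       prod-eq : ∀ i n → i ℕ.+ n ℕ.≤ suc r → ∀ Φ → E (Chain.prod (pY Y) i n) Φ ≡ E (Chain.prod (pY Y') i n) Φ
       prod-eq i zero _ Φ = refl
       prod-eq i (suc n) le Φ = trans (E-cong (pY Y i) (λ v _ → prod-eq (suc i) n (ℕ.≤-trans (ℕ.≤-reflexive (sym (ℕ.+-suc i n))) le) _))
         (law-low (rem i Y) (rem i Y') (λ v → E (Chain.prod (pY Y') (suc i) n) (λ l → Φ (v ∷ l))) (rem-len i Y i≤r p) (rem-len i Y' i≤r p') (h i i≤r))
         where
         i≤r : i ℕ.≤ r
         i≤r = ℕ.≤-pred (ℕ.≤-trans (ℕ.≤-trans (ℕ.≤-reflexive (ℕ.+-comm 1 i)) (ℕ.+-monoʳ-≤ i (s≤s z≤n))) le)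
       chain-eq : chain r Y ≡ chain r Y'
       chain-eq = trans (chain-mixed Y) (trans (prod-eq 0 (suc r) ℕ.≤-refl (λ l → cpT 0 (map ct l ++ []))) (sym (chain-mixed Y')))

     -- On poor tuples the chain density is short of the edge density by `ε'`. Poorness is
     -- measurable for the lower types, so the hybrid argument applies to it and shows that the
     -- total shortfall is at most the light edges plus the energy cost.
     poor-rare : (θ + θ) * (ε' * Eᵏ (suc r) (λ Y → 𝟙 (poor Y))) ≤ (θ + θ) * (r /1 * δ) + suc r /1 * cost
     poor-rare = ≤-sub (≤-trans (add≥0 (add≥0 (sub≥0 (mul-monoˡ (θ + θ) (add≥0 0≤θ 0≤θ) first)) (sub≥0 hyb)) (mul≥0 (add≥0 0≤θ 0≤θ) (sub≥0 second)))
         (≤-reflexive (solve 7 (λ t e c C f d k → t :* (f :- C) :- t :* e :+ (t :* C :+ k :- t :* c) :+ t :* (c :+ d :- f) := t :* d :+ k :- t :* e) refl (θ + θ) (ε' * E M χ) (E M (λ Y → χ Y * cpT 0 (map ct (acts Y 0 (suc r))))) (E M (λ Y → χ Y * chain r Y)) (E M (λ Y → f Y * χ Y)) (r /1 * δ) (suc r /1 * cost))))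
       where
       χ : List V → ℚ
       χ Y = 𝟙 (poor Y)
       hyb : (θ + θ) * E M (λ Y → χ Y * cpT 0 (map ct (acts Y 0 (suc r)))) ≤ (θ + θ) * E M (λ Y → χ Y * chain r Y) + suc r /1 * cost
       hyb = Mix.chain-hybrid χ (λ Y _ → 𝟙∈ (poor Y)) (λ Y Y' p p' h → cong 𝟙 (poor-meas Y Y' p p' h))
       point : ∀ Y → ε' * χ Y ≤ dens Y * χ Y - χ Y * chain r Y
       point Y with bool-case (poor Y)
       ... | inj₁ e rewrite e = ≤-by (dens Y - ε' - chain r Y) (<⇒≤ (sub>0 (<ᵇ⇒< e))) (solve 3 (λ d e c → d :* (con 1ℚ) :- (con 1ℚ) :* c := e :* (con 1ℚ) :+ (d :- e :- c)) refl (dens Y) ε' (chain r Y))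
       ... | inj₂ e rewrite e = ≤-reflexive (solve 3 (λ d e c → e :* (con 0ℚ) := d :* (con 0ℚ) :- (con 0ℚ) :* c) refl (dens Y) ε' (chain r Y))
       first : ε' * E M χ ≤ E M (λ Y → f Y * χ Y) - E M (λ Y → χ Y * chain r Y)
       first = ≤-trans (≤-reflexive (sym (E-* M ε' χ))) (≤-trans (E-mono M (λ Y _ → point Y)) (≤-reflexive (trans (E-- M (λ Y → dens Y * χ Y) (λ Y → χ Y * chain r Y)) (cong (_- E M (λ Y → χ Y * chain r Y)) (CL.cond-test lowY f χ (λ Y Y' p p' e → cong 𝟙 (poor-meas Y Y' p p' (lowY-rem Y Y' e))))))))
       second : E M (λ Y → f Y * χ Y) ≤ E M (λ Y → χ Y * cpT 0 (map ct (acts Y 0 (suc r)))) + r /1 * δ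
       second = ≤-trans (E-mono M (λ Y _ → pt Y)) (≤-trans (≤-reflexive (E-+ M (λ Y → χ Y * cpT 0 (map ct (acts Y 0 (suc r)))) (lost 0 r))) (+-monoʳ-≤ (E M (λ Y → χ Y * cpT 0 (map ct (acts Y 0 (suc r))))) (E-lost 0 r)))
         where
         pt : ∀ Y → f Y * χ Y ≤ χ Y * cpT 0 (map ct (acts Y 0 (suc r))) + lost 0 r Y
         pt Y = ≤-trans (mul-monoʳ (χ Y) (𝟙≥0 (poor Y)) (f≤ 0 r Y)) (≤-by ((1ℚ - χ Y) * lost 0 r Y) (mul≥0 (sub≥0 (𝟙≤1 (poor Y))) (lost≥0 0 r Y))
           (solve 3 (λ C s x → x :* C :+ s := (C :+ s) :* x :+ ((con 1ℚ) :- x) :* s) refl (cpT 0 (map ct (acts Y 0 (suc r)))) (lost 0 r Y) (χ Y)))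

   module _ (i j : ℕ) (r≡ : i ℕ.+ suc j ≡ r) (θ₁ : ℚ) (0≤θ₁ : 0ℚ ≤ θ₁)
     (free : ∀ T₁ x y z T₂ → Len i T₁ → Len j T₂ → edge (col (T₁ ++ x ∷ y ∷ T₂)) ≡ true → edge (col (T₁ ++ y ∷ z ∷ T₂)) ≡ true → edge (col (T₁ ++ x ∷ z ∷ T₂)) ≡ true → ⊥) where
     open Triangle i j r≡ using (𝓔; A₃; tri-hybrid)
     module LT = LK.Triangle i j (trans (ℕ.+-suc i (suc j)) (cong suc r≡)) free

     tri-avg : ℚ
     tri-avg = 𝓔 (λ x y z T₁ T₂ → tri i T₁ x y z T₂)

     gbar : ℚ
     gbar = EV (LK.gain i w₀)

     tri-rare₁ : (θ + θ) * tri-avg ≤ (θ + θ) * 𝓔 A₃ + (cost + (cost + cost))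
     tri-rare₁ = tri-hybrid

     -- A separate accuracy `θ₁`: it belongs to the edge gains over `w₀`, whereas `θ` belongs to the
     -- gains of types over `ext ++ w₀` and is chosen after the length of `w₀`.
     tri-rare₂ : (θ₁ + θ₁) * ((δ * (δ * δ)) * 𝓔 A₃) ≤ (θ₁ * θ₁ + gbar) + ((θ₁ * θ₁ + gbar) + (θ₁ * θ₁ + gbar))
     tri-rare₂ = LT.triangle-β w₀ θ₁ 0≤θ₁ δ 0≤δ

 -- Energy increment, averaging and the choice of the sample.

 climb : ∀ (S : ℕ → ℚ) Bd θ J → 0ℚ ≤ S 0 → S J ≤ Bd → Bd < J /1 * θ → ∃ λ m → m ℕ.< J × S (suc m) - S m ≤ θ
 climb S Bd θ J 0≤ ≤Bd lt with go J
   where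
   go : ∀ J → (∃ λ m → m ℕ.< J × S (suc m) - S m ≤ θ) ⊎ (J /1 * θ ≤ S J - S 0)
   go zero = inj₂ (≤-reflexive (trans (zeroˡ θ) (sym (+-inverseʳ (S 0)))))
   go (suc J) with go J
   ... | inj₁ (m , m< , h) = inj₁ (m , ℕ.m≤n⇒m≤1+n m< , h)
   ... | inj₂ h with S (suc J) - S J ℚ.≤? θ
   ... | yes q = inj₁ (J , ℕ.≤-refl , q)
   ... | no q = inj₂ (≤-sub (≤-trans (add≥0 (sub≥0 h) (sub≥0 (<⇒≤ (≰⇒> q)))) (≤-reflexive (solve 5 (λ j t a b c → b :- a :- j :* t :+ (c :- b :- t) := c :- a :- ((con 1ℚ) :+ j) :* t) refl (J /1) θ (S 0) (S J) (S (suc J))))))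
 ... | inj₁ x = x
 ... | inj₂ h = ⊥-elim (<⇒≱ lt (≤-trans h (≤-trans (≤-by (S 0) 0≤ (solve 2 (λ a b → a := a :- b :+ b) refl (S J) (S 0))) ≤Bd)))

 combs : {A : Set} → ℕ → List A → List (List A)
 combs zero l = [] ∷ []
 combs (suc k) [] = []
 combs (suc k) (x ∷ l) = map (x ∷_) (combs k l) ++ combs (suc k) l

 ncomb : ℕ → ℕ → ℕ
 ncomb N zero = 1
 ncomb zero (suc k) = 0
 ncomb (suc N) (suc k) = ncomb N k ℕ.+ ncomb N (suc k)

 ⊆-combs : ∀ {A : Set} {Y l : List A} → Y ⊆ l → Y ∈ combs (length Y) l
 ⊆-combs {Y = []} p = here refl
 ⊆-combs {Y = x ∷ Y} (y ∷ʳ p) = ∈-++⁺ʳ (map (y ∷_) (combs (length Y) _)) (⊆-combs p)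
 ⊆-combs {Y = x ∷ Y} (refl ∷ p) = ∈-++⁺ˡ (∈-map⁺ (x ∷_) (⊆-combs p))

 module _ {A : Set} (M : FullMean {A} (λ _ → ⊤)) where

   -- Any `k` of the `N` independent samples are again `k` independent samples, and `ncomb`, defined
   -- by Pascal's rule, counts the choices.
   E-combs : ∀ N k φ → Eᴸ M N (λ zs → ∑ (combs k zs) φ) ≡ ncomb N k /1 * Eᴸ M k φ
   E-combs N zero φ = trans (E-const (mean (lists M N)) _) (solve 1 (λ x → x :+ (con 0ℚ) := ((con 1ℚ) :+ (con 0ℚ)) :* x) refl (φ []))
   E-combs zero (suc k) φ = sym (zeroˡ _)
   E-combs (suc N) (suc k) φ = trans (E-cong mM (λ v _ → trans (E-cong mN (λ l _ → trans (∑-++ (map (v ∷_) (combs k l)) _ φ) (cong (_+ _) (∑-map (v ∷_) (combs k l) φ))))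
       (trans (E-+ mN _ _) (cong₂ _+_ (E-combs N k (λ l → φ (v ∷ l))) (E-combs N (suc k) φ)))))
     (trans (E-+ mM _ _) (trans (cong₂ _+_ (E-* mM (ncomb N k /1) _) (E-const mM _)) (trans (sym (distribʳ (Eᴸ M (suc k) φ) (ncomb N k /1) (ncomb N (suc k) /1))) (cong (_* Eᴸ M (suc k) φ) (sym (/1-+ (ncomb N k) _))))))
     where
     mM = mean M
     mN = mean (lists M N)

 tri3 : {A : Set} → (List A → A → A → A → List A → ℚ) → ℕ → List A → ℚ
 tri3 φ zero (x ∷ y ∷ z ∷ T) = φ [] x y z T
 tri3 φ zero _ = 0ℚ
 tri3 φ (suc i) [] = 0ℚ
 tri3 φ (suc i) (t ∷ l) = tri3 (λ T → φ (t ∷ T)) i l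

 tri3-++ : ∀ {A : Set} φ (T₁ : List A) {x y z T₂} → tri3 φ (length T₁) (T₁ ++ x ∷ y ∷ z ∷ T₂) ≡ φ T₁ x y z T₂
 tri3-++ φ [] = refl
 tri3-++ φ (t ∷ T₁) = tri3-++ (λ T → φ (t ∷ T)) T₁

 tri3≥0 : ∀ {A : Set} (φ : List A → A → A → A → List A → ℚ) → (∀ T₁ x y z T₂ → 0ℚ ≤ φ T₁ x y z T₂) → ∀ i l → 0ℚ ≤ tri3 φ i l
 tri3≥0 φ h zero [] = ≤-refl
 tri3≥0 φ h zero (x ∷ []) = ≤-refl
 tri3≥0 φ h zero (x ∷ y ∷ []) = ≤-refl
 tri3≥0 φ h zero (x ∷ y ∷ z ∷ T) = h [] x y z T
 tri3≥0 φ h (suc i) [] = ≤-refl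
 tri3≥0 φ h (suc i) (t ∷ l) = tri3≥0 (λ T → φ (t ∷ T)) (λ T → h (t ∷ T)) i l

 E-tri3 : ∀ {A : Set} (M : FullMean {A} (λ _ → ⊤)) i j φ → Eᴸ M (i ℕ.+ suc (suc (suc j))) (tri3 φ i) ≡
   E (mean M) (λ x → E (mean M) (λ y → E (mean M) (λ z → Eᴸ M i (λ T₁ → Eᴸ M j (λ T₂ → φ T₁ x y z T₂)))))
 E-tri3 M zero j φ = refl
 E-tri3 M (suc i) j φ = trans (E-cong mM (λ t _ → E-tri3 M i j (λ T → φ (t ∷ T))))
   (trans (E-comm mM mM _) (E-cong mM (λ x _ → trans (E-comm mM mM _) (E-cong mM (λ y _ → E-comm mM mM _)))))
   where mM = mean M

 listsOver : {B : Set} → List B → ℕ → List (List B)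
 listsOver Bs zero = [] ∷ []
 listsOver Bs (suc n) = concatMap (λ b → map (b ∷_) (listsOver Bs n)) Bs

 ∈-listsOver : ∀ {B : Set} (Bs : List B) l → (∀ {b} → b ∈ l → b ∈ Bs) → l ∈ listsOver Bs (length l)
 ∈-listsOver Bs [] h = here refl
 ∈-listsOver Bs (b ∷ l) h = ∈-concatMap⁺ (λ b → map (b ∷_) (listsOver Bs (length l))) (Any.map (λ { refl → ∈-map⁺ (b ∷_) (∈-listsOver Bs l (h ∘ there)) }) (h (here refl)))

 pow2 : ℕ → ℕ
 pow2 zero = 1
 pow2 (suc n) = pow2 n ℕ.+ pow2 n

 length-subs : ∀ {A : Set} (l : List A) → length (subs l) ≡ pow2 (length l)
 length-subs [] = refl
 length-subs (x ∷ l) = trans (length-++ (map (x ∷_) (subs l))) (cong₂ ℕ._+_ (trans (length-map (x ∷_) (subs l)) (length-subs l)) (length-subs l))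

 -- Dividing by `1 + A` instead of `A` covers the case `A = 0`.
 small : ∀ A t → 0ℚ ≤ A → 0ℚ < t → ∃ λ x → 0ℚ < x × A * x ≤ t
 small A t A≥0 t>0 = t * inv (1ℚ + A) , mul>0 t>0 (inv>0 1+A>0) , ≤-trans (≤-reflexive (solve 3 (λ a t i → a :* (t :* i) := t :* (i :* a)) refl A t (inv (1ℚ + A))))
     (≤-trans (mul-monoˡ t (<⇒≤ t>0) (≤-trans (mul-monoˡ (inv (1ℚ + A)) (inv≥0 (<⇒≤ 1+A>0)) (≤-by 1ℚ 0≤1 (+-comm 1ℚ A))) (inv*≤1 (1ℚ + A)))) (≤-reflexive (*-identityʳ t)))
   where
   1+A>0 : 0ℚ < 1ℚ + A
   1+A>0 = add>0 0<1 A≥0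

 sum-upTo : (ℕ → ℕ) → ℕ → ℕ
 sum-upTo g zero = 0
 sum-upTo g (suc n) = g n ℕ.+ sum-upTo g n

 ≤-sum-upTo : ∀ g {m} n → m ℕ.< n → g m ℕ.≤ sum-upTo g n
 ≤-sum-upTo g {m} (suc n) (s≤s p) with ℕ.m≤n⇒m<n∨m≡n p
 ... | inj₁ q = ℕ.≤-trans (≤-sum-upTo g n q) (ℕ.m≤n+m _ (g n))
 ... | inj₂ refl = ℕ.m≤m+n (g n) _

 pairM : ∀ {A B : Set} {P : A → Set} {Q : B → Set} → Mean P → Mean Q → Mean {A × B} (λ ab → P (proj₁ ab) × Q (proj₂ ab))
 pairM {A} {B} {P} {Q} M N = record
   { E = λ f → E M (λ a → E N (λ b → f (a , b)))
   ; E-cong = λ h → E-cong M (λ a p → E-cong N (λ b q → h (a , b) (p , q)))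
   ; E-+ = λ f g → trans (E-cong M (λ a _ → E-+ N _ _)) (E-+ M _ _)
   ; E-* = λ c f → trans (E-cong M (λ a _ → E-* N c _)) (E-* M c _)
   ; E-mono = λ h → E-mono M (λ a p → E-mono N (λ b q → h (a , b) (p , q)))
   ; E-1 = trans (E-cong M (λ a _ → E-1 N)) (E-1 M)
   ; E-swap = λ L f → trans (E-cong M (λ a _ → E-swap N L _)) (E-swap M L _)
   ; E-< = λ c h → E-< M c (λ a p → E-< N c (λ b q → h (a , b) (p , q)))
   ; search = λ R → srch R (search M (λ a → found (search N (λ b → R (a , b)))))
   }
   where
   found : ∀ {X Y : Set} → X ⊎ Y → Bool
   found (inj₁ _) = true
   found (inj₂ _) = false
   srch : ∀ (R : A × B → Bool) → (∃ λ a → P a × found (search N (λ b → R (a , b))) ≡ true) ⊎ (∀ a → P a → found (search N (λ b → R (a , b))) ≡ false) →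
     (∃ λ ab → (P (proj₁ ab) × Q (proj₂ ab)) × R ab ≡ true) ⊎ (∀ ab → P (proj₁ ab) × Q (proj₂ ab) → R ab ≡ false)
   srch R (inj₁ (a , p , e)) with search N (λ b → R (a , b))
   ... | inj₁ (b , q , t) = inj₁ ((a , b) , (p , q) , t)
   srch R (inj₂ none) = inj₂ none'
     where
     none' : ∀ ab → P (proj₁ ab) × Q (proj₂ ab) → R ab ≡ false
     none' (a , b) (p , q) with search N (λ b → R (a , b)) | none a p
     ... | inj₂ t | _ = t b q

 E-∃≤ : ∀ {A : Set} {P : A → Set} (M : Mean P) f → ∃ λ a → P a × f a ≤ E M f
 E-∃≤ {A} {P} M f = conv (E-∃ M {λ a → - f a} (- E M f) (≤-reflexive (sym (E-neg M f))))
   where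
   conv : (∃ λ a → P a × - E M f ≤ - f a) → ∃ λ a → P a × f a ≤ E M f
   conv (a , p , h) = a , p , ≤-sub (≤-trans (sub≥0 h) (≤-reflexive (solve 2 (λ x y → (:- x) :- (:- y) := y :- x) refl (f a) (E M f))))

 module Averaging {A : Set} {P : A → Set} (Mw : Mean P) (r : ℕ) (poors : A → ℚ) (tris Fs gbar : ℕ → A → ℚ) (G₂ : A → ℚ)
   (δ θ θ₁ ε' K K' : ℚ) (0<δ : 0ℚ < δ) (0<θ : 0ℚ < θ) (0<θ₁ : 0ℚ < θ₁) (0<ε' : 0ℚ < ε') (K≤K' : K ≤ K')
   (C₁ C₂ : ℚ) (0≤C₁ : 0ℚ ≤ C₁) (0≤C₂ : 0ℚ ≤ C₂)
   (poors-bound : ∀ we → P we → (θ + θ) * (ε' * poors we) ≤ (θ + θ) * (r /1 * δ) + suc r /1 * (K * (θ * θ) + G₂ we))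
   (tris-bound₁ : ∀ i → i ℕ.< r → ∀ we → P we → (θ + θ) * tris i we ≤ (θ + θ) * Fs i we + (K * (θ * θ) + G₂ we + (K * (θ * θ) + G₂ we + (K * (θ * θ) + G₂ we))))
   (tris-bound₂ : ∀ i → i ℕ.< r → ∀ we → P we → (θ₁ + θ₁) * ((δ * (δ * δ)) * Fs i we) ≤ (θ₁ * θ₁ + gbar i we) + ((θ₁ * θ₁ + gbar i we) + (θ₁ * θ₁ + gbar i we)))
   (gK : ∀ i → i ℕ.< r → E Mw (gbar i) ≤ θ₁ * θ₁) (gR : E Mw G₂ ≤ K' * (θ * θ)) where

   δ³ : ℚ
   δ³ = δ * (δ * δ)

   δ³>0 : 0ℚ < δ³
   δ³>0 = mul>0 0<δ (mul>0 0<δ 0<δ)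

   defects : A → ℚ
   defects we = C₁ * poors we + C₂ * ∑ (upTo r) (λ i → tris i we)

   private
     g₂ : ℚ
     g₂ = E Mw (λ we → G₂ we)
     Kc : ℚ
     Kc = K * (θ * θ) + g₂
     -- The discretisation term and the averaged gain are at most `K' * (θ * θ)` each. The factor
     -- `θ + θ` is split off because the left side of every estimate carries it.
     Kc≤ : Kc ≤ (θ + θ) * (K' * θ)
     Kc≤ = ≤-by ((K' - K) * (θ * θ) + (K' * (θ * θ) - g₂)) (add≥0 (mul≥0 (sub≥0 K≤K') (sq≥0 θ)) (sub≥0 gR)) (solve 4 (λ t k k' g → (t :+ t) :* (k' :* t) := k :* (t :* t) :+ g :+ ((k' :- k) :* (t :* t) :+ (k' :* (t :* t) :- g))) refl θ K K' g₂)
     2θ>0 : 0ℚ < θ + θ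
     2θ>0 = add>0 0<θ (<⇒≤ 0<θ)
     2θ₁>0 : 0ℚ < θ₁ + θ₁
     2θ₁>0 = add>0 0<θ₁ (<⇒≤ 0<θ₁)

   poors-avg : ε' * E Mw (λ we → poors we) ≤ r /1 * δ + suc r /1 * (K' * θ)
   poors-avg = mul-cancelˡ-≤ (θ + θ) 2θ>0 (≤-trans (≤-reflexive (trans (cong ((θ + θ) *_) (sym (E-* Mw ε' (λ we → poors we)))) (sym (E-* Mw (θ + θ) (λ we → ε' * poors we)))))
     (≤-trans (E-mono Mw {g = λ we → (θ + θ) * (r /1 * δ) + suc r /1 * (K * (θ * θ) + G₂ we)} (λ we p → poors-bound we p))
     (≤-trans (≤-reflexive (trans (E-+ Mw (λ _ → (θ + θ) * (r /1 * δ)) (λ we → suc r /1 * (K * (θ * θ) + G₂ we))) (cong₂ _+_ (E-const Mw _) (trans (E-* Mw (suc r /1) (λ we → K * (θ * θ) + G₂ we)) (cong (suc r /1 *_) (trans (E-+ Mw (λ _ → K * (θ * θ)) (λ we → G₂ we)) (cong (_+ g₂) (E-const Mw _))))))))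
     (≤-trans (+-monoʳ-≤ _ (mul-monoˡ (suc r /1) (/1≥0 (suc r)) Kc≤)) (≤-reflexive (solve 4 (λ t a k b → t :* a :+ k :* (t :* b) := t :* (a :+ k :* b)) refl (θ + θ) (r /1 * δ) (suc r /1) (K' * θ)))))))

   tris-avg : ∀ i → i ℕ.< r → E Mw (λ we → tris i we) ≤ inv δ³ * (θ₁ + (θ₁ + θ₁)) + (K' * θ + (K' * θ + K' * θ))
   tris-avg i i<r = mul-cancelˡ-≤ (θ + θ) 2θ>0 (≤-trans (≤-reflexive (sym (E-* Mw (θ + θ) (λ we → tris i we))))
       (≤-trans (E-mono Mw {g = λ we → (θ + θ) * F we + (c we + (c we + c we))} (λ we p → tris-bound₁ i i<r we p))
       (≤-trans (≤-reflexive (trans (E-+ Mw (λ we → (θ + θ) * F we) (λ we → c we + (c we + c we))) (cong₂ _+_ (E-* Mw (θ + θ) F) (trans (E-+ Mw c (λ we → c we + c we)) (cong₂ _+_ Ec (trans (E-+ Mw c c) (cong₂ _+_ Ec Ec)))))))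
       (≤-trans (+-mono-≤ (mul-monoˡ (θ + θ) (<⇒≤ 2θ>0) F≤) (+-mono-≤ Kc≤ (+-mono-≤ Kc≤ Kc≤))) (≤-reflexive (solve 3 (λ t a b → t :* a :+ (t :* b :+ (t :* b :+ t :* b)) := t :* (a :+ (b :+ (b :+ b)))) refl (θ + θ) (inv δ³ * (θ₁ + (θ₁ + θ₁))) (K' * θ)))))))
     where
     F c : A → ℚ
     F we = Fs i we
     c we = K * (θ * θ) + G₂ we
     Ec : E Mw c ≡ Kc
     Ec = trans (E-+ Mw (λ _ → K * (θ * θ)) (λ we → G₂ we)) (cong (_+ g₂) (E-const Mw _))
     g₁ : ℚ
     g₁ = E Mw (λ we → gbar i we)
     sq : A → ℚ
     sq we = θ₁ * θ₁ + gbar i we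
     Esq : E Mw sq ≡ θ₁ * θ₁ + g₁
     Esq = trans (E-+ Mw (λ _ → θ₁ * θ₁) (λ we → gbar i we)) (cong (_+ g₁) (E-const Mw _))
     Esq≤ : E Mw sq ≤ (θ₁ + θ₁) * θ₁
     Esq≤ = ≤-trans (≤-reflexive Esq) (≤-trans (+-monoʳ-≤ (θ₁ * θ₁) (gK i i<r)) (≤-reflexive (solve 1 (λ t → t :* t :+ t :* t := (t :+ t) :* t) refl θ₁)))
     δF≤ : δ³ * E Mw F ≤ θ₁ + (θ₁ + θ₁)
     δF≤ = mul-cancelˡ-≤ (θ₁ + θ₁) 2θ₁>0 (≤-trans (≤-reflexive (trans (cong ((θ₁ + θ₁) *_) (sym (E-* Mw δ³ F))) (sym (E-* Mw (θ₁ + θ₁) (λ we → δ³ * F we)))))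
       (≤-trans (E-mono Mw {g = λ we → sq we + (sq we + sq we)} (λ we p → tris-bound₂ i i<r we p))
       (≤-trans (≤-reflexive (trans (E-+ Mw sq (λ we → sq we + sq we)) (cong (E Mw sq +_) (E-+ Mw sq sq)))) (≤-trans (+-mono-≤ Esq≤ (+-mono-≤ Esq≤ Esq≤)) (≤-reflexive (solve 2 (λ t a → t :* a :+ (t :* a :+ t :* a) := t :* (a :+ (a :+ a))) refl (θ₁ + θ₁) θ₁))))))
     F≤ : E Mw F ≤ inv δ³ * (θ₁ + (θ₁ + θ₁))
     F≤ = ≤-trans (≤-reflexive (sym (trans (solve 3 (λ i d f → i :* (d :* f) := (i :* d) :* f) refl (inv δ³) δ³ (E Mw F)) (trans (cong (_* E Mw F) (inv-inverseˡ δ³ (>0⇒≢0 δ³>0))) (*-identityˡ _))))) (mul-monoˡ (inv δ³) (inv≥0 (<⇒≤ δ³>0)) δF≤)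

   poors-bd tris-bd : ℚ
   poors-bd = inv ε' * (r /1 * δ + suc r /1 * (K' * θ))
   tris-bd = inv δ³ * (θ₁ + (θ₁ + θ₁)) + (K' * θ + (K' * θ + K' * θ))

   poors≤ : E Mw poors ≤ poors-bd
   poors≤ = ≤-trans (≤-reflexive (sym (trans (sym (*-assoc (inv ε') ε' (E Mw poors))) (trans (cong (_* E Mw poors) (inv-inverseˡ ε' (>0⇒≢0 0<ε'))) (*-identityˡ (E Mw poors)))))) (mul-monoˡ (inv ε') (inv≥0 (<⇒≤ 0<ε')) poors-avg)

   ∑-tris≤ : ∑ (upTo r) (λ i → E Mw (tris i)) ≤ r /1 * tris-bd
   ∑-tris≤ = ≤-trans (∑-≤const (upTo r) tris-bd (λ i i∈ → tris-avg i (∈-upTo⁻ i∈))) (≤-reflexive (cong (λ n → n /1 * tris-bd) (length-upTo r)))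

   E-defects : E Mw defects ≡ C₁ * E Mw poors + C₂ * ∑ (upTo r) (λ i → E Mw (tris i))
   E-defects = trans (E-+ Mw (λ we → C₁ * poors we) (λ we → C₂ * ∑ (upTo r) (λ i → tris i we))) (cong₂ _+_ (E-* Mw C₁ poors) (trans (E-* Mw C₂ (λ we → ∑ (upTo r) (λ i → tris i we))) (cong (C₂ *_) (sym (∑-swap (upTo r) (lin Mw) tris)))))

   -- Both kinds of defect enter one weighted sum, so a single sample is good for all of them.
   defects-small : ∃ λ we → P we × defects we ≤ C₁ * poors-bd + C₂ * (r /1 * tris-bd)
   defects-small = conv (E-∃≤ Mw defects)
     where
     conv : (∃ λ we → P we × defects we ≤ E Mw defects) → ∃ λ we → P we × defects we ≤ C₁ * poors-bd + C₂ * (r /1 * tris-bd)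
     conv (we , p , h) = we , p , ≤-trans h (≤-trans (≤-reflexive E-defects) (+-mono-≤ (mul-monoˡ C₁ 0≤C₁ poors≤) (mul-monoˡ C₂ 0≤C₂ ∑-tris≤)))

 -- density of edges among the tuples with the lower types of Y relative to the sample w
 density : {V B : Set} (_≟V_ : DecidableEquality V) (_≟B_ : DecidableEquality B) (col : List V → B)   (col-set : ∀ l l' → (∀ v → v ∈ l → v ∈ l') → (∀ v → v ∈ l' → v ∈ l) → col l ≡ col l')   (edge : B → Bool) (MV : FullMean {V} (λ _ → ⊤)) (r : ℕ) → List V → List V → ℚ
 density {V} {B} _≟V_ _≟B_ col col-set edge MV r w Y = Cond.cond (lists MV (suc r)) (≡-dec (≡-dec (≡-dec _≟B_))) low (λ Z → 𝟙 (edge (col Z))) (low Y)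
   where
   low : List V → List (List (List B))
   low Z = map (λ j → map (λ l → Types.tp _≟V_ _≟B_ col col-set (rem l (rem j Z) ++ w)) (upTo r)) (upTo (suc r))

 -- The extension grows by two vertices at a time, since the gains of types compare a sample with
 -- one having two more vertices.
 dbl : ℕ → ℕ
 dbl zero = 0
 dbl (suc j) = suc (suc (dbl j))

 module PigeonK {V B : Set} (_≟V_ : DecidableEquality V) (_≟B_ : DecidableEquality B) (col : List V → B)
   (col-set : ∀ l l' → (∀ v → v ∈ l → v ∈ l') → (∀ v → v ∈ l' → v ∈ l) → col l ≡ col l')
   (edge : B → Bool) (MV : FullMean {V} (λ _ → ⊤)) (r : ℕ) where
   private
     mV = mean MV
     gain = LevelK.gain _≟V_ _≟B_ col col-set edge MV (suc r)
     energy = LevelK.energyK _≟V_ _≟B_ col col-set edge MV (suc r)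

   energy-step : ∀ i m → Eᴸ MV (suc m) (energy i) - Eᴸ MV m (energy i) ≡ Eᴸ MV m (λ w → E mV (gain i w))
   energy-step i m = trans (cong₂ _-_ (E-comm mV (mean (lists MV m)) (λ v w → energy i (v ∷ w))) (E-cong (mean (lists MV m)) (λ w _ → sym (E-const mV (energy i w)))))
     (trans (sym (E-- (mean (lists MV m)) (λ w → E mV (λ v → energy i (v ∷ w))) (λ w → E mV (λ v → energy i w))))
     (E-cong (mean (lists MV m)) (λ w _ → trans (sym (E-- mV (λ v → energy i (v ∷ w)) (λ v → energy i w))) (E-cong mV (λ v _ → sym (LevelK.gain-energy _≟V_ _≟B_ col col-set edge MV (suc r) i w v))))))

   energy∈ : ∀ i w → energy i w ∈[0,1]
   energy∈ i w = E∈ (mean (lists MV (suc r))) (λ Y p → let h = LevelK.W∈ _≟V_ _≟B_ col col-set edge MV (suc r) i w Y p in *∈ h h)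

   gain≥0 : ∀ i w v → 0ℚ ≤ gain i w v
   gain≥0 = LevelK.gain≥0 _≟V_ _≟B_ col col-set edge MV (suc r)

   -- The energies of all `r` positions are added before the pigeonhole, so one sample length serves
   -- every position; the total energy is at most `r`.
   pigeonK : ∀ η J → r /1 < J /1 * η → ∃ λ m → m ℕ.< J × (∀ i → i ℕ.< r → Eᴸ MV m (λ w → E mV (gain i w)) ≤ η)
   pigeonK η J h = conv (climb S (r /1) η J S≥0 S≤ h)
     where
     S : ℕ → ℚ
     S m = ∑ (upTo r) (λ i → Eᴸ MV m (energy i))
     S≥0 : 0ℚ ≤ S 0
     S≥0 = ∑≥0 (upTo r) (λ i _ → proj₁ (energy∈ i []))
     S≤ : S J ≤ r /1
     S≤ = ≤-trans (∑-≤const (upTo r) 1ℚ (λ i _ → proj₂ (E∈ (mean (lists MV J)) (λ w _ → energy∈ i w)))) (≤-reflexive (trans (*-identityʳ _) (cong _/1 (length-upTo r))))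
     step : ∀ m → S (suc m) - S m ≡ ∑ (upTo r) (λ i → Eᴸ MV m (λ w → E mV (gain i w)))
     step m = trans (sym (Lin.L-- (∑-lin (upTo r)) (λ i → Eᴸ MV (suc m) (energy i)) (λ i → Eᴸ MV m (energy i)))) (∑-cong (upTo r) (λ i _ → energy-step i m))
     conv : (∃ λ m → m ℕ.< J × S (suc m) - S m ≤ η) → ∃ λ m → m ℕ.< J × (∀ i → i ℕ.< r → Eᴸ MV m (λ w → E mV (gain i w)) ≤ η)
     conv (m , m< , q) = m , m< , λ i i<r → ≤-trans (∑-≥term (upTo r) {λ i → Eᴸ MV m (λ w → E mV (gain i w))} (λ i _ → E≥0 (mean (lists MV m)) (λ w _ → E≥0 mV (λ v _ → gain≥0 i w v))) (∈-upTo⁺ i<r)) (≤-trans (≤-reflexive (sym (step m))) q)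

 module Pick {V B : Set} (_≟V_ : DecidableEquality V) (_≟B_ : DecidableEquality B) (col : List V → B)
   (col-set : ∀ l l' → (∀ v → v ∈ l → v ∈ l') → (∀ v → v ∈ l' → v ∈ l) → col l ≡ col l')
   (edge : B → Bool) (MV : FullMean {V} (λ _ → ⊤)) (r : ℕ) (X₀ : List V) (X₀-len : Len r X₀)
   (free : ∀ i j → i ℕ.+ suc j ≡ r → ∀ T₁ x y z T₂ → Len i T₁ → Len j T₂ → edge (col (T₁ ++ x ∷ y ∷ T₂)) ≡ true → edge (col (T₁ ++ y ∷ z ∷ T₂)) ≡ true → edge (col (T₁ ++ x ∷ z ∷ T₂)) ≡ true → ⊥)
   (m₀ : ℕ) (W₀ : List V) (W₀-len : Len m₀ W₀)
   (Q : List (List B)) (Q-unique : Unique Q) (Q-all : ∀ w → Len m₀ w → ∀ X → Len r X → Types.tp _≟V_ _≟B_ col col-set (X ++ w) ∈ Q)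
   (δ θ θ₁ ε' : ℚ) (0<δ : 0ℚ < δ) (0<θ : 0ℚ < θ) (0<θ₁ : 0ℚ < θ₁) (0<ε' : 0ℚ < ε') where

   -- `Q-all` speaks only of samples of length `m₀`; other lists are sent to a default one, so that
   -- all quantities are total functions of `w₀`.
   fw : List V → List V
   fw w with length w ℕ.≟ m₀
   ... | yes _ = w
   ... | no _ = W₀

   fw-len : ∀ w → Len m₀ (fw w)
   fw-len w with length w ℕ.≟ m₀
   ... | yes p = p
   ... | no _ = W₀-len

   fw-id : ∀ w → Len m₀ w → fw w ≡ w
   fw-id w p with length w ℕ.≟ m₀
   ... | yes _ = refl
   ... | no n = ⊥-elim (n p)

   mV : Mean {V} (λ _ → ⊤)
   mV = mean MV

   gainK : ℕ → List V → V → ℚ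
   gainK = LevelK.gain _≟V_ _≟B_ col col-set edge MV (suc r)

   energyK : ℕ → List V → ℚ
   energyK = LevelK.energyK _≟V_ _≟B_ col col-set edge MV (suc r)

   energyR : List V → List V → ℚ
   energyR w₀ w = LevelR.energyR _≟V_ _≟B_ col col-set MV r (fw w₀) Q Q-unique (Q-all (fw w₀) (fw-len w₀)) w

   gainR : List V → List V → List V → ℚ
   gainR w₀ u w = LevelR.gainR _≟V_ _≟B_ col col-set MV r (fw w₀) Q Q-unique (Q-all (fw w₀) (fw-len w₀)) u w

   poor : List V → List V → List V → Bool
   poor w₀ ext Y = Estimates.poor _≟V_ _≟B_ col col-set edge MV r (fw w₀) ext X₀ X₀-len Q Q-unique (Q-all (fw w₀) (fw-len w₀)) δ θ (<⇒≤ 0<δ) (<⇒≤ 0<θ) ε' Y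

   tri : List V → List V → ℕ → List V → V → V → V → List V → ℚ
   tri w₀ ext = Estimates.tri _≟V_ _≟B_ col col-set edge MV r (fw w₀) ext X₀ X₀-len Q Q-unique (Q-all (fw w₀) (fw-len w₀)) δ θ (<⇒≤ 0<δ) (<⇒≤ 0<θ)

   poors : List V × List V → ℚ
   poors (w₀ , ext) = Eᴸ MV (suc r) (λ Y → 𝟙 (poor w₀ ext Y))

   tris : ℕ → List V × List V → ℚ
   tris i (w₀ , ext) = Eᴸ MV (suc (suc r)) (tri3 (tri w₀ ext i) i)

   G₂ : List V × List V → ℚ
   G₂ (w₀ , ext) = E mV (λ x → E mV (λ y → gainR w₀ (x ∷ y ∷ []) (ext ++ fw w₀)))

   gbar : ℕ → List V × List V → ℚ
   gbar i (w₀ , ext) = E mV (gainK i (fw w₀))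

   K : ℚ
   K = length Q /1

   cost : List V → List V → ℚ
   cost w₀ ext = Estimates.cost _≟V_ _≟B_ col col-set edge MV r (fw w₀) ext X₀ X₀-len Q Q-unique (Q-all (fw w₀) (fw-len w₀)) δ θ (<⇒≤ 0<δ) (<⇒≤ 0<θ)

   cost-eq : ∀ w₀ ext → cost w₀ ext ≡ K * (θ * θ) + G₂ (w₀ , ext)
   cost-eq w₀ ext = trans (E-cong mV (λ x _ → trans (E-+ mV (λ _ → K * (θ * θ)) (λ y → gainR w₀ (x ∷ y ∷ []) (ext ++ fw w₀))) (cong (_+ E mV (λ y → gainR w₀ (x ∷ y ∷ []) (ext ++ fw w₀))) (E-const mV (K * (θ * θ))))))
     (trans (E-+ mV (λ _ → K * (θ * θ)) (λ x → E mV (λ y → gainR w₀ (x ∷ y ∷ []) (ext ++ fw w₀)))) (cong (_+ G₂ (w₀ , ext)) (E-const mV (K * (θ * θ)))))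

   poors-bound : ∀ w₀ ext → (θ + θ) * (ε' * poors (w₀ , ext)) ≤ (θ + θ) * (r /1 * δ) + suc r /1 * (K * (θ * θ) + G₂ (w₀ , ext))
   poors-bound w₀ ext = subst (λ c → (θ + θ) * (ε' * poors (w₀ , ext)) ≤ (θ + θ) * (r /1 * δ) + suc r /1 * c) (cost-eq w₀ ext)
     (Estimates.poor-rare _≟V_ _≟B_ col col-set edge MV r (fw w₀) ext X₀ X₀-len Q Q-unique (Q-all (fw w₀) (fw-len w₀)) δ θ (<⇒≤ 0<δ) (<⇒≤ 0<θ) ε')

   co : ℕ → ℕ
   co i = r ℕ.∸ suc i

   co≡ : ∀ i → i ℕ.< r → i ℕ.+ suc (co i) ≡ r
   co≡ i i<r = trans (ℕ.+-suc i (co i)) (ℕ.m+[n∸m]≡n i<r)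

   Fs′ : ∀ i j → i ℕ.+ suc j ≡ r → List V × List V → ℚ
   Fs′ i j e (w₀ , ext) = Mixed.Triangle.𝓔 _≟V_ _≟B_ col col-set MV r (fw w₀) ext X₀ X₀-len Q Q-unique (Q-all (fw w₀) (fw-len w₀)) (LevelK.β _≟V_ _≟B_ col col-set edge MV (suc r) δ (fw w₀)) θ (<⇒≤ 0<θ) i j e
     (Mixed.Triangle.A₃ _≟V_ _≟B_ col col-set MV r (fw w₀) ext X₀ X₀-len Q Q-unique (Q-all (fw w₀) (fw-len w₀)) (LevelK.β _≟V_ _≟B_ col col-set edge MV (suc r) δ (fw w₀)) θ (<⇒≤ 0<θ) i j e)

   Fs : ℕ → List V × List V → ℚ
   Fs i we with i ℕ.<? r
   ... | yes i<r = Fs′ i (co i) (co≡ i i<r) we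
   ... | no _ = 0ℚ

   tris-eq : ∀ i j (e : i ℕ.+ suc j ≡ r) w₀ ext → tris i (w₀ , ext) ≡
     Estimates.tri-avg _≟V_ _≟B_ col col-set edge MV r (fw w₀) ext X₀ X₀-len Q Q-unique (Q-all (fw w₀) (fw-len w₀)) δ θ (<⇒≤ 0<δ) (<⇒≤ 0<θ) i j e θ₁ (<⇒≤ 0<θ₁) (free i j e)
   tris-eq i j e w₀ ext = trans (cong (λ n → Eᴸ MV n (tri3 (tri w₀ ext i) i)) (sym (trans (ℕ.+-suc i (suc (suc j))) (cong suc (trans (ℕ.+-suc i (suc j)) (cong suc e)))))) (E-tri3 MV i j (tri w₀ ext i))

   triple : ℚ → ℚ
   triple c = c + (c + c)

   tris-bound₁′ : ∀ i j (e : i ℕ.+ suc j ≡ r) w₀ ext → (θ + θ) * tris i (w₀ , ext) ≤ (θ + θ) * Fs′ i j e (w₀ , ext) + triple (K * (θ * θ) + G₂ (w₀ , ext))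
   tris-bound₁′ i j e w₀ ext = subst₂ (λ a c → (θ + θ) * a ≤ (θ + θ) * Fs′ i j e (w₀ , ext) + triple c) (sym (tris-eq i j e w₀ ext)) (cost-eq w₀ ext)
     (Estimates.tri-rare₁ _≟V_ _≟B_ col col-set edge MV r (fw w₀) ext X₀ X₀-len Q Q-unique (Q-all (fw w₀) (fw-len w₀)) δ θ (<⇒≤ 0<δ) (<⇒≤ 0<θ) i j e θ₁ (<⇒≤ 0<θ₁) (free i j e))

   tris-bound₂′ : ∀ i j (e : i ℕ.+ suc j ≡ r) w₀ ext → (θ₁ + θ₁) * ((δ * (δ * δ)) * Fs′ i j e (w₀ , ext)) ≤ triple (θ₁ * θ₁ + gbar i (w₀ , ext))
   tris-bound₂′ i j e w₀ ext = Estimates.tri-rare₂ _≟V_ _≟B_ col col-set edge MV r (fw w₀) ext X₀ X₀-len Q Q-unique (Q-all (fw w₀) (fw-len w₀)) δ θ (<⇒≤ 0<δ) (<⇒≤ 0<θ) i j e θ₁ (<⇒≤ 0<θ₁) (free i j e)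

   Fs-yes : ∀ i (i<r : i ℕ.< r) we → ∃ λ e → Fs i we ≡ Fs′ i (co i) e we
   Fs-yes i i<r we with i ℕ.<? r
   ... | yes p = co≡ i p , refl
   ... | no n = ⊥-elim (n i<r)

   tris-bound₁ : ∀ i → i ℕ.< r → ∀ w₀ ext → (θ + θ) * tris i (w₀ , ext) ≤ (θ + θ) * Fs i (w₀ , ext) + triple (K * (θ * θ) + G₂ (w₀ , ext))
   tris-bound₁ i i<r w₀ ext = let e , q = Fs-yes i i<r (w₀ , ext) in subst (λ F → (θ + θ) * tris i (w₀ , ext) ≤ (θ + θ) * F + triple (K * (θ * θ) + G₂ (w₀ , ext))) (sym q) (tris-bound₁′ i (co i) e w₀ ext)

   tris-bound₂ : ∀ i → i ℕ.< r → ∀ w₀ ext → (θ₁ + θ₁) * ((δ * (δ * δ)) * Fs i (w₀ , ext)) ≤ triple (θ₁ * θ₁ + gbar i (w₀ , ext))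
   tris-bound₂ i i<r w₀ ext = let e , q = Fs-yes i i<r (w₀ , ext) in subst (λ F → (θ₁ + θ₁) * ((δ * (δ * δ)) * F) ≤ triple (θ₁ * θ₁ + gbar i (w₀ , ext))) (sym q) (tris-bound₂′ i (co i) e w₀ ext)

   Mw : (e : ℕ) → Mean (λ (we : List V × List V) → Len m₀ (proj₁ we) × Len e (proj₂ we))
   Mw e = pairM (mean (lists MV m₀)) (mean (lists MV e))

   energyR-bounds : ∀ w₀ w → 0ℚ ≤ energyR w₀ w × energyR w₀ w ≤ K
   energyR-bounds w₀ w = ∑≥0 Q (λ q _ → proj₁ (each q)) , ≤-trans (∑-≤const Q 1ℚ (λ q _ → proj₂ (each q))) (≤-reflexive (*-identityʳ K))
     where
     each : ∀ q → E (mean (lists MV r)) (λ X → LevelR.pr _≟V_ _≟B_ col col-set MV r (fw w₀) w q X * LevelR.pr _≟V_ _≟B_ col col-set MV r (fw w₀) w q X) ∈[0,1]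
     each q = E∈ (mean (lists MV r)) (λ X p → let h = Cond.cond∈ (lists MV r) (LevelR._≟L_ _≟V_ _≟B_ col col-set MV r (fw w₀)) (LevelR.low _≟V_ _≟B_ col col-set MV r (fw w₀) w) {LevelR.one _≟V_ _≟B_ col col-set MV r (fw w₀) q} (λ X _ → LevelR.one∈ _≟V_ _≟B_ col col-set MV r (fw w₀) q X) X p in *∈ h h)

   Rj : ℕ → ℚ
   Rj j = E (Mw (dbl j)) (λ we → energyR (proj₁ we) (proj₂ we ++ fw (proj₁ we)))

   -- Under the average the two new samples may be drawn after the others, so the growth of the mean
   -- energy is the mean of the gains.
   Rj-step : ∀ j → Rj (suc j) - Rj j ≡ E (Mw (dbl j)) G₂
   Rj-step j = trans (cong₂ _-_ (E-cong m0 (λ w₀ _ → trans (E-cong mV (λ x _ → E-comm mV mj (λ y ext → en w₀ (x ∷ y ∷ ext)))) (E-comm mV mj (λ x ext → E mV (λ y → en w₀ (x ∷ y ∷ ext))))))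
         (E-cong m0 (λ w₀ _ → E-cong mj (λ ext _ → sym (trans (E-const mV _) (E-const mV (en w₀ ext)))))))
     (trans (sym (E-- m0 (λ w₀ → E mj (λ ext → E mV (λ x → E mV (λ y → en w₀ (x ∷ y ∷ ext))))) (λ w₀ → E mj (λ ext → E mV (λ x → E mV (λ y → en w₀ ext))))))
     (E-cong m0 (λ w₀ _ → trans (sym (E-- mj (λ ext → E mV (λ x → E mV (λ y → en w₀ (x ∷ y ∷ ext)))) (λ ext → E mV (λ x → E mV (λ y → en w₀ ext)))))
       (E-cong mj (λ ext _ → trans (sym (E-- mV (λ x → E mV (λ y → en w₀ (x ∷ y ∷ ext))) (λ x → E mV (λ y → en w₀ ext))))
         (E-cong mV (λ x _ → trans (sym (E-- mV (λ y → en w₀ (x ∷ y ∷ ext)) (λ y → en w₀ ext)))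
           (E-cong mV (λ y _ → sym (LevelR.gainR-energy _≟V_ _≟B_ col col-set MV r (fw w₀) Q Q-unique (Q-all (fw w₀) (fw-len w₀)) (x ∷ y ∷ []) (ext ++ fw w₀)))))))))))
     where
     m0 = mean (lists MV m₀)
     mj = mean (lists MV (dbl j))
     en : List V → List V → ℚ
     en w₀ ext = energyR w₀ (ext ++ fw w₀)

   pigeonR : ∀ η J → K < J /1 * η → ∃ λ j → j ℕ.< J × E (Mw (dbl j)) G₂ ≤ η
   pigeonR η J h = conv (climb Rj K η J (E≥0 (Mw 0) (λ we _ → proj₁ (energyR-bounds (proj₁ we) (proj₂ we ++ fw (proj₁ we))))) (E≤ (Mw (dbl J)) K (λ we _ → proj₂ (energyR-bounds (proj₁ we) (proj₂ we ++ fw (proj₁ we))))) h)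
     where
     conv : (∃ λ j → j ℕ.< J × Rj (suc j) - Rj j ≤ η) → ∃ λ j → j ℕ.< J × E (Mw (dbl j)) G₂ ≤ η
     conv (j , j< , q) = j , j< , ≤-trans (≤-reflexive (sym (Rj-step j))) q

   module Choose (e : ℕ) (K' : ℚ) (K≤K' : K ≤ K') (gK : ∀ i → i ℕ.< r → Eᴸ MV m₀ (λ w → E mV (gainK i w)) ≤ θ₁ * θ₁) (gR : E (Mw e) G₂ ≤ K' * (θ * θ))
     (N : ℕ) (e₀ ρ : ℚ) (0<e₀ : 0ℚ < e₀) where

     -- Expected numbers among `N` vertices are densities times binomial coefficients; the factor
     -- `inv e₀` is Markov's inequality for triangle densities above `e₀`.
     C₁ C₂ : ℚ
     C₁ = ncomb N (suc r) /1
     C₂ = ncomb N (suc (suc r)) /1 * inv e₀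

     bd : ℚ
     bd = C₁ * (inv ε' * (r /1 * δ + suc r /1 * (K' * θ))) + C₂ * (r /1 * (inv (δ * (δ * δ)) * (θ₁ + (θ₁ + θ₁)) + (K' * θ + (K' * θ + K' * θ))))

     gK′ : ∀ i → i ℕ.< r → E (Mw e) (gbar i) ≤ θ₁ * θ₁
     gK′ i i<r = ≤-trans (≤-reflexive (E-cong (mean (lists MV m₀)) (λ w p → trans (E-const (mean (lists MV e)) (E mV (gainK i (fw w)))) (cong (λ v → E mV (gainK i v)) (fw-id w p))))) (gK i i<r)

     defects : List V → List V → ℚ
     defects w₀ ext = C₁ * poors (w₀ , ext) + C₂ * ∑ (upTo r) (λ i → tris i (w₀ , ext))

     choose-w : ∃ λ w₀ → ∃ λ ext → Len e ext × defects w₀ ext ≤ bd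
     choose-w = conv (Averaging.defects-small (Mw e) r poors tris Fs gbar G₂ δ θ θ₁ ε' K K' 0<δ 0<θ 0<θ₁ 0<ε' K≤K' C₁ C₂ (/1≥0 (ncomb N (suc r))) (mul≥0 (/1≥0 (ncomb N (suc (suc r)))) (inv≥0 (<⇒≤ 0<e₀)))
         (λ we _ → poors-bound (proj₁ we) (proj₂ we)) (λ i i<r we _ → tris-bound₁ i i<r (proj₁ we) (proj₂ we)) (λ i i<r we _ → tris-bound₂ i i<r (proj₁ we) (proj₂ we)) gK′ gR)
       where
       conv : (∃ λ we → (Len m₀ (proj₁ we) × Len e (proj₂ we)) × C₁ * poors we + C₂ * ∑ (upTo r) (λ i → tris i we) ≤ bd) → ∃ λ w₀ → ∃ λ ext → Len e ext × defects w₀ ext ≤ bd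
       conv ((w₀ , ext) , (_ , p) , h) = w₀ , ext , p , h

     module _ (w₀ ext : List V) (good : List V → Bool) (good-prob : ρ ≤ Eᴸ MV N (λ zs → 𝟙 (good zs))) (few : defects w₀ ext < ρ) where

       triU : ℕ → List V → ℚ
       triU i U = tri3 (tri w₀ ext i) i U

       bad₁ bad₂ : List V → ℚ
       bad₁ zs = ∑ (combs (suc r) zs) (λ Y → 𝟙 (poor w₀ ext Y))
       bad₂ zs = ∑ (upTo r) (λ i → ∑ (combs (suc (suc r)) zs) (λ U → inv e₀ * triU i U))

       MN : Mean (Len {V} N)
       MN = mean (lists MV N)

       E-bad₂ : E MN bad₂ ≡ C₂ * ∑ (upTo r) (λ i → tris i (w₀ , ext))
       E-bad₂ = trans (sym (∑-swap (upTo r) (lin MN) (λ i zs → ∑ (combs (suc (suc r)) zs) (λ U → inv e₀ * triU i U))))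
         (trans (∑-cong (upTo r) (λ i _ → trans (E-combs MV N (suc (suc r)) (λ U → inv e₀ * triU i U)) (trans (cong (ncomb N (suc (suc r)) /1 *_) (E-* (mean (lists MV (suc (suc r)))) (inv e₀) (triU i))) (sym (*-assoc (ncomb N (suc (suc r)) /1) (inv e₀) _)))))
         (∑-* (upTo r) C₂ (λ i → tris i (w₀ , ext))))

       E-score : ρ - defects w₀ ext ≤ E MN (λ zs → 𝟙 (good zs) - (bad₁ zs + bad₂ zs))
       E-score = ≤-trans (+-monoˡ-≤ (- defects w₀ ext) good-prob) (≤-reflexive (sym (trans (E-- MN (λ zs → 𝟙 (good zs)) (λ zs → bad₁ zs + bad₂ zs)) (cong (λ t → Eᴸ MV N (λ zs → 𝟙 (good zs)) - t) (trans (E-+ MN bad₁ bad₂) (cong₂ _+_ (E-combs MV N (suc r) (λ Y → 𝟙 (poor w₀ ext Y))) E-bad₂))))))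

       tri≥0 : ∀ i U → 0ℚ ≤ triU i U
       tri≥0 i = tri3≥0 (tri w₀ ext i) (Estimates.tri≥0 _≟V_ _≟B_ col col-set edge MV r (fw w₀) ext X₀ X₀-len Q Q-unique (Q-all (fw w₀) (fw-len w₀)) δ θ (<⇒≤ 0<δ) (<⇒≤ 0<θ) i) i

       -- First moment: the score "good minus bad" has positive mean. Where it is positive, `good`
       -- holds and all bad terms together are below 1, so no tuple is poor and every triangle
       -- density is at most `e₀`.
       choose-zs : ∃ λ zs → Len N zs × good zs ≡ true × (∀ Y → Y ⊆ zs → Len (suc r) Y → poor w₀ ext Y ≡ false) × (∀ i U → i ℕ.< r → U ⊆ zs → Len (suc (suc r)) U → triU i U ≤ e₀)
       choose-zs = conv (E-∃ MN (ρ - defects w₀ ext) E-score)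
         where
         bad₁≥0 : ∀ zs → 0ℚ ≤ bad₁ zs
         bad₁≥0 zs = ∑≥0 (combs (suc r) zs) (λ Y _ → 𝟙≥0 (poor w₀ ext Y))
         inner≥0 : ∀ i zs → 0ℚ ≤ ∑ (combs (suc (suc r)) zs) (λ U → inv e₀ * triU i U)
         inner≥0 i zs = ∑≥0 (combs (suc (suc r)) zs) (λ U _ → mul≥0 (inv≥0 (<⇒≤ 0<e₀)) (tri≥0 i U))
         bad₂≥0 : ∀ zs → 0ℚ ≤ bad₂ zs
         bad₂≥0 zs = ∑≥0 (upTo r) (λ i _ → inner≥0 i zs)
         conv : (∃ λ zs → Len N zs × ρ - defects w₀ ext ≤ 𝟙 (good zs) - (bad₁ zs + bad₂ zs)) → ∃ λ zs → Len N zs × good zs ≡ true × (∀ Y → Y ⊆ zs → Len (suc r) Y → poor w₀ ext Y ≡ false) × (∀ i U → i ℕ.< r → U ⊆ zs → Len (suc (suc r)) U → triU i U ≤ e₀)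
         conv (zs , len , h) = zs , len , is-good , no-poor , small-tri
           where
           bad< : bad₁ zs + bad₂ zs < 𝟙 (good zs)
           bad< = <-sub (<-≤-trans (sub>0 few) h)
           is-good : good zs ≡ true
           is-good = not-false (good zs) (λ e → <⇒≱ bad< (≤-trans (≤-reflexive (cong 𝟙 e)) (add≥0 (bad₁≥0 zs) (bad₂≥0 zs))))
           bad<1 : bad₁ zs + bad₂ zs < 1ℚ
           bad<1 = <-≤-trans bad< (𝟙≤1 (good zs))
           no-poor : ∀ Y → Y ⊆ zs → Len (suc r) Y → poor w₀ ext Y ≡ false
           no-poor Y Y⊆ p = not-true (poor w₀ ext Y) (λ e → <⇒≱ bad<1 (≤-trans (≤-trans (≤-reflexive (cong 𝟙 (sym e))) (∑-≥term (combs (suc r) zs) {λ Y → 𝟙 (poor w₀ ext Y)} (λ Y _ → 𝟙≥0 (poor w₀ ext Y)) (subst (λ n → Y ∈ combs n zs) p (⊆-combs Y⊆)))) (≤-by (bad₂ zs) (bad₂≥0 zs) refl)))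
           small-tri : ∀ i U → i ℕ.< r → U ⊆ zs → Len (suc (suc r)) U → triU i U ≤ e₀
           small-tri i U i<r U⊆ p = ≤-trans (≤-reflexive (sym (trans (solve 3 (λ e i t → e :* (i :* t) := (i :* e) :* t) refl e₀ (inv e₀) (triU i U)) (trans (cong (_* triU i U) (inv-inverseˡ e₀ (>0⇒≢0 0<e₀))) (*-identityˡ _)))))
               (≤-trans (mul-monoˡ e₀ (<⇒≤ 0<e₀) le1) (≤-reflexive (*-identityʳ e₀)))
             where
             le1 : inv e₀ * triU i U ≤ 1ℚ
             le1 = ≤-trans (∑-≥term (combs (suc (suc r)) zs) {λ U → inv e₀ * triU i U} (λ U _ → mul≥0 (inv≥0 (<⇒≤ 0<e₀)) (tri≥0 i U)) (subst (λ n → U ∈ combs n zs) p (⊆-combs U⊆)))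
               (≤-trans (∑-≥term (upTo r) {λ i → ∑ (combs (suc (suc r)) zs) (λ U → inv e₀ * triU i U)} (λ i _ → inner≥0 i zs) (∈-upTo⁺ i<r))
               (≤-trans (≤-by (bad₁ zs) (bad₁≥0 zs) (+-comm (bad₁ zs) (bad₂ zs))) (<⇒≤ bad<1)))

 dbl-mono : ∀ {m n} → m ℕ.≤ n → dbl m ℕ.≤ dbl n
 dbl-mono z≤n = z≤n
 dbl-mono (s≤s p) = s≤s (s≤s (dbl-mono p))

 some-list : ∀ {A : Set} (M : FullMean {A} (λ _ → ⊤)) r → ∃ (Len {A} r)
 some-list M r = let l , p , _ = E-∃ (mean (lists M r)) {λ _ → 1ℚ} 1ℚ (≤-reflexive (sym (E-1 (mean (lists M r))))) in l , p

 -- the samples needed are bounded in terms of the alphabet and the target probabilities alone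
 module Upper (r' : ℕ) {B : Set} (_≟B_ : DecidableEquality B) (Bs : List B) (edge : B → Bool) (N : ℕ) (e₀ ε' ρ : ℚ)
   (0<e₀ : 0ℚ < e₀) (0<ε' : 0ℚ < ε') (0<ρ : 0ℚ < ρ) where

   r : ℕ
   r = suc r'

   C₁ C₂ t A₁ : ℚ
   C₁ = ncomb N (suc r) /1
   C₂ = ncomb N (suc (suc r)) /1 * inv e₀
   -- The three errors governed by `δ`, `θ₁` and `θ` receive a quarter of `ρ` each, which leaves a
   -- strict margin.
   t = ½ * (½ * ρ)
   A₁ = C₁ * (inv ε' * r /1)

   C₂≥0 : 0ℚ ≤ C₂
   C₂≥0 = mul≥0 (/1≥0 (ncomb N (suc (suc r)))) (inv≥0 (<⇒≤ 0<e₀))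

   t>0 : 0ℚ < t
   t>0 = mul>0 0<½ (mul>0 0<½ 0<ρ)

   pickδ : ∃ λ δ → 0ℚ < δ × A₁ * δ ≤ t
   pickδ = small A₁ t (mul≥0 (/1≥0 (ncomb N (suc r))) (mul≥0 (inv≥0 (<⇒≤ 0<ε')) (/1≥0 r))) t>0

   module AtDelta (δ : ℚ) (0<δ : 0ℚ < δ) (δ-small : A₁ * δ ≤ t) where
     A₂ : ℚ
     A₂ = C₂ * (r /1 * (inv (δ * (δ * δ)) * (1ℚ + (1ℚ + 1ℚ))))

     δ³>0 : 0ℚ < δ * (δ * δ)
     δ³>0 = mul>0 0<δ (mul>0 0<δ 0<δ)

     pickθ₁ : ∃ λ θ₁ → 0ℚ < θ₁ × A₂ * θ₁ ≤ t
     pickθ₁ = small A₂ t (mul≥0 C₂≥0 (mul≥0 (/1≥0 r) (mul≥0 (inv≥0 (<⇒≤ δ³>0)) (add≥0 0≤1 (add≥0 0≤1 0≤1))))) t>0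

     module AtTheta (θ₁ : ℚ) (0<θ₁ : 0ℚ < θ₁) (θ₁-small : A₂ * θ₁ ≤ t) (J₁ : ℕ) (J₁-large : r /1 < J₁ /1 * (θ₁ * θ₁)) where

       Q : ℕ → List (List B)
       Q m₀ = deduplicate (≡-dec _≟B_) (listsOver Bs (pow2 (r ℕ.+ m₀)))

       -- The additional 1 makes the comparison with the energy bound strict, as the pigeonhole
       -- requires.
       K' : ℕ → ℚ
       K' m₀ = suc (length (Q m₀)) /1

       A₃ : ℕ → ℚ
       A₃ m₀ = C₁ * (inv ε' * (suc r /1 * K' m₀)) + C₂ * (r /1 * (K' m₀ + (K' m₀ + K' m₀)))

       pickθ : ∀ m₀ → ∃ λ θ → 0ℚ < θ × A₃ m₀ * θ ≤ t
       pickθ m₀ = small (A₃ m₀) t (add≥0 (mul≥0 (/1≥0 (ncomb N (suc r))) (mul≥0 (inv≥0 (<⇒≤ 0<ε')) (mul≥0 (/1≥0 (suc r)) K'≥0))) (mul≥0 C₂≥0 (mul≥0 (/1≥0 r) (add≥0 K'≥0 (add≥0 K'≥0 K'≥0))))) t>0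
         where
         K'≥0 : 0ℚ ≤ K' m₀
         K'≥0 = /1≥0 (suc (length (Q m₀)))

       θOf : ℕ → ℚ
       θOf m₀ = proj₁ (pickθ m₀)

       θ>0 : ∀ m₀ → 0ℚ < θOf m₀
       θ>0 m₀ = proj₁ (proj₂ (pickθ m₀))

       J₂ : ℕ → ℕ
       J₂ m₀ = proj₁ (archimedes* (mul>0 (θ>0 m₀) (θ>0 m₀)))

       -- `θ`, and with it the length of the extension, depends on the length `m₀` that the first
       -- pigeonhole finds. Summing over all candidates gives a bound known in advance.
       mmax : ℕ
       mmax = J₁ ℕ.+ sum-upTo (λ m₀ → dbl (J₂ m₀)) J₁

       module _ (d₁ ε c : ℚ) (sh : ℕ) (d₁-large : pow (½ + ε) r + r /1 * c < d₁ - ε')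
         {V : Set} (_≟V_ : DecidableEquality V) (MV : FullMean {V} (λ _ → ⊤)) (col : List V → B) (col-Bs : ∀ l → col l ∈ Bs)
         (col-set : ∀ l l' → (∀ v → v ∈ l → v ∈ l') → (∀ v → v ∈ l' → v ∈ l) → col l ≡ col l')
         (free : ∀ i j → i ℕ.+ suc j ≡ r → ∀ T₁ x y z T₂ → Len i T₁ → Len j T₂ → edge (col (T₁ ++ x ∷ y ∷ T₂)) ≡ true → edge (col (T₁ ++ y ∷ z ∷ T₂)) ≡ true → edge (col (T₁ ++ x ∷ z ∷ T₂)) ≡ true → ⊥)
         (red : Obstruction V (List V) r N sh ε c e₀)
         (dense : ∀ w → length w ℕ.≤ mmax → ∃ λ (good : List V → Bool) → ρ ≤ Eᴸ MV N (λ zs → 𝟙 (good zs)) ×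
           (∀ zs → Len N zs → good zs ≡ true → ∀ I → I ⊆ zs → sh ℕ.≤ length I → ∃ λ Y → Y ⊆ I × length Y ≡ suc r × d₁ ≤ density _≟V_ _≟B_ col col-set edge MV r w Y)) where

         at-m₀ : ∀ m₀ → m₀ ℕ.< J₁ → (∀ i → i ℕ.< r → Eᴸ MV m₀ (λ w → E (mean MV) (LevelK.gain _≟V_ _≟B_ col col-set edge MV (suc r) i w)) ≤ θ₁ * θ₁) → ⊥
         at-m₀ m₀ m₀< gK = at-j (Pk.pigeonR (K' m₀ * (θ * θ)) (J₂ m₀) K-small)
           where
           θ : ℚ
           θ = θOf m₀
           Q-all : ∀ w → Len m₀ w → ∀ X → Len r X → Types.tp _≟V_ _≟B_ col col-set (X ++ w) ∈ Q m₀
           Q-all w p X q = ∈-deduplicate⁺ (≡-dec _≟B_) (subst (λ n → map col (subs (X ++ w)) ∈ listsOver Bs n) len (∈-listsOver Bs _ (λ b∈ → inBs (∈-map⁻ col b∈))))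
             where
             len : length (map col (subs (X ++ w))) ≡ pow2 (r ℕ.+ m₀)
             len = trans (length-map col (subs (X ++ w))) (trans (length-subs (X ++ w)) (cong pow2 (trans (length-++ X) (cong₂ ℕ._+_ q p))))
             inBs : ∀ {b} → (∃ λ l → l ∈ subs (X ++ w) × b ≡ col l) → b ∈ Bs
             inBs (l , _ , refl) = col-Bs l
           module Pk = Pick _≟V_ _≟B_ col col-set edge MV r (proj₁ (some-list MV r)) (proj₂ (some-list MV r)) free m₀ (proj₁ (some-list MV m₀)) (proj₂ (some-list MV m₀))
             (Q m₀) (deduplicate-! (≡-dec _≟B_) _) Q-all δ θ θ₁ ε' 0<δ (θ>0 m₀) 0<θ₁ 0<ε'
           K-small : length (Q m₀) /1 < J₂ m₀ /1 * (K' m₀ * (θ * θ))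
           K-small = <-≤-trans (subst (_< K' m₀) (+-identityˡ _) (subst₂ _<_ (+-comm _ 0ℚ) (+-comm _ 1ℚ) (+-monoʳ-< (length (Q m₀) /1) 0<1)))
             (≤-trans (≤-by (K' m₀ * (J₂ m₀ /1 * (θ * θ) - 1ℚ)) (mul≥0 (/1≥0 (suc (length (Q m₀)))) (sub≥0 (proj₂ (archimedes* (mul>0 (θ>0 m₀) (θ>0 m₀)))))) (solve 3 (λ k j q → k :* (j :* q) := k :+ k :* (j :* q :- (con 1ℚ))) refl (K' m₀) (J₂ m₀ /1) (θ * θ))) (≤-reflexive (solve 3 (λ k j q → k :* (j :* q) := j :* (k :* q)) refl (K' m₀) (J₂ m₀ /1) (θ * θ))))
           at-j : (∃ λ j → j ℕ.< J₂ m₀ × E (Pk.Mw (dbl j)) Pk.G₂ ≤ K' m₀ * (θ * θ)) → ⊥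
           at-j (j , j< , gR) = at-w Ch.choose-w
             where
             module Ch = Pk.Choose (dbl j) (K' m₀) (≤-by 1ℚ 0≤1 (+-comm 1ℚ _)) gK gR N e₀ ρ 0<e₀
             bd<ρ : Ch.bd < ρ
             bd<ρ = ≤-<-trans (≤-trans (≤-reflexive split) (≤-trans (+-mono-≤ (+-mono-≤ δ-small θ₁-small) (proj₂ (proj₂ (pickθ m₀)))) (≤-reflexive (solve 1 (λ r → (con ½) :* ((con ½) :* r) :+ (con ½) :* ((con ½) :* r) :+ (con ½) :* ((con ½) :* r) := r :- (con ½) :* ((con ½) :* r)) refl ρ)))) (<-sub (<-≤-trans t>0 (≤-reflexive (solve 2 (λ r t → t := r :- (r :- t)) refl ρ t))))
               where
               split : Ch.bd ≡ A₁ * δ + A₂ * θ₁ + A₃ m₀ * θ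
               split = trans (cong₂ _+_ (solve 6 (λ c i r d k q → c :* (i :* (r :* d :+ k :* q)) := c :* (i :* r) :* d :+ c :* (i :* (k :* q))) refl C₁ (inv ε') (r /1) δ (suc r /1) (K' m₀ * θ))
                   (solve 5 (λ c r i t q → c :* (r :* (i :* (t :+ (t :+ t)) :+ q)) := c :* (r :* (i :* ((con 1ℚ) :+ ((con 1ℚ) :+ (con 1ℚ))))) :* t :+ c :* (r :* q)) refl C₂ (r /1) (inv (δ * (δ * δ))) θ₁ (K' m₀ * θ + (K' m₀ * θ + K' m₀ * θ))))
                 (trans (cong₂ (λ a b → A₁ * δ + a + (A₂ * θ₁ + b)) (solve 5 (λ c i k q t → c :* (i :* (k :* (q :* t))) := c :* (i :* (k :* q)) :* t) refl C₁ (inv ε') (suc r /1) (K' m₀) θ) (solve 4 (λ c r k t → c :* (r :* (k :* t :+ (k :* t :+ k :* t))) := c :* (r :* (k :+ (k :+ k))) :* t) refl C₂ (r /1) (K' m₀) θ))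
                 (solve 5 (λ a b p q t → a :+ p :* t :+ (b :+ q :* t) := a :+ b :+ (p :+ q) :* t) refl (A₁ * δ) (A₂ * θ₁) (C₁ * (inv ε' * (suc r /1 * K' m₀))) (C₂ * (r /1 * (K' m₀ + (K' m₀ + K' m₀)))) θ))
             at-w : (∃ λ w₀ → ∃ λ ext → Len (dbl j) ext × Ch.defects w₀ ext ≤ Ch.bd) → ⊥
             at-w (w₀ , ext , ext-len , few) = at-good (dense w w-len)
               where
               w : List V
               w = ext ++ Pk.fw w₀
               w-len : length w ℕ.≤ mmax
               w-len = ℕ.≤-trans (ℕ.≤-reflexive (trans (length-++ ext) (trans (cong₂ ℕ._+_ ext-len (Pk.fw-len w₀)) (ℕ.+-comm (dbl j) m₀)))) (ℕ.+-mono-≤ (ℕ.<⇒≤ m₀<) (ℕ.≤-trans (dbl-mono (ℕ.<⇒≤ j<)) (≤-sum-upTo (λ m₀ → dbl (J₂ m₀)) J₁ m₀<)))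
               at-good : (∃ λ (good : List V → Bool) → ρ ≤ Eᴸ MV N (λ zs → 𝟙 (good zs)) ×
                 (∀ zs → Len N zs → good zs ≡ true → ∀ I → I ⊆ zs → sh ℕ.≤ length I → ∃ λ Y → Y ⊆ I × length Y ≡ suc r × d₁ ≤ density _≟V_ _≟B_ col col-set edge MV r w Y)) → ⊥
               at-good (good , prob , hyp) = at-zs (Ch.choose-zs w₀ ext good prob (≤-<-trans few bd<ρ))
                 where
                 at-zs : (∃ λ zs → Len N zs × good zs ≡ true × (∀ Y → Y ⊆ zs → Len (suc r) Y → Pk.poor w₀ ext Y ≡ false) × (∀ i U → i ℕ.< r → U ⊆ zs → Len (suc (suc r)) U → tri3 (Pk.tri w₀ ext i) i U ≤ e₀)) → ⊥
                 at-zs (zs , len , is-good , rich , light) = red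
                     (Estimates.law _≟V_ _≟B_ col col-set edge MV r (Pk.fw w₀) ext (proj₁ (some-list MV r)) (proj₂ (some-list MV r)) (Q m₀) (deduplicate-! (≡-dec _≟B_) _) (Q-all (Pk.fw w₀) (Pk.fw-len w₀)) δ θ (<⇒≤ 0<δ) (<⇒≤ (θ>0 m₀)))
                     (λ i a b → LevelK.β _≟V_ _≟B_ col col-set edge MV (suc r) δ (Pk.fw w₀) i (LevelR.ct _≟V_ _≟B_ col col-set MV r (Pk.fw w₀) a) (LevelR.ct _≟V_ _≟B_ col col-set MV r (Pk.fw w₀) b))
                     zs (ℕ.≤-reflexive (sym len)) hered small-tri
                   where
                   hered : ∀ I → I ⊆ zs → sh ℕ.≤ length I → ∃ λ Y → Y ⊆ I × length Y ≡ suc r × pow (½ + ε) r + r /1 * c <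
                     Estimates.chain _≟V_ _≟B_ col col-set edge MV r (Pk.fw w₀) ext (proj₁ (some-list MV r)) (proj₂ (some-list MV r)) (Q m₀) (deduplicate-! (≡-dec _≟B_) _) (Q-all (Pk.fw w₀) (Pk.fw-len w₀)) δ θ (<⇒≤ 0<δ) (<⇒≤ (θ>0 m₀)) r Y
                   hered I I⊆ big = conv (hyp zs len is-good I I⊆ big)
                     where
                     conv : (∃ λ Y → Y ⊆ I × length Y ≡ suc r × d₁ ≤ density _≟V_ _≟B_ col col-set edge MV r w Y) → _
                     conv (Y , Y⊆ , Ylen , h) = Y , Y⊆ , Ylen , <-≤-trans d₁-large (≤-trans (+-monoˡ-≤ (- ε') h) (≮ᵇ⇒≥ (rich Y (⊆-trans Y⊆ I⊆) Ylen)))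
                   small-tri : ∀ i T₁ x y z T₂ → length T₁ ≡ i → length T₁ ℕ.+ suc (length T₂) ≡ r → T₁ ++ x ∷ y ∷ z ∷ T₂ ⊆ zs → Pk.tri w₀ ext i T₁ x y z T₂ ≤ e₀
                   small-tri i T₁ x y z T₂ refl lenr sub = ≤-trans (≤-reflexive (sym (tri3-++ (Pk.tri w₀ ext i) T₁)))
                     (light i (T₁ ++ x ∷ y ∷ z ∷ T₂) (ℕ.≤-trans (ℕ.≤-trans (ℕ.≤-reflexive (ℕ.+-comm 1 i)) (ℕ.+-monoʳ-≤ i (s≤s z≤n))) (ℕ.≤-reflexive lenr)) sub
                       (trans (length-++ T₁) (trans (ℕ.+-suc i _) (cong suc (trans (ℕ.+-suc i _) (cong suc lenr))))))

         contradiction : ⊥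
         contradiction = conv (PigeonK.pigeonK _≟V_ _≟B_ col col-set edge MV r (θ₁ * θ₁) J₁ J₁-large)
           where
           conv : (∃ λ m → m ℕ.< J₁ × (∀ i → i ℕ.< r → Eᴸ MV m (λ w → E (mean MV) (LevelK.gain _≟V_ _≟B_ col col-set edge MV (suc r) i w)) ≤ θ₁ * θ₁)) → ⊥
           conv (m , m< , gK) = at-m₀ m m< gK

open Sampling

-- Subsets as increasing lists.

module UpperBounds where
 open import Data.Bool.ListAction using (any)
 import Data.Bool.Properties as Bool
 open import Data.Bool.Properties using (∧-identityʳ)
 import Data.Fin as Fin
 open import Data.Fin using (Fin; zero; suc; toℕ)
 import Data.Fin.Properties as Fin
 import Data.Fin.Subset as Sub
 open import Data.Fin.Subset using (Subset; ∣_∣; ⁅_⁆; _∪_) renaming (_∈_ to _∈ₛ_; _⊆_ to _⊆ₛ_; ⊥ to ∅)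
 import Data.Fin.Subset.Properties as Sub
 open import Data.List.Base using (cartesianProduct)
 open import Data.List.Membership.Propositional.Properties using (∈-map⁺; ∈-map⁻; ∈-++⁺ˡ; ∈-++⁺ʳ; ∈-allFin; ∈-upTo⁺; ∈-upTo⁻; ∈-++⁻; ∈-cartesianProduct⁺)
 open import Data.List.Properties using (length-map; map-tabulate; length-upTo; length-++; length-tabulate; ≡-dec; map-∘; ∷-injectiveˡ; ∷-injectiveʳ; map-++)
 open import Data.List.Relation.Binary.Sublist.Propositional using (_⊆_; []; _∷_; _∷ʳ_; ⊆-refl; ⊆-trans; minimum; ⊆-antisym)
 open import Data.List.Relation.Binary.Sublist.Propositional.Properties using (++⁺ʳ; ++⁺ˡ)
 import Data.List.Relation.Unary.All as All
 open import Data.List.Relation.Unary.AllPairs using ([]; _∷_)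
 open import Data.List.Relation.Unary.Unique.Propositional using (Unique)
 import Data.Nat.DivMod as DM
 open import Data.Nat.Divisibility using (divides-refl)
 import Data.Product.Properties as Prod
 open import Data.Rational using (ℚ; 0ℚ; 1ℚ; ½; _≤_; _<_)
 import Data.Rational.Properties as ℚ
 open import Data.Rational.Properties using (≤-trans; ≤-reflexive; <⇒≤; ≤-refl; <-≤-trans; ≤-<-trans; ≰⇒>)
 import Data.Vec as Vec
 open import Data.Vec using (Vec; []; _∷_; lookup)
 import Data.Vec.Properties as Vec
 open import Function using (_∘_; id)
 open import Relation.Binary.Definitions using (Tri; tri<; tri≈; tri>)

 setL : ∀ {n} → List (Fin n) → Subset n
 setL [] = ∅
 setL (v ∷ l) = ⁅ v ⁆ ∪ setL l

 ∈-setL⁺ : ∀ {n} {v : Fin n} l → v ∈ l → v ∈ₛ setL l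
 ∈-setL⁺ (x ∷ l) (here refl) = Sub.x∈p∪q⁺ (inj₁ (Sub.x∈⁅x⁆ x))
 ∈-setL⁺ (x ∷ l) (there p) = Sub.x∈p∪q⁺ (inj₂ (∈-setL⁺ l p))

 ∈-setL⁻ : ∀ {n} {v : Fin n} l → v ∈ₛ setL l → v ∈ l
 ∈-setL⁻ [] p = ⊥-elim (Sub.∉⊥ p)
 ∈-setL⁻ (x ∷ l) p with Sub.x∈p∪q⁻ ⁅ x ⁆ (setL l) p
 ... | inj₁ q = here (Sub.x∈⁅y⁆⇒x≡y x q)
 ... | inj₂ q = there (∈-setL⁻ l q)

 setL-cong : ∀ {n} (l l' : List (Fin n)) → (∀ v → v ∈ l → v ∈ l') → (∀ v → v ∈ l' → v ∈ l) → setL l ≡ setL l'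
 setL-cong l l' to from = Sub.⊆-antisym (λ p → ∈-setL⁺ l' (to _ (∈-setL⁻ l p))) (λ p → ∈-setL⁺ l (from _ (∈-setL⁻ l' p)))

 setL-suc : ∀ {n} (l : List (Fin n)) → setL (map suc l) ≡ false ∷ setL l
 setL-suc [] = refl
 setL-suc (v ∷ l) = cong (⁅ suc v ⁆ ∪_) (setL-suc l)

 setL-zero : ∀ {n} (l : List (Fin n)) → setL (zero ∷ map suc l) ≡ true ∷ setL l
 setL-zero l = trans (cong (⁅ zero ⁆ ∪_) (setL-suc l)) (cong (true ∷_) (Sub.∪-identityˡ (setL l)))

 above : ∀ {n} → Fin n → List (Fin n) → Bool
 above v [] = true
 above v (x ∷ l) = ⌊ v Fin.<? x ⌋

 inc : ∀ {n} → List (Fin n) → Bool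
 inc [] = true
 inc (x ∷ l) = above x l ∧ inc l

 elems : ∀ {n} → Subset n → List (Fin n)
 elems [] = []
 elems (true ∷ s) = zero ∷ map suc (elems s)
 elems (false ∷ s) = map suc (elems s)

 <?-suc : ∀ {n} (v x : Fin n) → ⌊ suc v Fin.<? suc x ⌋ ≡ ⌊ v Fin.<? x ⌋
 <?-suc v x with v Fin.<? x | suc v Fin.<? suc x
 ... | yes _ | yes _ = refl
 ... | no _ | no _ = refl
 ... | yes p | no q = ⊥-elim (q (s≤s p))
 ... | no p | yes (s≤s q) = ⊥-elim (p q)

 above-suc : ∀ {n} (v : Fin n) l → above (suc v) (map suc l) ≡ above v l
 above-suc v [] = refl
 above-suc v (x ∷ l) = <?-suc v x

 inc-suc : ∀ {n} (l : List (Fin n)) → inc (map suc l) ≡ inc l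
 inc-suc [] = refl
 inc-suc (x ∷ l) = cong₂ _∧_ (above-suc x l) (inc-suc l)

 inc-zero : ∀ {n} (l : List (Fin n)) → inc (zero ∷ map suc l) ≡ inc l
 inc-zero [] = refl
 inc-zero (x ∷ l) = inc-suc (x ∷ l)

 -- A sum over all `k`-tuples, that is, an expectation before normalisation; the factor `𝟙 (inc l)`
 -- will select one tuple for each `k`-set.
 S : ∀ n (k : ℕ) → (List (Fin n) → ℚ) → ℚ
 S n zero φ = φ []
 S n (suc k) φ = ∑ (allFin n) (λ v → S n k (λ l → φ (v ∷ l)))

 S-cong : ∀ n k {φ ψ} → (∀ l → Len k l → φ l ≡ ψ l) → S n k φ ≡ S n k ψ
 S-cong n zero h = h [] refl
 S-cong n (suc k) h = ∑-cong (allFin n) (λ v _ → S-cong n k (λ l p → h (v ∷ l) (cong suc p)))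

 S-0 : ∀ n k {φ} → (∀ l → Len k l → φ l ≡ 0ℚ) → S n k φ ≡ 0ℚ
 S-0 n zero h = h [] refl
 S-0 n (suc k) h = trans (∑-cong (allFin n) (λ v _ → S-0 n k (λ l p → h (v ∷ l) (cong suc p)))) (trans (∑-const (allFin n) 0ℚ) (zeroʳ _))

 ∑-allFin : ∀ n (f : Fin (suc n) → ℚ) → ∑ (allFin (suc n)) f ≡ f zero + ∑ (allFin n) (f ∘ suc)
 ∑-allFin n f = cong (f zero +_) (trans (cong (λ l → ∑ l f) (sym (map-tabulate id suc))) (∑-map suc (allFin n) f))

 data HasZero {n} : List (Fin (suc n)) → Set where
   here : ∀ {l} → HasZero (zero ∷ l)
   there : ∀ {x l} → HasZero l → HasZero (x ∷ l)

 S-suc : ∀ n k φ → (∀ l → HasZero l → φ l ≡ 0ℚ) → S (suc n) k φ ≡ S n k (λ l → φ (map suc l))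
 S-suc n zero φ h = refl
 S-suc n (suc k) φ h = trans (∑-allFin n _) (trans (cong₂ _+_ (S-0 (suc n) k (λ l _ → h (zero ∷ l) here)) (∑-cong (allFin n) (λ v _ → S-suc n k (λ l → φ (suc v ∷ l)) (λ l z → h (suc v ∷ l) (there z))))) (+-identityˡ _))

 zero-not-above : ∀ {n} (v : Fin (suc n)) l → HasZero l → inc (v ∷ l) ≡ false
 zero-not-above {n} v (.zero ∷ l) here with v Fin.<? zero {n}
 ... | no _ = refl
 zero-not-above v (x ∷ l) (there z) = trans (cong (above v (x ∷ l) ∧_) (zero-not-above x l z)) (Bool.∧-zeroʳ _)

 hasSize-true : ∀ {n} k (s : Subset n) → hasSize k s ≡ true → ∣ s ∣ ≡ k
 hasSize-true k s e with ∣ s ∣ ℕ.≟ k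
 ... | yes p = p

 hasSize-suc : ∀ {n} k (s : Subset n) → hasSize (suc k) (true ∷ s) ≡ hasSize k s
 hasSize-suc k s with ∣ s ∣ ℕ.≟ k | suc ∣ s ∣ ℕ.≟ suc k
 ... | yes _ | yes _ = refl
 ... | no _ | no _ = refl
 ... | yes refl | no q = ⊥-elim (q refl)
 ... | no p | yes q = ⊥-elim (p (suc-inj q))

 ∑-filter : ∀ {A : Set} (b : A → Bool) (l : List A) f → ∑ (filter (λ s → b s Bool.≟ true) l) f ≡ ∑ l (λ s → 𝟙 (b s) * f s)
 ∑-filter b [] f = refl
 ∑-filter b (x ∷ l) f with b x
 ... | true = cong₂ _+_ (sym (*-identityˡ (f x))) (∑-filter b l f)
 ... | false = trans (∑-filter b l f) (sym (trans (cong (_+ _) (zeroˡ (f x))) (+-identityˡ _)))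

 -- Both sides are split by membership of `zero`, which can only be the first entry of an increasing
 -- list.
 ∑-subsets : ∀ n k (F : Subset n → ℚ) → ∑ (allSubsets n) (λ s → 𝟙 (hasSize k s) * F s) ≡ S n k (λ l → 𝟙 (inc l) * F (setL l))
 ∑-subsets zero zero F = +-identityʳ _
 ∑-subsets zero (suc k) F = trans (+-identityʳ _) (zeroˡ _)
 ∑-subsets (suc n) zero F = trans (∑-++ (map (true ∷_) (allSubsets n)) _ _) (trans (cong₂ _+_ left right) (+-identityˡ _))
   where
   left : ∑ (map (true ∷_) (allSubsets n)) (λ s → 𝟙 (hasSize 0 s) * F s) ≡ 0ℚ
   left = trans (∑-map (true ∷_) (allSubsets n) _) (trans (∑-cong (allSubsets n) (λ s _ → zeroˡ (F (true ∷ s)))) (trans (∑-const (allSubsets n) 0ℚ) (zeroʳ _)))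
   right : ∑ (map (false ∷_) (allSubsets n)) (λ s → 𝟙 (hasSize 0 s) * F s) ≡ 1ℚ * F (false ∷ ∅)
   right = trans (∑-map (false ∷_) (allSubsets n) _) (∑-subsets n zero (F ∘ (false ∷_)))
 ∑-subsets (suc n) (suc k) F = trans (∑-++ (map (true ∷_) (allSubsets n)) _ _) (trans (cong₂ _+_ left right) (sym whole))
   where
   φ : List (Fin (suc n)) → ℚ
   φ l = 𝟙 (inc l) * F (setL l)
   left : ∑ (map (true ∷_) (allSubsets n)) (λ s → 𝟙 (hasSize (suc k) s) * F s) ≡ S n k (λ l → φ (zero ∷ map suc l))
   left = trans (∑-map (true ∷_) (allSubsets n) _) (trans (∑-cong (allSubsets n) (λ s _ → cong (λ b → 𝟙 b * F (true ∷ s)) (hasSize-suc k s)))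
     (trans (∑-subsets n k (F ∘ (true ∷_))) (S-cong n k (λ l _ → cong₂ (λ b s → 𝟙 b * F s) (sym (inc-zero l)) (sym (setL-zero l))))))
   right : ∑ (map (false ∷_) (allSubsets n)) (λ s → 𝟙 (hasSize (suc k) s) * F s) ≡ S n (suc k) (λ l → φ (map suc l))
   right = trans (∑-map (false ∷_) (allSubsets n) _) (trans (∑-subsets n (suc k) (F ∘ (false ∷_))) (S-cong n (suc k) (λ l _ → cong₂ (λ b s → 𝟙 b * F s) (sym (inc-suc l)) (sym (setL-suc l)))))
   vanish : ∀ v l → HasZero l → φ (v ∷ l) ≡ 0ℚ
   vanish v l z = trans (cong (λ b → 𝟙 b * F (setL (v ∷ l))) (zero-not-above v l z)) (zeroˡ _)
   whole : S (suc n) (suc k) φ ≡ S n k (λ l → φ (zero ∷ map suc l)) + S n (suc k) (λ l → φ (map suc l))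
   whole = trans (∑-allFin n _) (cong₂ _+_ (S-suc n k (λ l → φ (zero ∷ l)) (vanish zero)) (∑-cong (allFin n) (λ v _ → S-suc n k (λ l → φ (suc v ∷ l)) (vanish (suc v)))))

 ∑-kSubsets : ∀ n k (F : Subset n → ℚ) → ∑ (kSubsets n k) F ≡ S n k (λ l → 𝟙 (inc l) * F (setL l))
 ∑-kSubsets n k F = trans (∑-filter (hasSize k) (allSubsets n) F) (∑-subsets n k F)

 count-∑ : ∀ {A : Set} (b : A → Bool) (l : List A) → length (filter (λ s → b s Bool.≟ true) l) /1 ≡ ∑ l (𝟙 ∘ b)
 count-∑ b l = trans (sym (*-identityʳ _)) (trans (sym (∑-const (filter (λ s → b s Bool.≟ true) l) 1ℚ)) (trans (∑-filter b l (λ _ → 1ℚ)) (∑-cong l (λ s _ → *-identityʳ _))))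

 countKk-S : ∀ {n} k j (G : Hypergraph n) → countKk k j G /1 ≡ S n k (λ l → 𝟙 (inc l) * 𝟙 (inKk j G (setL l)))
 countKk-S {n} k j G = trans (count-∑ (inKk j G) (kSubsets n k)) (∑-kSubsets n k (λ s → 𝟙 (inKk j G s)))

 countKkE-S : ∀ {n} k j (G E : Hypergraph n) → countKkE k j G E /1 ≡ S n k (λ l → 𝟙 (inc l) * (𝟙 (inKk j G (setL l)) * 𝟙 (E (setL l))))
 countKkE-S {n} k j G E = trans (count-∑ (λ s → inKk j G s ∧ E s) (kSubsets n k)) (trans (∑-kSubsets n k (λ s → 𝟙 (inKk j G s ∧ E s))) (S-cong n k (λ l _ → cong (𝟙 (inc l) *_) (𝟙-∧ (inKk j G (setL l)) (E (setL l))))))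

 opaque
   unfolding _+_

   Dense-/1 : ∀ {n} k d η j (E : Hypergraph n) → Dense k d η j E → ∀ G → Uniform j G → d * countKk k j G /1 - η * (n ℕ.^ k) /1 ≤ countKkE k j G E /1
   Dense-/1 {n} k d η j E D G u = subst₂ (λ a b → d * a - η * b ≤ countKkE k j G E /1) (sym (/1≡ℕtoℚ (countKk k j G))) (sym (/1≡ℕtoℚ (n ℕ.^ k))) (subst (d * ℕtoℚ (countKk k j G) - η * ℕtoℚ (n ℕ.^ k) ≤_) (sym (/1≡ℕtoℚ (countKkE k j G E))) (D G u))

   /1-Dense : ∀ {n} k d η j (E : Hypergraph n) → (∀ G → Uniform j G → d * countKk k j G /1 - η * (n ℕ.^ k) /1 ≤ countKkE k j G E /1) → Dense k d η j E
   /1-Dense {n} k d η j E h G u = subst₂ (λ a b → d * a - η * b ≤ ℕtoℚ (countKkE k j G E)) (/1≡ℕtoℚ (countKk k j G)) (/1≡ℕtoℚ (n ℕ.^ k)) (subst (d * countKk k j G /1 - η * (n ℕ.^ k) /1 ≤_) (/1≡ℕtoℚ (countKkE k j G E)) (h G u))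

 allB-∈ : ∀ {A : Set} (p : A → Bool) l → allB p l ≡ true → ∀ {x} → x ∈ l → p x ≡ true
 allB-∈ p (x ∷ l) e (here refl) = proj₁ (∧-true (p x) _ e)
 allB-∈ p (x ∷ l) e (there q) = allB-∈ p l (proj₂ (∧-true (p x) _ e)) q

 ∈-allB : ∀ {A : Set} (p : A → Bool) l → (∀ {x} → x ∈ l → p x ≡ true) → allB p l ≡ true
 ∈-allB p [] h = refl
 ∈-allB p (x ∷ l) h = ∧-intro (h (here refl)) (∈-allB p l (h ∘ there))

 ∈-allSubsets : ∀ {n} (s : Subset n) → s ∈ allSubsets n
 ∈-allSubsets [] = here refl
 ∈-allSubsets (true ∷ s) = ∈-++⁺ˡ (∈-map⁺ (true ∷_) (∈-allSubsets s))
 ∈-allSubsets {suc n} (false ∷ s) = ∈-++⁺ʳ (map (true ∷_) (allSubsets n)) (∈-map⁺ (false ∷_) (∈-allSubsets s))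

 subsetB⇒⊆ : ∀ {n} (t s : Subset n) → subsetB t s ≡ true → t ⊆ₛ s
 subsetB⇒⊆ {n} t s e {x} x∈t = Vec.lookup⇒[]= x s (trans (sym (cong (λ b → if b then lookup s x else true) (Vec.[]=⇒lookup x∈t))) (allB-∈ (λ i → if lookup t i then lookup s i else true) (allFin n) e (∈-allFin x)))

 ⊆⇒subsetB : ∀ {n} (t s : Subset n) → t ⊆ₛ s → subsetB t s ≡ true
 ⊆⇒subsetB {n} t s h = ∈-allB _ (allFin n) (λ {i} _ → one i (lookup t i) refl)
   where
   one : ∀ i b → lookup t i ≡ b → (if b then lookup s i else true) ≡ true
   one i true e = Vec.[]=⇒lookup (h (Vec.lookup⇒[]= i t e))
   one i false e = refl

 inKk⇒ : ∀ {n} j (G : Hypergraph n) s → inKk j G s ≡ true → ∀ t → t ⊆ₛ s → ∣ t ∣ ≡ j → G t ≡ true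
 inKk⇒ j G s e t sub size = trans (sym (cong (λ b → if b then G t else true) (∧-intro (⊆⇒subsetB t s sub) has))) (allB-∈ _ (allSubsets _) e (∈-allSubsets t))
   where
   has : hasSize j t ≡ true
   has with ∣ t ∣ ℕ.≟ j
   ... | yes _ = refl
   ... | no n = ⊥-elim (n size)

 ⇒inKk : ∀ {n} j (G : Hypergraph n) s → (∀ t → t ⊆ₛ s → ∣ t ∣ ≡ j → G t ≡ true) → inKk j G s ≡ true
 ⇒inKk j G s h = ∈-allB _ (allSubsets _) (λ {t} _ → one t (subsetB t s ∧ hasSize j t) refl)
   where
   one : ∀ t b → subsetB t s ∧ hasSize j t ≡ b → (if b then G t else true) ≡ true
   one t true e = h t (subsetB⇒⊆ t s (proj₁ (∧-true (subsetB t s) _ e))) (hasSize-true j t (proj₂ (∧-true (subsetB t s) _ e)))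
   one t false e = refl

 above-< : ∀ {n} (v : Fin n) l → above v l ∧ inc l ≡ true → ∀ {x} → x ∈ l → v Fin.< x
 above-< v (y ∷ l) e (here refl) with v Fin.<? y
 ... | yes p = p
 above-< v (y ∷ l) e (there q) with v Fin.<? y
 ... | yes p = ℕ.<-trans p (above-< y l e q)

 inc-tail : ∀ {n} (x : Fin n) l → inc (x ∷ l) ≡ true → inc l ≡ true
 inc-tail x l e = proj₂ (∧-true (above x l) (inc l) e)

 inc-⊆ : ∀ {n} (A Z : List (Fin n)) → inc A ≡ true → inc Z ≡ true → (∀ {x} → x ∈ A → x ∈ Z) → A ⊆ Z
 inc-⊆ [] Z _ _ h = minimum Z
 inc-⊆ (a ∷ A) [] _ _ h with h (here refl)
 ... | ()
 inc-⊆ (a ∷ A) (z ∷ Z) ia iz h with a Fin.≟ z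
 ... | yes refl = refl ∷ inc-⊆ A Z (inc-tail a A ia) (inc-tail a Z iz) (λ {x} x∈ → skip x∈ (h (there x∈)))
   where
   skip : ∀ {x} → x ∈ A → x ∈ a ∷ Z → x ∈ Z
   skip x∈ (here refl) = ⊥-elim (ℕ.<-irrefl refl (above-< a A ia x∈))
   skip x∈ (there q) = q
 ... | no a≢z = z ∷ʳ inc-⊆ (a ∷ A) Z ia (inc-tail z Z iz) (λ x∈ → skip x∈ (h x∈))
   where
   a∈Z : a ∈ Z
   a∈Z with h (here refl)
   ... | here e = ⊥-elim (a≢z e)
   ... | there q = q
   skip : ∀ {x} → x ∈ a ∷ A → x ∈ z ∷ Z → x ∈ Z
   skip x∈ (there q) = q
   skip (here e) (here e') = ⊥-elim (a≢z (trans (sym e) e'))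
   skip (there x∈) (here refl) = ⊥-elim (ℕ.<-irrefl refl (ℕ.<-trans (above-< z Z iz a∈Z) (above-< a A ia x∈)))

 ⊆-inc : ∀ {n} {A Z : List (Fin n)} → A ⊆ Z → inc Z ≡ true → inc A ≡ true
 ⊆-inc [] _ = refl
 ⊆-inc {Z = y ∷ Z} (y ∷ʳ p) e = ⊆-inc p (inc-tail y Z e)
 ⊆-inc {A = a ∷ A} {Z = a ∷ Z} (refl ∷ p) e = ∧-intro (ab A p) (⊆-inc p (inc-tail a Z e))
   where
   ab : ∀ A → A ⊆ Z → above a A ≡ true
   ab [] p = refl
   ab (x ∷ A) p with a Fin.<? x
   ... | yes _ = refl
   ... | no n = ⊥-elim (n (above-< a Z e (⊆⇒∈ p (here refl))))

 inc-unique : ∀ {n} (A Z : List (Fin n)) → inc A ≡ true → inc Z ≡ true → (∀ {x} → x ∈ A → x ∈ Z) → (∀ {x} → x ∈ Z → x ∈ A) → A ≡ Z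
 inc-unique A Z ia iz to from = ⊆-antisym (inc-⊆ A Z ia iz to) (inc-⊆ Z A iz ia from)

 inc-elems : ∀ {n} (s : Subset n) → inc (elems s) ≡ true
 inc-elems [] = refl
 inc-elems (true ∷ s) = trans (inc-zero (elems s)) (inc-elems s)
 inc-elems (false ∷ s) = trans (inc-suc (elems s)) (inc-elems s)

 setL-elems : ∀ {n} (s : Subset n) → setL (elems s) ≡ s
 setL-elems [] = refl
 setL-elems (true ∷ s) = trans (setL-zero (elems s)) (cong (true ∷_) (setL-elems s))
 setL-elems (false ∷ s) = trans (setL-suc (elems s)) (cong (false ∷_) (setL-elems s))

 elems-setL : ∀ {n} (Z : List (Fin n)) → inc Z ≡ true → elems (setL Z) ≡ Z
 elems-setL Z iz = inc-unique _ Z (inc-elems (setL Z)) iz (λ p → ∈-setL⁻ Z (subst (_ ∈ₛ_) (setL-elems (setL Z)) (∈-setL⁺ _ p))) (λ p → ∈-setL⁻ _ (subst (_ ∈ₛ_) (sym (setL-elems (setL Z))) (∈-setL⁺ Z p)))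

 size-elems : ∀ {n} (s : Subset n) → ∣ s ∣ ≡ length (elems s)
 size-elems [] = refl
 size-elems (true ∷ s) = cong suc (trans (size-elems s) (sym (length-map suc (elems s))))
 size-elems (false ∷ s) = trans (size-elems s) (sym (length-map suc (elems s)))

 size-setL : ∀ {n} (Z : List (Fin n)) → inc Z ≡ true → ∣ setL Z ∣ ≡ length Z
 size-setL Z iz = trans (size-elems (setL Z)) (cong length (elems-setL Z iz))

 rem-⊆ : ∀ {A : Set} i (l : List A) → rem i l ⊆ l
 rem-⊆ i [] = []
 rem-⊆ zero (x ∷ l) = x ∷ʳ ⊆-refl
 rem-⊆ (suc i) (x ∷ l) = refl ∷ rem-⊆ i l

 same-length-⊆ : ∀ {A : Set} {Y Z : List A} → Y ⊆ Z → length Y ≡ length Z → Y ≡ Z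
 same-length-⊆ [] _ = refl
 same-length-⊆ (y ∷ʳ p) e = ⊥-elim (ℕ.<-irrefl e (s≤s (len-⊆ p)))
   where
   len-⊆ : ∀ {A : Set} {Y Z : List A} → Y ⊆ Z → length Y ℕ.≤ length Z
   len-⊆ [] = z≤n
   len-⊆ (y ∷ʳ p) = ℕ.m≤n⇒m≤1+n (len-⊆ p)
   len-⊆ (_ ∷ p) = s≤s (len-⊆ p)
 same-length-⊆ (refl ∷ p) e = cong (_ ∷_) (same-length-⊆ p (suc-inj e))

 ⊆-rem : ∀ {A : Set} {Y Z : List A} → Y ⊆ Z → length Y ℕ.< length Z → ∃ λ j → j ℕ.< length Z × Y ⊆ rem j Z
 ⊆-rem (y ∷ʳ p) _ = 0 , s≤s z≤n , p
 ⊆-rem (refl ∷ p) (s≤s lt) with ⊆-rem p lt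
 ... | j , j< , q = suc j , s≤s j< , refl ∷ q

 -- This indexes the (k-2)-subsets of a `k`-set by pairs of deletions, the form in which lower types
 -- store them.
 two-rem : ∀ {A : Set} q {Y Z : List A} → Y ⊆ Z → Len q Y → Len (suc (suc q)) Z → ∃ λ j → j ℕ.< suc (suc q) × ∃ λ l → l ℕ.< suc q × Y ≡ rem l (rem j Z)
 two-rem q {Y} {Z} p ly lz with ⊆-rem p (subst₂ ℕ._<_ (sym ly) (sym lz) (ℕ.m≤n⇒m≤1+n ℕ.≤-refl))
 ... | j , j< , p₁ with ⊆-rem p₁ (subst₂ ℕ._<_ (sym ly) (sym lr) ℕ.≤-refl)
   where
   lr : length (rem j Z) ≡ suc q
   lr = suc-inj (trans (length-rem j Z j<) lz)
 ... | l , l< , p₂ = j , subst (j ℕ.<_) lz j< , l , subst (l ℕ.<_) lr l< , same-length-⊆ p₂ (trans ly (sym lrr))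
   where
   lr : length (rem j Z) ≡ suc q
   lr = suc-inj (trans (length-rem j Z j<) lz)
   lrr : length (rem l (rem j Z)) ≡ q
   lrr = suc-inj (trans (length-rem l (rem j Z) l<) lr)

 len-rem-rem : ∀ {A : Set} q (Z : List A) → Len (suc (suc q)) Z → ∀ {j l} → j ℕ.< suc (suc q) → l ℕ.< suc q → length (rem l (rem j Z)) ≡ q
 len-rem-rem q Z lz {j} {l} j< l< = suc-inj (trans (length-rem l (rem j Z) (subst (l ℕ.<_) (sym lr) l<)) lr)
   where
   lr : length (rem j Z) ≡ suc q
   lr = suc-inj (trans (length-rem j Z (subst (j ℕ.<_) (sym lz) j<)) lz)

 inKk-list⇒ : ∀ {n} q (G : Hypergraph n) Z → inc Z ≡ true → Len (suc (suc q)) Z → inKk q G (setL Z) ≡ true →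
   ∀ {j l} → j ℕ.< suc (suc q) → l ℕ.< suc q → G (setL (rem l (rem j Z))) ≡ true
 inKk-list⇒ q G Z iz lz e {j} {l} j< l< = inKk⇒ q G (setL Z) e (setL A) (λ p → ∈-setL⁺ Z (⊆⇒∈ A⊆Z (∈-setL⁻ A p))) (trans (size-setL A (⊆-inc A⊆Z iz)) (len-rem-rem q Z lz j< l<))
   where
   A = rem l (rem j Z)
   A⊆Z : A ⊆ Z
   A⊆Z = ⊆-trans (rem-⊆ l _) (rem-⊆ j Z)

 ⇒inKk-list : ∀ {n} q (G : Hypergraph n) Z → inc Z ≡ true → Len (suc (suc q)) Z →
   (∀ {j l} → j ℕ.< suc (suc q) → l ℕ.< suc q → G (setL (rem l (rem j Z))) ≡ true) → inKk q G (setL Z) ≡ true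
 ⇒inKk-list q G Z iz lz h = ⇒inKk q G (setL Z) each
   where
   each : ∀ t → t ⊆ₛ setL Z → ∣ t ∣ ≡ q → G t ≡ true
   each t sub size with two-rem q {elems t} {Z} (inc-⊆ (elems t) Z (inc-elems t) iz (λ p → ∈-setL⁻ Z (sub (subst (_ ∈ₛ_) (setL-elems t) (∈-setL⁺ (elems t) p))))) (trans (sym (size-elems t)) size) lz
   ... | j , j< , l , l< , e = trans (cong G (trans (sym (setL-elems t)) (cong setL e))) (h j< l<)

 any-∃ : ∀ {A : Set} (Q : A → Bool) l → any Q l ≡ true → ∃ λ x → x ∈ l × Q x ≡ true
 any-∃ Q (x ∷ l) p with Q x in eq
 ... | true = x , here refl , eq
 ... | false with any-∃ Q l p
 ... | y , q , e = y , there q , e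

 ∃-any : ∀ {A : Set} (Q : A → Bool) {x} l → x ∈ l → Q x ≡ true → any Q l ≡ true
 ∃-any Q (x ∷ l) (here refl) e rewrite e = refl
 ∃-any Q (x ∷ l) (there p) e with Q x
 ... | true = refl
 ... | false = ∃-any Q l p e

 ∈-image⁻ : ∀ {p n} (φ : Fin p → Fin n) s {v} → v ∈ₛ image φ s → ∃ λ x → x ∈ₛ s × φ x ≡ v
 ∈-image⁻ {p} φ s {v} v∈ with any-∃ _ (allFin p) (trans (sym (Vec.lookup∘tabulate _ v)) (Vec.[]=⇒lookup v∈))
 ... | x , _ , e with φ x Fin.≟ v | ∧-true (lookup s x) _ e
 ... | yes q | a , _ = x , Vec.lookup⇒[]= x s a , q

 ∈-image⁺ : ∀ {p n} (φ : Fin p → Fin n) s {x} → x ∈ₛ s → φ x ∈ₛ image φ s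
 ∈-image⁺ {p} φ s {x} x∈ = Vec.lookup⇒[]= (φ x) _ (trans (Vec.lookup∘tabulate _ (φ x)) (∃-any _ (allFin p) (∈-allFin x) (∧-intro (Vec.[]=⇒lookup x∈) self)))
   where
   self : ⌊ φ x Fin.≟ φ x ⌋ ≡ true
   self with φ x Fin.≟ φ x
   ... | yes _ = refl
   ... | no n = ⊥-elim (n refl)

 lookup-rem : ∀ {A : Set} m (L : List A) (j : Fin (length L)) → toℕ j ≢ m → List.lookup L j ∈ rem m L
 lookup-rem zero (x ∷ L) zero ne = ⊥-elim (ne refl)
 lookup-rem zero (x ∷ L) (suc j) ne = ∈-lookup L j
   where
   ∈-lookup : ∀ {A : Set} (L : List A) j → List.lookup L j ∈ L
   ∈-lookup (x ∷ L) zero = here refl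
   ∈-lookup (x ∷ L) (suc j) = there (∈-lookup L j)
 lookup-rem (suc m) (x ∷ L) zero ne = here refl
 lookup-rem (suc m) (x ∷ L) (suc j) ne = there (lookup-rem m L j (ne ∘ cong suc))

 rem-lookup : ∀ {A : Set} m (L : List A) {v} → v ∈ rem m L → ∃ λ (j : Fin (length L)) → toℕ j ≢ m × List.lookup L j ≡ v
 rem-lookup zero (x ∷ L) p with find L p
   where
   find : ∀ {A : Set} (L : List A) {v} → v ∈ L → ∃ λ j → List.lookup L j ≡ v
   find (x ∷ L) (here refl) = zero , refl
   find (x ∷ L) (there p) with find L p
   ... | j , e = suc j , e
 ... | j , e = suc j , (λ ()) , e
 rem-lookup (suc m) (x ∷ L) (here refl) = zero , (λ ()) , refl
 rem-lookup (suc m) (x ∷ L) (there p) with rem-lookup m L p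
 ... | j , ne , e = suc j , (λ q → ne (suc-inj q)) , e

 lookup-inj : ∀ {A : Set} (L : List A) → Unique L → ∀ i j → List.lookup L i ≡ List.lookup L j → i ≡ j
 lookup-inj (x ∷ L) (f ∷ u) zero zero e = refl
 lookup-inj (x ∷ L) (f ∷ u) zero (suc j) e = ⊥-elim (All.lookup f (in-L L j) e)
   where
   in-L : ∀ {A : Set} (L : List A) j → List.lookup L j ∈ L
   in-L (x ∷ L) zero = here refl
   in-L (x ∷ L) (suc j) = there (in-L L j)
 lookup-inj (x ∷ L) (f ∷ u) (suc i) zero e = ⊥-elim (All.lookup f (in-L L i) (sym e))
   where
   in-L : ∀ {A : Set} (L : List A) j → List.lookup L j ∈ L
   in-L (x ∷ L) zero = here refl
   in-L (x ∷ L) (suc j) = there (in-L L j)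
 lookup-inj (x ∷ L) (f ∷ u) (suc i) (suc j) e = cong suc (lookup-inj L u i j e)

 size-add : ∀ {n} (v : Fin n) s → ∣ ⁅ v ⁆ ∪ s ∣ ℕ.≤ suc ∣ s ∣
 size-add zero (true ∷ s) = s≤s (ℕ.≤-trans (ℕ.≤-reflexive (cong ∣_∣ (Sub.∪-identityˡ s))) (ℕ.n≤1+n ∣ s ∣))
 size-add zero (false ∷ s) = s≤s (ℕ.≤-reflexive (cong ∣_∣ (Sub.∪-identityˡ s)))
 size-add (suc v) (true ∷ s) = s≤s (size-add v s)
 size-add (suc v) (false ∷ s) = size-add v s

 size-≤ : ∀ {n} (l : List (Fin n)) → ∣ setL l ∣ ℕ.≤ length l
 size-≤ {n} [] = ℕ.≤-reflexive (Sub.∣⊥∣≡0 n)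
 size-≤ (v ∷ l) = ℕ.≤-trans (size-add v (setL l)) (s≤s (size-≤ l))

 size-distinct : ∀ {n} (v : Fin n) l → ∣ setL (v ∷ l) ∣ ≡ length (v ∷ l) → ¬ v ∈ l
 size-distinct v l e v∈ = ℕ.<-irrefl e (s≤s (ℕ.≤-trans (ℕ.≤-reflexive (cong ∣_∣ (setL-cong (v ∷ l) l (λ { x (here refl) → v∈ ; x (there p) → p }) (λ x → there)))) (size-≤ l)))

 size-tail : ∀ {n} (v : Fin n) l → ∣ setL (v ∷ l) ∣ ≡ length (v ∷ l) → ∣ setL l ∣ ≡ length l
 size-tail v l e = ℕ.≤-antisym (size-≤ l) (ℕ.≤-pred (ℕ.≤-trans (ℕ.≤-reflexive (sym e)) (size-add v (setL l))))

 size-unique : ∀ {n} (l : List (Fin n)) → ∣ setL l ∣ ≡ length l → Unique l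
 size-unique [] e = []
 size-unique (v ∷ l) e = All.tabulate (λ {x} x∈ q → size-distinct v l e (subst (_∈ l) (sym q) x∈)) ∷ size-unique l (size-tail v l e)

 -- Deleting position 0, 1 or 2 of `x ∷ y ∷ z ∷ T` gives the three edges of the forbidden
 -- hypergraph; uniformity of `E` makes all the listed vertices distinct.
 link-triangle : ∀ {n} q (E : Hypergraph n) → Uniform (suc (suc q)) E → Free (F-edge (suc (suc q))) E → ∀ x y z T → Len q T →
   E (setL (x ∷ y ∷ T)) ≡ true → E (setL (y ∷ z ∷ T)) ≡ true → E (setL (x ∷ z ∷ T)) ≡ true → ⊥
 link-triangle {n} q E U fr x y z T lT exy eyz exz = fr (φ , φ-inj , edges)
   where
   k = suc (suc q)
   L : List (Fin n)
   L = x ∷ y ∷ z ∷ T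
   lenL : length L ≡ suc k
   lenL = cong (λ m → ℕ.suc (ℕ.suc (ℕ.suc m))) lT
   uniq : ∀ a b → E (setL (a ∷ b ∷ T)) ≡ true → Unique (a ∷ b ∷ T)
   uniq a b e = size-unique (a ∷ b ∷ T) (trans (U _ e) (cong (λ m → ℕ.suc (ℕ.suc m)) (sym lT)))
   uL : Unique L
   uL with uniq x y exy | uniq y z eyz | uniq x z exz
   ... | (xy All.∷ xT) ∷ _ | (yz All.∷ yT) ∷ (zT ∷ uT) | (xz All.∷ _) ∷ _ = (xy All.∷ xz All.∷ xT) ∷ (yz All.∷ yT) ∷ zT ∷ uT
   φ : Fin (suc k) → Fin n
   φ i = List.lookup L (Fin.cast (sym lenL) i)
   φ-inj : ∀ {i j} → φ i ≡ φ j → i ≡ j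
   φ-inj {i} {j} e = Fin.toℕ-injective (trans (sym (Fin.toℕ-cast (sym lenL) i)) (trans (cong toℕ (lookup-inj L uL _ _ e)) (Fin.toℕ-cast (sym lenL) j)))
   img : ∀ i → image φ (Sub.∁ ⁅ i ⁆) ≡ setL (rem (toℕ i) L)
   img i = Sub.⊆-antisym to from
     where
     to : image φ (Sub.∁ ⁅ i ⁆) ⊆ₛ setL (rem (toℕ i) L)
     to p with ∈-image⁻ φ (Sub.∁ ⁅ i ⁆) p
     ... | j , j∈ , refl = ∈-setL⁺ _ (lookup-rem (toℕ i) L _ (λ e → Sub.x∈∁p⇒x∉p j∈ (subst (_∈ₛ ⁅ i ⁆) (Fin.toℕ-injective (trans (sym e) (Fin.toℕ-cast (sym lenL) j))) (Sub.x∈⁅x⁆ i))))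
     from : setL (rem (toℕ i) L) ⊆ₛ image φ (Sub.∁ ⁅ i ⁆)
     from {v} p with rem-lookup (toℕ i) L (∈-setL⁻ _ p)
     ... | j , ne , e = subst (_∈ₛ image φ (Sub.∁ ⁅ i ⁆)) (trans (cong (List.lookup L) (Fin.toℕ-injective (trans (Fin.toℕ-cast (sym lenL) _) (Fin.toℕ-cast lenL j)))) e)
       (∈-image⁺ φ (Sub.∁ ⁅ i ⁆) {Fin.cast lenL j} (Sub.x∉p⇒x∈∁p (λ m → ne (trans (sym (Fin.toℕ-cast lenL j)) (cong toℕ (Sub.x∈⁅y⁆⇒x≡y i m))))))
   edges : ∀ s → F-edge k s → E (image φ s) ≡ true
   edges s (i , i<3 , refl) = trans (cong E (img i)) (byi (toℕ i) i<3)
     where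
     byi : ∀ m → m ℕ.< 3 → E (setL (rem m L)) ≡ true
     byi 0 _ = eyz
     byi 1 _ = exz
     byi 2 _ = exy
     byi (suc (suc (suc m))) (s≤s (s≤s (s≤s ())))

 combs-⊆ : ∀ {A : Set} k (l : List A) {Y} → Y ∈ combs k l → Y ⊆ l × Len k Y
 combs-⊆ zero l (here refl) = minimum l , refl
 combs-⊆ (suc k) (x ∷ l) p with ∈-++⁻ (map (x ∷_) (combs k l)) p
 ... | inj₂ q = let s , e = combs-⊆ (suc k) l q in x ∷ʳ s , e
 ... | inj₁ q with ∈-map⁻ (x ∷_) q
 ... | Y , r , refl = let s , e = combs-⊆ k l r in refl ∷ s , cong suc e

 div-≤ : ∀ {c m X} → 0ℚ < m → c * m ≤ X → c ≤ inv m * X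
 div-≤ {c} {m} {X} m>0 h = ≤-trans (≤-reflexive (trans (sym (*-identityʳ c)) (trans (cong (c *_) (sym (inv-inverseˡ m (>0⇒≢0 m>0)))) (solve 3 (λ c i m → c :* (i :* m) := i :* (c :* m)) refl c (inv m) m)))) (mul-monoˡ (inv m) (inv≥0 (<⇒≤ m>0)) h)

 true-hasSize : ∀ {n} k (s : Subset n) → ∣ s ∣ ≡ k → hasSize k s ≡ true
 true-hasSize k s e with ∣ s ∣ ℕ.≟ k
 ... | yes _ = refl
 ... | no ne = ⊥-elim (ne e)

 bool-iff : ∀ a b → (a ≡ true → b ≡ true) → (b ≡ true → a ≡ true) → a ≡ b
 bool-iff true b f g = sym (f refl)
 bool-iff false true f g = g refl
 bool-iff false false f g = refl

 -- Uniform tuples: counts as expectations.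

 module Uni (n : ℕ) (ne : 0 ℕ.< n) where

   len : length (allFin n) ≡ n
   len = length-tabulate id

   MF : FullMean {Fin n} (λ _ → ⊤)
   MF = uniform (allFin n) (subst (0 ℕ.<_) (sym len) ne) ∈-allFin

   u : ℚ
   u = inv (length (allFin n) /1)

   u≥0 : 0ℚ ≤ u
   u≥0 = inv≥0 (/1≥0 (length (allFin n)))

   u*n : u * n /1 ≡ 1ℚ
   u*n = trans (cong (λ m → inv (m /1) * n /1) len) (inv-inverseˡ (n /1) (>0⇒≢0 (/1>0′ ne)))

   E-S : ∀ k φ → Eᴸ MF k φ ≡ pow u k * S n k φ
   E-S zero φ = sym (*-identityˡ _)
   E-S (suc k) φ = trans (cong (u *_) (trans (∑-cong (allFin n) (λ v _ → E-S k (λ l → φ (v ∷ l)))) (∑-* (allFin n) (pow u k) _))) (sym (*-assoc u (pow u k) _))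

   pow-n : ∀ k → pow u k * (n ℕ.^ k) /1 ≡ 1ℚ
   pow-n zero = solve 0 ((con 1ℚ) :* ((con 1ℚ) :+ (con 0ℚ)) := (con 1ℚ)) refl
   pow-n (suc k) = trans (cong (pow u (suc k) *_) (/1-* n (n ℕ.^ k))) (trans (solve 4 (λ u p n m → u :* p :* (n :* m) := (u :* n) :* (p :* m)) refl u (pow u k) (n /1) ((n ℕ.^ k) /1)) (trans (cong₂ _*_ u*n (pow-n k)) (*-identityˡ 1ℚ)))

   -- After division by the number of all `k`-tuples the additive error becomes `η` itself.
   Dense-E : ∀ k d η j (E : Hypergraph n) → Dense k d η j E → ∀ G → Uniform j G →
     d * Eᴸ MF k (λ l → 𝟙 (inc l) * 𝟙 (inKk j G (setL l))) - η ≤ Eᴸ MF k (λ l → 𝟙 (inc l) * (𝟙 (inKk j G (setL l)) * 𝟙 (E (setL l))))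
   Dense-E k d η j E D G U = ≤-trans (≤-reflexive (trans (cong₂ (λ a b → d * a - b) (E-S k _) (sym (trans (cong (η *_) (pow-n k)) (*-identityʳ η)))) (trans (solve 5 (λ d p s h m → d :* (p :* s) :- h :* (p :* m) := p :* (d :* s :- h :* m)) refl d (pow u k) _ η ((n ℕ.^ k) /1)) (cong (λ s → pow u k * (d * s - η * (n ℕ.^ k) /1)) (sym (countKk-S k j G))))))
     (≤-trans (mul-monoˡ (pow u k) (pow≥0 u≥0 k) (Dense-/1 k d η j E D G U)) (≤-reflexive (trans (cong (pow u k *_) (countKkE-S k j G E)) (sym (E-S k _)))))

 allB-∑ : ∀ {A : Set} (P : A → Bool) xs → 1ℚ ≤ 𝟙 (allB P xs) + ∑ xs (λ x → 𝟙 (not (P x)))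
 allB-∑ P [] = ≤-reflexive (sym (+-identityʳ 1ℚ))
 allB-∑ P (x ∷ xs) with P x
 ... | true = ≤-trans (allB-∑ P xs) (≤-reflexive (cong (𝟙 (allB P xs) +_) (sym (+-identityˡ _))))
 ... | false = ≤-by (∑ xs (λ x → 𝟙 (not (P x)))) (∑≥0 xs (λ x _ → 𝟙≥0 (not (P x)))) (+-identityˡ _)

 -- Cells of types and the transfer of the density hypothesis to them.

 module Heavy {V O : Set} (MV : FullMean {V} (λ _ → ⊤)) (_≟O_ : DecidableEquality O) (p N : ℕ) (τ : List V → O) (Ls : List O) (τ∈ : ∀ l → Len p l → τ l ∈ Ls)
   (η₂ : ℚ) (η₂≥0 : 0ℚ ≤ η₂) (lbl : List V → Bool) where
   open Cond (lists MV p) _≟O_ using (at; mass; at-refl; mass≥0)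

   is-heavy : O → Bool
   is-heavy o = η₂ ≤ᵇ mass τ o

   good : List V → Bool
   good zs = lbl zs ∧ allB (λ Y → is-heavy (τ Y)) (combs p zs)

   -- There are at most as many light classes as entries of `Ls`, each of mass at most `η₂`; so rare
   -- classes are avoided by a union bound.
   light-rare : Eᴸ MV p (λ Y → 𝟙 (not (is-heavy (τ Y)))) ≤ length Ls /1 * η₂
   light-rare = ≤-trans (E-mono M {g = λ Y → ∑ Ls (λ o → 𝟙 (not (is-heavy o)) * at τ o Y)} pointwise)
     (≤-trans (≤-reflexive (trans (sym (∑-swap Ls (lin M) (λ o Y → 𝟙 (not (is-heavy o)) * at τ o Y))) (∑-cong Ls (λ o _ → E-* M (𝟙 (not (is-heavy o))) (at τ o)))))
     (∑-≤const Ls η₂ (λ o _ → each o (is-heavy o) refl)))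
     where
     M = mean (lists MV p)
     pointwise : ∀ Y → Len p Y → 𝟙 (not (is-heavy (τ Y))) ≤ ∑ Ls (λ o → 𝟙 (not (is-heavy o)) * at τ o Y)
     pointwise Y l = ≤-trans (≤-reflexive (trans (sym (*-identityʳ _)) (cong (𝟙 (not (is-heavy (τ Y))) *_) (sym (at-refl τ Y refl)))))
       (∑-≥term Ls (λ o _ → mul≥0 (𝟙≥0 (not (is-heavy o))) (𝟙≥0 ⌊ τ Y ≟O o ⌋)) (τ∈ Y l))
     each : ∀ o b → (η₂ ≤ᵇ mass τ o) ≡ b → 𝟙 (not b) * mass τ o ≤ η₂
     each o true e = ≤-trans (≤-reflexive (zeroˡ _)) η₂≥0
     each o false e = ≤-trans (≤-reflexive (*-identityˡ _)) (<⇒≤ (≰ᵇ⇒> e))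

   good-likely : Eᴸ MV N (λ zs → 𝟙 (lbl zs)) - ncomb N p /1 * (length Ls /1 * η₂) ≤ Eᴸ MV N (λ zs → 𝟙 (good zs))
   good-likely = ≤-trans (+-mono-≤ (E-mono M pointwise) (neg-antimono-≤ (≤-trans (≤-reflexive (E-combs MV N p (λ Y → 𝟙 (not (is-heavy (τ Y)))))) (mul-monoˡ (ncomb N p /1) (/1≥0 (ncomb N p)) light-rare))))
     (≤-reflexive (trans (cong (_- E M bad) (E-+ M (λ zs → 𝟙 (good zs)) bad)) (solve 2 (λ a b → a :+ b :- b := a) refl (E M (λ zs → 𝟙 (good zs))) (E M bad))))
     where
     M = mean (lists MV N)
     bad : List V → ℚ
     bad zs = ∑ (combs p zs) (λ Y → 𝟙 (not (is-heavy (τ Y))))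
     pointwise : ∀ zs → Len N zs → 𝟙 (lbl zs) ≤ 𝟙 (good zs) + bad zs
     pointwise zs _ with lbl zs
     ... | true = allB-∑ (λ Y → is-heavy (τ Y)) (combs p zs)
     ... | false = add≥0 ≤-refl (∑≥0 (combs p zs) (λ Y _ → 𝟙≥0 (not (is-heavy (τ Y)))))

   good-lbl : ∀ zs → good zs ≡ true → lbl zs ≡ true
   good-lbl zs e = proj₁ (∧-true (lbl zs) _ e)

   good-heavy : ∀ zs → good zs ≡ true → ∀ {Y} → Y ⊆ zs → Len p Y → η₂ ≤ mass τ (τ Y)
   good-heavy zs e {Y} sub l = ≤ᵇ⇒≤ (allB-∈ (λ Y → is-heavy (τ Y)) (combs p zs) (proj₂ (∧-true (lbl zs) _ e)) (subst (λ m → Y ∈ combs m zs) l (⊆-combs sub)))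

 -- One reason for treating `k ≥ 4` separately: used for two successive deletions, it needs at least
 -- two entries to remain for a comparison.
 inc-from : ∀ {L} (l : List (Fin L)) → 3 ℕ.≤ length l → (∀ j → j ℕ.< length l → inc (rem j l) ≡ true) → inc l ≡ true
 inc-from (x ∷ y ∷ z ∷ T) _ h = ∧-intro (proj₁ (∧-true ⌊ x Fin.<? y ⌋ _ (h 2 (s≤s (s≤s (s≤s z≤n)))))) (h 0 (s≤s z≤n))
 inc-from [] () h
 inc-from (x ∷ []) (s≤s ()) h
 inc-from (x ∷ y ∷ []) (s≤s (s≤s ())) h

 ∈-from : ∀ {A : Set} (P : A → Set) (l : List A) → 2 ℕ.≤ length l → (∀ j → j ℕ.< length l → ∀ {x} → x ∈ rem j l → P x) → ∀ {x} → x ∈ l → P x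
 ∈-from P (x ∷ y ∷ T) _ h (here refl) = h 1 (s≤s (s≤s z≤n)) (here refl)
 ∈-from P (x ∷ y ∷ T) _ h (there p) = h 0 (s≤s z≤n) p
 ∈-from P (x ∷ []) (s≤s ()) h p

 ≡-from : ∀ {A : Set} (l l' : List A) → 2 ℕ.≤ length l → length l ≡ length l' → (∀ j → j ℕ.< length l → rem j l ≡ rem j l') → l ≡ l'
 ≡-from (x ∷ y ∷ T) (x' ∷ y' ∷ T') _ _ h with h 0 (s≤s z≤n) | h 1 (s≤s (s≤s z≤n))
 ... | refl | refl = refl
 ≡-from (x ∷ []) l' (s≤s ()) e h

 lookup-< : ∀ {L} (x y : Fin L) → ⌊ x Fin.<? y ⌋ ≡ true → x Fin.< y
 lookup-< x y e with x Fin.<? y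
 ... | yes p = p

 inc-map-inj : ∀ {n L} (lab : Fin n → Fin L) Y → inc (map lab Y) ≡ true → ∀ {x y} → x ∈ Y → y ∈ Y → lab x ≡ lab y → x ≡ y
 inc-map-inj lab (z ∷ Y) e (here refl) (here refl) q = refl
 inc-map-inj lab (z ∷ Y) e (here refl) (there y∈) q = ⊥-elim (ℕ.<-irrefl (cong toℕ q) (above-< (lab z) (map lab Y) e (∈-map⁺ lab y∈)))
 inc-map-inj lab (z ∷ Y) e (there x∈) (here refl) q = ⊥-elim (ℕ.<-irrefl (cong toℕ (sym q)) (above-< (lab z) (map lab Y) e (∈-map⁺ lab x∈)))
 inc-map-inj lab (z ∷ Y) e (there x∈) (there y∈) q = inc-map-inj lab Y (inc-tail (lab z) (map lab Y) e) x∈ y∈ q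

 map-inj-on : ∀ {A B : Set} (f : A → B) (Y : List A) → (∀ {x y} → x ∈ Y → y ∈ Y → f x ≡ f y → x ≡ y) → ∀ l l' → (∀ {x} → x ∈ l → x ∈ Y) → (∀ {x} → x ∈ l' → x ∈ Y) → map f l ≡ map f l' → l ≡ l'
 map-inj-on f Y inj [] [] _ _ _ = refl
 map-inj-on f Y inj (x ∷ l) (y ∷ l') s s' e = cong₂ _∷_ (inj (s (here refl)) (s' (here refl)) (∷-injectiveˡ e)) (map-inj-on f Y inj l l' (s ∘ there) (s' ∘ there) (∷-injectiveʳ e))

 inc-map⁻ : ∀ {n L} (lab : Fin n → Fin L) → (∀ x y → lab x Fin.< lab y → x Fin.< y) → ∀ Z → inc (map lab Z) ≡ true → inc Z ≡ true
 inc-map⁻ lab mono [] e = refl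
 inc-map⁻ lab mono (x ∷ []) e = refl
 inc-map⁻ lab mono (x ∷ y ∷ Z) e = ∧-intro lt (inc-map⁻ lab mono (y ∷ Z) (inc-tail (lab x) (map lab (y ∷ Z)) e))
   where
   lt : ⌊ x Fin.<? y ⌋ ≡ true
   lt with x Fin.<? y
   ... | yes _ = refl
   ... | no no' = ⊥-elim (no' (mono x y (lookup-< (lab x) (lab y) (proj₁ (∧-true ⌊ lab x Fin.<? lab y ⌋ _ e)))))

 module Labelled {n L : ℕ} (lab : Fin n → Fin L) (lab-mono : ∀ x y → lab x Fin.< lab y → x Fin.< y) (E : Hypergraph n) where

   B : Set
   B = Bool × Subset L

   _≟B_ : DecidableEquality B
   _≟B_ = Prod.≡-dec Bool._≟_ (Vec.≡-dec Bool._≟_)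

   Bs : List B
   Bs = cartesianProduct (true ∷ false ∷ []) (allSubsets L)

   -- Besides the edge, a colour records the block labels of the tuple, so equal types imply equal
   -- labels position by position.
   col : List (Fin n) → B
   col l = E (setL l) , setL (map lab l)

   col-Bs : ∀ l → col l ∈ Bs
   col-Bs l = ∈-cartesianProduct⁺ (bools (E (setL l))) (∈-allSubsets (setL (map lab l)))
     where
     bools : ∀ b → b ∈ true ∷ false ∷ []
     bools true = here refl
     bools false = there (here refl)

   map-∈ : ∀ (l l' : List (Fin n)) → (∀ v → v ∈ l → v ∈ l') → ∀ v → v ∈ map lab l → v ∈ map lab l'
   map-∈ l l' h v p with ∈-map⁻ lab p
   ... | x , x∈ , refl = ∈-map⁺ lab (h x x∈)

   col-set : ∀ l l' → (∀ v → v ∈ l → v ∈ l') → (∀ v → v ∈ l' → v ∈ l) → col l ≡ col l'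
   col-set l l' to from = cong₂ _,_ (cong E (setL-cong l l' to from)) (setL-cong (map lab l) (map lab l') (map-∈ l l' to) (map-∈ l' l from))

   open Types Fin._≟_ _≟B_ col col-set public using (tp; _≟T_; Same; same-⊂; same-col; Same-tp)

   tp-lab : ∀ {p} w (A A' : List (Fin n)) → Len p A → Len p A' → tp (A ++ w) ≡ tp (A' ++ w) → map lab A ≡ map lab A'
   tp-lab w = zipped (λ A A' → tp (A ++ w) ≡ tp (A' ++ w) → map lab A ≡ map lab A')
     (λ Π e → trans (sym (map-∘ Π)) (trans (map-∈-≡ Π (λ {x} x∈ → one x (same-⊂ {π' = x ∷ []} (Same-tp Π w e) (λ { (here refl) → ∈-++⁺ˡ x∈ })))) (map-∘ Π)))
     where
     one : ∀ x → Same (x ∷ []) → lab (proj₁ x) ≡ lab (proj₂ x)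
     one x s with ∈-setL⁻ (lab (proj₂ x) ∷ []) (subst (lab (proj₁ x) ∈ₛ_) (cong proj₂ (same-col {x ∷ []} s)) (∈-setL⁺ (lab (proj₁ x) ∷ []) (here refl)))
     ... | here e = e

   module Cells (q : ℕ) (w : List (Fin n)) where

     k : ℕ
     k = suc (suc q)

     low : List (Fin n) → List (List (List B))
     low Z = map (λ j → map (λ l → tp (rem l (rem j Z) ++ w)) (upTo (suc q))) (upTo k)

     low⇒ : ∀ {Z Y} → low Z ≡ low Y → ∀ {j l} → j ℕ.< k → l ℕ.< suc q → tp (rem l (rem j Z) ++ w) ≡ tp (rem l (rem j Y) ++ w)
     low⇒ {Z} {Y} e {j} {l} j< l< = map-≡-∈ {f = λ l → tp (rem l (rem j Z) ++ w)} {g = λ l → tp (rem l (rem j Y) ++ w)} (upTo (suc q))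
       (map-≡-∈ {f = λ j → map (λ l → tp (rem l (rem j Z) ++ w)) (upTo (suc q))} {g = λ j → map (λ l → tp (rem l (rem j Y) ++ w)) (upTo (suc q))} (upTo k) e (∈-upTo⁺ j<)) (∈-upTo⁺ l<)

     ⇒low : ∀ {Z Y} → (∀ {j l} → j ℕ.< k → l ℕ.< suc q → tp (rem l (rem j Z) ++ w) ≡ tp (rem l (rem j Y) ++ w)) → low Z ≡ low Y
     ⇒low h = map-∈-≡ (upTo k) (λ j∈ → map-∈-≡ (upTo (suc q)) (λ l∈ → h (∈-upTo⁻ j∈) (∈-upTo⁻ l∈)))

     low-lab : 1 ℕ.≤ q → ∀ Z Y → Len k Z → Len k Y → low Z ≡ low Y → map lab Z ≡ map lab Y
     low-lab 1≤q Z Y lz ly e = ≡-from (map lab Z) (map lab Y) (ℕ.≤-trans (s≤s (s≤s z≤n)) (ℕ.≤-reflexive (sym lz'))) (trans lz' (sym ly'))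
       (λ j j< → subst₂ _≡_ (map-rem lab j Z) (map-rem lab j Y) (inner j (subst (j ℕ.<_) lz' j<)))
       where
       lz' : length (map lab Z) ≡ k
       lz' = trans (length-map lab Z) lz
       ly' : length (map lab Y) ≡ k
       ly' = trans (length-map lab Y) ly
       len-rem : ∀ j Z → j ℕ.< k → Len k Z → length (map lab (rem j Z)) ≡ suc q
       len-rem j Z j< lz = trans (length-map lab (rem j Z)) (suc-inj (trans (length-rem j Z (subst (j ℕ.<_) (sym lz) j<)) lz))
       inner : ∀ j → j ℕ.< k → map lab (rem j Z) ≡ map lab (rem j Y)
       inner j j< = ≡-from (map lab (rem j Z)) (map lab (rem j Y)) (ℕ.≤-trans (s≤s 1≤q) (ℕ.≤-reflexive (sym (len-rem j Z j< lz)))) (trans (len-rem j Z j< lz) (sym (len-rem j Y j< ly)))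
         (λ l l< → subst₂ _≡_ (map-rem lab l (rem j Z)) (map-rem lab l (rem j Y))
           (let l<' = subst (l ℕ.<_) (len-rem j Z j< lz) l< in tp-lab w (rem l (rem j Z)) (rem l (rem j Y)) (len-rem-rem q Z lz j< l<') (len-rem-rem q Y ly j< l<') (low⇒ {Z} {Y} e j< l<')))

     low-inc : 1 ℕ.≤ q → ∀ Z Y → Len k Z → Len k Y → inc (map lab Y) ≡ true → low Z ≡ low Y → inc Z ≡ true
     low-inc 1≤q Z Y lz ly iy e = inc-map⁻ lab lab-mono Z (subst (λ l → inc l ≡ true) (sym (low-lab 1≤q Z Y lz ly e)) iy)

     module Transversal (2≤q : 2 ℕ.≤ q) (Y : List (Fin n)) (ly : Len k Y) (iy : inc (map lab Y) ≡ true) where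

       match : List (Fin n) → List (Fin n) → Bool
       match t A = ⌊ tp (t ++ w) ≟T tp (A ++ w) ⌋

       match-true : ∀ {t A} → match t A ≡ true → tp (t ++ w) ≡ tp (A ++ w)
       match-true {t} {A} e with tp (t ++ w) ≟T tp (A ++ w)
       ... | yes p = p

       true-match : ∀ {t A} → tp (t ++ w) ≡ tp (A ++ w) → match t A ≡ true
       true-match {t} {A} e with tp (t ++ w) ≟T tp (A ++ w)
       ... | yes p = refl
       ... | no ne = ⊥-elim (ne e)

       -- The labels of `Y` are distinct and increasing, so a `k`-set cannot realise the lower types
       -- of `Y` in a different arrangement: the cliques of this hypergraph are exactly the cell of
       -- `Y`.
       G : Hypergraph n
       G t = hasSize q t ∧ any (match (elems t)) (combs q Y)

       G-uniform : Uniform q G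
       G-uniform t e = hasSize-true q t (proj₁ (∧-true (hasSize q t) _ e))

       1≤q : 1 ℕ.≤ q
       1≤q = ℕ.≤-trans (s≤s z≤n) 2≤q

       cell⇐ : ∀ Z → Len k Z → low Z ≡ low Y → inc Z ≡ true × inKk q G (setL Z) ≡ true
       cell⇐ Z lz e = iz , ⇒inKk-list q G Z iz lz in-G
         where
         iz : inc Z ≡ true
         iz = low-inc 1≤q Z Y lz ly iy e
         in-G : ∀ {j l} → j ℕ.< k → l ℕ.< suc q → G (setL (rem l (rem j Z))) ≡ true
         in-G {j} {l} j< l< = ∧-intro size (subst (λ t → any (match t) (combs q Y) ≡ true) (sym (elems-setL A iA))
             (∃-any (match A) (combs q Y) (subst (λ m → rem l (rem j Y) ∈ combs m Y) (len-rem-rem q Y ly j< l<) (⊆-combs (⊆-trans (rem-⊆ l _) (rem-⊆ j Y)))) (true-match {A} {rem l (rem j Y)} (low⇒ {Z} {Y} e j< l<))))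
           where
           A = rem l (rem j Z)
           iA : inc A ≡ true
           iA = ⊆-inc (⊆-trans (rem-⊆ l _) (rem-⊆ j Z)) iz
           size : hasSize q (setL A) ≡ true
           size = true-hasSize q (setL A) (trans (size-setL A iA) (len-rem-rem q Z lz j< l<))

       -- The labels of the small subtuples reassemble to an increasing list of labels of `Z` inside
       -- that of `Y`, hence equal to it. As labels are injective on `Y`, every subtuple of `Z`
       -- matches the one of `Y` at the same positions.
       cell⇒ : ∀ Z → Len k Z → inc Z ≡ true → inKk q G (setL Z) ≡ true → low Z ≡ low Y
       cell⇒ Z lz iz e = ⇒low {Z} {Y} final
         where
         found : ∀ {j l} → j ℕ.< k → l ℕ.< suc q → ∃ λ A → (A ⊆ Y × Len q A) × tp (rem l (rem j Z) ++ w) ≡ tp (A ++ w)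
         found {j} {l} j< l< with any-∃ (match (elems (setL (rem l (rem j Z))))) (combs q Y) (proj₂ (∧-true (hasSize q (setL (rem l (rem j Z)))) _ (inKk-list⇒ q G Z iz lz e j< l<)))
         ... | A , A∈ , m = A , combs-⊆ q Y A∈ , trans (cong (λ t → tp (t ++ w)) (sym (elems-setL (rem l (rem j Z)) (⊆-inc (⊆-trans (rem-⊆ l _) (rem-⊆ j Z)) iz)))) (match-true {elems (setL (rem l (rem j Z)))} {A} m)
         λZ λY : List (Fin L)
         λZ = map lab Z
         λY = map lab Y
         lz' : length λZ ≡ k
         lz' = trans (length-map lab Z) lz
         labs : ∀ {j l} → j ℕ.< k → l ℕ.< suc q → ∃ λ A → A ⊆ Y × rem l (rem j λZ) ≡ map lab A
         labs {j} {l} j< l< with found j< l<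
         ... | A , (A⊆ , la) , t = A , A⊆ , trans (sym (trans (map-rem lab l (rem j Z)) (cong (rem l) (map-rem lab j Z)))) (tp-lab w (rem l (rem j Z)) A (len-rem-rem q Z lz j< l<) la t)
         len-rem : ∀ j → j ℕ.< k → length (rem j λZ) ≡ suc q
         len-rem j j< = suc-inj (trans (length-rem j λZ (subst (j ℕ.<_) (sym lz') j<)) lz')
         ⊆-map : ∀ {A Y : List (Fin n)} → A ⊆ Y → map lab A ⊆ map lab Y
         ⊆-map [] = []
         ⊆-map (y ∷ʳ p) = lab y ∷ʳ ⊆-map p
         ⊆-map (refl ∷ p) = refl ∷ ⊆-map p
         inc-λZ : inc λZ ≡ true
         inc-λZ = inc-from λZ (ℕ.≤-trans (s≤s (ℕ.≤-trans 2≤q (ℕ.n≤1+n q))) (ℕ.≤-reflexive (sym lz')))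
           (λ j j< → let j<' = subst (j ℕ.<_) lz' j< in inc-from (rem j λZ) (ℕ.≤-trans (s≤s 2≤q) (ℕ.≤-reflexive (sym (len-rem j j<'))))
             (λ l l< → let A , A⊆ , eq = labs j<' (subst (l ℕ.<_) (len-rem j j<') l<) in subst (λ t → inc t ≡ true) (sym eq) (⊆-inc (⊆-map A⊆) iy)))
         λZ∈ : ∀ {x} → x ∈ λZ → x ∈ λY
         λZ∈ = ∈-from (_∈ λY) λZ (ℕ.≤-trans (s≤s (s≤s z≤n)) (ℕ.≤-reflexive (sym lz')))
           (λ j j< → let j<' = subst (j ℕ.<_) lz' j< in ∈-from (_∈ λY) (rem j λZ) (ℕ.≤-trans (s≤s 1≤q) (ℕ.≤-reflexive (sym (len-rem j j<'))))
             (λ l l< {x} x∈ → let A , A⊆ , eq = labs j<' (subst (l ℕ.<_) (len-rem j j<') l<) in ⊆⇒∈ (⊆-map A⊆) (subst (x ∈_) eq x∈)))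
         λZ≡λY : λZ ≡ λY
         λZ≡λY = same-length-⊆ (inc-⊆ λZ λY inc-λZ iy λZ∈) (trans lz' (sym (trans (length-map lab Y) ly)))
         final : ∀ {j l} → j ℕ.< k → l ℕ.< suc q → tp (rem l (rem j Z) ++ w) ≡ tp (rem l (rem j Y) ++ w)
         final {j} {l} j< l< with found j< l<
         ... | A , (A⊆ , la) , t = trans t (cong (λ A → tp (A ++ w)) (map-inj-on lab Y (inc-map-inj lab Y iy) A (rem l (rem j Y)) (⊆⇒∈ A⊆) (⊆⇒∈ (⊆-trans (rem-⊆ l _) (rem-⊆ j Y)))
             (trans (sym (tp-lab w (rem l (rem j Z)) A (len-rem-rem q Z lz j< l<) la t))
             (trans (map-rem lab l (rem j Z)) (trans (cong (rem l) (map-rem lab j Z)) (trans (cong (λ t → rem l (rem j t)) λZ≡λY) (sym (trans (map-rem lab l (rem j Y)) (cong (rem l) (map-rem lab j Y))))))))))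

       cell-𝟙 : ∀ Z → Len k Z → 𝟙 (inc Z) * 𝟙 (inKk q G (setL Z)) ≡ 𝟙 ⌊ ≡-dec (≡-dec (≡-dec _≟B_)) (low Z) (low Y) ⌋
       cell-𝟙 Z lz = both (inc Z) (inKk q G (setL Z)) (≡-dec (≡-dec (≡-dec _≟B_)) (low Z) (low Y)) (cell⇒ Z lz) (cell⇐ Z lz)
         where
         both : ∀ a b (D : Dec (low Z ≡ low Y)) → (a ≡ true → b ≡ true → low Z ≡ low Y) → (low Z ≡ low Y → a ≡ true × b ≡ true) → 𝟙 a * 𝟙 b ≡ 𝟙 ⌊ D ⌋
         both a b (yes e) f g with g e
         ... | refl , refl = *-identityˡ 1ℚ
         both false b (no ne) f g = zeroˡ (𝟙 b)
         both true false (no ne) f g = zeroʳ 1ℚ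
         both true true (no ne) f g = ⊥-elim (ne (f refl refl))

 module _ {n L : ℕ} (ne : 0 ℕ.< n) (lab : Fin n → Fin L) (lab-mono : ∀ x y → lab x Fin.< lab y → x Fin.< y) (H : Hypergraph n) where
   open Labelled lab lab-mono H
   open Uni n ne using (MF; Dense-E)

   dens : ℕ → List (Fin n) → List (Fin n) → ℚ
   dens q w Y = density Fin._≟_ _≟B_ col col-set proj₁ MF (suc q) w Y

   massL : ∀ q (w Y : List (Fin n)) → ℚ
   massL q w Y = Cond.mass (lists MF (suc (suc q))) (≡-dec (≡-dec (≡-dec _≟B_))) (Cells.low q w) (Cells.low q w Y)

   -- The cell is itself of the form K_k(G), so the hypothesis speaks about it directly; its mass of
   -- at least `η₂` turns the additive error `η` into a relative error `ε'`.
   dens-transversal : ∀ q w → 2 ℕ.≤ q → ∀ Y → Len (suc (suc q)) Y → inc (map lab Y) ≡ true → ∀ d η ε' η₂ → Dense (suc (suc q)) d η q H →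
     0ℚ < η₂ → 0ℚ ≤ ε' → η ≤ ε' * η₂ → η₂ ≤ massL q w Y → d - ε' ≤ dens q w Y
   dens-transversal q w 2≤q Y ly iy d η ε' η₂ D η₂>0 ε'≥0 η-small heavy = div-≤ {m = m} (<-≤-trans η₂>0 heavy)
       (≤-trans (≤-sub (≤-trans (add≥0 (mul≥0 ε'≥0 (sub≥0 heavy)) (sub≥0 η-small)) (≤-reflexive (solve 5 (λ d e m h g → e :* (m :- g) :+ (e :* g :- h) := d :* m :- h :- (d :- e) :* m) refl d ε' m η η₂))))
       (≤-trans (≤-reflexive (cong (λ x → d * x - η) (E-cong M {f = at} {g = λ Z → 𝟙 (inc Z) * 𝟙 (inKk q G (setL Z))} (λ Z lz → sym (cell-𝟙 Z lz)))))
       (≤-trans (Dense-E (suc (suc q)) d η q H D G G-uniform)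
       (≤-reflexive (E-cong M {f = λ Z → 𝟙 (inc Z) * (𝟙 (inKk q G (setL Z)) * 𝟙 (H (setL Z)))} {g = λ Z → at Z * 𝟙 (H (setL Z))} (λ Z lz → trans (sym (*-assoc (𝟙 (inc Z)) (𝟙 (inKk q G (setL Z))) (𝟙 (H (setL Z))))) (cong (_* 𝟙 (H (setL Z))) (cell-𝟙 Z lz))))))))
     where
     open Cells q w
     open Transversal 2≤q Y ly iy
     M = mean (lists MF (suc (suc q)))
     m : ℚ
     m = massL q w Y
     at : List (Fin n) → ℚ
     at Z = 𝟙 ⌊ ≡-dec (≡-dec (≡-dec _≟B_)) (low Z) (low Y) ⌋

 -- The minimum of a multi-affine function over the cube is attained at a vertex.

 upd : ∀ {n} → (Fin n → ℚ) → Fin n → ℚ → Fin n → ℚ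
 upd ψ v c x = if ⌊ x Fin.≟ v ⌋ then c else ψ x

 upd-other : ∀ {n} (ψ : Fin n → ℚ) v c x → x ≢ v → upd ψ v c x ≡ ψ x
 upd-other ψ v c x ne with x Fin.≟ v
 ... | yes e = ⊥-elim (ne e)
 ... | no _ = refl

 prodL : ∀ {A : Set} → (A → ℚ) → List A → ℚ
 prodL ψ [] = 1ℚ
 prodL ψ (x ∷ Z) = ψ x * prodL ψ Z

 prodL-cong : ∀ {A : Set} {ψ φ : A → ℚ} Z → (∀ x → x ∈ Z → ψ x ≡ φ x) → prodL ψ Z ≡ prodL φ Z
 prodL-cong [] h = refl
 prodL-cong (x ∷ Z) h = cong₂ _*_ (h x (here refl)) (prodL-cong Z (λ y → h y ∘ there))

 prodL-upd : ∀ {n} (ψ : Fin n → ℚ) v c Z → ¬ v ∈ Z → prodL (upd ψ v c) Z ≡ prodL ψ Z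
 prodL-upd ψ v c Z v∉ = prodL-cong Z (λ x x∈ → upd-other ψ v c x (λ { refl → v∉ x∈ }))

 -- An increasing list contains `v` at most once, so the value at `v` enters the product to degree
 -- at most one.
 prodL-affine : ∀ {n} (ψ : Fin n → ℚ) v Z → inc Z ≡ true → prodL ψ Z ≡ ψ v * prodL (upd ψ v 1ℚ) Z + (1ℚ - ψ v) * prodL (upd ψ v 0ℚ) Z
 prodL-affine ψ v [] _ = solve 1 (λ a → (con 1ℚ) := a :* (con 1ℚ) :+ ((con 1ℚ) :- a) :* (con 1ℚ)) refl (ψ v)
 prodL-affine ψ v (x ∷ Z) i with x Fin.≟ v
 ... | no ne = trans (cong (ψ x *_) (prodL-affine ψ v Z (inc-tail x Z i))) (solve 4 (λ x a p q → x :* (a :* p :+ ((con 1ℚ) :- a) :* q) := a :* (x :* p) :+ ((con 1ℚ) :- a) :* (x :* q)) refl (ψ x) (ψ v) _ _)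
 ... | yes refl = trans (solve 2 (λ a r → a :* r := a :* ((con 1ℚ) :* r) :+ ((con 1ℚ) :- a) :* ((con 0ℚ) :* r)) refl (ψ x) (prodL ψ Z)) (sym (cong₂ (λ p q → ψ x * (1ℚ * p) + (1ℚ - ψ x) * (0ℚ * q)) (prodL-upd ψ x 1ℚ Z x∉) (prodL-upd ψ x 0ℚ Z x∉)))
   where
   x∉ : ¬ x ∈ Z
   x∉ x∈ = ℕ.<-irrefl refl (above-< x Z i x∈)

 module Rounding {n : ℕ} (MV : FullMean {Fin n} (λ _ → ⊤)) (k : ℕ) (a : List (Fin n) → ℚ) where
   private
     M = mean (lists MV k)

   Φ : (Fin n → ℚ) → ℚ
   Φ ψ = E M (λ Z → 𝟙 (inc Z) * (a Z * prodL ψ Z))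

   Φ-affine : ∀ ψ v → Φ ψ ≡ ψ v * Φ (upd ψ v 1ℚ) + (1ℚ - ψ v) * Φ (upd ψ v 0ℚ)
   Φ-affine ψ v = trans (E-cong M (λ Z _ → each Z (inc Z) refl)) (trans (E-+ M (λ Z → ψ v * g 1ℚ Z) (λ Z → (1ℚ - ψ v) * g 0ℚ Z)) (cong₂ _+_ (E-* M (ψ v) (g 1ℚ)) (E-* M (1ℚ - ψ v) (g 0ℚ))))
     where
     g : ℚ → List (Fin n) → ℚ
     g c Z = 𝟙 (inc Z) * (a Z * prodL (upd ψ v c) Z)
     each : ∀ Z b → inc Z ≡ b → 𝟙 b * (a Z * prodL ψ Z) ≡ ψ v * (𝟙 b * (a Z * prodL (upd ψ v 1ℚ) Z)) + (1ℚ - ψ v) * (𝟙 b * (a Z * prodL (upd ψ v 0ℚ) Z))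
     each Z true i = trans (cong (λ x → 1ℚ * (a Z * x)) (prodL-affine ψ v Z i)) (solve 4 (λ a t p q → (con 1ℚ) :* (a :* (t :* p :+ ((con 1ℚ) :- t) :* q)) := t :* ((con 1ℚ) :* (a :* p)) :+ ((con 1ℚ) :- t) :* ((con 1ℚ) :* (a :* q))) refl (a Z) (ψ v) _ _)
     each Z false i = solve 4 (λ x y z t → (con 0ℚ) :* x := t :* ((con 0ℚ) :* y) :+ ((con 1ℚ) :- t) :* ((con 0ℚ) :* z)) refl _ _ _ (ψ v)

   round : ∀ c → (∀ (b : Fin n → Bool) → c ≤ Φ (𝟙 ∘ b)) → ∀ ψ → (∀ v → ψ v ∈[0,1]) → c ≤ Φ ψ
   -- The coordinates still to be rounded are listed, the others agree with the Boolean function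
   -- carried along. At the start none is rounded, so that function may be anything.
   round c bool ψ ψ∈ = go (allFin n) ψ (λ _ → true) ψ∈ (λ v → inj₁ (∈-allFin v))
     where
     go : ∀ (vs : List (Fin n)) ψ (b : Fin n → Bool) → (∀ v → ψ v ∈[0,1]) → (∀ v → v ∈ vs ⊎ ψ v ≡ 𝟙 (b v)) → c ≤ Φ ψ
     go [] ψ b ψ∈ h = ≤-trans (bool b) (≤-reflexive (E-cong M (λ Z _ → cong (λ x → 𝟙 (inc Z) * (a Z * x)) (prodL-cong Z (λ x _ → is x)))))
       where
       is : ∀ x → 𝟙 (b x) ≡ ψ x
       is x with h x
       ... | inj₂ e = sym e
     go (v ∷ vs) ψ b ψ∈ h = ≤-trans (≤-reflexive (solve 2 (λ c t → c := t :* c :+ ((con 1ℚ) :- t) :* c) refl c (ψ v)))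
         (≤-trans (+-mono-≤ (mul-monoˡ (ψ v) (proj₁ (ψ∈ v)) (at true)) (mul-monoˡ (1ℚ - ψ v) (sub≥0 (proj₂ (ψ∈ v))) (at false))) (≤-reflexive (sym (Φ-affine ψ v))))
       where
       at : ∀ s → c ≤ Φ (upd ψ v (𝟙 s))
       at s = go vs (upd ψ v (𝟙 s)) (λ x → if ⌊ x Fin.≟ v ⌋ then s else b x) in01 fixed
         where
         in01 : ∀ x → upd ψ v (𝟙 s) x ∈[0,1]
         in01 x with x Fin.≟ v
         ... | yes _ = 𝟙∈ s
         ... | no _ = ψ∈ x
         fixed : ∀ x → x ∈ vs ⊎ upd ψ v (𝟙 s) x ≡ 𝟙 (if ⌊ x Fin.≟ v ⌋ then s else b x)
         fixed x with x Fin.≟ v | h x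
         ... | yes _ | _ = inj₂ refl
         ... | no _ | inj₂ e = inj₂ e
         ... | no ne | inj₁ (here e) = ⊥-elim (ne e)
         ... | no _ | inj₁ (there p) = inj₁ p

 -- Triples (k = 3)

 -- For uniformity 1, `G` is a vertex set and its cliques are the triples inside it; so the
 -- hypothesis is a lower bound for `Φ` at the vertices of the cube.
 Dense-triples : ∀ {n} (ne : 0 ℕ.< n) d η (H : Hypergraph n) → Dense 3 d η 1 H → ∀ (b : Fin n → Bool) →
   - η ≤ Rounding.Φ (Uni.MF n ne) 3 (λ Z → 𝟙 (H (setL Z)) - d) (𝟙 ∘ b)
 Dense-triples {n} ne d η H D b = ≤-sub (≤-trans (sub≥0 (Uni.Dense-E n ne 3 d η 1 H D G G-uniform)) (≤-reflexive (sym (trans (cong (_- (- η)) split) (solve 4 (λ a b d h → a :- d :* b :- (:- h) := a :- (d :* b :- h)) refl (E M fK) (E M K) d η)))))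
   where
   M = mean (lists (Uni.MF n ne) 3)
   G : Hypergraph n
   G t = hasSize 1 t ∧ allB b (elems t)
   G-uniform : Uniform 1 G
   G-uniform t e = hasSize-true 1 t (proj₁ (∧-true (hasSize 1 t) _ e))
   K fK : List (Fin n) → ℚ
   K Z = 𝟙 (inc Z) * 𝟙 (inKk 1 G (setL Z))
   fK Z = 𝟙 (inc Z) * (𝟙 (inKk 1 G (setL Z)) * 𝟙 (H (setL Z)))
   single : ∀ x → G (setL (x ∷ [])) ≡ b x
   single x = trans (cong₂ _∧_ (true-hasSize 1 (setL (x ∷ [])) (size-setL (x ∷ []) refl)) (cong (allB b) (elems-setL (x ∷ []) refl))) (Bool.∧-identityʳ (b x))
   K-prod : ∀ Z → Len 3 Z → inc Z ≡ true → 𝟙 (inKk 1 G (setL Z)) ≡ prodL (𝟙 ∘ b) Z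
   K-prod (x ∷ y ∷ z ∷ []) refl i = trans (cong 𝟙 eq) (trans (𝟙-∧ (b x) _) (cong (𝟙 (b x) *_) (trans (𝟙-∧ (b y) (b z)) (cong (𝟙 (b y) *_) (sym (*-identityʳ _))))))
     where
     from : inKk 1 G (setL (x ∷ y ∷ z ∷ [])) ≡ true → b x ∧ (b y ∧ b z) ≡ true
     from e = let h = λ {j} {l} → inKk-list⇒ 1 G (x ∷ y ∷ z ∷ []) i refl e {j} {l} in
       ∧-intro (trans (sym (single x)) (h {1} {1} (s≤s (s≤s z≤n)) (s≤s (s≤s z≤n)))) (∧-intro (trans (sym (single y)) (h {0} {1} (s≤s z≤n) (s≤s (s≤s z≤n)))) (trans (sym (single z)) (h {0} {0} (s≤s z≤n) (s≤s z≤n))))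
     to : b x ∧ (b y ∧ b z) ≡ true → inKk 1 G (setL (x ∷ y ∷ z ∷ [])) ≡ true
     to e = ⇒inKk-list 1 G (x ∷ y ∷ z ∷ []) i refl pick
       where
       bx = proj₁ (∧-true (b x) _ e)
       by = proj₁ (∧-true (b y) _ (proj₂ (∧-true (b x) _ e)))
       bz = proj₂ (∧-true (b y) _ (proj₂ (∧-true (b x) _ e)))
       pick : ∀ {j l} → j ℕ.< 3 → l ℕ.< 2 → G (setL (rem l (rem j (x ∷ y ∷ z ∷ [])))) ≡ true
       pick {0} {0} _ _ = trans (single z) bz
       pick {0} {1} _ _ = trans (single y) by
       pick {1} {0} _ _ = trans (single z) bz
       pick {1} {1} _ _ = trans (single x) bx
       pick {2} {0} _ _ = trans (single y) by
       pick {2} {1} _ _ = trans (single x) bx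
       pick {suc (suc (suc j))} (s≤s (s≤s (s≤s ())))
       pick {l = suc (suc l)} _ (s≤s (s≤s ()))
     eq : inKk 1 G (setL (x ∷ y ∷ z ∷ [])) ≡ b x ∧ (b y ∧ b z)
     eq = bool-iff _ _ from to
   split : E M (λ Z → 𝟙 (inc Z) * ((𝟙 (H (setL Z)) - d) * prodL (𝟙 ∘ b) Z)) ≡ E M fK - d * E M K
   split = trans (E-cong M (λ Z lz → each Z (inc Z) (K-prod Z lz))) (trans (E-- M fK (λ Z → d * K Z)) (cong (λ x → E M fK - x) (E-* M d K)))
     where
     each : ∀ Z i → (i ≡ true → 𝟙 (inKk 1 G (setL Z)) ≡ prodL (𝟙 ∘ b) Z) → 𝟙 i * ((𝟙 (H (setL Z)) - d) * prodL (𝟙 ∘ b) Z) ≡ 𝟙 i * (𝟙 (inKk 1 G (setL Z)) * 𝟙 (H (setL Z))) - d * (𝟙 i * 𝟙 (inKk 1 G (setL Z)))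
     each Z true h = trans (cong (λ x → 1ℚ * ((𝟙 (H (setL Z)) - d) * x)) (sym (h refl))) (solve 3 (λ f d p → (con 1ℚ) :* ((f :- d) :* p) := (con 1ℚ) :* (p :* f) :- d :* ((con 1ℚ) :* p)) refl (𝟙 (H (setL Z))) d (𝟙 (inKk 1 G (setL Z))))
     each Z false h = solve 4 (λ f d p q → (con 0ℚ) :* ((f :- d) :* p) := (con 0ℚ) :* (q :* f) :- d :* ((con 0ℚ) :* q)) refl (𝟙 (H (setL Z))) d (prodL (𝟙 ∘ b) Z) (𝟙 (inKk 1 G (setL Z)))

 <?-true : ∀ {L} {x y : Fin L} → x Fin.< y → ⌊ x Fin.<? y ⌋ ≡ true
 <?-true {x = x} {y} lt with x Fin.<? y
 ... | yes _ = refl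
 ... | no ne = ⊥-elim (ne lt)

 𝟙-≡ : ∀ {L} {x y : Fin L} → x ≡ y → 𝟙 ⌊ y Fin.≟ x ⌋ ≡ 1ℚ
 𝟙-≡ {x = x} refl with x Fin.≟ x
 ... | yes _ = refl
 ... | no ne = ⊥-elim (ne refl)

 ∑-⊆ : ∀ {A : Set} {xs ys : List A} {f : A → ℚ} → xs ⊆ ys → (∀ y → y ∈ ys → 0ℚ ≤ f y) → ∑ xs f ≤ ∑ ys f
 ∑-⊆ [] h = ≤-refl
 ∑-⊆ {f = f} (y ∷ʳ p) h = ≤-trans (∑-⊆ p (λ x → h x ∘ there)) (≤-by (f y) (h y (here refl)) (+-comm (f y) _))
 ∑-⊆ {xs = x ∷ _} {f = f} (refl ∷ p) h = +-monoʳ-≤ (f x) (∑-⊆ p (λ x → h x ∘ there))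

 ∑-≥const : ∀ {A : Set} (xs : List A) {f} c → (∀ a → a ∈ xs → c ≤ f a) → length xs /1 * c ≤ ∑ xs f
 ∑-≥const xs c p = ≤-trans (≤-reflexive (sym (∑-const xs c))) (∑-mono xs p)

 inc-++-< : ∀ {L} (A C : List (Fin L)) → inc (A ++ C) ≡ true → ∀ {x y} → x ∈ A → y ∈ C → x Fin.< y
 inc-++-< (a ∷ A) C e (here refl) y∈ = above-< a (A ++ C) e (∈-++⁺ʳ A y∈)
 inc-++-< (a ∷ A) C e (there x∈) y∈ = inc-++-< A C (inc-tail a (A ++ C) e) x∈ y∈

 count-lab : ∀ {n L} (lab : Fin n → Fin L) I → inc (map lab I) ≡ true → ∀ a → ∑ I (λ y → 𝟙 ⌊ lab y Fin.≟ a ⌋) ≤ 1ℚ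
 count-lab lab [] e a = 0≤1
 count-lab lab (y ∷ I) e a with lab y Fin.≟ a
 ... | no _ = ≤-trans (≤-reflexive (+-identityˡ _)) (count-lab lab I (inc-tail (lab y) (map lab I) e) a)
 ... | yes refl = ≤-reflexive (trans (cong (1ℚ +_) (trans (∑-cong I (λ x x∈ → none x x∈)) (trans (∑-const I 0ℚ) (zeroʳ _)))) (+-identityʳ 1ℚ))
   where
   none : ∀ x → x ∈ I → 𝟙 ⌊ lab x Fin.≟ lab y ⌋ ≡ 0ℚ
   none x x∈ with lab x Fin.≟ lab y
   ... | no _ = refl
   ... | yes q = ⊥-elim (ℕ.<-irrefl (cong toℕ (sym q)) (above-< (lab y) (map lab I) e (∈-map⁺ lab x∈)))

 tri₃ : ∀ {A : Set} → (A → ℚ) → (A → ℚ) → (A → ℚ) → List A → ℚ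
 tri₃ φ₁ φ₂ φ₃ (x ∷ y ∷ z ∷ []) = φ₁ x * (φ₂ y * φ₃ z)
 tri₃ φ₁ φ₂ φ₃ _ = 0ℚ

 E-tri₃ : ∀ {A : Set} (MV : FullMean {A} (λ _ → ⊤)) φ₁ φ₂ φ₃ → Eᴸ MV 3 (tri₃ φ₁ φ₂ φ₃) ≡ E (mean MV) φ₁ * (E (mean MV) φ₂ * E (mean MV) φ₃)
 E-tri₃ MV φ₁ φ₂ φ₃ = trans (E-cong M (λ x _ → trans (E-cong M (λ y _ → trans (E-* M (φ₁ x) (λ z → φ₂ y * φ₃ z)) (cong (φ₁ x *_) (E-* M (φ₂ y) φ₃))))
     (trans (E-* M (φ₁ x) (λ y → φ₂ y * E M φ₃)) (cong (φ₁ x *_) (E-*ʳ M φ₂ (E M φ₃)))))) (E-*ʳ M φ₁ (E M φ₂ * E M φ₃))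
   where M = mean MV

 tri-∑ : ∀ {A : Set} (I : List A) (h : A → A → ℚ) Z → Len 3 Z → prodL (λ x → ∑ I (λ y → h y x)) Z ≡ ∑ I (λ y₁ → ∑ I (λ y₂ → ∑ I (λ y₃ → tri₃ (h y₁) (h y₂) (h y₃) Z)))
 tri-∑ I h (x₁ ∷ x₂ ∷ x₃ ∷ []) refl = trans (cong (λ t → s x₁ * (s x₂ * t)) (*-identityʳ _)) (trans (sym (Lin.L-*ʳ (∑-lin I) (λ y → h y x₁) (s x₂ * s x₃)))
     (∑-cong I (λ y₁ _ → trans (cong (h y₁ x₁ *_) (sym (Lin.L-*ʳ (∑-lin I) (λ y → h y x₂) (s x₃)))) (trans (sym (∑-* I (h y₁ x₁) (λ y₂ → h y₂ x₂ * s x₃)))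
       (∑-cong I (λ y₂ _ → trans (cong (h y₁ x₁ *_) (sym (∑-* I (h y₂ x₂) (λ y → h y x₃)))) (sym (∑-* I (h y₁ x₁) (λ y₃ → h y₂ x₂ * h y₃ x₃)))))))))
   where
   s : _ → ℚ
   s x = ∑ I (λ y → h y x)

 dec3 : ∀ {P Q R X : Set} (D₁ : Dec P) (D₂ : Dec Q) (D₃ : Dec R) (D : Dec X) → (P → Q → R → X) → (X → P × Q × R) → 𝟙 ⌊ D₁ ⌋ * (𝟙 ⌊ D₂ ⌋ * 𝟙 ⌊ D₃ ⌋) ≡ 𝟙 ⌊ D ⌋
 dec3 (yes p) (yes q) (yes r) (yes _) f g = solve 0 ((con 1ℚ) :* ((con 1ℚ) :* (con 1ℚ)) := (con 1ℚ)) refl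
 dec3 (yes p) (yes q) (yes r) (no ne) f g = ⊥-elim (ne (f p q r))
 dec3 (no p) D₂ D₃ (yes e) f g = ⊥-elim (p (proj₁ (g e)))
 dec3 (no p) D₂ D₃ (no _) f g = zeroˡ _
 dec3 (yes _) (no q) D₃ (yes e) f g = ⊥-elim (q (proj₁ (proj₂ (g e))))
 dec3 (yes _) (no q) D₃ (no _) f g = trans (cong (1ℚ *_) (zeroˡ _)) (zeroʳ 1ℚ)
 dec3 (yes _) (yes _) (no r) (yes e) f g = ⊥-elim (r (proj₂ (proj₂ (g e))))
 dec3 (yes _) (yes _) (no r) (no _) f g = solve 0 ((con 1ℚ) :* ((con 1ℚ) :* (con 0ℚ)) := (con 0ℚ)) refl

 ≤-div : ∀ {c m X} → 0ℚ < m → inv m * X ≤ c → X ≤ c * m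
 ≤-div {c} {m} {X} m>0 h = ≤-trans (≤-reflexive (sym (trans (solve 3 (λ i x m → i :* x :* m := (i :* m) :* x) refl (inv m) X m) (trans (cong (_* X) (inv-inverseˡ m (>0⇒≢0 m>0))) (*-identityˡ X))))) (mul-monoʳ m (<⇒≤ m>0) h)

 module Triples {n L : ℕ} (ne : 0 ℕ.< n) (lab : Fin n → Fin L) (lab-mono : ∀ x y → lab x Fin.< lab y → x Fin.< y) (H : Hypergraph n)
   (w : List (Fin n)) (d η ε' η₂ : ℚ) (D3 : Dense 3 d η 1 H) (d≥0 : 0ℚ ≤ d) (ε'≥0 : 0ℚ ≤ ε') (η₂>0 : 0ℚ < η₂) where
   open Labelled lab lab-mono H
   open Cells 1 w using (low; low⇒; ⇒low; low-inc)
   open Uni n ne using (MF)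
   private
     V = Fin n
     M = mean MF
     M3 = mean (lists MF 3)

   τ : List V → List B
   τ l = tp (l ++ w)

   mass1 : V → ℚ
   mass1 y = Cond.mass (lists MF 1) _≟T_ τ (τ (y ∷ []))

   at : V → V → ℚ
   at y x = 𝟙 ⌊ τ (x ∷ []) ≟T τ (y ∷ []) ⌋

   -- The weight that scales the class of `y` to mass `η₂`, so that all triples of classes count
   -- equally.
   c : V → ℚ
   c y = η₂ * inv (mass1 y)

   a : List V → ℚ
   a Z = 𝟙 (H (setL Z)) - d

   e3 : ℚ
   e3 = η₂ * (η₂ * η₂)

   e3≥0 : 0ℚ ≤ e3
   e3≥0 = <⇒≤ (mul>0 η₂>0 (mul>0 η₂>0 η₂>0))

   at≥0 : ∀ y x → 0ℚ ≤ at y x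
   at≥0 y x = 𝟙≥0 ⌊ τ (x ∷ []) ≟T τ (y ∷ []) ⌋

   at-lab : ∀ y x → at y x ≤ 𝟙 ⌊ lab y Fin.≟ lab x ⌋
   at-lab y x = go (τ (x ∷ []) ≟T τ (y ∷ [])) (lab y Fin.≟ lab x)
     where
     go : (D : Dec (τ (x ∷ []) ≡ τ (y ∷ []))) (D' : Dec (lab y ≡ lab x)) → 𝟙 ⌊ D ⌋ ≤ 𝟙 ⌊ D' ⌋
     go (yes _) (yes _) = ≤-refl
     go (no _) D' = 𝟙≥0 ⌊ D' ⌋
     go (yes e) (no ne) = ⊥-elim (ne (sym (∷-injectiveˡ (tp-lab w (x ∷ []) (y ∷ []) refl refl e))))

   tri-at≥0 : ∀ y₁ y₂ y₃ Z → 0ℚ ≤ tri₃ (at y₁) (at y₂) (at y₃) Z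
   tri-at≥0 y₁ y₂ y₃ [] = ≤-refl
   tri-at≥0 y₁ y₂ y₃ (_ ∷ []) = ≤-refl
   tri-at≥0 y₁ y₂ y₃ (_ ∷ _ ∷ []) = ≤-refl
   tri-at≥0 y₁ y₂ y₃ (x₁ ∷ x₂ ∷ x₃ ∷ []) = mul≥0 (at≥0 y₁ x₁) (mul≥0 (at≥0 y₂ x₂) (at≥0 y₃ x₃))
   tri-at≥0 y₁ y₂ y₃ (_ ∷ _ ∷ _ ∷ _ ∷ _) = ≤-refl

   part : V → V → V → ℚ
   part y₁ y₂ y₃ = E M3 (λ Z → 𝟙 (inc Z) * (a Z * tri₃ (at y₁) (at y₂) (at y₃) Z))

   T : V → V → V → ℚ
   T y₁ y₂ y₃ = c y₁ * (c y₂ * c y₃) * part y₁ y₂ y₃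

   m3 : V → V → V → ℚ
   m3 y₁ y₂ y₃ = mass1 y₁ * (mass1 y₂ * mass1 y₃)

   -- The trivial bound, which has to suffice for triples with coinciding labels.
   part-≤ : ∀ y₁ y₂ y₃ → part y₁ y₂ y₃ ≤ m3 y₁ y₂ y₃
   part-≤ y₁ y₂ y₃ = ≤-trans (E-mono M3 (λ Z _ → each (inc Z) (H (setL Z)) (tri-at≥0 y₁ y₂ y₃ Z))) (≤-reflexive (E-tri₃ MF (at y₁) (at y₂) (at y₃)))
     where
     each : ∀ i b {t} → 0ℚ ≤ t → 𝟙 i * ((𝟙 b - d) * t) ≤ t
     each false b t≥0 = ≤-trans (≤-reflexive (zeroˡ _)) t≥0
     each true true {t} t≥0 = ≤-by (d * t) (mul≥0 d≥0 t≥0) (solve 2 (λ d t → t := (con 1ℚ) :* (((con 1ℚ) :- d) :* t) :+ d :* t) refl d t)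
     each true false {t} t≥0 = ≤-by (d * t + t) (add≥0 (mul≥0 d≥0 t≥0) t≥0) (solve 2 (λ d t → t := (con 1ℚ) :* (((con 0ℚ) :- d) :* t) :+ (d :* t :+ t)) refl d t)

   at-no : ∀ y x → lab y ≢ lab x → at y x ≡ 0ℚ
   at-no y x ne = go (τ (x ∷ []) ≟T τ (y ∷ []))
     where
     go : (D : Dec (τ (x ∷ []) ≡ τ (y ∷ []))) → 𝟙 ⌊ D ⌋ ≡ 0ℚ
     go (yes e) = ⊥-elim (ne (sym (∷-injectiveˡ (tp-lab w (x ∷ []) (y ∷ []) refl refl e))))
     go (no _) = refl

   at-0 : ∀ y₁ y₂ x₁ x₂ → ¬ (lab y₁ ≡ lab x₁ × lab y₂ ≡ lab x₂) → at y₁ x₁ * at y₂ x₂ ≡ 0ℚ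
   at-0 y₁ y₂ x₁ x₂ h = go (lab y₁ Fin.≟ lab x₁)
     where
     go : Dec (lab y₁ ≡ lab x₁) → at y₁ x₁ * at y₂ x₂ ≡ 0ℚ
     go (no ne) = trans (cong (_* at y₂ x₂) (at-no y₁ x₁ ne)) (zeroˡ _)
     go (yes e₁) = trans (cong (at y₁ x₁ *_) (at-no y₂ x₂ (λ e₂ → h (e₁ , e₂)))) (zeroʳ _)

   -- Types determine labels, and labels respect the order of vertices, so an increasing triple
   -- cannot meet classes whose labels descend.
   part-0 : ∀ y₁ y₂ y₃ → (lab y₂ Fin.< lab y₁ ⊎ lab y₃ Fin.< lab y₂) → part y₁ y₂ y₃ ≡ 0ℚ
   part-0 y₁ y₂ y₃ h = trans (E-cong M3 {g = λ _ → 0ℚ} each) (E-0 M3)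
     where
     swapped : ∀ y y' x x' → lab y' Fin.< lab y → x Fin.< x' → ¬ (lab y ≡ lab x × lab y' ≡ lab x')
     swapped y y' x x' lt lt' (e , e') = ℕ.<-asym lt' (lab-mono x' x (subst₂ Fin._<_ e' e lt))
     vanish : ∀ i x₁ x₂ x₃ → (i ≡ true → x₁ Fin.< x₂ × x₂ Fin.< x₃) → 𝟙 i * (a (x₁ ∷ x₂ ∷ x₃ ∷ []) * (at y₁ x₁ * (at y₂ x₂ * at y₃ x₃))) ≡ 0ℚ
     vanish false x₁ x₂ x₃ _ = zeroˡ _
     vanish true x₁ x₂ x₃ lt = trans (cong (λ t → 1ℚ * (a (x₁ ∷ x₂ ∷ x₃ ∷ []) * t)) (zero-tri h)) (solve 1 (λ x → (con 1ℚ) :* (x :* (con 0ℚ)) := (con 0ℚ)) refl (a (x₁ ∷ x₂ ∷ x₃ ∷ [])))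
       where
       zero-tri : (lab y₂ Fin.< lab y₁ ⊎ lab y₃ Fin.< lab y₂) → at y₁ x₁ * (at y₂ x₂ * at y₃ x₃) ≡ 0ℚ
       zero-tri (inj₁ q) = trans (sym (*-assoc _ _ _)) (trans (cong (_* at y₃ x₃) (at-0 y₁ y₂ x₁ x₂ (swapped y₁ y₂ x₁ x₂ q (proj₁ (lt refl))))) (zeroˡ _))
       zero-tri (inj₂ q) = trans (cong (at y₁ x₁ *_) (at-0 y₂ y₃ x₂ x₃ (swapped y₂ y₃ x₂ x₃ q (proj₂ (lt refl))))) (zeroʳ _)
     each : ∀ Z → Len 3 Z → 𝟙 (inc Z) * (a Z * tri₃ (at y₁) (at y₂) (at y₃) Z) ≡ 0ℚ
     each (x₁ ∷ x₂ ∷ x₃ ∷ []) refl = vanish (inc (x₁ ∷ x₂ ∷ x₃ ∷ [])) x₁ x₂ x₃ (λ e → above-< x₁ (x₂ ∷ x₃ ∷ []) e (here refl) , above-< x₂ (x₃ ∷ []) (inc-tail x₁ (x₂ ∷ x₃ ∷ []) e) (here refl))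

   module _ (y₁ y₂ y₃ : V) (iy : inc (map lab (y₁ ∷ y₂ ∷ y₃ ∷ [])) ≡ true) where
     private
       Y : List V
       Y = y₁ ∷ y₂ ∷ y₃ ∷ []

     atL : List V → ℚ
     atL Z = 𝟙 ⌊ ≡-dec (≡-dec (≡-dec _≟B_)) (low Z) (low Y) ⌋

     low3⇒ : ∀ x₁ x₂ x₃ → low (x₁ ∷ x₂ ∷ x₃ ∷ []) ≡ low Y → τ (x₁ ∷ []) ≡ τ (y₁ ∷ []) × τ (x₂ ∷ []) ≡ τ (y₂ ∷ []) × τ (x₃ ∷ []) ≡ τ (y₃ ∷ [])
     low3⇒ x₁ x₂ x₃ e = low⇒ {x₁ ∷ x₂ ∷ x₃ ∷ []} {Y} e {1} {1} (s≤s (s≤s z≤n)) (s≤s (s≤s z≤n)) , low⇒ {x₁ ∷ x₂ ∷ x₃ ∷ []} {Y} e {0} {1} (s≤s z≤n) (s≤s (s≤s z≤n)) , low⇒ {x₁ ∷ x₂ ∷ x₃ ∷ []} {Y} e {0} {0} (s≤s z≤n) (s≤s z≤n)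

     low3⇐ : ∀ x₁ x₂ x₃ → τ (x₁ ∷ []) ≡ τ (y₁ ∷ []) → τ (x₂ ∷ []) ≡ τ (y₂ ∷ []) → τ (x₃ ∷ []) ≡ τ (y₃ ∷ []) → low (x₁ ∷ x₂ ∷ x₃ ∷ []) ≡ low Y
     low3⇐ x₁ x₂ x₃ p q r = cong₂ _∷_ (cong₂ _∷_ r (cong₂ _∷_ q refl)) (cong₂ _∷_ (cong₂ _∷_ r (cong₂ _∷_ p refl)) (cong₂ _∷_ (cong₂ _∷_ q (cong₂ _∷_ p refl)) refl))

     atL-tri : ∀ Z → Len 3 Z → tri₃ (at y₁) (at y₂) (at y₃) Z ≡ atL Z
     atL-tri (x₁ ∷ x₂ ∷ x₃ ∷ []) refl = dec3 (τ (x₁ ∷ []) ≟T τ (y₁ ∷ [])) (τ (x₂ ∷ []) ≟T τ (y₂ ∷ [])) (τ (x₃ ∷ []) ≟T τ (y₃ ∷ [])) (≡-dec (≡-dec (≡-dec _≟B_)) (low (x₁ ∷ x₂ ∷ x₃ ∷ [])) (low Y)) (low3⇐ x₁ x₂ x₃) (low3⇒ x₁ x₂ x₃)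

     fat : List V → ℚ
     fat Z = atL Z * 𝟙 (H (setL Z))

     E-atL : E M3 atL ≡ m3 y₁ y₂ y₃
     E-atL = trans (E-cong M3 {f = atL} {g = tri₃ (at y₁) (at y₂) (at y₃)} (λ Z lz → sym (atL-tri Z lz))) (E-tri₃ MF (at y₁) (at y₂) (at y₃))

     massL≡ : massL ne lab lab-mono H 1 w Y ≡ m3 y₁ y₂ y₃
     massL≡ = E-atL

     fat-small : 0ℚ < m3 y₁ y₂ y₃ → dens ne lab lab-mono H 1 w Y ≤ d - ε' → E M3 fat ≤ (d - ε') * m3 y₁ y₂ y₃
     fat-small m>0 small = subst (λ t → E M3 fat ≤ (d - ε') * t) massL≡ (≤-div {c = d - ε'} {massL ne lab lab-mono H 1 w Y} {E M3 fat} (subst (0ℚ <_) (sym massL≡) m>0) small)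

     part-point : ∀ Z → Len 3 Z → 𝟙 (inc Z) * (a Z * tri₃ (at y₁) (at y₂) (at y₃) Z) ≡ fat Z - d * atL Z
     part-point Z lz = trans (cong (λ t → 𝟙 (inc Z) * (a Z * t)) (atL-tri Z lz)) (go (inc Z) (≡-dec (≡-dec (≡-dec _≟B_)) (low Z) (low Y)) (low-inc (s≤s z≤n) Z Y lz refl iy))
       where
       go : ∀ i (Dc : Dec (low Z ≡ low Y)) → (low Z ≡ low Y → i ≡ true) → 𝟙 i * (a Z * 𝟙 ⌊ Dc ⌋) ≡ 𝟙 ⌊ Dc ⌋ * 𝟙 (H (setL Z)) - d * 𝟙 ⌊ Dc ⌋
       go i (no _) h = solve 3 (λ i f d → i :* ((f :- d) :* (con 0ℚ)) := (con 0ℚ) :* f :- d :* (con 0ℚ)) refl (𝟙 i) (𝟙 (H (setL Z))) d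
       go i (yes e) h = trans (cong (λ i → 𝟙 i * (a Z * 1ℚ)) (h e)) (solve 2 (λ f d → (con 1ℚ) :* ((f :- d) :* (con 1ℚ)) := (con 1ℚ) :* f :- d :* (con 1ℚ)) refl (𝟙 (H (setL Z))) d)

     part≡ : part y₁ y₂ y₃ ≡ E M3 fat - d * m3 y₁ y₂ y₃
     part≡ = trans (E-cong M3 {f = λ Z → 𝟙 (inc Z) * (a Z * tri₃ (at y₁) (at y₂) (at y₃) Z)} {g = λ Z → fat Z - d * atL Z} part-point) (trans (E-- M3 fat (λ Z → d * atL Z)) (cong (λ x → E M3 fat - x) (trans (E-* M3 d atL) (cong (d *_) E-atL))))

     part-strict : (∀ y → y ∈ Y → 0ℚ < mass1 y) → dens ne lab lab-mono H 1 w Y < d - ε' → part y₁ y₂ y₃ ≤ (- ε') * m3 y₁ y₂ y₃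
     part-strict pos small = ≤-trans (≤-reflexive part≡)
         (≤-sub (≤-trans (sub≥0 (fat-small (mul>0 (pos y₁ (here refl)) (mul>0 (pos y₂ (there (here refl))) (pos y₃ (there (there (here refl)))))) (<⇒≤ small))) (≤-reflexive (solve 4 (λ d e m x → (d :- e) :* m :- x := (:- e) :* m :- (x :- d :* m)) refl d ε' (m3 y₁ y₂ y₃) (E M3 fat)))))

   module Choose (I : List V) (iI : inc (map lab I) ≡ true) (heavy : ∀ y → y ∈ I → η₂ ≤ mass1 y) where

     pos1 : ∀ y → y ∈ I → 0ℚ < mass1 y
     pos1 y y∈ = <-≤-trans η₂>0 (heavy y y∈)

     c*m : ∀ y → y ∈ I → c y * mass1 y ≡ η₂
     c*m y y∈ = trans (*-assoc η₂ _ _) (trans (cong (η₂ *_) (inv-inverseˡ (mass1 y) (>0⇒≢0 (pos1 y y∈)))) (*-identityʳ η₂))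

     c≥0 : ∀ y → y ∈ I → 0ℚ ≤ c y
     c≥0 y y∈ = mul≥0 (<⇒≤ η₂>0) (inv≥0 (<⇒≤ (pos1 y y∈)))

     c≤1 : ∀ y → y ∈ I → c y ≤ 1ℚ
     c≤1 y y∈ = mul-cancelˡ-≤ (mass1 y) (pos1 y y∈) (≤-trans (≤-reflexive (trans (*-comm (mass1 y) (c y)) (c*m y y∈))) (≤-trans (heavy y y∈) (≤-reflexive (sym (*-identityʳ _)))))

     -- A fractional vertex set meeting all classes of `I` equally. It stays below 1 because the
     -- labels in `I` are distinct and a vertex has only one label.
     ψ : V → ℚ
     ψ x = ∑ I (λ y → c y * at y x)

     ψ∈ : ∀ x → ψ x ∈[0,1]
     ψ∈ x = ∑≥0 I (λ y y∈ → mul≥0 (c≥0 y y∈) (at≥0 y x)) ,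
       ≤-trans (∑-mono I (λ y y∈ → ≤-trans (mul-monoʳ (at y x) (at≥0 y x) (c≤1 y y∈)) (≤-trans (≤-reflexive (*-identityˡ _)) (at-lab y x)))) (count-lab lab I iI (lab x))

     Φ≡ : Rounding.Φ MF 3 a ψ ≡ ∑ I (λ y₁ → ∑ I (λ y₂ → ∑ I (λ y₃ → T y₁ y₂ y₃)))
     Φ≡ = trans (E-cong M3 (λ Z lz → point Z lz)) (trans (sym (∑-swap I (lin M3) (λ y₁ Z → ∑ I (λ y₂ → ∑ I (λ y₃ → cF y₁ y₂ y₃ Z))))) (∑-cong I (λ y₁ _ → trans (sym (∑-swap I (lin M3) (λ y₂ Z → ∑ I (λ y₃ → cF y₁ y₂ y₃ Z)))) (∑-cong I (λ y₂ _ → trans (sym (∑-swap I (lin M3) (cF y₁ y₂))) (∑-cong I (λ y₃ _ → E-* M3 (c y₁ * (c y₂ * c y₃)) (F y₁ y₂ y₃))))))))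
       where
       F : V → V → V → List V → ℚ
       F y₁ y₂ y₃ Z = 𝟙 (inc Z) * (a Z * tri₃ (at y₁) (at y₂) (at y₃) Z)
       cF : V → V → V → List V → ℚ
       cF y₁ y₂ y₃ Z = c y₁ * (c y₂ * c y₃) * F y₁ y₂ y₃ Z
       scale : ∀ y₁ y₂ y₃ Z → Len 3 Z → 𝟙 (inc Z) * a Z * tri₃ (λ x → c y₁ * at y₁ x) (λ x → c y₂ * at y₂ x) (λ x → c y₃ * at y₃ x) Z ≡ c y₁ * (c y₂ * c y₃) * F y₁ y₂ y₃ Z
       scale y₁ y₂ y₃ Z@(x₁ ∷ x₂ ∷ x₃ ∷ []) refl = solve 8 (λ i a p q r x y z → i :* a :* (p :* x :* (q :* y :* (r :* z))) := p :* (q :* r) :* (i :* (a :* (x :* (y :* z))))) refl (𝟙 (inc Z)) (a Z) (c y₁) (c y₂) (c y₃) (at y₁ x₁) (at y₂ x₂) (at y₃ x₃)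
       point : ∀ Z → Len 3 Z → 𝟙 (inc Z) * (a Z * prodL ψ Z) ≡ ∑ I (λ y₁ → ∑ I (λ y₂ → ∑ I (λ y₃ → c y₁ * (c y₂ * c y₃) * F y₁ y₂ y₃ Z)))
       point Z lz = trans (sym (*-assoc _ _ _)) (trans (cong (𝟙 (inc Z) * a Z *_) (tri-∑ I (λ y x → c y * at y x) Z lz)) (trans (sym (∑-* I (𝟙 (inc Z) * a Z) _)) (∑-cong I (λ y₁ _ → trans (sym (∑-* I (𝟙 (inc Z) * a Z) _)) (∑-cong I (λ y₂ _ → trans (sym (∑-* I (𝟙 (inc Z) * a Z) _)) (∑-cong I (λ y₃ _ → scale y₁ y₂ y₃ Z lz))))))))

     eqs : V → V → V → ℚ
     eqs y₁ y₂ y₃ = 𝟙 ⌊ lab y₂ Fin.≟ lab y₁ ⌋ + 𝟙 ⌊ lab y₃ Fin.≟ lab y₂ ⌋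

     eqs≥0 : ∀ y₁ y₂ y₃ → 0ℚ ≤ eqs y₁ y₂ y₃
     eqs≥0 y₁ y₂ y₃ = add≥0 (𝟙≥0 ⌊ lab y₂ Fin.≟ lab y₁ ⌋) (𝟙≥0 ⌊ lab y₃ Fin.≟ lab y₂ ⌋)

     i : ℚ
     i = length I /1

     eqs-sum : ∑ I (λ y₁ → ∑ I (λ y₂ → ∑ I (λ y₃ → eqs y₁ y₂ y₃))) ≤ i * (i + i)
     eqs-sum = ∑-≤const I (i + i) (λ y₁ _ → ≤-trans (∑-mono I (λ y₂ _ → ≤-trans (≤-reflexive (trans (∑-+ I (λ _ → 𝟙 ⌊ lab y₂ Fin.≟ lab y₁ ⌋) _) (cong (_+ _) (∑-const I _)))) (+-monoʳ-≤ (i * 𝟙 ⌊ lab y₂ Fin.≟ lab y₁ ⌋) (count-lab lab I iI (lab y₂)))))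
       (≤-trans (≤-reflexive (trans (∑-+ I (λ y₂ → i * 𝟙 ⌊ lab y₂ Fin.≟ lab y₁ ⌋) (λ _ → 1ℚ)) (cong₂ _+_ (∑-* I i _) (trans (∑-const I 1ℚ) (*-identityʳ i)))))
         (+-monoˡ-≤ i (≤-trans (mul-monoˡ i (/1≥0 (length I)) (count-lab lab I iI (lab y₁))) (≤-reflexive (*-identityʳ i))))))

     module _ (sparse : ∀ Y → Y ⊆ I → Len 3 Y → dens ne lab lab-mono H 1 w Y < d - ε') where

       ccc : ∀ {y₁ y₂ y₃} → y₁ ∈ I → y₂ ∈ I → y₃ ∈ I → c y₁ * (c y₂ * c y₃) * m3 y₁ y₂ y₃ ≡ e3
       ccc {y₁} {y₂} {y₃} p q r = trans (solve 6 (λ a b c x y z → a :* (b :* c) :* (x :* (y :* z)) := (a :* x) :* ((b :* y) :* (c :* z))) refl (c y₁) (c y₂) (c y₃) (mass1 y₁) (mass1 y₂) (mass1 y₃)) (cong₂ _*_ (c*m y₁ p) (cong₂ _*_ (c*m y₂ q) (c*m y₃ r)))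

       ccc≥0 : ∀ {y₁ y₂ y₃} → y₁ ∈ I → y₂ ∈ I → y₃ ∈ I → 0ℚ ≤ c y₁ * (c y₂ * c y₃)
       ccc≥0 {y₁} {y₂} {y₃} p q r = mul≥0 (c≥0 y₁ p) (mul≥0 (c≥0 y₂ q) (c≥0 y₃ r))

       T≤ : ∀ {y₁ y₂ y₃} → y₁ ∈ I → y₂ ∈ I → y₃ ∈ I → T y₁ y₂ y₃ ≤ e3
       T≤ {y₁} {y₂} {y₃} p q r = ≤-trans (mul-monoˡ (c y₁ * (c y₂ * c y₃)) (ccc≥0 p q r) (part-≤ y₁ y₂ y₃)) (≤-reflexive (ccc p q r))

       T-strict : ∀ {y₁ y₂ y₃} → y₁ ∈ I → y₂ ∈ I → y₃ ∈ I → lab y₁ Fin.< lab y₂ → lab y₂ Fin.< lab y₃ → T y₁ y₂ y₃ ≤ - (ε' * e3)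
       T-strict {y₁} {y₂} {y₃} p q r lt lt' = ≤-trans (mul-monoˡ (c y₁ * (c y₂ * c y₃)) (ccc≥0 p q r) (part-strict y₁ y₂ y₃ iy (λ y y∈ → pos1 y (in-I y∈)) (sparse Y (inc-⊆ Y I (inc-map⁻ lab lab-mono Y iy) (inc-map⁻ lab lab-mono I iI) in-I) refl)))
           (≤-reflexive (trans (solve 3 (λ c e m → c :* ((:- e) :* m) := (:- (e :* (c :* m)))) refl (c y₁ * (c y₂ * c y₃)) ε' (m3 y₁ y₂ y₃)) (cong (λ x → - (ε' * x)) (ccc p q r))))
         where
         Y : List V
         Y = y₁ ∷ y₂ ∷ y₃ ∷ []
         in-I : ∀ {y} → y ∈ Y → y ∈ I
         in-I (here refl) = p
         in-I (there (here refl)) = q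
         in-I (there (there (here refl))) = r
         iy : inc (map lab Y) ≡ true
         iy = ∧-intro (<?-true lt) (∧-intro (<?-true lt') refl)

       -- The slack of the crude bound that charges `e3` to each coincidence of labels. If all cells
       -- are sparse, it is nonnegative for every triple from `I` and at least `ε' * e3` for
       -- strictly increasing labels.
       D : V → V → V → ℚ
       D y₁ y₂ y₃ = e3 * eqs y₁ y₂ y₃ - T y₁ y₂ y₃

       D-strict : ∀ {y₁ y₂ y₃} → y₁ ∈ I → y₂ ∈ I → y₃ ∈ I → lab y₁ Fin.< lab y₂ → lab y₂ Fin.< lab y₃ → ε' * e3 ≤ D y₁ y₂ y₃
       D-strict {y₁} {y₂} {y₃} p q r lt lt' = ≤-sub (≤-trans (add≥0 (mul≥0 e3≥0 (eqs≥0 y₁ y₂ y₃)) (sub≥0 (T-strict p q r lt lt'))) (≤-reflexive (solve 3 (λ a e t → a :+ ((:- e) :- t) := a :- t :- e) refl (e3 * eqs y₁ y₂ y₃) (ε' * e3) (T y₁ y₂ y₃))))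

       D≥0 : ∀ y₁ → y₁ ∈ I → ∀ y₂ → y₂ ∈ I → ∀ y₃ → y₃ ∈ I → 0ℚ ≤ D y₁ y₂ y₃
       D≥0 y₁ p y₂ q y₃ r = go (Fin.<-cmp (lab y₁) (lab y₂)) (Fin.<-cmp (lab y₂) (lab y₃))
         where
         tie : ∀ t → 0ℚ ≤ t → eqs y₁ y₂ y₃ ≡ 1ℚ + t → 0ℚ ≤ D y₁ y₂ y₃
         tie t t≥0 e = ≤-trans (add≥0 (sub≥0 (T≤ p q r)) (mul≥0 e3≥0 t≥0)) (≤-reflexive (trans (solve 3 (λ e t x → e :- x :+ e :* t := e :* ((con 1ℚ) :+ t) :- x) refl e3 t (T y₁ y₂ y₃)) (cong (λ x → e3 * x - T y₁ y₂ y₃) (sym e))))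
         nil : part y₁ y₂ y₃ ≡ 0ℚ → 0ℚ ≤ D y₁ y₂ y₃
         nil e = ≤-trans (mul≥0 e3≥0 (eqs≥0 y₁ y₂ y₃)) (≤-reflexive (sym (trans (cong (λ x → e3 * eqs y₁ y₂ y₃ - c y₁ * (c y₂ * c y₃) * x) e) (solve 2 (λ a b → a :- b :* (con 0ℚ) := a) refl (e3 * eqs y₁ y₂ y₃) (c y₁ * (c y₂ * c y₃))))))
         go : Tri (lab y₁ Fin.< lab y₂) (lab y₁ ≡ lab y₂) (lab y₂ Fin.< lab y₁) → Tri (lab y₂ Fin.< lab y₃) (lab y₂ ≡ lab y₃) (lab y₃ Fin.< lab y₂) → 0ℚ ≤ D y₁ y₂ y₃
         go (tri< l _ _) (tri< l' _ _) = ≤-trans (mul≥0 ε'≥0 e3≥0) (D-strict p q r l l')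
         go (tri≈ _ e _) _ = tie (𝟙 ⌊ lab y₃ Fin.≟ lab y₂ ⌋) (𝟙≥0 ⌊ lab y₃ Fin.≟ lab y₂ ⌋) (cong (_+ _) (𝟙-≡ e))
         go _ (tri≈ _ e _) = tie (𝟙 ⌊ lab y₂ Fin.≟ lab y₁ ⌋) (𝟙≥0 ⌊ lab y₂ Fin.≟ lab y₁ ⌋) (trans (cong (𝟙 ⌊ lab y₂ Fin.≟ lab y₁ ⌋ +_) (𝟙-≡ e)) (+-comm _ 1ℚ))
         go (tri> _ _ l) _ = nil (part-0 y₁ y₂ y₃ (inj₁ l))
         go _ (tri> _ _ l) = nil (part-0 y₁ y₂ y₃ (inj₂ l))

       -- Coincidences of labels are only quadratic in number, and rounding bounds the sum of all
       -- `T` below by `- η`.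
       ∑D : ∑ I (λ y₁ → ∑ I (λ y₂ → ∑ I (λ y₃ → D y₁ y₂ y₃))) ≤ e3 * (i * (i + i)) + η
       ∑D = ≤-trans (≤-reflexive split) (≤-trans (+-mono-≤ (mul-monoˡ e3 e3≥0 eqs-sum) (neg-antimono-≤ (≤-trans (Rounding.round MF 3 a (- η) (Dense-triples ne d η H D3) ψ ψ∈) (≤-reflexive Φ≡)))) (≤-reflexive (solve 2 (λ a h → a :- (:- h) := a :+ h) refl (e3 * (i * (i + i))) η)))
         where
         split : ∑ I (λ y₁ → ∑ I (λ y₂ → ∑ I (λ y₃ → D y₁ y₂ y₃))) ≡ e3 * ∑ I (λ y₁ → ∑ I (λ y₂ → ∑ I (λ y₃ → eqs y₁ y₂ y₃))) - ∑ I (λ y₁ → ∑ I (λ y₂ → ∑ I (λ y₃ → T y₁ y₂ y₃)))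
         split = trans (∑-cong I (λ y₁ _ → trans (∑-cong I (λ y₂ _ → trans (Lin.L-- (∑-lin I) (λ y₃ → e3 * eqs y₁ y₂ y₃) (T y₁ y₂)) (cong (_- ∑ I (T y₁ y₂)) (∑-* I e3 (eqs y₁ y₂)))))
             (trans (Lin.L-- (∑-lin I) (λ y₂ → e3 * ∑ I (eqs y₁ y₂)) (λ y₂ → ∑ I (T y₁ y₂))) (cong (_- ∑ I (λ y₂ → ∑ I (T y₁ y₂))) (∑-* I e3 (λ y₂ → ∑ I (eqs y₁ y₂)))))))
           (trans (Lin.L-- (∑-lin I) (λ y₁ → e3 * ∑ I (λ y₂ → ∑ I (eqs y₁ y₂))) (λ y₁ → ∑ I (λ y₂ → ∑ I (T y₁ y₂)))) (cong (_- ∑ I (λ y₁ → ∑ I (λ y₂ → ∑ I (T y₁ y₂)))) (∑-* I e3 (λ y₁ → ∑ I (λ y₂ → ∑ I (eqs y₁ y₂))))))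

       -- One vertex from each of three consecutive segments gives strictly increasing labels. There
       -- are cubically many such triples, which beats the quadratic bound of `∑D` when `I` is long.
       ∑D-large : ∀ A C F → A ++ C ++ F ≡ I → length A /1 * (length C /1 * (length F /1 * (ε' * e3))) ≤ ∑ I (λ y₁ → ∑ I (λ y₂ → ∑ I (λ y₃ → D y₁ y₂ y₃)))
       ∑D-large A C F refl = ≤-trans (∑-≥const A _ (λ y₁ p → ≤-trans (∑-≥const C _ (λ y₂ q → ≤-trans (∑-≥const F (ε' * e3) (λ y₃ r → D-strict (∈-++⁺ˡ p) (∈-++⁺ʳ A (∈-++⁺ˡ q)) (∈-++⁺ʳ A (∈-++⁺ʳ C r)) (lt₁ p (∈-++⁺ˡ q)) (lt₂ q r)))
           (∑-⊆ F⊆ (D≥0 y₁ (∈-++⁺ˡ p) y₂ (∈-++⁺ʳ A (∈-++⁺ˡ q))))))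
           (∑-⊆ C⊆ (λ y₂ q → ∑≥0 (A ++ C ++ F) (D≥0 y₁ (∈-++⁺ˡ p) y₂ q)))))
           (∑-⊆ A⊆ (λ y₁ p → ∑≥0 (A ++ C ++ F) (λ y₂ q → ∑≥0 (A ++ C ++ F) (D≥0 y₁ p y₂ q))))
         where
         A⊆ : A ⊆ A ++ C ++ F
         A⊆ = ++⁺ʳ (C ++ F) ⊆-refl
         C⊆ : C ⊆ A ++ C ++ F
         C⊆ = ++⁺ˡ A (++⁺ʳ F ⊆-refl)
         F⊆ : F ⊆ A ++ C ++ F
         F⊆ = ++⁺ˡ A (++⁺ˡ C ⊆-refl)
         lt₁ : ∀ {x y} → x ∈ A → y ∈ C ++ F → lab x Fin.< lab y
         lt₁ p q = inc-++-< (map lab A) (map lab (C ++ F)) (subst (λ l → inc l ≡ true) (map-++ lab A (C ++ F)) iI) (∈-map⁺ lab p) (∈-map⁺ lab q)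
         iCF : inc (map lab (C ++ F)) ≡ true
         iCF = ⊆-inc (++⁺ˡ (map lab A) ⊆-refl) (subst (λ l → inc l ≡ true) (map-++ lab A (C ++ F)) iI)
         lt₂ : ∀ {x y} → x ∈ C → y ∈ F → lab x Fin.< lab y
         lt₂ p q = inc-++-< (map lab C) (map lab F) (subst (λ l → inc l ≡ true) (map-++ lab C F) iCF) (∈-map⁺ lab p) (∈-map⁺ lab q)

     some-dense : ∀ A C F → A ++ C ++ F ≡ I → e3 * (i * (i + i)) + η < length A /1 * (length C /1 * (length F /1 * (ε' * e3))) →
       ∃ λ Y → Y ⊆ I × Len 3 Y × d - ε' ≤ dens ne lab lab-mono H 1 w Y
     some-dense A C F e big = conv (any-list (λ Y → (d - ε') ≤ᵇ dens ne lab lab-mono H 1 w Y) (combs 3 I))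
       where
       conv : (∃ λ Y → Y ∈ combs 3 I × ((d - ε') ≤ᵇ dens ne lab lab-mono H 1 w Y) ≡ true) ⊎ (∀ Y → Y ∈ combs 3 I → ((d - ε') ≤ᵇ dens ne lab lab-mono H 1 w Y) ≡ false) → _
       conv (inj₁ (Y , Y∈ , q)) = Y , proj₁ (combs-⊆ 3 I Y∈) , proj₂ (combs-⊆ 3 I Y∈) , ≤ᵇ⇒≤ q
       conv (inj₂ none) = ⊥-elim (<⇒≱ big (≤-trans (∑D-large sparse A C F e) (∑D sparse)))
         where
         sparse : ∀ Y → Y ⊆ I → Len 3 Y → dens ne lab lab-mono H 1 w Y < d - ε'
         sparse Y s l = ≰ᵇ⇒> (none Y (subst (λ m → Y ∈ combs m I) l (⊆-combs s)))

 -- Labels: consecutive blocks of equal size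

 fin-≟-suc : ∀ {n} (y x : Fin n) → ⌊ suc y Fin.≟ suc x ⌋ ≡ ⌊ y Fin.≟ x ⌋
 fin-≟-suc y x with y Fin.≟ x | suc y Fin.≟ suc x
 ... | yes _ | yes _ = refl
 ... | no _ | no _ = refl
 ... | yes refl | no ne = ⊥-elim (ne refl)
 ... | no ne | yes e = ⊥-elim (ne (Fin.suc-injective e))

 ∑-single : ∀ n (x : Fin n) → ∑ (allFin n) (λ y → 𝟙 ⌊ y Fin.≟ x ⌋) ≡ 1ℚ
 ∑-single (suc n) zero = trans (∑-allFin n _) (trans (cong (1ℚ +_) (trans (∑-const (allFin n) 0ℚ) (zeroʳ _))) (+-identityʳ 1ℚ))
 ∑-single (suc n) (suc x) = trans (∑-allFin n _) (trans (+-identityˡ _) (trans (∑-cong (allFin n) (λ y _ → cong 𝟙 (fin-≟-suc y x))) (∑-single n x)))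

 block-sum : ∀ n s b (f : ℕ → ℚ) → (∀ m → 0ℚ ≤ f m) → (∀ t → t ℕ.< b → 1ℚ ≤ f (s ℕ.+ t)) → s ℕ.+ b ℕ.≤ n → b /1 ≤ ∑ (allFin n) (f ∘ toℕ)
 block-sum zero zero zero f nn h le = ≤-refl
 block-sum (suc n) (suc s) b f nn h (s≤s le) = ≤-trans (block-sum n s b (f ∘ suc) (λ m → nn (suc m)) h le) (≤-trans (≤-by (f 0) (nn 0) (+-comm (f 0) _)) (≤-reflexive (sym (∑-allFin n (f ∘ toℕ)))))
 block-sum (suc n) zero zero f nn h le = ∑≥0 (allFin (suc n)) (λ v _ → nn (toℕ v))
 block-sum (suc n) zero (suc b) f nn h (s≤s le) = ≤-trans (+-mono-≤ (h 0 (s≤s z≤n)) (block-sum n zero b (f ∘ suc) (λ m → nn (suc m)) (λ t t< → h (suc t) (s≤s t<)) le)) (≤-reflexive (sym (∑-allFin n (f ∘ toℕ))))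

 run : ∀ {V : Set} → (V → ℕ) → ℕ → List V → Bool
 run lb i [] = true
 run lb i (z ∷ zs) = ⌊ lb z ℕ.≟ i ⌋ ∧ run lb (suc i) zs

 run-inc : ∀ {n L} (lab : Fin n → Fin L) i zs → run (toℕ ∘ lab) i zs ≡ true → inc (map lab zs) ≡ true
 run-inc lab i [] e = refl
 run-inc lab i (z ∷ zs) e = ∧-intro (first zs (proj₂ (∧-true _ (run (toℕ ∘ lab) (suc i) zs) e))) (run-inc lab (suc i) zs (proj₂ (∧-true _ (run (toℕ ∘ lab) (suc i) zs) e)))
   where
   val : ∀ z i zs → run (toℕ ∘ lab) i (z ∷ zs) ≡ true → toℕ (lab z) ≡ i
   val z i zs e with toℕ (lab z) ℕ.≟ i
   ... | yes p = p
   first : ∀ zs' → run (toℕ ∘ lab) (suc i) zs' ≡ true → above (lab z) (map lab zs') ≡ true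
   first [] _ = refl
   first (y ∷ zs') e' = <?-true (ℕ.≤-reflexive (trans (cong suc (val z i zs e)) (sym (val y (suc i) zs' e'))))

 run-prob : ∀ {V : Set} (MV : FullMean {V} (λ _ → ⊤)) lb α N → 0ℚ ≤ α → (∀ i → i ℕ.< N → α ≤ E (mean MV) (λ v → 𝟙 ⌊ lb v ℕ.≟ i ⌋)) → ∀ i m → i ℕ.+ m ℕ.≤ N → pow α m ≤ Eᴸ MV m (λ zs → 𝟙 (run lb i zs))
 run-prob MV lb α N α≥0 h i zero le = ≤-refl
 run-prob MV lb α N α≥0 h i (suc m) le = ≤-trans (mul-mono α≥0 (E≥0 (mean (lists MV m)) (λ zs _ → 𝟙≥0 (run lb (suc i) zs))) (h i (ℕ.≤-trans (ℕ.≤-trans (ℕ.≤-reflexive (ℕ.+-comm 1 i)) (ℕ.+-monoʳ-≤ i (s≤s z≤n))) le)) (run-prob MV lb α N α≥0 h (suc i) m (ℕ.≤-trans (ℕ.≤-reflexive (sym (ℕ.+-suc i m))) le)))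
   (≤-reflexive (sym (trans (E-cong (mean MV) (λ v _ → trans (E-cong (mean (lists MV m)) (λ zs _ → 𝟙-∧ ⌊ lb v ℕ.≟ i ⌋ (run lb (suc i) zs))) (E-* (mean (lists MV m)) (𝟙 ⌊ lb v ℕ.≟ i ⌋) (λ zs → 𝟙 (run lb (suc i) zs))))) (E-*ʳ (mean MV) (λ v → 𝟙 ⌊ lb v ℕ.≟ i ⌋) (Eᴸ MV m (λ zs → 𝟙 (run lb (suc i) zs)))))))

 module Blocks (n N' : ℕ) (N≤n : suc N' ℕ.≤ n) where
   private
     N = suc N'

   ne : 0 ℕ.< n
   ne = ℕ.≤-trans (s≤s z≤n) N≤n

   -- The block length is the quotient of `n` by `N`, positive since `N ≤ n`. The first `N` blocks
   -- are complete, and `N + N` labels cover all vertices.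
   size : ∃ λ b' → N ℕ.* suc b' ℕ.≤ n × n ℕ.≤ (N ℕ.+ N) ℕ.* suc b'
   size = go (n DM./ N) refl
     where
     go : ∀ b → n DM./ N ≡ b → ∃ λ b' → N ℕ.* suc b' ℕ.≤ n × n ℕ.≤ (N ℕ.+ N) ℕ.* suc b'
     go zero e = ⊥-elim (ℕ.<⇒≱ (subst (ℕ._< N) (sym (trans (DM.m≡m%n+[m/n]*n n N) (trans (cong (λ b → n DM.% N ℕ.+ b ℕ.* N) e) (ℕ.+-identityʳ _)))) (DM.m%n<n n N)) N≤n)
     go (suc b') e = b' , ℕ.≤-trans (ℕ.≤-reflexive (trans (ℕ.*-comm N (suc b')) (cong (ℕ._* N) (sym e)))) (DM.m/n*n≤m n N) ,
       ℕ.≤-trans (ℕ.≤-reflexive (DM.m≡m%n+[m/n]*n n N)) (ℕ.≤-trans (ℕ.+-mono-≤ (ℕ.≤-trans (ℕ.<⇒≤ (DM.m%n<n n N)) (ℕ.m≤m*n N (suc b'))) (ℕ.≤-reflexive (trans (cong (ℕ._* N) e) (ℕ.*-comm (suc b') N)))) (ℕ.≤-reflexive (sym (ℕ.*-distribʳ-+ (suc b') N N))))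

   b : ℕ
   b = suc (proj₁ size)

   bound : ∀ (v : Fin n) → toℕ v DM./ b ℕ.< N ℕ.+ N
   bound v = DM.m<n*o⇒m/o<n {toℕ v} {N ℕ.+ N} {b} (ℕ.<-≤-trans (Fin.toℕ<n v) (proj₂ (proj₂ size)))

   lab : Fin n → Fin (N ℕ.+ N)
   lab v = Fin.fromℕ< (bound v)

   toℕ-lab : ∀ v → toℕ (lab v) ≡ toℕ v DM./ b
   toℕ-lab v = Fin.toℕ-fromℕ< (bound v)

   lab-mono : ∀ x y → lab x Fin.< lab y → x Fin.< y
   lab-mono x y lt = ℕ.≰⇒> (λ y≤x → ℕ.<⇒≱ lt (subst₂ ℕ._≤_ (sym (toℕ-lab y)) (sym (toℕ-lab x)) (DM./-monoˡ-≤ b y≤x)))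

   α : ℚ
   α = inv ((N ℕ.+ N) /1)

   open Uni n ne using (MF; len)

   label-prob : ∀ i → i ℕ.< N → α ≤ E (mean MF) (λ v → 𝟙 ⌊ toℕ (lab v) ℕ.≟ i ⌋)
   label-prob i i<N = subst (λ m → α ≤ inv (m /1) * ∑ (allFin n) (λ v → 𝟙 ⌊ toℕ (lab v) ℕ.≟ i ⌋)) (sym len) (div-≤ {α} {n /1} (/1>0′ ne) (≤-trans below
       (≤-trans (block-sum n (i ℕ.* b) b (λ m → 𝟙 ⌊ m DM./ b ℕ.≟ i ⌋) (λ m → 𝟙≥0 ⌊ m DM./ b ℕ.≟ i ⌋) (λ t t< → ≤-reflexive (sym (is-i t t<))) fits)
         (≤-reflexive (∑-cong (allFin n) (λ v _ → cong (λ m → 𝟙 ⌊ m ℕ.≟ i ⌋) (sym (toℕ-lab v))))))))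
     where
     below : α * n /1 ≤ b /1
     below = ≤-trans (mul-monoˡ α (inv≥0 (/1≥0 (N ℕ.+ N))) (/1-mono (proj₂ (proj₂ size)))) (≤-reflexive (trans (cong (α *_) (/1-* (N ℕ.+ N) b)) (trans (sym (*-assoc α _ _)) (trans (cong (_* b /1) (inv-inverseˡ _ (>0⇒≢0 (/1>0′ {N ℕ.+ N} (s≤s z≤n))))) (*-identityˡ _)))))
     fits : i ℕ.* b ℕ.+ b ℕ.≤ n
     fits = ℕ.≤-trans (ℕ.≤-reflexive (ℕ.+-comm (i ℕ.* b) b)) (ℕ.≤-trans (ℕ.*-monoˡ-≤ b i<N) (proj₁ (proj₂ size)))
     ≟-refl : ∀ m j → m ≡ j → 𝟙 ⌊ m ℕ.≟ j ⌋ ≡ 1ℚ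
     ≟-refl m j e with m ℕ.≟ j
     ... | yes _ = refl
     ... | no ne = ⊥-elim (ne e)
     is-i : ∀ t → t ℕ.< b → 𝟙 ⌊ (i ℕ.* b ℕ.+ t) DM./ b ℕ.≟ i ⌋ ≡ 1ℚ
     is-i t t< = ≟-refl _ i (trans (DM.+-distrib-/-∣ˡ {i ℕ.* b} t {b} (divides-refl i)) (trans (cong₂ ℕ._+_ (DM.m*n/n≡m i b) (DM.m<n⇒m/n≡0 t<)) (ℕ.+-identityʳ i)))

   runs : List (Fin n) → Bool
   runs = run (toℕ ∘ lab) 0

   runs-prob : pow α N ≤ Eᴸ MF N (λ zs → 𝟙 (runs zs))
   runs-prob = run-prob MF (toℕ ∘ lab) α N (inv≥0 (/1≥0 (N ℕ.+ N))) label-prob 0 N ℕ.≤-refl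

 -- Pairs (k = 2)

 𝟙< : ∀ {n} {x y : Fin n} → x Fin.< y → 𝟙 ⌊ x Fin.<? y ⌋ ≡ 1ℚ
 𝟙< lt = cong 𝟙 (<?-true lt)

 𝟙≮ : ∀ {n} {x y : Fin n} → ¬ (x Fin.< y) → 𝟙 ⌊ x Fin.<? y ⌋ ≡ 0ℚ
 𝟙≮ {x = x} {y} nlt with x Fin.<? y
 ... | yes p = ⊥-elim (nlt p)
 ... | no _ = refl

 -- For pairs the lower types are constant, so `dens` is the density among all ordered pairs: twice
 -- that among increasing ones, up to the diagonal of mass `u`.
 dens-pairs : ∀ {n L} (ne : 0 ℕ.< n) (lab : Fin n → Fin L) (lab-mono : ∀ x y → lab x Fin.< lab y → x Fin.< y) (H : Hypergraph n) →
   ∀ w d η ε' → 0ℚ ≤ d → d ≤ 1ℚ → Dense 2 d η 0 H → η + η + Uni.u n ne ≤ ε' → ∀ Y → Len 2 Y → d - ε' ≤ dens ne lab lab-mono H 0 w Y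
 dens-pairs {n} ne lab lab-mono H w d η ε' d≥0 d≤1 D small Y ly = div-≤ {d - ε'} {massL ne lab lab-mono H 0 w Y} {E M2 (λ Z → at Z * f Z)} (<-≤-trans 0<1 (≤-reflexive (sym mass≡)))
     (≤-trans (≤-reflexive (trans (cong ((d - ε') *_) mass≡) (*-identityʳ _))) (≤-trans main (≤-reflexive (E-cong M2 {f} {λ Z → at Z * f Z} (λ Z lz → sym (trans (cong (_* f Z) (at-1 Z lz)) (*-identityˡ (f Z))))))))
   where
   open Labelled lab lab-mono H
   open Cells 0 w using (low)
   open Uni n ne using (MF; Dense-E; u; u≥0)
   M = mean MF
   M2 = mean (lists MF 2)
   f at I : List (Fin n) → ℚ
   f Z = 𝟙 (H (setL Z))
   at Z = 𝟙 ⌊ ≡-dec (≡-dec (≡-dec _≟B_)) (low Z) (low Y) ⌋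
   I Z = 𝟙 (inc Z)
   low≡ : ∀ Z Y → Len 2 Z → Len 2 Y → low Z ≡ low Y
   low≡ (_ ∷ _ ∷ []) (_ ∷ _ ∷ []) refl refl = refl
   at-1 : ∀ Z → Len 2 Z → at Z ≡ 1ℚ
   at-1 Z lz = go (≡-dec (≡-dec (≡-dec _≟B_)) (low Z) (low Y))
     where
     go : (D : Dec (low Z ≡ low Y)) → 𝟙 ⌊ D ⌋ ≡ 1ℚ
     go (yes _) = refl
     go (no ne) = ⊥-elim (ne (low≡ Z Y lz ly))
   mass≡ : massL ne lab lab-mono H 0 w Y ≡ 1ℚ
   mass≡ = trans (E-cong M2 {at} {λ _ → 1ℚ} at-1) (E-1 M2)
   G : Hypergraph n
   G = hasSize 0
   K1 : ∀ s → inKk 0 G s ≡ true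
   K1 s = ⇒inKk 0 G s (λ t _ e → true-hasSize 0 t e)
   If : List (Fin n) → ℚ
   If Z = I Z * f Z
   dense : d * E M2 I - η ≤ E M2 If
   dense = subst₂ (λ a b → d * a - η ≤ b) (E-cong M2 {λ l → 𝟙 (inc l) * 𝟙 (inKk 0 G (setL l))} {I} (λ Z _ → trans (cong (λ b → I Z * 𝟙 b) (K1 (setL Z))) (*-identityʳ _)))
     (E-cong M2 {λ l → 𝟙 (inc l) * (𝟙 (inKk 0 G (setL l)) * 𝟙 (H (setL l)))} {If} (λ Z _ → cong (I Z *_) (trans (cong (λ b → 𝟙 b * f Z) (K1 (setL Z))) (*-identityˡ _))))
     (Dense-E 2 d η 0 H D G (λ s e → hasSize-true 0 s e))
   sw : List (Fin n) → List (Fin n)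
   sw (x ∷ y ∷ []) = y ∷ x ∷ []
   sw l = l
   E-sw : ∀ (φ : List (Fin n) → ℚ) → E M2 (λ Z → φ (sw Z)) ≡ E M2 φ
   E-sw φ = E-comm M M (λ x y → φ (y ∷ x ∷ []))
   I≡ : ∀ x y → I (x ∷ y ∷ []) ≡ 𝟙 ⌊ x Fin.<? y ⌋
   I≡ x y = cong 𝟙 (∧-identityʳ ⌊ x Fin.<? y ⌋)
   eqL : List (Fin n) → ℚ
   eqL (x ∷ y ∷ []) = 𝟙 ⌊ y Fin.≟ x ⌋
   eqL _ = 0ℚ
   E-eq : E M2 eqL ≡ u
   E-eq = trans (E-cong M {g = λ _ → u} (λ x _ → trans (cong (u *_) (∑-single n x)) (*-identityʳ u))) (E-const M u)
   cover : ∀ Z → Len 2 Z → 1ℚ ≤ I Z + I (sw Z) + eqL Z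
   cover (x ∷ y ∷ []) refl = subst₂ (λ a b → 1ℚ ≤ a + b + 𝟙 ⌊ y Fin.≟ x ⌋) (sym (I≡ x y)) (sym (I≡ y x)) (go (Fin.<-cmp x y))
     where
     go : Tri (x Fin.< y) (x ≡ y) (y Fin.< x) → 1ℚ ≤ 𝟙 ⌊ x Fin.<? y ⌋ + 𝟙 ⌊ y Fin.<? x ⌋ + 𝟙 ⌊ y Fin.≟ x ⌋
     go (tri< lt _ _) = ≤-by (𝟙 ⌊ y Fin.<? x ⌋ + 𝟙 ⌊ y Fin.≟ x ⌋) (add≥0 (𝟙≥0 ⌊ y Fin.<? x ⌋) (𝟙≥0 ⌊ y Fin.≟ x ⌋)) (trans (cong (λ a → a + 𝟙 ⌊ y Fin.<? x ⌋ + 𝟙 ⌊ y Fin.≟ x ⌋) (𝟙< lt)) (+-assoc _ _ _))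
     go (tri≈ _ e _) = ≤-by (𝟙 ⌊ x Fin.<? y ⌋ + 𝟙 ⌊ y Fin.<? x ⌋) (add≥0 (𝟙≥0 ⌊ x Fin.<? y ⌋) (𝟙≥0 ⌊ y Fin.<? x ⌋)) (trans (cong (𝟙 ⌊ x Fin.<? y ⌋ + 𝟙 ⌊ y Fin.<? x ⌋ +_) (𝟙-≡ e)) (+-comm _ 1ℚ))
     go (tri> _ _ lt) = ≤-by (𝟙 ⌊ x Fin.<? y ⌋ + 𝟙 ⌊ y Fin.≟ x ⌋) (add≥0 (𝟙≥0 ⌊ x Fin.<? y ⌋) (𝟙≥0 ⌊ y Fin.≟ x ⌋)) (trans (cong (λ a → 𝟙 ⌊ x Fin.<? y ⌋ + a + 𝟙 ⌊ y Fin.≟ x ⌋) (𝟙< lt)) (solve 2 (λ a b → a :+ (con 1ℚ) :+ b := (con 1ℚ) :+ (a :+ b)) refl (𝟙 ⌊ x Fin.<? y ⌋) (𝟙 ⌊ y Fin.≟ x ⌋)))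
   disjoint : ∀ Z → Len 2 Z → If Z + If (sw Z) ≤ f Z
   disjoint (x ∷ y ∷ []) refl = ≤-trans (≤-reflexive (cong₂ _+_ (cong (_* f (x ∷ y ∷ [])) (I≡ x y)) (cong₂ _*_ (I≡ y x) (cong (λ s → 𝟙 (H s)) (setL-cong (y ∷ x ∷ []) (x ∷ y ∷ []) (flip2 y x) (flip2 x y)))))) (go (Fin.<-cmp x y))
     where
     flip2 : ∀ (y x : Fin n) v → v ∈ y ∷ x ∷ [] → v ∈ x ∷ y ∷ []
     flip2 y x v (here e) = there (here e)
     flip2 y x v (there (here e)) = here e
     F = f (x ∷ y ∷ [])
     F≥0 : 0ℚ ≤ F
     F≥0 = 𝟙≥0 (H (setL (x ∷ y ∷ [])))
     go : Tri (x Fin.< y) (x ≡ y) (y Fin.< x) → 𝟙 ⌊ x Fin.<? y ⌋ * F + 𝟙 ⌊ y Fin.<? x ⌋ * F ≤ F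
     go (tri< lt _ nl) = ≤-reflexive (trans (cong₂ (λ a b → a * F + b * F) (𝟙< lt) (𝟙≮ nl)) (solve 1 (λ f → (con 1ℚ) :* f :+ (con 0ℚ) :* f := f) refl F))
     go (tri≈ nl _ nl') = ≤-trans (≤-reflexive (trans (cong₂ (λ a b → a * F + b * F) (𝟙≮ nl) (𝟙≮ nl')) (solve 1 (λ f → (con 0ℚ) :* f :+ (con 0ℚ) :* f := (con 0ℚ)) refl F))) F≥0
     go (tri> nl _ lt) = ≤-reflexive (trans (cong₂ (λ a b → a * F + b * F) (𝟙≮ nl) (𝟙< lt)) (solve 1 (λ f → (con 0ℚ) :* f :+ (con 1ℚ) :* f := f) refl F))
   2I : 1ℚ ≤ E M2 I + E M2 I + u
   2I = ≤-trans (≤-reflexive (sym (E-1 M2))) (≤-trans (E-mono M2 {λ _ → 1ℚ} {λ Z → I Z + I (sw Z) + eqL Z} cover) (≤-reflexive (trans (E-+ M2 (λ Z → I Z + I (sw Z)) eqL) (cong₂ _+_ (trans (E-+ M2 I (λ Z → I (sw Z))) (cong (E M2 I +_) (E-sw I))) E-eq))))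
   2If : E M2 If + E M2 If ≤ E M2 f
   2If = ≤-trans (≤-reflexive (sym (trans (E-+ M2 If (λ Z → If (sw Z))) (cong (E M2 If +_) (E-sw If))))) (E-mono M2 {λ Z → If Z + If (sw Z)} {f} disjoint)
   main : d - ε' ≤ E M2 f
   main = ≤-trans (≤-sub (≤-trans (add≥0 (add≥0 (sub≥0 small) (mul≥0 u≥0 (sub≥0 d≤1))) (mul≥0 d≥0 (sub≥0 2I))) (≤-reflexive (solve 5 (λ d e h u i → e :- (h :+ h :+ u) :+ u :* ((con 1ℚ) :- d) :+ d :* (i :+ i :+ u :- (con 1ℚ)) := d :* i :- h :+ (d :* i :- h) :- (d :- e)) refl d ε' η u (E M2 I)))))
     (≤-trans (+-mono-≤ dense dense) 2If)

 Labels : ℕ → Set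
 Labels L = Bool × Subset L

 _≟Lab_ : ∀ {L} → DecidableEquality (Labels L)
 _≟Lab_ = Prod.≡-dec Bool._≟_ (Vec.≡-dec Bool._≟_)

 allLabels : ∀ L → List (Labels L)
 allLabels L = cartesianProduct (true ∷ false ∷ []) (allSubsets L)

 -- Half of the lower bound for the probability that `N` samples carry the labels 0, 1, ... in
 -- order; the other half pays for light classes.
 ρ : ℕ → ℚ
 ρ N = ½ * pow (inv ((N ℕ.+ N) /1)) N

 pow>0 : ∀ {x} → 0ℚ < x → ∀ n → 0ℚ < pow x n
 pow>0 p zero = 0<1
 pow>0 p (suc n) = mul>0 p (pow>0 p n)

 ρ>0 : ∀ N' → 0ℚ < ρ (suc N')
 ρ>0 N' = mul>0 0<½ (pow>0 (inv>0 (/1>0′ {suc N' ℕ.+ suc N'} (s≤s z≤n))) (suc N'))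

 -- what the sampling argument needs to know about a dense hypergraph
 RichAt : (q : ℕ) (d ε' : ℚ) (sh N' mmax : ℕ) → Set
 RichAt q d ε' sh N' mmax = ∃ λ η → 0ℚ < η × ∃ λ n₀ → ∀ n → n₀ ℕ.≤ n → (N≤n : suc N' ℕ.≤ n) → ∀ (H : Hypergraph n) → Dense (suc (suc q)) d η q H →
   ∀ w → length w ℕ.≤ mmax → ∃ λ (good : List (Fin n) → Bool) → ρ (suc N') ≤ Eᴸ (Uni.MF n (Blocks.ne n N' N≤n)) (suc N') (λ zs → 𝟙 (good zs)) ×
     (∀ zs → Len (suc N') zs → good zs ≡ true → ∀ I → I ⊆ zs → sh ℕ.≤ length I →
       ∃ λ Y → Y ⊆ I × length Y ≡ suc (suc q) × d - ε' ≤ dens (Blocks.ne n N' N≤n) (Blocks.lab n N' N≤n) (Blocks.lab-mono n N' N≤n) H q w Y)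

 -- The length `sh` comes before `N'` and `mmax` because the bound of `reduced`, which determines
 -- both, depends on it.
 Rich : (q : ℕ) (d ε' : ℚ) → Set
 Rich q d ε' = ∃ λ sh → ∀ N' mmax → RichAt q d ε' sh N' mmax

 prefix : ∀ {A : Set} m (I : List A) → m ℕ.≤ length I → ∃ λ C → ∃ λ R → C ++ R ≡ I × length C ≡ m
 prefix zero I _ = [] , I , refl , refl
 prefix (suc m) (x ∷ I) (s≤s p) with prefix m I p
 ... | C , R , e , l = x ∷ C , R , cong (x ∷_) e , cong suc l

 prefix-⊆ : ∀ {A : Set} m (I : List A) → m ℕ.≤ length I → ∃ λ Y → Y ⊆ I × length Y ≡ m
 prefix-⊆ m I p with prefix m I p
 ... | C , R , refl , l = C , ++⁺ʳ R ⊆-refl , l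

 inv≤1 : ∀ n → inv (suc n /1) ≤ 1ℚ
 inv≤1 n = ≤-trans (≤-trans (≤-reflexive (sym (*-identityʳ _))) (mul-monoˡ (inv (suc n /1)) (inv≥0 (/1≥0 (suc n))) (≤-by (n /1) (/1≥0 n) refl))) (inv*≤1 (suc n /1))

 pow≤1 : ∀ {x} → 0ℚ ≤ x → x ≤ 1ℚ → ∀ n → pow x n ≤ 1ℚ
 pow≤1 p q zero = ≤-refl
 pow≤1 p q (suc n) = mul≤1 p q (pow≤1 p q n)

 rich-pairs : ∀ d ε' → 0ℚ ≤ d → d ≤ 1ℚ → 0ℚ < ε' → Rich 0 d ε'
 rich-pairs d ε' d≥0 d≤1 ε'>0 = 2 , λ N' mmax → h , h>0 , proj₁ n₀ , λ n n₀≤n N≤n H D w _ → (λ _ → true) , prob n N' N≤n ,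
     λ zs _ _ I I⊆ two → pick n N' N≤n H D w n₀≤n I (prefix-⊆ 2 I two)
   where
   h : ℚ
   -- The two copies of `h` use half of `ε'`, and the diagonal term `u` uses the other half once `n`
   -- is large.
   h = ½ * (½ * ε')
   h>0 : 0ℚ < h
   h>0 = mul>0 0<½ (mul>0 0<½ ε'>0)
   n₀ : ∃ λ m → 1ℚ ≤ m /1 * (½ * ε')
   n₀ = archimedes* (mul>0 0<½ ε'>0)
   prob : ∀ n N' N≤n → ρ (suc N') ≤ Eᴸ (Uni.MF n (Blocks.ne n N' N≤n)) (suc N') (λ zs → 1ℚ)
   prob n N' N≤n = ≤-trans (≤-trans (mul≤1 0≤½ (≤-by ½ 0≤½ (solve 0 ((con 1ℚ) := (con ½) :+ (con ½)) refl)) (pow≤1 (inv≥0 (/1≥0 (suc N' ℕ.+ suc N'))) (inv≤1 (N' ℕ.+ suc N')) (suc N'))) ≤-refl) (≤-reflexive (sym (E-1 (mean (lists (Uni.MF n (Blocks.ne n N' N≤n)) (suc N'))))))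
   pick : ∀ n N' N≤n H → Dense 2 d h 0 H → ∀ w → proj₁ n₀ ℕ.≤ n → ∀ I → (∃ λ Y → Y ⊆ I × length Y ≡ 2) →
     ∃ λ Y → Y ⊆ I × length Y ≡ 2 × d - ε' ≤ dens (Blocks.ne n N' N≤n) (Blocks.lab n N' N≤n) (Blocks.lab-mono n N' N≤n) H 0 w Y
   pick n N' N≤n H D w n₀≤n I (Y , Y⊆ , l) = Y , Y⊆ , l , dens-pairs (Blocks.ne n N' N≤n) (Blocks.lab n N' N≤n) (Blocks.lab-mono n N' N≤n) H w d h ε' d≥0 d≤1 D η-small Y l
     where
     ne = Blocks.ne n N' N≤n
     u≤ : Uni.u n ne ≤ ½ * ε'
     u≤ = ≤-trans (≤-reflexive (sym (*-identityʳ _))) (≤-trans (mul-monoˡ (Uni.u n ne) (Uni.u≥0 n ne) (≤-trans (proj₂ n₀) (mul-monoʳ (½ * ε') (<⇒≤ (mul>0 0<½ ε'>0)) (/1-mono n₀≤n))))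
       (≤-reflexive (trans (sym (*-assoc _ _ _)) (trans (cong (_* (½ * ε')) (Uni.u*n n ne)) (*-identityˡ _)))))
     η-small : h + h + Uni.u n ne ≤ ε'
     η-small = ≤-trans (+-monoʳ-≤ (h + h) u≤) (≤-reflexive (solve 1 (λ e → (con ½) :* ((con ½) :* e) :+ (con ½) :* ((con ½) :* e) :+ (con ½) :* e := e) refl ε'))

 -- a threshold below which classes are rare, uniformly in the length of the sample
 threshold : ∀ N' p (Λ : ℕ → ℕ) mmax → ∃ λ η₂ → 0ℚ < η₂ × (∀ m → m ℕ.≤ mmax → ncomb (suc N') p /1 * (Λ m /1 * η₂) ≤ ρ (suc N'))
 threshold N' p Λ mmax = conv (small (ncomb N p /1 * Λ* /1) (ρ N) (mul≥0 (/1≥0 (ncomb N p)) (/1≥0 Λ*)) (ρ>0 N'))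
   where
   N = suc N'
   Λ* : ℕ
   Λ* = sum-upTo Λ (suc mmax)
   conv : (∃ λ x → 0ℚ < x × ncomb N p /1 * Λ* /1 * x ≤ ρ N) → ∃ λ η₂ → 0ℚ < η₂ × (∀ m → m ℕ.≤ mmax → ncomb N p /1 * (Λ m /1 * η₂) ≤ ρ N)
   conv (x , x>0 , h) = x , x>0 , λ m m≤ → ≤-trans (mul-monoˡ (ncomb N p /1) (/1≥0 (ncomb N p)) (mul-monoʳ x (<⇒≤ x>0) (/1-mono (≤-sum-upTo Λ (suc mmax) (s≤s m≤))))) (≤-trans (≤-reflexive (sym (*-assoc _ _ _))) h)

 ⊆-map : ∀ {A B : Set} (f : A → B) {xs ys} → xs ⊆ ys → map f xs ⊆ map f ys
 ⊆-map f [] = []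
 ⊆-map f (y ∷ʳ p) = f y ∷ʳ ⊆-map f p
 ⊆-map f (refl ∷ p) = refl ∷ ⊆-map f p

 module _ (n N' : ℕ) (N≤n : suc N' ℕ.≤ n) (H : Hypergraph n) where
   open Blocks n N' N≤n using (ne; lab; lab-mono; runs; runs-prob; α)
   open Labelled lab lab-mono H using (col; col-set; col-Bs; tp)
   private
     N = suc N'
     MV = Uni.MF n ne
     Bs = allLabels (N ℕ.+ N)

   tp∈ : ∀ p w l → Len p l → tp (l ++ w) ∈ listsOver Bs (pow2 (p ℕ.+ length w))
   tp∈ p w l e = subst (λ m → tp (l ++ w) ∈ listsOver Bs m) (trans (length-map col (subs (l ++ w))) (trans (length-subs (l ++ w)) (cong pow2 (trans (length-++ l) (cong (ℕ._+ length w) e)))))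
       (∈-listsOver Bs (tp (l ++ w)) (λ b∈ → inBs (∈-map⁻ col b∈)))
     where
     inBs : ∀ {b} → (∃ λ l' → l' ∈ subs (l ++ w) × b ≡ col l') → b ∈ Bs
     inBs (l' , _ , refl) = col-Bs l'

   good-prob : ∀ {O : Set} (_≟O_ : DecidableEquality O) p (τ : List (Fin n) → O) (Ls : List O) (τ∈ : ∀ l → Len p l → τ l ∈ Ls) η₂ (η₂≥0 : 0ℚ ≤ η₂) →
     ncomb N p /1 * (length Ls /1 * η₂) ≤ ρ N → ρ N ≤ Eᴸ MV N (λ zs → 𝟙 (Heavy.good MV _≟O_ p N τ Ls τ∈ η₂ η₂≥0 runs zs))
   good-prob _≟O_ p τ Ls τ∈ η₂ η₂≥0 h = ≤-trans (≤-sub (≤-trans (add≥0 (sub≥0 runs-prob) (sub≥0 h)) (≤-reflexive (solve 3 (λ a p x → a :- p :+ ((con ½) :* p :- x) := a :- x :- (con ½) :* p) refl (Eᴸ MV N (λ zs → 𝟙 (runs zs))) (pow α N) (ncomb N p /1 * (length Ls /1 * η₂))))))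
     (Heavy.good-likely MV _≟O_ p N τ Ls τ∈ η₂ η₂≥0 runs)

   sub-inc : ∀ zs → runs zs ≡ true → ∀ {I} → I ⊆ zs → inc (map lab I) ≡ true
   sub-inc zs e I⊆ = ⊆-inc (⊆-map lab I⊆) (run-inc lab 0 zs e)

   low∈ : ∀ q w l → Len (suc (suc q)) l → Labelled.Cells.low lab lab-mono H q w l ∈ listsOver (listsOver (listsOver Bs (pow2 (q ℕ.+ length w))) (suc q)) (suc (suc q))
   low∈ q w l e = subst (λ m → low l ∈ listsOver L₁ m) (trans (length-map row (upTo (suc (suc q)))) (length-upTo (suc (suc q)))) (∈-listsOver L₁ (low l) (λ b∈ → outer (∈-map⁻ row b∈)))
     where
     open Labelled.Cells lab lab-mono H q w using (low)
     L₀ = listsOver Bs (pow2 (q ℕ.+ length w))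
     L₁ = listsOver L₀ (suc q)
     row : ℕ → List (List (Labels (N ℕ.+ N)))
     row j = map (λ i → tp (rem i (rem j l) ++ w)) (upTo (suc q))
     inner : ∀ j → j ℕ.< suc (suc q) → ∀ {b} → (∃ λ i → i ∈ upTo (suc q) × b ≡ tp (rem i (rem j l) ++ w)) → b ∈ L₀
     inner j j< (i , i∈ , refl) = tp∈ q w (rem i (rem j l)) (len-rem-rem q l e j< (∈-upTo⁻ i∈))
     outer : ∀ {r} → (∃ λ j → j ∈ upTo (suc (suc q)) × r ≡ row j) → r ∈ L₁
     outer (j , j∈ , refl) = subst (λ m → row j ∈ listsOver L₀ m) (trans (length-map (λ i → tp (rem i (rem j l) ++ w)) (upTo (suc q))) (length-upTo (suc q))) (∈-listsOver L₀ (row j) (λ b∈ → inner j (∈-upTo⁻ j∈) (∈-map⁻ (λ i → tp (rem i (rem j l) ++ w)) b∈)))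

 rich-many : ∀ q → 2 ℕ.≤ q → ∀ d ε' → 0ℚ < ε' → Rich q d ε'
 rich-many q 2≤q d ε' ε'>0 = suc (suc q) , λ N' mmax → at N' mmax (threshold N' (suc (suc q)) (Λ N') mmax)
   where
   k = suc (suc q)
   Ls : ∀ N' (m : ℕ) → List (List (List (List (Labels (suc N' ℕ.+ suc N')))))
   Ls N' m = listsOver (listsOver (listsOver (allLabels (suc N' ℕ.+ suc N')) (pow2 (q ℕ.+ m))) (suc q)) k
   Λ : ℕ → ℕ → ℕ
   Λ N' m = length (Ls N' m)
   low : ∀ N' n (N≤n : suc N' ℕ.≤ n) (H : Hypergraph n) w → List (Fin n) → List (List (List (Labels (suc N' ℕ.+ suc N'))))
   low N' n N≤n H w = Labelled.Cells.low (Blocks.lab n N' N≤n) (Blocks.lab-mono n N' N≤n) H q w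
   at : ∀ N' mmax → (∃ λ η₂ → 0ℚ < η₂ × (∀ m → m ℕ.≤ mmax → ncomb (suc N') k /1 * (Λ N' m /1 * η₂) ≤ ρ (suc N'))) → RichAt q d ε' k N' mmax
   at N' mmax (η₂ , η₂>0 , rare) = ε' * η₂ , mul>0 ε'>0 η₂>0 , 0 , λ n _ N≤n H D w w≤ → good n N≤n H w ,
     good-prob n N' N≤n H (≡-dec (≡-dec (≡-dec _≟Lab_))) k (low N' n N≤n H w) (Ls N' (length w)) (low∈ n N' N≤n H q w) η₂ (<⇒≤ η₂>0) (rare (length w) w≤) ,
     λ zs lzs g I I⊆ big → pick n N≤n H D w zs g I I⊆ (prefix-⊆ k I big)
     where
     good : ∀ n (N≤n : suc N' ℕ.≤ n) (H : Hypergraph n) w → List (Fin n) → Bool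
     good n N≤n H w = Heavy.good (Uni.MF n (Blocks.ne n N' N≤n)) (≡-dec (≡-dec (≡-dec _≟Lab_))) k (suc N') (low N' n N≤n H w) (Ls N' (length w)) (low∈ n N' N≤n H q w) η₂ (<⇒≤ η₂>0) (Blocks.runs n N' N≤n)
     pick : ∀ n (N≤n : suc N' ℕ.≤ n) (H : Hypergraph n) → Dense k d (ε' * η₂) q H → ∀ w zs → good n N≤n H w zs ≡ true → ∀ I → I ⊆ zs → (∃ λ Y → Y ⊆ I × length Y ≡ k) →
       ∃ λ Y → Y ⊆ I × length Y ≡ k × d - ε' ≤ dens (Blocks.ne n N' N≤n) (Blocks.lab n N' N≤n) (Blocks.lab-mono n N' N≤n) H q w Y
     pick n N≤n H D w zs g I I⊆ (Y , Y⊆ , l) = Y , Y⊆ , l , dens-transversal (Blocks.ne n N' N≤n) (Blocks.lab n N' N≤n) (Blocks.lab-mono n N' N≤n) H q w 2≤q Y l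
       (sub-inc n N' N≤n H zs (Heavy.good-lbl (Uni.MF n (Blocks.ne n N' N≤n)) (≡-dec (≡-dec (≡-dec _≟Lab_))) k (suc N') (low N' n N≤n H w) (Ls N' (length w)) (low∈ n N' N≤n H q w) η₂ (<⇒≤ η₂>0) (Blocks.runs n N' N≤n) zs g) (⊆-trans Y⊆ I⊆))
       d (ε' * η₂) ε' η₂ D η₂>0 (<⇒≤ ε'>0) ≤-refl
       (Heavy.good-heavy (Uni.MF n (Blocks.ne n N' N≤n)) (≡-dec (≡-dec (≡-dec _≟Lab_))) k (suc N') (low N' n N≤n H w) (Ls N' (length w)) (low∈ n N' N≤n H q w) η₂ (<⇒≤ η₂>0) (Blocks.runs n N' N≤n) zs g (⊆-trans Y⊆ I⊆) l)

 rich-triples : ∀ d ε' → 0ℚ ≤ d → 0ℚ < ε' → Rich 1 d ε'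
 rich-triples d ε' d≥0 ε'>0 = s ℕ.+ (s ℕ.+ s) , λ N' mmax → at N' mmax (threshold N' 1 (Λ N') mmax)
   where
   nineteen : ℚ
   -- For `i = 3s` the coincidences cost `e3` times `18 * s * s`; one more unit covers `η` and keeps
   -- the inequality strict.
   nineteen = 19 /1
   s-large : ∃ λ m → 1ℚ ≤ m /1 * (ε' * inv nineteen)
   s-large = archimedes* (mul>0 ε'>0 (inv>0 (/1>0 18)))
   s : ℕ
   s = proj₁ s-large
   S' : ℚ
   S' = s /1
   Sε : nineteen ≤ S' * ε'
   Sε = ≤-trans (≤-reflexive (sym (*-identityʳ nineteen))) (≤-trans (mul-monoˡ nineteen (/1≥0 19) (proj₂ s-large)) (≤-reflexive (trans (solve 4 (λ n s e i → n :* (s :* (e :* i)) := (i :* n) :* (s :* e)) refl nineteen S' ε' (inv nineteen)) (trans (cong (_* (S' * ε')) (inv-inverseˡ nineteen (>0⇒≢0 (/1>0 18)))) (*-identityˡ _)))))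
   1≤S : 1ℚ ≤ S'
   1≤S = go s (proj₂ s-large)
     where
     go : ∀ m → 1ℚ ≤ m /1 * (ε' * inv nineteen) → 1ℚ ≤ m /1
     go zero h = ⊥-elim (<⇒≱ 0<1 (≤-trans h (≤-reflexive (zeroˡ _))))
     go (suc m) h = ≤-by (m /1) (/1≥0 m) refl
   Ls : ∀ N' (m : ℕ) → List (List (Labels (suc N' ℕ.+ suc N')))
   Ls N' m = listsOver (allLabels (suc N' ℕ.+ suc N')) (pow2 (1 ℕ.+ m))
   Λ : ℕ → ℕ → ℕ
   Λ N' m = length (Ls N' m)
   τ : ∀ N' n (N≤n : suc N' ℕ.≤ n) (H : Hypergraph n) (w : List (Fin n)) → List (Fin n) → List (Labels (suc N' ℕ.+ suc N'))
   τ N' n N≤n H w l = Labelled.tp (Blocks.lab n N' N≤n) (Blocks.lab-mono n N' N≤n) H (l ++ w)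
   at : ∀ N' mmax → (∃ λ η₂ → 0ℚ < η₂ × (∀ m → m ℕ.≤ mmax → ncomb (suc N') 1 /1 * (Λ N' m /1 * η₂) ≤ ρ (suc N'))) → RichAt 1 d ε' (s ℕ.+ (s ℕ.+ s)) N' mmax
   at N' mmax (η₂ , η₂>0 , rare) = η , mul>0 0<½ e3>0 , 0 , λ n _ N≤n H D w w≤ → good n N≤n H w ,
     good-prob n N' N≤n H (≡-dec _≟Lab_) 1 (τ N' n N≤n H w) (Ls N' (length w)) (tp∈ n N' N≤n H 1 w) η₂ (<⇒≤ η₂>0) (rare (length w) w≤) ,
     λ zs lzs g I I⊆ big → pick n N≤n H D w zs g I I⊆ (thirds I big)
     where
     e3 η : ℚ
     e3 = η₂ * (η₂ * η₂)
     η = ½ * e3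
     e3>0 : 0ℚ < e3
     e3>0 = mul>0 η₂>0 (mul>0 η₂>0 η₂>0)
     good : ∀ n (N≤n : suc N' ℕ.≤ n) (H : Hypergraph n) w → List (Fin n) → Bool
     good n N≤n H w = Heavy.good (Uni.MF n (Blocks.ne n N' N≤n)) (≡-dec _≟Lab_) 1 (suc N') (τ N' n N≤n H w) (Ls N' (length w)) (tp∈ n N' N≤n H 1 w) η₂ (<⇒≤ η₂>0) (Blocks.runs n N' N≤n)
     thirds : ∀ {A : Set} (I : List A) → s ℕ.+ (s ℕ.+ s) ℕ.≤ length I → ∃ λ A₁ → ∃ λ A₂ → ∃ λ A₃ → A₁ ++ A₂ ++ A₃ ⊆ I × length A₁ ≡ s × length A₂ ≡ s × length A₃ ≡ s
     thirds I le = first (prefix (s ℕ.+ (s ℕ.+ s)) I le)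
       where
       third : ∀ A₁ R → length A₁ ≡ s → (∃ λ A₂ → ∃ λ A₃ → A₂ ++ A₃ ≡ R × length A₂ ≡ s) → A₁ ++ R ⊆ I → length R ≡ s ℕ.+ s → ∃ λ A₁ → ∃ λ A₂ → ∃ λ A₃ → A₁ ++ A₂ ++ A₃ ⊆ I × length A₁ ≡ s × length A₂ ≡ s × length A₃ ≡ s
       third A₁ R l₁ (A₂ , A₃ , refl , l₂) sub lR = A₁ , A₂ , A₃ , sub , l₁ , l₂ , ℕ.+-cancelˡ-≡ s (length A₃) s (trans (cong (ℕ._+ length A₃) (sym l₂)) (trans (sym (length-++ A₂)) lR))
       second : ∀ C → length C ≡ s ℕ.+ (s ℕ.+ s) → (∃ λ A₁ → ∃ λ R → A₁ ++ R ≡ C × length A₁ ≡ s) → C ⊆ I → ∃ λ A₁ → ∃ λ A₂ → ∃ λ A₃ → A₁ ++ A₂ ++ A₃ ⊆ I × length A₁ ≡ s × length A₂ ≡ s × length A₃ ≡ s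
       second C lC (A₁ , R , refl , l₁) sub = third A₁ R l₁ (prefix s R (ℕ.≤-trans (ℕ.m≤m+n s s) (ℕ.≤-reflexive (sym lR)))) sub lR
         where
         lR : length R ≡ s ℕ.+ s
         lR = ℕ.+-cancelˡ-≡ s (length R) (s ℕ.+ s) (trans (cong (ℕ._+ length R) (sym l₁)) (trans (sym (length-++ A₁)) lC))
       first : (∃ λ C → ∃ λ R → C ++ R ≡ I × length C ≡ s ℕ.+ (s ℕ.+ s)) → ∃ λ A₁ → ∃ λ A₂ → ∃ λ A₃ → A₁ ++ A₂ ++ A₃ ⊆ I × length A₁ ≡ s × length A₂ ≡ s × length A₃ ≡ s
       first (C , R , refl , lC) = second C lC (prefix s C (ℕ.≤-trans (ℕ.m≤m+n s _) (ℕ.≤-reflexive (sym lC)))) (++⁺ʳ R ⊆-refl)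
     big : ∀ i a b c → i ≡ S' + (S' + S') → a ≡ S' → b ≡ S' → c ≡ S' → e3 * (i * (i + i)) + η < a * (b * (c * (ε' * e3)))
     big i a b c refl refl refl refl = <-sub (<-≤-trans (mul>0 0<½ e3>0) (≤-trans (≤-by (S' * S' * e3 * (S' * ε' - nineteen) + e3 * (S' * S' - 1ℚ))
         (add≥0 (mul≥0 (mul≥0 (mul≥0 S≥0 S≥0) (<⇒≤ e3>0)) (sub≥0 Sε)) (mul≥0 (<⇒≤ e3>0) (sub≥0 1≤SS))) refl)
         (≤-reflexive (solve 3 (λ s e x → (con ½) :* e :+ (s :* s :* e :* (s :* x :- ((con 1ℚ) :+ ((con 1ℚ) :+ ((con 1ℚ) :+ ((con 1ℚ) :+ ((con 1ℚ) :+ ((con 1ℚ) :+ ((con 1ℚ) :+ ((con 1ℚ) :+ ((con 1ℚ) :+ ((con 1ℚ) :+ ((con 1ℚ) :+ ((con 1ℚ) :+ ((con 1ℚ) :+ ((con 1ℚ) :+ ((con 1ℚ) :+ ((con 1ℚ) :+ ((con 1ℚ) :+ ((con 1ℚ) :+ ((con 1ℚ) :+ (con 0ℚ))))))))))))))))))))) :+ e :* (s :* s :- (con 1ℚ))) := s :* (s :* (s :* (x :* e))) :- (e :* ((s :+ (s :+ s)) :* (s :+ (s :+ s) :+ (s :+ (s :+ s)))) :+ (con ½) :* e)) refl S' e3 ε'))))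
       where
       S≥0 : 0ℚ ≤ S'
       S≥0 = /1≥0 s
       1≤SS : 1ℚ ≤ S' * S'
       1≤SS = ≤-trans 1≤S (≤-trans (≤-reflexive (sym (*-identityʳ S'))) (mul-monoˡ S' S≥0 1≤S))
     pick : ∀ n (N≤n : suc N' ℕ.≤ n) (H : Hypergraph n) → Dense 3 d η 1 H → ∀ w zs → good n N≤n H w zs ≡ true → ∀ I → I ⊆ zs →
       (∃ λ A₁ → ∃ λ A₂ → ∃ λ A₃ → A₁ ++ A₂ ++ A₃ ⊆ I × length A₁ ≡ s × length A₂ ≡ s × length A₃ ≡ s) →
       ∃ λ Y → Y ⊆ I × length Y ≡ 3 × d - ε' ≤ dens (Blocks.ne n N' N≤n) (Blocks.lab n N' N≤n) (Blocks.lab-mono n N' N≤n) H 1 w Y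
     pick n N≤n H D w zs g I I⊆ (A₁ , A₂ , A₃ , sub , l₁ , l₂ , l₃) = conv (Triples.Choose.some-dense (Blocks.ne n N' N≤n) (Blocks.lab n N' N≤n) (Blocks.lab-mono n N' N≤n) H w d η ε' η₂ D d≥0 (<⇒≤ ε'>0) η₂>0 J
         (sub-inc n N' N≤n H zs (Heavy.good-lbl (Uni.MF n (Blocks.ne n N' N≤n)) (≡-dec _≟Lab_) 1 (suc N') (τ N' n N≤n H w) (Ls N' (length w)) (tp∈ n N' N≤n H 1 w) η₂ (<⇒≤ η₂>0) (Blocks.runs n N' N≤n) zs g) J⊆)
         (λ y y∈ → Heavy.good-heavy (Uni.MF n (Blocks.ne n N' N≤n)) (≡-dec _≟Lab_) 1 (suc N') (τ N' n N≤n H w) (Ls N' (length w)) (tp∈ n N' N≤n H 1 w) η₂ (<⇒≤ η₂>0) (Blocks.runs n N' N≤n) zs g (⊆-trans (∈⇒[]⊆ y∈) J⊆) refl)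
         A₁ A₂ A₃ refl (big (length J /1) (length A₁ /1) (length A₂ /1) (length A₃ /1) lenJ (cong _/1 l₁) (cong _/1 l₂) (cong _/1 l₃)))
       where
       J : List (Fin n)
       J = A₁ ++ A₂ ++ A₃
       J⊆ : J ⊆ zs
       J⊆ = ⊆-trans sub I⊆
       lenJ : length J /1 ≡ S' + (S' + S')
       lenJ = trans (cong _/1 (trans (length-++ A₁) (cong₂ ℕ._+_ l₁ (trans (length-++ A₂) (cong₂ ℕ._+_ l₂ l₃))))) (trans (/1-+ s (s ℕ.+ s)) (cong (S' +_) (/1-+ s s)))
       conv : (∃ λ Y → Y ⊆ J × Len 3 Y × d - ε' ≤ dens (Blocks.ne n N' N≤n) (Blocks.lab n N' N≤n) (Blocks.lab-mono n N' N≤n) H 1 w Y) →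
         ∃ λ Y → Y ⊆ I × length Y ≡ 3 × d - ε' ≤ dens (Blocks.ne n N' N≤n) (Blocks.lab n N' N≤n) (Blocks.lab-mono n N' N≤n) H 1 w Y
       conv (Y , Y⊆ , l , h) = Y , ⊆-trans Y⊆ sub , l , h

 -- Assembling the upper bound.

 pow-½+ : ∀ x → 0ℚ ≤ x → x ≤ ½ → ∀ r → pow (½ + x) r ≤ pow ½ r + r /1 * x
 pow-½+ x x≥0 x≤ zero = ≤-reflexive (solve 1 (λ x → (con 1ℚ) := (con 1ℚ) :+ (con 0ℚ) :* x) refl x)
 pow-½+ x x≥0 x≤ (suc r) = ≤-sub (≤-trans (add≥0 (add≥0 (mul≥0 0≤½ (sub≥0 (pow-½+ x x≥0 x≤ r))) (mul≥0 x≥0 (sub≥0 A≤1))) (mul≥0 0≤½ (mul≥0 (/1≥0 r) x≥0)))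
     (≤-reflexive (solve 4 (λ x p r a → (con ½) :* (p :+ r :* x :- a) :+ x :* ((con 1ℚ) :- a) :+ (con ½) :* (r :* x) := (con ½) :* p :+ ((con 1ℚ) :+ r) :* x :- ((con ½) :+ x) :* a) refl x (pow ½ r) (r /1) (pow (½ + x) r))))
   where
   A≤1 : pow (½ + x) r ≤ 1ℚ
   A≤1 = pow≤1 (add≥0 0≤½ x≥0) (≤-trans (+-monoʳ-≤ ½ x≤) (≤-reflexive (solve 0 ((con ½) :+ (con ½) := (con 1ℚ)) refl))) r

 to-front : ∀ {n} (H : Hypergraph n) T₁ a b T₂ → H (setL (T₁ ++ a ∷ b ∷ T₂)) ≡ true → H (setL (a ∷ b ∷ T₁ ++ T₂)) ≡ true
 to-front H T₁ a b T₂ e = trans (cong H (setL-cong (a ∷ b ∷ T₁ ++ T₂) (T₁ ++ a ∷ b ∷ T₂) to from)) e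
   where
   to : ∀ v → v ∈ a ∷ b ∷ T₁ ++ T₂ → v ∈ T₁ ++ a ∷ b ∷ T₂
   to v (here e) = ∈-++⁺ʳ T₁ (here e)
   to v (there (here e)) = ∈-++⁺ʳ T₁ (there (here e))
   to v (there (there p)) with ∈-++⁻ T₁ p
   ... | inj₁ l = ∈-++⁺ˡ l
   ... | inj₂ l = ∈-++⁺ʳ T₁ (there (there l))
   from : ∀ v → v ∈ T₁ ++ a ∷ b ∷ T₂ → v ∈ a ∷ b ∷ T₁ ++ T₂
   from v p with ∈-++⁻ T₁ p
   ... | inj₁ l = there (there (∈-++⁺ˡ l))
   ... | inj₂ (here e) = here e
   ... | inj₂ (there (here e)) = there (here e)
   ... | inj₂ (there (there l)) = there (there (∈-++⁺ʳ T₁ l))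

 no-triangle : ∀ {n} q (H : Hypergraph n) → Uniform (suc (suc q)) H → Free (F-edge (suc (suc q))) H → ∀ i j → i ℕ.+ suc j ≡ suc q → ∀ T₁ x y z T₂ → Len i T₁ → Len j T₂ →
   H (setL (T₁ ++ x ∷ y ∷ T₂)) ≡ true → H (setL (T₁ ++ y ∷ z ∷ T₂)) ≡ true → H (setL (T₁ ++ x ∷ z ∷ T₂)) ≡ true → ⊥
 no-triangle q H uni fr i j e T₁ x y z T₂ l₁ l₂ xy yz xz = link-triangle q H uni fr x y z (T₁ ++ T₂) (suc-inj (trans (cong suc (trans (length-++ T₁) (cong₂ ℕ._+_ l₁ l₂))) (trans (sym (ℕ.+-suc i j)) e)))
   (to-front H T₁ x y T₂ xy) (to-front H T₁ y z T₂ yz) (to-front H T₁ x z T₂ xz)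

 module UpperBound (q : ℕ) (d : ℚ) (d-large : pow ½ (suc q) < d) (adm : Admissible (suc (suc q)) q (suc (suc (suc q))) (F-edge (suc (suc q))) d) where

   r k : ℕ
   r = suc q
   k = suc r

   t ε' A : ℚ
   t = d - pow ½ r
   -- This much is lost twice, from the hypothesis to cells and from cells to chains, which leaves
   -- half of the excess `t` for the terms in `x`.
   ε' = ½ * (½ * t)
   -- The first two summands pay for the terms linear in `x` in `d₁-large`; the summand `t` ensures
   -- `x ≤ ½`.
   A = r /1 + r /1 + t

   t>0 : 0ℚ < t
   t>0 = sub>0 d-large

   ε'>0 : 0ℚ < ε'
   ε'>0 = mul>0 0<½ (mul>0 0<½ t>0)

   module _ (rich : Rich q d ε') (x : ℚ) (x>0 : 0ℚ < x) (x-small : A * x ≤ ε') where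

     x≤½ : x ≤ ½
     x≤½ = mul-cancelˡ-≤ t t>0 (≤-trans (≤-by ((r /1 + r /1) * x) (mul≥0 (add≥0 (/1≥0 r) (/1≥0 r)) (<⇒≤ x>0)) (solve 3 (λ r t x → (r :+ r :+ t) :* x := t :* x :+ (r :+ r) :* x) refl (r /1) t x)) (≤-trans x-small (≤-by ε' (<⇒≤ ε'>0) (solve 1 (λ t → t :* (con ½) := (con ½) :* ((con ½) :* t) :+ (con ½) :* ((con ½) :* t)) refl t))))

     d₁-large : pow (½ + x) r + r /1 * x < d - ε' - ε'
     d₁-large = ≤-<-trans (+-monoˡ-≤ (r /1 * x) (pow-½+ x (<⇒≤ x>0) x≤½ r)) (<-sub (<-≤-trans (add>0 (mul>0 t>0 x>0) (add≥0 (sub≥0 x-small) (<⇒≤ ε'>0))) (≤-reflexive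
       (solve 4 (λ d r x p → (d :- p) :* x :+ ((con ½) :* ((con ½) :* (d :- p)) :- (r :+ r :+ (d :- p)) :* x :+ (con ½) :* ((con ½) :* (d :- p))) := (d :- (con ½) :* ((con ½) :* (d :- p)) :- (con ½) :* ((con ½) :* (d :- p))) :- (p :+ r :* x :+ r :* x)) refl d (r /1) x (pow ½ r)))))

     sh : ℕ
     sh = proj₁ rich

     contra : ⊥
     -- `x` serves both as the margin above one half and as the mass `c` demanded of a heavy pair.
     contra = with-N (reduced q x x x>0 x≤½ x>0 sh)
       where
       with-N : (∃ λ N → ∃ λ e₀ → 0ℚ < e₀ ×
         (∀ {V Ω : Set} (_≟_ : DecidableEquality V) → Obstruction V Ω r N sh x x e₀)) → ⊥
       with-N (N' , e₀ , e₀>0 , red) = with-δ (Upper.pickδ q _≟Lab_ (allLabels (N ℕ.+ N)) proj₁ N e₀ ε' (ρ N) e₀>0 ε'>0 (ρ>0 N'))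
         where
         N : ℕ
         N = suc N'
         with-δ : (∃ λ δ → 0ℚ < δ × Upper.A₁ q _≟Lab_ (allLabels (N ℕ.+ N)) proj₁ N e₀ ε' (ρ N) e₀>0 ε'>0 (ρ>0 N') * δ ≤ Upper.t q _≟Lab_ (allLabels (N ℕ.+ N)) proj₁ N e₀ ε' (ρ N) e₀>0 ε'>0 (ρ>0 N')) → ⊥
         with-δ (δ , δ>0 , δ-small) = with-θ (Upper.AtDelta.pickθ₁ q _≟Lab_ (allLabels (N ℕ.+ N)) proj₁ N e₀ ε' (ρ N) e₀>0 ε'>0 (ρ>0 N') δ δ>0 δ-small)
           where
           with-θ : (∃ λ θ₁ → 0ℚ < θ₁ × Upper.AtDelta.A₂ q _≟Lab_ (allLabels (N ℕ.+ N)) proj₁ N e₀ ε' (ρ N) e₀>0 ε'>0 (ρ>0 N') δ δ>0 δ-small * θ₁ ≤ Upper.t q _≟Lab_ (allLabels (N ℕ.+ N)) proj₁ N e₀ ε' (ρ N) e₀>0 ε'>0 (ρ>0 N')) → ⊥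
           with-θ (θ₁ , θ₁>0 , θ₁-small) = with-J (archimedes* (mul>0 θ₁>0 θ₁>0))
             where
             with-J : (∃ λ m → 1ℚ ≤ m /1 * (θ₁ * θ₁)) → ⊥
             with-J (m , m-large) = with-η (proj₂ rich N' (Upper.AtDelta.AtTheta.mmax q _≟Lab_ (allLabels (N ℕ.+ N)) proj₁ N e₀ ε' (ρ N) e₀>0 ε'>0 (ρ>0 N') δ δ>0 δ-small θ₁ θ₁>0 θ₁-small J₁ J₁-large))
               where
               J₁ : ℕ
               J₁ = suc r ℕ.* m
               J₁-large : r /1 < J₁ /1 * (θ₁ * θ₁)
               J₁-large = <-≤-trans (<-sub (<-≤-trans 0<1 (≤-reflexive (solve 1 (λ r → (con 1ℚ) := (con 1ℚ) :+ r :- r) refl (r /1))))) (≤-trans (≤-reflexive (sym (*-identityʳ (suc r /1)))) (≤-trans (mul-monoˡ (suc r /1) (/1≥0 (suc r)) m-large) (≤-reflexive (trans (sym (*-assoc _ _ _)) (cong (_* (θ₁ * θ₁)) (sym (/1-* (suc r) m)))))))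
               with-η : RichAt q d ε' sh N' (Upper.AtDelta.AtTheta.mmax q _≟Lab_ (allLabels (N ℕ.+ N)) proj₁ N e₀ ε' (ρ N) e₀>0 ε'>0 (ρ>0 N') δ δ>0 δ-small θ₁ θ₁>0 θ₁-small J₁ J₁-large) → ⊥
               with-η (η , η>0 , n₀ , samples) = with-H (adm η η>0 (N ℕ.+ n₀))
                 where
                 with-H : (∃ λ n → N ℕ.+ n₀ ℕ.≤ n × Σ (Hypergraph n) λ H → Uniform k H × Free (F-edge k) H × Dense k d η q H) → ⊥
                 with-H (n , n-large , H , uni , fr , D) = Upper.AtDelta.AtTheta.contradiction q _≟Lab_ (allLabels (N ℕ.+ N)) proj₁ N e₀ ε' (ρ N) e₀>0 ε'>0 (ρ>0 N') δ δ>0 δ-small θ₁ θ₁>0 θ₁-small J₁ J₁-large (d - ε') x x sh d₁-large Fin._≟_ (Uni.MF n (Blocks.ne n N' N≤n)) col col-Bs col-set (no-triangle q H uni fr)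
                     (λ p β zs le → red Fin._≟_ p β zs (ℕ.≤-trans (ℕ.n≤1+n N') le))
                     (samples n (ℕ.≤-trans (ℕ.m≤n+m n₀ N) n-large) N≤n H D)
                   where
                   N≤n : N ℕ.≤ n
                   N≤n = ℕ.≤-trans (ℕ.m≤m+n N n₀) n-large
                   open Labelled (Blocks.lab n N' N≤n) (Blocks.lab-mono n N' N≤n) H using (col; col-Bs; col-set)

 rich : ∀ q d ε' → 0ℚ ≤ d → d ≤ 1ℚ → 0ℚ < ε' → Rich q d ε'
 rich 0 d ε' d≥0 d≤1 ε'>0 = rich-pairs d ε' d≥0 d≤1 ε'>0
 rich 1 d ε' d≥0 d≤1 ε'>0 = rich-triples d ε' d≥0 ε'>0
 rich (suc (suc q)) d ε' d≥0 d≤1 ε'>0 = rich-many (suc (suc q)) (s≤s (s≤s z≤n)) d ε' ε'>0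

 opaque
   unfolding _+_

   halfPow≡ : ∀ m → halfPow m ≡ pow ½ m
   halfPow≡ zero = refl
   halfPow≡ (suc m) = cong (½ *_) (halfPow≡ m)

 upper-bound : ∀ q d → 0ℚ ≤ d → d ≤ 1ℚ → Admissible (suc (suc q)) q (suc (suc (suc q))) (F-edge (suc (suc q))) d → d ≤ halfPow (suc q)
 upper-bound q d d≥0 d≤1 adm = go (d ≤ᵇ pow ½ (suc q)) refl
   where
   go : ∀ b → (d ≤ᵇ pow ½ (suc q)) ≡ b → d ≤ halfPow (suc q)
   go true e = ≤-trans (≤ᵇ⇒≤ e) (≤-reflexive (sym (halfPow≡ (suc q))))
   go false e = ⊥-elim (conv (small ((UpperBound.A q d (≰ᵇ⇒> e) adm)) (UpperBound.ε' q d (≰ᵇ⇒> e) adm) (add≥0 (add≥0 (/1≥0 (suc q)) (/1≥0 (suc q))) (<⇒≤ (UpperBound.t>0 q d (≰ᵇ⇒> e) adm))) (UpperBound.ε'>0 q d (≰ᵇ⇒> e) adm)))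
     where
     conv : (∃ λ x → 0ℚ < x × (UpperBound.A q d (≰ᵇ⇒> e) adm) * x ≤ (UpperBound.ε' q d (≰ᵇ⇒> e) adm)) → ⊥
     conv (x , x>0 , h) = (UpperBound.contra q d (≰ᵇ⇒> e) adm) (rich q d (UpperBound.ε' q d (≰ᵇ⇒> e) adm) d≥0 d≤1 (UpperBound.ε'>0 q d (≰ᵇ⇒> e) adm)) x x>0 h

open UpperBounds

-- The lower bound: box norms, random signs and the sign hypergraph.

module LowerBounds where
 import Data.Bool.Properties as Bool
 import Data.Fin as Fin
 open import Data.Fin using (Fin; zero; suc; toℕ)
 import Data.Fin.Properties as Fin
 import Data.Fin.Subset as Sub
 open import Data.Fin.Subset using (Subset; ⁅_⁆) renaming (_∈_ to _∈ₛ_; _⊆_ to _⊆ₛ_)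
 import Data.Fin.Subset.Properties as Sub
 open import Data.List.Membership.Propositional.Properties using (∈-map⁺; ∈-map⁻; ∈-allFin; ∈-upTo⁺; ∈-upTo⁻; ∈-++⁻)
 open import Data.List.Properties using (length-upTo; length-++; ++-assoc; ∷ʳ-injective; ≡-dec; ++-identityʳ)
 open import Data.Rational using (ℚ; 0ℚ; 1ℚ; ½; _≤_; _<_)
 import Data.Rational.Properties as ℚ
 open import Data.Rational.Properties using (≤-trans; ≤-reflexive; <⇒≤; ≤-refl; <-≤-trans; ≤-<-trans; ≰⇒>; ≤-total)
 open import Function using (_∘_)
 open import Relation.Binary.Definitions using (Tri; tri<; tri≈; tri>)

 -- Box norms

 -- The variance of `X` is nonnegative.
 jensen² : ∀ {A : Set} {P : A → Set} (M : Mean P) (X : A → ℚ) → E M X * E M X ≤ E M (λ a → X a * X a)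
 jensen² M X = ≤-sub (≤-trans (E≥0 M {λ a → (X a - c) * (X a - c)} (λ a _ → sq≥0 (X a - c))) (≤-reflexive (trans (E-cong M {g = λ a → X a * X a + ((- (c + c)) * X a + c * c)} (λ a _ → solve 2 (λ x c → (x :- c) :* (x :- c) := x :* x :+ ((:- (c :+ c)) :* x :+ c :* c)) refl (X a) c))
     (trans (E-+ M (λ a → X a * X a) (λ a → (- (c + c)) * X a + c * c)) (trans (cong (E M (λ a → X a * X a) +_) (trans (E-+ M (λ a → (- (c + c)) * X a) (λ _ → c * c)) (cong₂ _+_ (E-* M (- (c + c)) X) (E-const M (c * c))))) (solve 2 (λ y c → y :+ ((:- (c :+ c)) :* c :+ c :* c) := y :- c :* c) refl (E M (λ a → X a * X a)) c))))))
   where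
   c : ℚ
   c = E M X

 sq-mono : ∀ {x y} → 0ℚ ≤ x → x ≤ y → x * x ≤ y * y
 sq-mono 0≤x x≤y = mul-mono 0≤x (≤-trans 0≤x x≤y) x≤y x≤y

 -- x ^ (2 ^ r)
 pw : ℕ → ℚ → ℚ
 pw zero x = x
 pw (suc r) x = pw r (x * x)

 pw-mono : ∀ r {x y} → 0ℚ ≤ x → x ≤ y → pw r x ≤ pw r y
 pw-mono zero _ h = h
 pw-mono (suc r) {x} 0≤x h = pw-mono r (sq≥0 x) (sq-mono 0≤x h)

 pw≥0 : ∀ r {x} → 0ℚ ≤ x → 0ℚ ≤ pw r x
 pw≥0 zero h = h
 pw≥0 (suc r) {x} h = pw≥0 r (sq≥0 x)

 pw-mono-< : ∀ r {x y} → 0ℚ ≤ x → x < y → pw r x < pw r y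
 pw-mono-< zero _ h = h
 pw-mono-< (suc r) {x} {y} 0≤x h = pw-mono-< r (sq≥0 x) (≤-<-trans (mul-monoˡ x 0≤x (<⇒≤ h)) (subst₂ _<_ (*-comm y x) refl (mul-mono-<ˡ y (≤-<-trans 0≤x h) h)))

 pw>0 : ∀ r {x} → 0ℚ < x → 0ℚ < pw r x
 pw>0 zero h = h
 pw>0 (suc r) h = pw>0 r (mul>0 h h)

 -- The power is even, so a negative `x` may be replaced by `- x`, and it is strictly increasing on
 -- nonnegative arguments. This is the only way a root is taken.
 pw-lower : ∀ r {x δ} → 0ℚ ≤ δ → pw (suc r) x ≤ pw (suc r) δ → - δ ≤ x
 pw-lower r {x} {δ} 0≤δ h = go (≤-total (- δ) x)
   where
   go : (- δ) ≤ x ⊎ x ≤ (- δ) → (- δ) ≤ x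
   go (inj₁ p) = p
   go (inj₂ p) = ≤-trans (neg-antimono-≤ -x≤δ) (≤-reflexive (solve 1 (λ x → (:- (:- x)) := x) refl x))
     where
     -x≤δ : - x ≤ δ
     -x≤δ = by (≤-total (- x) δ)
       where
       by : (- x) ≤ δ ⊎ δ ≤ (- x) → (- x) ≤ δ
       by (inj₁ q) = q
       by (inj₂ q) with (- x) ℚ.≤? δ
       ... | yes q' = q'
       ... | no nq = ⊥-elim (<⇒≱ (pw-mono-< (suc r) 0≤δ (≰⇒> nq)) (≤-trans (≤-reflexive (cong (pw r) (solve 1 (λ x → (:- x) :* (:- x) := x :* x) refl x))) h))

 jensen : ∀ r {A : Set} {P : A → Set} (M : Mean P) (X : A → ℚ) → pw r (E M X) ≤ E M (λ a → pw r (X a))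
 jensen zero M X = ≤-refl
 jensen (suc r) M X = ≤-trans (pw-mono r (sq≥0 (E M X)) (jensen² M X)) (jensen r M (λ a → X a * X a))

 module Box {V : Set} (MV : FullMean {V} (λ _ → ⊤)) (v₀ : V) where
   private
     M = mean MV

   -- The box norm raised to the power 2^r: every coordinate is doubled, and the values of `h` at
   -- all corners are multiplied.
   T : ℕ → (List V → ℚ) → ℚ
   T zero h = h []
   T (suc r) h = E M (λ a → E M (λ b → T r (λ y → h (a ∷ y) * h (b ∷ y))))

   T-cong : ∀ r {h h'} → (∀ y → Len r y → h y ≡ h' y) → T r h ≡ T r h'
   T-cong zero e = e [] refl
   T-cong (suc r) e = E-cong M (λ a _ → E-cong M (λ b _ → T-cong r (λ y l → cong₂ _*_ (e (a ∷ y) (cong suc l)) (e (b ∷ y) (cong suc l)))))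

   -- products of functions each of which is bounded by 1 and ignores some coordinate
   Cyl : ℕ → (List V → ℚ) → Set
   Cyl zero Φ = Φ [] ≡ 1ℚ
   Cyl (suc r) Φ = ∃ λ (φ : List V → ℚ) → ∃ λ (Φ' : List V → ℚ) → (∀ y → φ y * φ y ≤ 1ℚ) × (∀ a y → Len r y → Φ (a ∷ y) ≡ φ y * Φ' (a ∷ y)) × (∀ a b → Cyl r (λ y → Φ' (a ∷ y) * Φ' (b ∷ y)))

   Cyl-cong : ∀ r Φ Ψ → (∀ y → Len r y → Φ y ≡ Ψ y) → Cyl r Φ → Cyl r Ψ
   Cyl-cong zero Φ Ψ e c = trans (sym (e [] refl)) c
   Cyl-cong (suc r) Φ Ψ e (φ , Φ' , b , eq , rec) = φ , Φ' , b , (λ a y l → trans (sym (e (a ∷ y) (cong suc l))) (eq a y l)) , rec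

   Cyl-1 : ∀ r → Cyl r (λ _ → 1ℚ)
   Cyl-1 zero = refl
   Cyl-1 (suc r) = (λ _ → 1ℚ) , (λ _ → 1ℚ) , (λ _ → ≤-reflexive (*-identityˡ 1ℚ)) , (λ _ _ _ → sym (*-identityˡ 1ℚ)) , (λ _ _ → Cyl-cong r (λ _ → 1ℚ) (λ _ → 1ℚ * 1ℚ) (λ _ _ → sym (*-identityˡ 1ℚ)) (Cyl-1 r))

   sq≤1-* : ∀ {x y} → x * x ≤ 1ℚ → y * y ≤ 1ℚ → (x * y) * (x * y) ≤ 1ℚ
   sq≤1-* {x} {y} p q = ≤-trans (≤-reflexive (solve 2 (λ x y → (x :* y) :* (x :* y) := (x :* x) :* (y :* y)) refl x y)) (mul≤1 (sq≥0 x) p q)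

   Cyl-* : ∀ r Φ Ψ → Cyl r Φ → Cyl r Ψ → Cyl r (λ y → Φ y * Ψ y)
   Cyl-* zero Φ Ψ p q = trans (cong₂ _*_ p q) (*-identityˡ 1ℚ)
   Cyl-* (suc r) Φ Ψ (φ , Φ' , b , eq , rec) (ψ , Ψ' , b' , eq' , rec') = (λ y → φ y * ψ y) , (λ y → Φ' y * Ψ' y) , (λ y → sq≤1-* {φ y} {ψ y} (b y) (b' y)) ,
     (λ a y l → trans (cong₂ _*_ (eq a y l) (eq' a y l)) (solve 4 (λ p q r s → p :* q :* (r :* s) := p :* r :* (q :* s)) refl (φ y) (Φ' (a ∷ y)) (ψ y) (Ψ' (a ∷ y)))) ,
     (λ a b → Cyl-cong r (λ y → (Φ' (a ∷ y) * Φ' (b ∷ y)) * (Ψ' (a ∷ y) * Ψ' (b ∷ y))) (λ y → (Φ' (a ∷ y) * Ψ' (a ∷ y)) * (Φ' (b ∷ y) * Ψ' (b ∷ y))) (λ y _ → solve 4 (λ p q r s → p :* q :* (r :* s) := p :* r :* (q :* s)) refl (Φ' (a ∷ y)) (Φ' (b ∷ y)) (Ψ' (a ∷ y)) (Ψ' (b ∷ y))) (Cyl-* r (λ y → Φ' (a ∷ y) * Φ' (b ∷ y)) (λ y → Ψ' (a ∷ y) * Ψ' (b ∷ y)) (rec a b) (rec' a b)))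

   Ignores : ℕ → ℕ → (List V → ℚ) → Set
   Ignores r c f = ∀ y a b → Len r (insertAt c a y) → f (insertAt c a y) ≡ f (insertAt c b y)

   -- When the recursion reaches the ignored coordinate, `f` itself becomes the bounded factor, with
   -- `v₀` filling that slot; the coordinates before it only multiply copies of `f`.
   Cyl-ignores : ∀ r c f → c ℕ.< r → (∀ y → f y * f y ≤ 1ℚ) → Ignores r c f → Cyl r f
   Cyl-ignores (suc r) zero f _ bd ig = (λ y → f (v₀ ∷ y)) , (λ _ → 1ℚ) , (λ y → bd (v₀ ∷ y)) , (λ a y l → trans (ig y a v₀ (cong suc l)) (sym (*-identityʳ _))) , (λ _ _ → Cyl-cong r (λ _ → 1ℚ) (λ _ → 1ℚ * 1ℚ) (λ _ _ → sym (*-identityˡ 1ℚ)) (Cyl-1 r))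
   Cyl-ignores (suc r) (suc c) f (s≤s c<) bd ig = (λ _ → 1ℚ) , f , (λ _ → ≤-reflexive (*-identityˡ 1ℚ)) , (λ a y _ → sym (*-identityˡ _)) ,
     (λ a b → Cyl-ignores r c (λ y → f (a ∷ y) * f (b ∷ y)) c< (λ y → sq≤1-* {f (a ∷ y)} {f (b ∷ y)} (bd (a ∷ y)) (bd (b ∷ y))) (λ y x x' l → cong₂ _*_ (ig (a ∷ y) x x' (cong suc l)) (ig (b ∷ y) x x' (cong suc l))))

   -- one Cauchy–Schwarz step per coordinate
   gcs : ∀ r h Φ → Cyl r Φ → pw r (Eᴸ MV r (λ y → h y * Φ y)) ≤ T r h
   gcs zero h Φ c = ≤-reflexive (trans (cong (h [] *_) c) (*-identityʳ _))
   gcs (suc r) h Φ (φ , Φ' , b , eq , rec) = ≤-trans (pw-mono r (sq≥0 X) step) (≤-trans (jensen r M (λ a → E M (Q a))) (≤-trans (E-mono M (λ a _ → jensen r M (Q a))) (E-mono M (λ a _ → E-mono M (λ a' _ → one a a')))))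
     where
     Mr = mean (lists MV r)
     k : V → List V → ℚ
     k a y = h (a ∷ y) * Φ' (a ∷ y)
     e : List V → ℚ
     e y = E M (λ a → k a y)
     X : ℚ
     X = Eᴸ MV (suc r) (λ y → h y * Φ y)
     Q : V → V → ℚ
     Q a a' = E Mr (λ y → k a y * k a' y)
     X≡ : X ≡ E Mr (λ y → φ y * e y)
     X≡ = trans (E-cong M (λ a _ → E-cong Mr {g = λ y → φ y * k a y} (λ y l → trans (cong (h (a ∷ y) *_) (eq a y l)) (solve 3 (λ h p f → h :* (p :* f) := p :* (h :* f)) refl (h (a ∷ y)) (φ y) (Φ' (a ∷ y)))))) (trans (E-comm M Mr (λ a y → φ y * k a y)) (E-cong Mr (λ y _ → E-* M (φ y) (λ a → k a y))))
     ee : ∀ y → e y * e y ≡ E M (λ a → E M (λ a' → k a y * k a' y))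
     ee y = trans (sym (E-*ʳ M (λ a → k a y) (e y))) (E-cong M (λ a _ → sym (E-* M (k a y) (λ a' → k a' y))))
     step : X * X ≤ E M (λ a → E M (Q a))
     step = ≤-trans (≤-reflexive (cong₂ _*_ X≡ X≡)) (≤-trans (jensen² Mr (λ y → φ y * e y)) (≤-trans (E-mono Mr {g = λ y → e y * e y} (λ y _ → ≤-trans (≤-reflexive (solve 2 (λ p e → (p :* e) :* (p :* e) := (p :* p) :* (e :* e)) refl (φ y) (e y))) (≤-trans (mul-monoʳ (e y * e y) (sq≥0 (e y)) (b y)) (≤-reflexive (*-identityˡ _)))))
       (≤-reflexive (trans (E-cong Mr (λ y _ → ee y)) (trans (E-comm Mr M (λ y a → E M (λ a' → k a y * k a' y))) (E-cong M (λ a _ → E-comm Mr M (λ y a' → k a y * k a' y))))))))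
     one : ∀ a a' → pw r (Q a a') ≤ T r (λ y → h (a ∷ y) * h (a' ∷ y))
     one a a' = ≤-trans (≤-reflexive (cong (pw r) (E-cong Mr (λ y _ → solve 4 (λ p q r s → p :* q :* (r :* s) := p :* r :* (q :* s)) refl (h (a ∷ y)) (Φ' (a ∷ y)) (h (a' ∷ y)) (Φ' (a' ∷ y)))))) (gcs r (λ y → h (a ∷ y) * h (a' ∷ y)) (λ y → Φ' (a ∷ y) * Φ' (a' ∷ y)) (rec a a'))

   -- By `gcs` with the constant 1 it dominates an iterated square.
   T≥0 : ∀ r h → 0ℚ ≤ T (suc r) h
   T≥0 r h = ≤-trans (pw≥0 r (sq≥0 (Eᴸ MV (suc r) (λ y → h y * 1ℚ)))) (gcs (suc r) h (λ _ → 1ℚ) (Cyl-1 (suc r)))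

   T≤1 : ∀ r h → (∀ y → h y * h y ≤ 1ℚ) → T r h ≤ 1ℚ
   T≤1 zero h bd = sq-cancel-≤ 0≤1 (≤-trans (bd []) (≤-reflexive (sym (*-identityˡ 1ℚ))))
   T≤1 (suc r) h bd = E≤ M 1ℚ (λ a _ → E≤ M 1ℚ (λ b _ → T≤1 r (λ y → h (a ∷ y) * h (b ∷ y)) (λ y → sq≤1-* {h (a ∷ y)} {h (b ∷ y)} (bd (a ∷ y)) (bd (b ∷ y)))))

 -- Random signs

 sgn : Bool → ℚ
 sgn true = 1ℚ
 sgn false = - 1ℚ

 sgn-sq : ∀ b → sgn b * sgn b ≡ 1ℚ
 sgn-sq true = *-identityˡ 1ℚ
 sgn-sq false = solve 0 ((:- (con 1ℚ)) :* (:- (con 1ℚ)) := (con 1ℚ)) refl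

 bits : FullMean {Bool} (λ _ → ⊤)
 bits = uniform (true ∷ false ∷ []) (s≤s z≤n) λ { true → here refl ; false → there (here refl) }

 module Signs {A : Set} (_≟_ : DecidableEquality A) where

   val : List A → List Bool → A → Bool
   val (x ∷ xs) (b ∷ bs) a = if ⌊ a ≟ x ⌋ then b else val xs bs a
   val _ _ a = false

   Blind : A → List A → (List Bool → ℚ) → Set
   Blind a₀ xs ψ = ∀ bs bs' → (∀ a → a ≢ a₀ → val xs bs a ≡ val xs bs' a) → ψ bs ≡ ψ bs'

   -- The first occurrence of `a₀` carries a bit that no other value of `val` depends on; averaging
   -- over this bit alone gives zero.
   signs-cancel : ∀ xs a₀ → a₀ ∈ xs → ∀ ψ → Blind a₀ xs ψ → Eᴸ bits (length xs) (λ bs → sgn (val xs bs a₀) * ψ bs) ≡ 0ℚ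
   signs-cancel (x ∷ xs) a₀ a₀∈ ψ bl = go (a₀ ≟ x)
     where
     Mx = mean (lists bits (length xs))
     F : Bool → List Bool → ℚ
     F b bs = sgn (val (x ∷ xs) (b ∷ bs) a₀) * ψ (b ∷ bs)
     tail∈ : a₀ ≢ x → a₀ ∈ x ∷ xs → a₀ ∈ xs
     tail∈ ne (here e) = ⊥-elim (ne e)
     tail∈ ne (there p) = p
     val-≡ : a₀ ≡ x → ∀ b bs → val (x ∷ xs) (b ∷ bs) a₀ ≡ b
     val-≡ e b bs with a₀ ≟ x
     ... | yes _ = refl
     ... | no ne = ⊥-elim (ne e)
     val-≢ : a₀ ≢ x → ∀ b bs → val (x ∷ xs) (b ∷ bs) a₀ ≡ val xs bs a₀
     val-≢ ne b bs with a₀ ≟ x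
     ... | yes e = ⊥-elim (ne e)
     ... | no _ = refl
     val-off : a₀ ≡ x → ∀ b b' bs a → a ≢ a₀ → val (x ∷ xs) (b ∷ bs) a ≡ val (x ∷ xs) (b' ∷ bs) a
     val-off e b b' bs a ne with a ≟ x
     ... | yes q = ⊥-elim (ne (trans q (sym e)))
     ... | no _ = refl
     val-tail : ∀ b bs bs' a → val xs bs a ≡ val xs bs' a → val (x ∷ xs) (b ∷ bs) a ≡ val (x ∷ xs) (b ∷ bs') a
     val-tail b bs bs' a e with a ≟ x
     ... | yes _ = refl
     ... | no _ = e
     go : Dec (a₀ ≡ x) → E (mean bits) (λ b → E Mx (F b)) ≡ 0ℚ
     go (no ne) = trans (E-cong (mean bits) {g = λ _ → 0ℚ} (λ b _ → trans (E-cong Mx (λ bs _ → cong (λ c → sgn c * ψ (b ∷ bs)) (val-≢ ne b bs))) (signs-cancel xs a₀ (tail∈ ne a₀∈) (λ bs → ψ (b ∷ bs)) (λ bs bs' h → bl (b ∷ bs) (b ∷ bs') (λ a na → val-tail b bs bs' a (h a na)))))) (E-0 (mean bits))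
     go (yes e) = trans (cong (λ s → inv (2 /1) * (E Mx (F true) + (s + 0ℚ))) neg) (solve 2 (λ i x → i :* (x :+ ((:- x) :+ (con 0ℚ))) := (con 0ℚ)) refl (inv (2 /1)) (E Mx (F true)))
       where
       neg : E Mx (F false) ≡ - E Mx (F true)
       neg = trans (E-cong Mx {g = λ bs → - F true bs} (λ bs _ → trans (cong₂ (λ c p → sgn c * p) (val-≡ e false bs) (bl (false ∷ bs) (true ∷ bs) (val-off e false true bs))) (trans (solve 1 (λ p → (:- (con 1ℚ)) :* p := (:- ((con 1ℚ) :* p))) refl (ψ (true ∷ bs))) (cong (λ c → - (sgn c * ψ (true ∷ bs))) (sym (val-≡ e true bs)))))) (E-neg Mx (F true))

 prodL-++ : ∀ {A : Set} (f : A → ℚ) xs ys → prodL f (xs ++ ys) ≡ prodL f xs * prodL f ys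
 prodL-++ f [] ys = sym (*-identityˡ _)
 prodL-++ f (x ∷ xs) ys = trans (cong (f x *_) (prodL-++ f xs ys)) (sym (*-assoc (f x) _ _))

 prodL-map : ∀ {A B : Set} (f : B → ℚ) (g : A → B) xs → prodL f (map g xs) ≡ prodL (f ∘ g) xs
 prodL-map f g [] = refl
 prodL-map f g (x ∷ xs) = cong (f (g x) *_) (prodL-map f g xs)

 prodL-sq≤1 : ∀ {A : Set} (f : A → ℚ) → (∀ a → f a * f a ≤ 1ℚ) → ∀ xs → prodL f xs * prodL f xs ≤ 1ℚ
 prodL-sq≤1 f h [] = ≤-reflexive (*-identityˡ 1ℚ)
 prodL-sq≤1 f h (x ∷ xs) = ≤-trans (≤-reflexive (solve 2 (λ x y → (x :* y) :* (x :* y) := (x :* x) :* (y :* y)) refl (f x) (prodL f xs))) (mul≤1 (sq≥0 (f x)) (h x) (prodL-sq≤1 f h xs))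

 module Average (n : ℕ) (ne : 0 ℕ.< n) (v₀ : Fin n) (R : ℕ) where
   open Uni n ne using (MF; u; u≥0)
   open Box MF v₀
   private
     V = Fin n
     M = mean MF

   _≟L_ : DecidableEquality (List V)
   _≟L_ = ≡-dec Fin._≟_

   open Signs _≟L_

   tuples : List (List V)
   tuples = listsOver (allFin n) R

   ∈-tuples : ∀ l → Len R l → l ∈ tuples
   ∈-tuples l e = subst (λ m → l ∈ listsOver (allFin n) m) e (∈-listsOver (allFin n) l (λ {b} _ → ∈-allFin b))

   MB : Mean (Len {Bool} (length tuples))
   MB = mean (lists bits (length tuples))

   g : List Bool → List V → Bool
   g = val tuples

   module _ (w : List V → ℚ) (w-sq : ∀ x → w x * w x ≤ 1ℚ) where

     h : List Bool → List V → ℚ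
     h bs x = w x * sgn (g bs x)

     h-sq : ∀ bs x → h bs x * h bs x ≤ 1ℚ
     h-sq bs x = sq≤1-* {w x} {sgn (g bs x)} (w-sq x) (≤-reflexive (sgn-sq (g bs x)))

     hp : List Bool → List (List V) → List V → ℚ
     hp bs Ps y = prodL (λ p → h bs (p ++ y)) Ps

     snoc : V → List V → List V
     snoc a p = p ++ a ∷ []

     hp-step : ∀ bs Ps a b y → hp bs Ps (a ∷ y) * hp bs Ps (b ∷ y) ≡ hp bs (map (snoc a) Ps ++ map (snoc b) Ps) y
     hp-step bs Ps a b y = trans (cong₂ _*_ (side a) (side b)) (sym (prodL-++ (λ p → h bs (p ++ y)) (map (snoc a) Ps) (map (snoc b) Ps)))
       where
       side : ∀ c → hp bs Ps (c ∷ y) ≡ prodL (λ p → h bs (p ++ y)) (map (snoc c) Ps)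
       side c = trans (prodL-cong Ps (λ p _ → cong (h bs) (sym (++-assoc p (c ∷ []) y)))) (sym (prodL-map (λ p → h bs (p ++ y)) (snoc c) Ps))

     -- a prefix that stays distinct from all others carries an independent sign
     avg : ∀ r p₀ Ps → length p₀ ℕ.+ r ≡ R → ¬ p₀ ∈ Ps → E MB (λ bs → T r (hp bs (p₀ ∷ Ps))) ≤ r /1 * u
     avg zero p₀ Ps len p₀∉ = ≤-reflexive (trans (E-cong MB (λ bs _ → solve 3 (λ w s p → w :* s :* p := s :* (w :* p)) refl (w (p₀ ++ [])) (sgn (g bs (p₀ ++ []))) (prodL (λ p → h bs (p ++ [])) Ps)))
         (trans (signs-cancel tuples (p₀ ++ []) (∈-tuples (p₀ ++ []) (trans (length-++ p₀) len)) (λ bs → w (p₀ ++ []) * prodL (λ p → h bs (p ++ [])) Ps) blind) (sym (zeroˡ u))))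
       where
       blind : Blind (p₀ ++ []) tuples (λ bs → w (p₀ ++ []) * prodL (λ p → h bs (p ++ [])) Ps)
       blind bs bs' e = cong (w (p₀ ++ []) *_) (prodL-cong Ps (λ p p∈ → cong (λ b → w (p ++ []) * sgn b) (e (p ++ []) (λ q → p₀∉ (subst (_∈ Ps) (trans (sym (++-identityʳ p)) (trans q (++-identityʳ p₀))) p∈)))))
     avg (suc r) p₀ Ps len p₀∉ = ≤-trans (≤-reflexive (trans (E-comm MB M (λ bs a → E M (λ b → T r (λ y → hp bs (p₀ ∷ Ps) (a ∷ y) * hp bs (p₀ ∷ Ps) (b ∷ y))))) (E-cong M (λ a _ → E-comm MB M (λ bs b → T r (λ y → hp bs (p₀ ∷ Ps) (a ∷ y) * hp bs (p₀ ∷ Ps) (b ∷ y)))))))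
         (≤-trans (E≤ M (r /1 * u + u) (λ a _ → ≤-trans (E-mono M {g = λ b → r /1 * u + 𝟙 ⌊ b Fin.≟ a ⌋} (λ b _ → each a b (b Fin.≟ a)))
           (≤-reflexive (trans (E-+ M (λ _ → r /1 * u) (λ b → 𝟙 ⌊ b Fin.≟ a ⌋)) (cong₂ _+_ (E-const M (r /1 * u)) (trans (cong (u *_) (∑-single n a)) (*-identityʳ u)))))))
         (≤-reflexive (solve 2 (λ r u → r :* u :+ u := ((con 1ℚ) :+ r) :* u) refl (r /1) u)))
       where
       F : V → V → List Bool → List V → ℚ
       F a b bs y = hp bs (p₀ ∷ Ps) (a ∷ y) * hp bs (p₀ ∷ Ps) (b ∷ y)
       -- Equal copies have probability `u` and get the trivial bound 1. For distinct ones, `p₀`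
       -- extended by `a` differs from every other extended prefix: from those ending in `b` by the
       -- last vertex, from those ending in `a` because `p₀` was new.
       each : ∀ a b (D : Dec (b ≡ a)) → E MB (λ bs → T r (F a b bs)) ≤ r /1 * u + 𝟙 ⌊ D ⌋
       each a b (yes _) = ≤-trans (E≤ MB 1ℚ (λ bs _ → T≤1 r (F a b bs) (λ y → sq≤1-* {hp bs (p₀ ∷ Ps) (a ∷ y)} {hp bs (p₀ ∷ Ps) (b ∷ y)} (prodL-sq≤1 (λ p → h bs (p ++ a ∷ y)) (λ p → h-sq bs (p ++ a ∷ y)) (p₀ ∷ Ps)) (prodL-sq≤1 (λ p → h bs (p ++ b ∷ y)) (λ p → h-sq bs (p ++ b ∷ y)) (p₀ ∷ Ps)))))
         (≤-by (r /1 * u) (mul≥0 (/1≥0 r) u≥0) (+-comm _ 1ℚ))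
       each a b (no b≢a) = ≤-trans (≤-reflexive (E-cong MB (λ bs _ → T-cong r {F a b bs} {hp bs (snoc a p₀ ∷ (map (snoc a) Ps ++ map (snoc b) (p₀ ∷ Ps)))} (λ y _ → hp-step bs (p₀ ∷ Ps) a b y))))
           (≤-trans (avg r (snoc a p₀) (map (snoc a) Ps ++ map (snoc b) (p₀ ∷ Ps)) (trans (cong (ℕ._+ r) (length-++ p₀)) (trans (ℕ.+-assoc (length p₀) 1 r) len)) (λ p → fresh (∈-++⁻ (map (snoc a) Ps) p))) (≤-reflexive (sym (+-identityʳ _))))
         where
         fresh : snoc a p₀ ∈ map (snoc a) Ps ⊎ snoc a p₀ ∈ map (snoc b) (p₀ ∷ Ps) → ⊥
         fresh (inj₁ p) with ∈-map⁻ (snoc a) p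
         ... | p' , p'∈ , e = p₀∉ (subst (_∈ Ps) (sym (proj₁ (∷ʳ-injective p₀ p' e))) p'∈)
         fresh (inj₂ p) with ∈-map⁻ (snoc b) p
         ... | p' , _ , e = b≢a (sym (proj₂ (∷ʳ-injective p₀ p' e)))

     avg-T : E MB (λ bs → T R (h bs)) ≤ R /1 * u
     avg-T = ≤-trans (≤-reflexive (E-cong MB (λ bs _ → T-cong R {h bs} {hp bs ([] ∷ [])} (λ y _ → sym (*-identityʳ _))))) (avg R [] [] refl (λ ()))

   wt : ℕ → V → List V → ℚ
   wt m v x = 𝟙 (inc (insertAt m v x))

   wt-sq : ∀ m v x → wt m v x * wt m v x ≤ 1ℚ
   wt-sq m v x = mul≤1 (𝟙≥0 (inc (insertAt m v x))) (𝟙≤1 (inc (insertAt m v x))) (𝟙≤1 (inc (insertAt m v x)))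

   -- A single sign function has to serve all positions, so they are averaged as one sum; when the
   -- terms are nonnegative, each is bounded by the total.
   good-signs : ∀ k → ∃ λ (s : List V → Bool) → ∑ (upTo k) (λ m → E M (λ v → T R (λ x → wt m v x * sgn (s x)))) ≤ k /1 * (R /1 * u)
   good-signs k = conv (E-∃≤ MB (λ bs → ∑ (upTo k) (λ m → E M (λ v → T R (h (wt m v) (wt-sq m v) bs)))))
     where
     bound : E MB (λ bs → ∑ (upTo k) (λ m → E M (λ v → T R (h (wt m v) (wt-sq m v) bs)))) ≤ k /1 * (R /1 * u)
     bound = ≤-trans (≤-reflexive (trans (sym (∑-swap (upTo k) (lin MB) (λ m bs → E M (λ v → T R (h (wt m v) (wt-sq m v) bs))))) (∑-cong (upTo k) (λ m _ → E-comm MB M (λ bs v → T R (h (wt m v) (wt-sq m v) bs))))))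
       (≤-trans (∑-≤const (upTo k) (R /1 * u) (λ m _ → E≤ M (R /1 * u) (λ v _ → avg-T (wt m v) (wt-sq m v)))) (≤-reflexive (cong (λ j → j /1 * (R /1 * u)) (length-upTo k))))
     conv : (∃ λ bs → Len (length tuples) bs × ∑ (upTo k) (λ m → E M (λ v → T R (h (wt m v) (wt-sq m v) bs))) ≤ E MB (λ bs → ∑ (upTo k) (λ m → E M (λ v → T R (h (wt m v) (wt-sq m v) bs))))) → ∃ λ (s : List V → Bool) → ∑ (upTo k) (λ m → E M (λ v → T R (λ x → wt m v x * sgn (s x)))) ≤ k /1 * (R /1 * u)
     conv (bs , _ , le) = g bs , ≤-trans le bound

 rem-below : ∀ {A : Set} j m v (y : List A) a b → j ℕ.< m → j ℕ.≤ length y → rem j (insertAt m v (insertAt j a y)) ≡ rem j (insertAt m v (insertAt j b y))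
 rem-below zero (suc m) v y a b _ _ = refl
 rem-below (suc j) (suc m) v (z ∷ y) a b (s≤s j<m) (s≤s j≤) = cong (z ∷_) (rem-below j m v y a b j<m j≤)

 rem-above : ∀ {A : Set} c m v (y : List A) a b → m ℕ.≤ c → c ℕ.≤ length y → rem (suc c) (insertAt m v (insertAt c a y)) ≡ rem (suc c) (insertAt m v (insertAt c b y))
 rem-above c zero v y a b _ c≤ = cong (v ∷_) (trans (rem-insert c a y c≤) (sym (rem-insert c b y c≤)))
 rem-above (suc c) (suc m) v (z ∷ y) a b (s≤s m≤) (s≤s c≤) = cong (z ∷_) (rem-above c m v y a b m≤ c≤)

 rem-comm : ∀ {A : Set} a b (l : List A) → a ℕ.≤ b → rem b (rem a l) ≡ rem a (rem (suc b) l)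
 rem-comm a b [] _ = refl
 rem-comm zero b (x ∷ l) _ = refl
 rem-comm (suc a) (suc b) (x ∷ l) (s≤s p) = cong (x ∷_) (rem-comm a b l p)

 𝟙-allB : ∀ {A : Set} (p : A → Bool) xs → 𝟙 (allB p xs) ≡ prodL (𝟙 ∘ p) xs
 𝟙-allB p [] = refl
 𝟙-allB p (x ∷ xs) = trans (𝟙-∧ (p x) (allB p xs)) (cong (𝟙 (p x) *_) (𝟙-allB p xs))

 sgn-xor : ∀ a b → sgn (a xor b) ≡ sgn a * (- sgn b)
 sgn-xor true true = solve 0 ((:- (con 1ℚ)) := (con 1ℚ) :* (:- (con 1ℚ))) refl
 sgn-xor true false = solve 0 ((con 1ℚ) := (con 1ℚ) :* (:- (:- (con 1ℚ)))) refl
 sgn-xor false true = solve 0 ((con 1ℚ) := (:- (con 1ℚ)) :* (:- (con 1ℚ))) refl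
 sgn-xor false false = solve 0 ((:- (con 1ℚ)) := (:- (con 1ℚ)) :* (:- (:- (con 1ℚ)))) refl

 𝟙-sgn : ∀ b → 𝟙 b ≡ ½ + ½ * sgn b
 𝟙-sgn true = solve 0 ((con 1ℚ) := (con ½) :+ (con ½) :* (con 1ℚ)) refl
 𝟙-sgn false = solve 0 ((con 0ℚ) := (con ½) :+ (con ½) :* (:- (con 1ℚ))) refl

 𝟙-sq : ∀ b → 𝟙 b * 𝟙 b ≤ 1ℚ
 𝟙-sq b = mul≤1 (𝟙≥0 b) (𝟙≤1 b) (𝟙≤1 b)

 𝟙-∨ : ∀ a b → (a ≡ true → b ≡ true → ⊥) → 𝟙 a + 𝟙 b ≡ 𝟙 (a ∨ b)
 𝟙-∨ true true h = ⊥-elim (h refl refl)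
 𝟙-∨ true false h = +-identityʳ 1ℚ
 𝟙-∨ false b h = +-identityˡ (𝟙 b)

 odd : ℕ → Bool
 odd zero = false
 odd (suc m) = not (odd m)

 -- The hypergraph of a sign function

 module SignGraph {n : ℕ} (s : List (Fin n) → Bool) (q : ℕ) where

   k : ℕ
   k = suc (suc q)

   -- `σ` is the excluded sign: the value is true when the twisted sign at `i` equals `not σ`.
   cb : Bool → List (Fin n) → ℕ → Bool
   cb σ Z i = (s (rem i Z) xor odd i) xor σ

   mono : Bool → ℕ → List (Fin n) → Bool
   mono σ zero Z = true
   mono σ (suc m) Z = cb σ Z m ∧ mono σ m Z

   H : Hypergraph n
   H t = hasSize k t ∧ (mono false k (elems t) ∨ mono true k (elems t))

   H-uniform : Uniform k H
   H-uniform t e = hasSize-true k t (proj₁ (∧-true (hasSize k t) _ e))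

   mono-∀ : ∀ σ m Z → mono σ m Z ≡ true → ∀ i → i ℕ.< m → cb σ Z i ≡ true
   mono-∀ σ (suc m) Z e i (s≤s i≤m) with ℕ.m≤n⇒m<n∨m≡n i≤m
   ... | inj₁ i<m = mono-∀ σ m Z (proj₂ (∧-true (cb σ Z m) _ e)) i i<m
   ... | inj₂ refl = proj₁ (∧-true (cb σ Z m) _ e)

   H-≥ : ∀ Z → Len k Z → inc Z ≡ true → 𝟙 (mono false k Z) + 𝟙 (mono true k Z) ≡ 𝟙 (H (setL Z))
   H-≥ Z lz iz = trans (𝟙-∨ (mono false k Z) (mono true k Z) (λ p p' → both (mono-∀ false k Z p 0 (s≤s z≤n)) (mono-∀ true k Z p' 0 (s≤s z≤n))))
       (cong 𝟙 (sym (cong₂ _∧_ (true-hasSize k (setL Z) (trans (size-setL Z iz) lz)) (cong (λ t → mono false k t ∨ mono true k t) (elems-setL Z iz)))))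
     where
     both : cb false Z 0 ≡ true → cb true Z 0 ≡ true → ⊥
     both = go (s (rem 0 Z) xor odd 0)
       where
       go : ∀ b → b xor false ≡ true → b xor true ≡ true → ⊥
       go true _ ()
       go false () _

   H-signs : ∀ Z → inc Z ≡ true → H (setL Z) ≡ true → Len k Z × ∃ λ σ → ∀ i → i ℕ.< k → s (rem i Z) xor odd i ≡ σ
   H-signs Z iz e = trans (sym (size-setL Z iz)) (H-uniform (setL Z) e) , split (bool-case (mono false k Z))
     where
     or : mono false k Z ∨ mono true k Z ≡ true
     or = subst (λ t → mono false k t ∨ mono true k t ≡ true) (elems-setL Z iz) (proj₂ (∧-true (hasSize k (setL Z)) _ e))
     xf : ∀ b → b xor false ≡ true → b ≡ true
     xf true _ = refl
     xt : ∀ b → b xor true ≡ true → b ≡ false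
     xt false _ = refl
     split : mono false k Z ≡ true ⊎ mono false k Z ≡ false → ∃ λ σ → ∀ i → i ℕ.< k → s (rem i Z) xor odd i ≡ σ
     split (inj₁ p) = true , λ i i< → xf _ (mono-∀ false k Z p i i<)
     split (inj₂ p) = false , λ i i< → xt _ (mono-∀ true k Z (subst (λ b → b ∨ mono true k Z ≡ true) p or) i i<)

   Signed : List (Fin n) → Bool → Set
   Signed Z σ = ∀ i → i ℕ.< k → s (rem i Z) xor odd i ≡ σ

   -- The set omitting both positions lies in both edges, as the face opposite `b` in one and
   -- opposite `a` in the other. The later deletion shifts its index by one, and this shift flips a
   -- parity, so the two twisted values cannot agree.
   clash< : ∀ L a b σ σ' → a ℕ.≤ b → b ℕ.< k → Signed (rem a L) σ → Signed (rem (suc b) L) σ' → σ xor odd a ≡ σ' xor odd (suc b) → ⊥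
   clash< L a b σ σ' a≤b b<k h h' = go (s (rem a (rem (suc b) L))) (odd a) (odd b) σ σ' (trans (cong (λ t → s t xor odd b) (sym (rem-comm a b L a≤b))) (h b b<k)) (h' a (ℕ.≤-<-trans a≤b b<k))
     where
     go : ∀ x oa ob σ σ' → x xor ob ≡ σ → x xor oa ≡ σ' → σ xor oa ≡ σ' xor not ob → ⊥
     go true true true _ _ refl refl ()
     go true true false _ _ refl refl ()
     go true false true _ _ refl refl ()
     go true false false _ _ refl refl ()
     go false true true _ _ refl refl ()
     go false true false _ _ refl refl ()
     go false false true _ _ refl refl ()
     go false false false _ _ refl refl ()

   clash : ∀ L a b σ σ' → a ≢ b → a ℕ.≤ k → b ℕ.≤ k → Signed (rem a L) σ → Signed (rem b L) σ' → σ xor odd a ≡ σ' xor odd b → ⊥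
   clash L a b σ σ' a≢b a≤ b≤ h h' e = go (ℕ.<-cmp a b)
     where
     up : ∀ a b σ σ' → a ℕ.< b → b ℕ.≤ k → Signed (rem a L) σ → Signed (rem b L) σ' → σ xor odd a ≡ σ' xor odd b → ⊥
     up a (suc b) σ σ' (s≤s a≤b) b≤ h h' e = clash< L a b σ σ' a≤b b≤ h h' e
     go : Tri (a ℕ.< b) (a ≡ b) (b ℕ.< a) → ⊥
     go (tri< lt _ _) = up a b σ σ' lt b≤ h h' e
     go (tri≈ _ eq _) = a≢b eq
     go (tri> _ _ lt) = up b a σ' σ lt a≤ h' h (sym e)

   position : ∀ (L : List (Fin n)) → inc L ≡ true → ∀ {x} → x ∈ L → ∃ λ p → p ℕ.< length L × (∀ {y} → y ∈ rem p L → y ∈ L × y ≢ x) × (∀ {y} → y ∈ L → y ≢ x → y ∈ rem p L)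
   position (z ∷ L) i (here refl) = 0 , s≤s z≤n , (λ p → there p , (λ { refl → ℕ.<-irrefl refl (above-< z L i p) })) , (λ { (here e) ne → ⊥-elim (ne e) ; (there p) _ → p })
   position (z ∷ L) i (there x∈) with position L (inc-tail z L i) x∈
   ... | p , p< , f , g = suc p , s≤s p< , (λ { (here refl) → here refl , (λ { refl → ℕ.<-irrefl refl (above-< z L i x∈) }) ; (there y∈) → there (proj₁ (f y∈)) , proj₂ (f y∈) }) , (λ { (here e) _ → here e ; (there y∈) ne → there (g y∈ ne) })

   -- By `clash`, the common sign of an edge twisted by the parity of its omitted vertex differs
   -- between any two of the three edges, but a Boolean has only two values.
   H-free : Free (F-edge k) H
   H-free (φ , φ-inj , edges) = three (τ zero z<3) (τ (suc zero) 1<3) (τ (suc (suc zero)) 2<3)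
       (differ zero (suc zero) (λ ()) z<3 1<3) (differ zero (suc (suc zero)) (λ ()) z<3 2<3) (differ (suc zero) (suc (suc zero)) (λ ()) 1<3 2<3)
     where
     z<3 : 0 ℕ.< 3
     z<3 = s≤s z≤n
     1<3 : 1 ℕ.< 3
     1<3 = s≤s (s≤s z≤n)
     2<3 : 2 ℕ.< 3
     2<3 = s≤s (s≤s (s≤s z≤n))
     W : Subset n
     W = setL (map φ (allFin (suc k)))
     L : List (Fin n)
     L = elems W
     iL : inc L ≡ true
     iL = inc-elems W
     ∈L : ∀ j → φ j ∈ L
     ∈L j = ∈-setL⁻ L (subst (φ j ∈ₛ_) (sym (setL-elems W)) (∈-setL⁺ (map φ (allFin (suc k))) (∈-map⁺ φ (∈-allFin j))))
     L∈ : ∀ {y} → y ∈ L → ∃ λ j → y ≡ φ j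
     L∈ {y} y∈ with ∈-map⁻ φ (∈-setL⁻ (map φ (allFin (suc k))) (subst (y ∈ₛ_) (setL-elems W) (∈-setL⁺ L y∈)))
     ... | j , _ , e = j , e
     place : ∀ j → ∃ λ p → p ℕ.< length L × (∀ {y} → y ∈ rem p L → y ∈ L × y ≢ φ j) × (∀ {y} → y ∈ L → y ≢ φ j → y ∈ rem p L)
     place j = position L iL (∈L j)
     at : Fin (suc k) → ℕ
     at j = proj₁ (place j)
     set≡ : ∀ i → image φ (Sub.∁ ⁅ i ⁆) ≡ setL (rem (at i) L)
     set≡ i = Sub.⊆-antisym to from
       where
       to : image φ (Sub.∁ ⁅ i ⁆) ⊆ₛ setL (rem (at i) L)
       to p with ∈-image⁻ φ (Sub.∁ ⁅ i ⁆) p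
       ... | j , j∈ , refl = ∈-setL⁺ (rem (at i) L) (proj₂ (proj₂ (proj₂ (place i))) (∈L j) (λ e → Sub.x∈∁p⇒x∉p j∈ (subst (_∈ₛ ⁅ i ⁆) (sym (φ-inj e)) (Sub.x∈⁅x⁆ i))))
       from : setL (rem (at i) L) ⊆ₛ image φ (Sub.∁ ⁅ i ⁆)
       from {y} p with proj₁ (proj₂ (proj₂ (place i))) (∈-setL⁻ (rem (at i) L) p)
       ... | y∈ , ne with L∈ y∈
       ... | j , refl = ∈-image⁺ φ (Sub.∁ ⁅ i ⁆) (Sub.x∉p⇒x∈∁p (λ m → ne (cong φ (Sub.x∈⁅y⁆⇒x≡y i m))))
     edge : ∀ i → toℕ i ℕ.< 3 → H (setL (rem (at i) L)) ≡ true
     edge i i<3 = subst (λ t → H t ≡ true) (set≡ i) (edges (Sub.∁ ⁅ i ⁆) (i , i<3 , refl))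
     signs : ∀ i → toℕ i ℕ.< 3 → Len k (rem (at i) L) × ∃ (Signed (rem (at i) L))
     signs i i<3 = H-signs (rem (at i) L) (⊆-inc (rem-⊆ (at i) L) iL) (edge i i<3)
     at-≤ : ∀ i → toℕ i ℕ.< 3 → at i ℕ.≤ k
     at-≤ i i<3 = ℕ.≤-pred (ℕ.≤-trans (proj₁ (proj₂ (place i))) (ℕ.≤-reflexive (trans (sym (length-rem (at i) L (proj₁ (proj₂ (place i))))) (cong suc (proj₁ (signs i i<3))))))
     σ : ∀ i → toℕ i ℕ.< 3 → Bool
     σ i i<3 = proj₁ (proj₂ (signs i i<3))
     τ : ∀ i → toℕ i ℕ.< 3 → Bool
     τ i p = σ i p xor odd (at i)
     at-≢ : ∀ i j → i ≢ j → at i ≢ at j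
     at-≢ i j i≢j e = proj₂ (proj₁ (proj₂ (proj₂ (place i))) (subst (λ p → φ i ∈ rem p L) (sym e) (proj₂ (proj₂ (proj₂ (place j))) (∈L i) (λ q → i≢j (φ-inj q))))) refl
     differ : ∀ i j → i ≢ j → ∀ p p' → τ i p ≡ τ j p' → ⊥
     differ i j i≢j p p' = clash L (at i) (at j) (σ i p) (σ j p') (at-≢ i j i≢j) (at-≤ i p) (at-≤ j p') (proj₂ (proj₂ (signs i p))) (proj₂ (proj₂ (signs j p')))
     three : ∀ a b c → (a ≡ b → ⊥) → (a ≡ c → ⊥) → (b ≡ c → ⊥) → ⊥
     three true true c p q r = p refl
     three true false true p q r = q refl
     three true false false p q r = r refl
     three false false c p q r = p refl
     three false true false p q r = q refl
     three false true true p q r = r refl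

 -- The density of the sign hypergraph over every clique set.

 module SignDensity {n : ℕ} (ne : 0 ℕ.< n) (v₀ : Fin n) (s : List (Fin n) → Bool) (q : ℕ) (κ δ : ℚ) (δ≥0 : 0ℚ ≤ δ) where
   open Uni n ne using (MF)
   open Box MF v₀
   open SignGraph s q
   private
     V = Fin n
     M = mean MF
     r = suc q
     Mk = mean (lists MF k)

   wt : ℕ → V → List V → ℚ
   wt m v x = 𝟙 (inc (insertAt m v x)) * sgn (s x)

   -- Deleting position `j` after inserting `v` at `m` removes an entry of `x`: coordinate `j` if
   -- `j` is below `m`, the preceding one if it is above.
   Cyl-remove : ∀ (F : List V → ℚ) → (∀ l → F l * F l ≤ 1ℚ) → ∀ m v j → m ℕ.≤ r → j ℕ.≤ r → j ≢ m → Cyl r (λ x → F (rem j (insertAt m v x)))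
   Cyl-remove F bd m v j m≤r j≤r j≢m = go (ℕ.<-cmp j m)
     where
     len : ∀ c (a : V) y → Len r (insertAt c a y) → length y ≡ q
     len c a y l = suc-inj (trans (sym (length-insert c a y)) l)
     down : ∀ j → j ℕ.≤ r → m ℕ.< j → Cyl r (λ x → F (rem j (insertAt m v x)))
     down (suc c) (s≤s c≤q) (s≤s m≤c) = Cyl-ignores r c (λ x → F (rem (suc c) (insertAt m v x))) (s≤s c≤q) (λ x → bd (rem (suc c) (insertAt m v x)))
       (λ y a b l → cong F (rem-above c m v y a b m≤c (ℕ.≤-trans c≤q (ℕ.≤-reflexive (sym (len c a y l))))))
     go : Tri (j ℕ.< m) (j ≡ m) (m ℕ.< j) → Cyl r (λ x → F (rem j (insertAt m v x)))
     go (tri< lt _ _) = Cyl-ignores r j (λ x → F (rem j (insertAt m v x))) (ℕ.<-≤-trans lt m≤r) (λ x → bd (rem j (insertAt m v x)))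
       (λ y a b l → cong F (rem-below j m v y a b lt (ℕ.≤-trans (ℕ.≤-pred (ℕ.<-≤-trans lt m≤r)) (ℕ.≤-reflexive (sym (len j a y l))))))
     go (tri≈ _ e _) = ⊥-elim (j≢m e)
     go (tri> _ _ gt) = down j j≤r gt

   -- If the first deletion takes away `v` itself, the second one supplies the ignored coordinate.
   Cyl-remove₂ : ∀ (F : List V → ℚ) → (∀ l → F l * F l ≤ 1ℚ) → ∀ m v j l → m ℕ.≤ r → j ℕ.≤ r → l ℕ.< r → Cyl r (λ x → F (rem l (rem j (insertAt m v x))))
   Cyl-remove₂ F bd m v j l m≤r j≤r l<r = go (j ℕ.≟ m)
     where
     go : Dec (j ≡ m) → Cyl r (λ x → F (rem l (rem j (insertAt m v x))))
     go (no ne') = Cyl-remove (λ t → F (rem l t)) (λ t → bd (rem l t)) m v j m≤r j≤r ne'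
     go (yes refl) = Cyl-cong r (λ x → F (rem l x)) (λ x → F (rem l (rem j (insertAt j v x)))) (λ y e → cong (λ t → F (rem l t)) (sym (rem-insert j v y (ℕ.≤-trans m≤r (ℕ.≤-reflexive (sym e))))))
       (Cyl-ignores r l (λ x → F (rem l x)) l<r (λ x → bd (rem l x)) (λ y a b e → cong F (trans (rem-insert l a y (fit y a e)) (sym (rem-insert l b y (fit y a e))))))
       where
       fit : ∀ y a → Len r (insertAt l a y) → l ℕ.≤ length y
       fit y a e = ℕ.≤-trans (ℕ.≤-pred l<r) (ℕ.≤-reflexive (sym (suc-inj (trans (sym (length-insert l a y)) e))))

   Cyl-prod : ∀ {A : Set} (js : List A) (F : A → List V → ℚ) → (∀ j → j ∈ js → Cyl r (F j)) → Cyl r (λ x → prodL (λ j → F j x) js)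
   Cyl-prod [] F h = Cyl-1 r
   Cyl-prod (j ∷ js) F h = Cyl-* r (F j) (λ x → prodL (λ j → F j x) js) (h j (here refl)) (Cyl-prod js F (λ i → h i ∘ there))

   module _ (G : Hypergraph n) where

     Kb : List V → Bool
     Kb Z = allB (λ j → allB (λ l → G (setL (rem l (rem j Z)))) (upTo r)) (upTo k)

     Kb≡ : ∀ Z → Len k Z → inc Z ≡ true → inKk q G (setL Z) ≡ Kb Z
     Kb≡ Z lz iz = bool-iff _ _ (λ e → ∈-allB _ (upTo k) (λ j∈ → ∈-allB _ (upTo r) (λ l∈ → inKk-list⇒ q G Z iz lz e (∈-upTo⁻ j∈) (∈-upTo⁻ l∈))))
       (λ e → ⇒inKk-list q G Z iz lz (λ {j} {l} j< l< → allB-∈ (λ l → G (setL (rem l (rem j Z)))) (upTo r) (allB-∈ (λ j → allB (λ l → G (setL (rem l (rem j Z)))) (upTo r)) (upTo k) e (∈-upTo⁺ j<)) (∈-upTo⁺ l<)))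

     K : List V → ℚ
     K Z = 𝟙 (Kb Z)

     K-prod : ∀ Z → K Z ≡ prodL (λ j → prodL (λ l → 𝟙 (G (setL (rem l (rem j Z))))) (upTo r)) (upTo k)
     K-prod Z = trans (𝟙-allB (λ j → allB (λ l → G (setL (rem l (rem j Z)))) (upTo r)) (upTo k)) (prodL-cong (upTo k) (λ j _ → 𝟙-allB (λ l → G (setL (rem l (rem j Z)))) (upTo r)))

     Cyl-K : ∀ m v → m ℕ.≤ r → Cyl r (λ x → K (insertAt m v x))
     Cyl-K m v m≤r = Cyl-cong r (λ x → prodL (λ j → prodL (λ l → F (rem l (rem j (insertAt m v x)))) (upTo r)) (upTo k)) (λ x → K (insertAt m v x)) (λ x _ → sym (K-prod (insertAt m v x)))
         (Cyl-prod (upTo k) (λ j x → prodL (λ l → F (rem l (rem j (insertAt m v x)))) (upTo r)) (λ j j∈ → Cyl-prod (upTo r) (λ l x → F (rem l (rem j (insertAt m v x)))) (λ l l∈ → Cyl-remove₂ F (λ t → 𝟙-sq (G (setL t))) m v j l m≤r (ℕ.≤-pred (∈-upTo⁻ j∈)) (∈-upTo⁻ l∈))))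
       where
       F : List V → ℚ
       F t = 𝟙 (G (setL t))

     Cyl-mono : ∀ σ m v m' → m ℕ.≤ r → m' ℕ.≤ m → Cyl r (λ x → 𝟙 (mono σ m' (insertAt m v x)))
     Cyl-mono σ m v zero m≤r _ = Cyl-1 r
     Cyl-mono σ m v (suc m') m≤r m'<m = Cyl-cong r (λ x → F (rem m' (insertAt m v x)) * 𝟙 (mono σ m' (insertAt m v x))) (λ x → 𝟙 (mono σ (suc m') (insertAt m v x))) (λ x _ → sym (𝟙-∧ (cb σ (insertAt m v x) m') (mono σ m' (insertAt m v x))))
         (Cyl-* r (λ x → F (rem m' (insertAt m v x))) (λ x → 𝟙 (mono σ m' (insertAt m v x))) (Cyl-remove F (λ t → 𝟙-sq ((s t xor odd m') xor σ)) m v m' m≤r (ℕ.≤-trans (ℕ.<⇒≤ m'<m) m≤r) (ℕ.<⇒≢ m'<m)) (Cyl-mono σ m v m' m≤r (ℕ.<⇒≤ m'<m)))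
       where
       F : List V → ℚ
       F t = 𝟙 ((s t xor odd m') xor σ)

     I : List V → ℚ
     I Z = 𝟙 (inc Z)

     -- The bias that remains when the indicator at position `m` is written as one half plus half a
     -- sign. Expanding one factor at a time leaves one such term per position instead of one per
     -- set of positions.
     X : Bool → ℕ → ℚ
     X σ m = E Mk (λ Z → I Z * (K Z * (sgn (cb σ Z m) * 𝟙 (mono σ m Z))))

     P : Bool → ℕ → ℚ
     P σ m = E Mk (λ Z → I Z * (K Z * 𝟙 (mono σ m Z)))

     module _ (box : ∀ m → m ℕ.< k → E M (λ v → T r (wt m v)) ≤ κ) (κ≤ : κ ≤ pw r δ) where

       -- With the vertex at position `m` fixed, the sign in question belongs to the whole remaining
       -- tuple, while every other factor omits one of its vertices. So all the other factors form a
       -- cylinder function and the box norm controls the average.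
       X-lower : ∀ σ m → m ℕ.< k → - δ ≤ X σ m
       X-lower σ m m<k = pw-lower q δ≥0 (≤-trans (≤-reflexive (cong (pw r) X≡)) (≤-trans (jensen r M Y) (≤-trans (E-mono M (λ v _ → gcs r (wt m v) (Φ v) (cyl v))) (≤-trans (box m m<k) κ≤))))
         where
         m≤r : m ℕ.≤ r
         m≤r = ℕ.≤-pred m<k
         c : ℚ
         c = (- sgn (odd m)) * (- sgn σ)
         c-sq : c * c ≤ 1ℚ
         c-sq = ≤-reflexive (trans (solve 2 (λ a b → ((:- a) :* (:- b)) :* ((:- a) :* (:- b)) := (a :* a) :* (b :* b)) refl (sgn (odd m)) (sgn σ)) (trans (cong₂ _*_ (sgn-sq (odd m)) (sgn-sq σ)) (*-identityˡ 1ℚ)))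
         Φ : V → List V → ℚ
         Φ v x = c * (K (insertAt m v x) * 𝟙 (mono σ m (insertAt m v x)))
         cyl : ∀ v → Cyl r (Φ v)
         cyl v = Cyl-* r (λ _ → c) (λ x → K (insertAt m v x) * 𝟙 (mono σ m (insertAt m v x))) (Cyl-ignores r 0 (λ _ → c) (s≤s z≤n) (λ _ → c-sq) (λ _ _ _ _ → refl))
           (Cyl-* r (λ x → K (insertAt m v x)) (λ x → 𝟙 (mono σ m (insertAt m v x))) (Cyl-K m v m≤r) (Cyl-mono σ m v m m≤r ℕ.≤-refl))
         Y : V → ℚ
         Y v = Eᴸ MF r (λ x → wt m v x * Φ v x)
         sgn≡ : ∀ v x → Len r x → sgn (cb σ (insertAt m v x) m) ≡ sgn (s x) * c
         sgn≡ v x l = trans (cong (λ t → sgn ((s t xor odd m) xor σ)) (rem-insert m v x (ℕ.≤-trans m≤r (ℕ.≤-reflexive (sym l))))) (trans (sgn-xor (s x xor odd m) σ) (trans (cong (_* (- sgn σ)) (sgn-xor (s x) (odd m))) (*-assoc _ _ _)))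
         X≡ : X σ m ≡ E M Y
         X≡ = trans (Eᴸ-insert MF r m m≤r (λ Z → I Z * (K Z * (sgn (cb σ Z m) * 𝟙 (mono σ m Z))))) (E-cong M (λ v _ → E-cong (mean (lists MF r)) {g = λ x → wt m v x * Φ v x} (λ x l →
           trans (cong (λ t → I (insertAt m v x) * (K (insertAt m v x) * (t * 𝟙 (mono σ m (insertAt m v x))))) (sgn≡ v x l)) (solve 5 (λ i k s c p → i :* (k :* (s :* c :* p)) := i :* s :* (c :* (k :* p))) refl (I (insertAt m v x)) (K (insertAt m v x)) (sgn (s x)) c (𝟙 (mono σ m (insertAt m v x)))))))

       -- The error does not accumulate: each step averages the previous error with the new bias,
       -- and both are at most `δ`.
       P-lower : ∀ σ m → m ℕ.≤ k → pow ½ m * E Mk (λ Z → I Z * K Z) - δ ≤ P σ m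
       P-lower σ zero _ = ≤-trans (≤-by δ δ≥0 (solve 2 (λ x d → x := (con 1ℚ) :* x :- d :+ d) refl (E Mk (λ Z → I Z * K Z)) δ)) (≤-reflexive (E-cong Mk (λ Z _ → cong (I Z *_) (sym (*-identityʳ (K Z))))))
       P-lower σ (suc m) m<k = ≤-trans (≤-sub (≤-trans (add≥0 (mul≥0 0≤½ (sub≥0 (P-lower σ m (ℕ.<⇒≤ m<k)))) (mul≥0 0≤½ (sub≥0 (X-lower σ m m<k))))
           (≤-reflexive (solve 5 (λ p w d x y → (con ½) :* (x :- (p :* w :- d)) :+ (con ½) :* (y :- (:- d)) := (con ½) :* x :+ (con ½) :* y :- ((con ½) :* p :* w :- d)) refl (pow ½ m) (E Mk (λ Z → I Z * K Z)) δ (P σ m) (X σ m)))))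
         (≤-reflexive (sym (trans (E-cong Mk {g = λ Z → ½ * f Z + ½ * x Z} each) (trans (E-+ Mk (λ Z → ½ * f Z) (λ Z → ½ * x Z)) (cong₂ _+_ (E-* Mk ½ f) (E-* Mk ½ x))))))
         where
         f x : List V → ℚ
         f Z = I Z * (K Z * 𝟙 (mono σ m Z))
         x Z = I Z * (K Z * (sgn (cb σ Z m) * 𝟙 (mono σ m Z)))
         each : ∀ Z → Len k Z → I Z * (K Z * 𝟙 (mono σ (suc m) Z)) ≡ ½ * f Z + ½ * x Z
         each Z _ = trans (cong (λ t → I Z * (K Z * t)) (trans (𝟙-∧ (cb σ Z m) (mono σ m Z)) (cong (_* 𝟙 (mono σ m Z)) (𝟙-sgn (cb σ Z m))))) (solve 4 (λ i k s p → i :* (k :* (((con ½) :+ (con ½) :* s) :* p)) := (con ½) :* (i :* (k :* p)) :+ (con ½) :* (i :* (k :* (s :* p)))) refl (I Z) (K Z) (sgn (cb σ Z m)) (𝟙 (mono σ m Z)))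

       -- The two monochromatic patterns are disjoint and have relative density `pow ½ k` each, up
       -- to `δ`.
       dense-E : pow ½ r * E Mk (λ Z → I Z * 𝟙 (inKk q G (setL Z))) - (δ + δ) ≤ E Mk (λ Z → I Z * (𝟙 (inKk q G (setL Z)) * 𝟙 (H (setL Z))))
       dense-E = ≤-trans (≤-reflexive (trans (cong (λ w → pow ½ r * w - (δ + δ)) (E-cong Mk {g = λ Z → I Z * K Z} (λ Z lz → on-inc Z (λ iz → cong 𝟙 (Kb≡ Z lz iz))))) (solve 3 (λ p w d → p :* w :- (d :+ d) := (con ½) :* p :* w :- d :+ ((con ½) :* p :* w :- d)) refl (pow ½ r) (E Mk (λ Z → I Z * K Z)) δ)))
         (≤-trans (+-mono-≤ (P-lower false k ℕ.≤-refl) (P-lower true k ℕ.≤-refl)) (≤-reflexive (sym (trans (E-cong Mk {g = λ Z → I Z * (K Z * 𝟙 (mono false k Z)) + I Z * (K Z * 𝟙 (mono true k Z))}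
           (λ Z lz → trans (on-inc Z (λ iz → cong₂ _*_ (cong 𝟙 (Kb≡ Z lz iz)) (sym (H-≥ Z lz iz)))) (solve 4 (λ i k a b → i :* (k :* (a :+ b)) := i :* (k :* a) :+ i :* (k :* b)) refl (I Z) (K Z) (𝟙 (mono false k Z)) (𝟙 (mono true k Z)))))
           (E-+ Mk (λ Z → I Z * (K Z * 𝟙 (mono false k Z))) (λ Z → I Z * (K Z * 𝟙 (mono true k Z))))))))
         where
         on-inc : ∀ Z {a b} → (inc Z ≡ true → a ≡ b) → I Z * a ≡ I Z * b
         on-inc Z {a} {b} h = go (inc Z) h
           where
           go : ∀ i → (i ≡ true → a ≡ b) → 𝟙 i * a ≡ 𝟙 i * b
           go true h = cong (1ℚ *_) (h refl)
           go false h = trans (zeroˡ a) (sym (zeroˡ b))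

 opaque
   unfolding _+_

   minus-< : ∀ h ε → 0ℚ < ε → Data.Rational._-_ h ε < h
   minus-< h ε ε>0 = <-sub {h - ε} {h} (<-≤-trans ε>0 (≤-reflexive (solve 2 (λ h e → e := h :- (h :- e)) refl h ε)))

 module Construction (q : ℕ) (η : ℚ) (η>0 : 0ℚ < η) (N : ℕ) where

   r k : ℕ
   r = suc q
   k = suc r

   δ κ A : ℚ
   -- Each of the two patterns loses `δ`. `κ` is the box-norm bound under which every bias stays
   -- above `- δ`, and `n` is taken so large that `A` divided by `n` is at most `κ`.
   δ = ½ * η
   κ = pw r δ
   A = k /1 * r /1

   δ>0 : 0ℚ < δ
   δ>0 = mul>0 0<½ η>0

   κ>0 : 0ℚ < κ
   κ>0 = pw>0 r δ>0

   large : ∃ λ m → A * inv κ ≤ m /1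
   large = archimedes (A * inv κ)

   n : ℕ
   n = suc (N ℕ.+ proj₁ large)

   ne : 0 ℕ.< n
   ne = s≤s z≤n

   open Uni n ne using (MF; u; u≥0; u*n; E-S; pow-n)

   A-small : k /1 * (r /1 * u) ≤ κ
   A-small = ≤-trans (≤-reflexive (solve 3 (λ k r u → k :* (r :* u) := (k :* r) :* u) refl (k /1) (r /1) u)) (≤-trans (mul-monoʳ u u≥0 A≤) (≤-reflexive (trans (solve 3 (λ n c u → n :* c :* u := c :* (u :* n)) refl (n /1) κ u) (trans (cong (κ *_) u*n) (*-identityʳ κ)))))
     where
     A≤ : A ≤ n /1 * κ
     A≤ = ≤-trans (≤-reflexive (sym (trans (*-assoc A (inv κ) κ) (trans (cong (A *_) (inv-inverseˡ κ (>0⇒≢0 κ>0))) (*-identityʳ A))))) (mul-monoʳ κ (<⇒≤ κ>0) (≤-trans (proj₂ large) (/1-mono (ℕ.m≤n⇒m≤1+n (ℕ.m≤n+m (proj₁ large) N)))))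

   signs : ∃ λ (s : List (Fin n) → Bool) → ∑ (upTo k) (λ m → E (mean MF) (λ v → Box.T MF zero r (λ x → 𝟙 (inc (insertAt m v x)) * sgn (s x)))) ≤ k /1 * (r /1 * u)
   signs = Average.good-signs n ne zero r k

   s : List (Fin n) → Bool
   s = proj₁ signs

   open SignGraph s q using (H; H-uniform; H-free)

   box : ∀ m → m ℕ.< k → E (mean MF) (λ v → Box.T MF zero r (SignDensity.wt ne zero s q κ δ (<⇒≤ δ>0) m v)) ≤ κ
   box m m<k = ≤-trans (∑-≥term (upTo k) {λ m → E (mean MF) (λ v → Box.T MF zero r (λ x → 𝟙 (inc (insertAt m v x)) * sgn (s x)))} (λ m _ → E≥0 (mean MF) (λ v _ → Box.T≥0 MF zero q (λ x → 𝟙 (inc (insertAt m v x)) * sgn (s x)))) (∈-upTo⁺ m<k)) (≤-trans (proj₂ signs) A-small)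

   H-dense : Dense k (halfPow r) η q H
   H-dense = subst (λ d → Dense k d η q H) (sym (halfPow≡ r)) (/1-Dense k (pow ½ r) η q H (λ G _ → mul-cancelˡ-≤ (pow u k) (pow>0 (inv>0 (/1>0′ (subst (0 ℕ.<_) (sym (Uni.len n ne)) ne))) k) (scaled G)))
     where
     scaled : ∀ G → pow u k * (pow ½ r * countKk k q G /1 - η * (n ℕ.^ k) /1) ≤ pow u k * countKkE k q G H /1
     scaled G = ≤-trans (≤-reflexive (trans (solve 5 (λ p d c h m → p :* (d :* c :- h :* m) := d :* (p :* c) :- h :* (p :* m)) refl (pow u k) (pow ½ r) (countKk k q G /1) η ((n ℕ.^ k) /1))
         (cong₂ (λ a b → pow ½ r * a - b) (trans (cong (pow u k *_) (countKk-S k q G)) (sym (E-S k (λ l → 𝟙 (inc l) * 𝟙 (inKk q G (setL l)))))) (trans (cong (η *_) (pow-n k)) (solve 1 (λ h → h :* (con 1ℚ) := (con ½) :* h :+ (con ½) :* h) refl η)))))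
       (≤-trans (SignDensity.dense-E ne zero s q κ δ (<⇒≤ δ>0) G box ≤-refl) (≤-reflexive (trans (E-S k (λ l → 𝟙 (inc l) * (𝟙 (inKk q G (setL l)) * 𝟙 (H (setL l))))) (cong (pow u k *_) (sym (countKkE-S k q G H))))))

 lower-bound : ∀ q → Admissible (suc (suc q)) q (suc (suc (suc q))) (F-edge (suc (suc q))) (halfPow (suc q))
 lower-bound q η η>0 N = n , ℕ.m≤n⇒m≤1+n (ℕ.m≤m+n N (proj₁ large)) , SignGraph.H s q , SignGraph.H-uniform s q , SignGraph.H-free s q , H-dense
   where open Construction q η η>0 N

 -- The supremum is attained: the value itself is admissible and serves as the witness for every
 -- `ε`.
 density-value : ∀ q → PiEquals (suc (suc q)) q (suc (suc (suc q))) (F-edge (suc (suc q))) (halfPow (suc q))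
 density-value q = upper-bound q , λ ε ε>0 → halfPow (suc q) , subst (0ℚ ≤_) (sym (halfPow≡ (suc q))) (pow≥0 0≤½ (suc q)) ,
   subst (_≤ 1ℚ) (sym (halfPow≡ (suc q))) (pow≤1 0≤½ (≤-by ½ 0≤½ (solve 0 ((con 1ℚ) := (con ½) :+ (con ½)) refl)) (suc q)) , lower-bound q , minus-< (halfPow (suc q)) ε ε>0

open import Data.Nat using (ℕ; suc; _≤_; _∸_)

theorem1p8 : ∀ (k : ℕ) → 2 ≤ k → PiEquals k (k ∸ 2) (suc k) (F-edge k) (halfPow (k ∸ 1))
theorem1p8 (suc zero) (s≤s ())
theorem1p8 (suc (suc q)) _ = LowerBounds.density-value q
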